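{- For the Attenuated Space poset $\mathcal A_q(N,M)$, the $q$-adjacency matrix $A$ is $Q$-polynomial.
   Context: Let $\mathbb F_q$ be a finite field with $q$ elements, let $N,M$ be positive integers, let $H$ be a vector space over $\mathbb F_q$ of dimension $N+M$, and fix a subspace $h\subseteq H$ of dimension $M$. Let $X$ be the set of subspaces $y\subseteq H$ with $y\cap h=0$, partially ordered by inclusion; this poset is the Attenuated Space poset $\mathcal A_q(N,M)$. For $y,z\in X$, $z$ covers $y$ when $y\subseteq z$ and $\dim z-\dim y=1$; $y,z$ are adjacent when one of them covers the other. Let $\mathrm{Mat}_X(\mathbb C)$ be the algebra of complex matrices with rows and columns indexed by $X$, acting on the standard module $V=\mathbb C^X$ by left multiplication. The $q$-adjacency matrix $A\in\mathrm{Mat}_X(\mathbb C)$ has $(y,z)$-entry $1$ if $y$ covers $z$; $q^{\dim y}$ if $z$ covers $y$; and $0$ if $y,z$ are not adjacent. For $0\le i\le N$ let $E^*_i\in\mathrm{Mat}_X(\mathbb C)$ be the diagonal matrix with $(y,y)$-entry $1$ if $\dim y=i$ and $0$ otherwise. Let $\mathbf M^*$ be the commutative subalgebra of $\mathrm{Mat}_X(\mathbb C)$ with basis $\{E^*_i\}_{i=0}^N$. Set $D=2N$; the matrix $A$ is diagonalizable with exactly $D+1$ eigenspaces in $V$. For an ordering $\{V_i\}_{i=0}^D$ of the eigenspaces of $A$, a dual adjacency matrix for this ordering is a matrix $\mathbf A^*$ that generates $\mathbf M^*$ and satisfies $\mathbf A^*V_i\subseteq V_{i-1}+V_i+V_{i+1}$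 for $0\le i\le D$, where $V_{ -1}=0$ and $V_{D+1}=0$. An ordering of the eigenspaces of $A$ is called $Q$-polynomial when it has a dual adjacency matrix. The matrix $A$ is called $Q$-polynomial when there exists a $Q$-polynomial ordering of its eigenspaces. -}

module Defs where

open import Level using (0ℓ; _⊔_) renaming (suc to lsuc)
open import Algebra.Bundles using (CommutativeRing)
open import Algebra.Module.Bundles using (Module)
open import Data.Bool.Base using (Bool; true; false; T; _∧_; if_then_else_)
open import Data.Bool.Properties using (T?)
open import Data.Fin.Base using (Fin; zero; suc; toℕ; fromℕ<)
import Data.Fin.Base as Fin using (finToFun; funToFin)
import Data.Fin.Properties as Fin
open import Data.Integer.Base as ℤ using (ℤ; +_; -[1+_])
open import Data.List.Base using (List; []; map; filter; deduplicate; allFin; length; lookup)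
  renaming (_∷_ to _∷ₗ_)
open import Data.List.Membership.Propositional using () renaming (_∈_ to _∈ₗ_)
open import Data.List.Membership.Propositional.Properties 
  using (∈-map⁺; ∈-allFin; ∈-lookup; ∈-filter⁻)
open import Data.List.Membership.Setoid.Properties as SetoidMembership using (∈-deduplicate⁺)
open import Data.List.Relation.Unary.All as All using ()
open import Data.List.Relation.Unary.AllPairs.Core using (AllPairs) renaming (_∷_ to _∷ₚ_)
import Data.List.Relation.Unary.AllPairs.Properties as AllPairs
open import Data.List.Relation.Unary.Any as Any using (Any; here; there; index)
open import Data.List.Relation.Unary.Any.Properties using (lookup-index)
open import Data.List.Relation.Unary.Unique.DecSetoid.Properties using (deduplicate-!)
open import Data.Nat.Base as ℕ using (ℕ; zero; suc)
import Data.Nat.Properties as ℕ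
open import Data.Product.Base using (∃; _×_; _,_; proj₁; proj₂; swap)
open import Data.Rational.Base as ℚ using (ℚ; 0ℚ; 1ℚ; ½; ∣_∣; Positive)
import Data.Rational.Properties as ℚ
open import Data.Vec.Functional using (Vector; _∷_)
open import Function.Base using (_∘_; case_of_)
open import Function.Bundles using (Inverse; _⇔_)
open import Relation.Binary.Bundles using (DecSetoid)
open import Relation.Binary.PropositionalEquality as ≡ using (_≡_)
open import Relation.Nullary.Decidable
  using (Dec; yes; no; does; ⌊_⌋; map′; toWitness; fromWitness; _→-dec_; _×-dec_)
open import Relation.Nullary.Negation using (¬_; contradiction)
open import Relation.Unary using (Pred)

------------------------------------------------------------------------
-- Real numbers: Cauchy sequences of rationals, up to differences tending to 0

record ℝ : Set where
  no-eta-equality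
  constructor mkℝ
  field
    approx : ℕ → ℚ
    cauchy : ∀ ε → 0ℚ ℚ.< ε → ∃ λ k → ∀ m n → k ℕ.≤ m → k ℕ.≤ n →
             ∣ approx m ℚ.- approx n ∣ ℚ.< ε

open ℝ public

infix 4 _≈ℝ_

_≈ℝ_ : ℝ → ℝ → Set
x ≈ℝ y = ∀ ε → 0ℚ ℚ.< ε → ∃ λ k → ∀ n → k ℕ.≤ n →
         ∣ approx x n ℚ.- approx y n ∣ ℚ.< ε

module Differences {c ℓ} (R : CommutativeRing c ℓ) where
  open CommutativeRing R
  open import Algebra.Properties.Ring ring using (-‿distribʳ-*; -‿+-comm)
  open import Algebra.Properties.CommutativeSemigroup +-commutativeSemigroup using (interchange)

  cancel : ∀ p q → p ≈ (p - q) + q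
  cancel p q = sym (trans (+-assoc p (- q) q) (trans (+-congˡ (-‿inverseˡ q)) (+-identityʳ p)))

  telescope : ∀ p q r → p - r ≈ (p - q) + (q - r)
  telescope p q r = trans (+-congʳ (cancel p q)) (+-assoc (p - q) q (- r))

  +-telescope : ∀ a b c d → (a + b) - (c + d) ≈ (a - c) + (b - d)
  +-telescope a b c d = trans (+-congˡ (sym (-‿+-comm c d))) (interchange a b (- c) (- d))

  *-sub : ∀ x y z → x * (y - z) ≈ x * y - x * z
  *-sub x y z = trans (distribˡ x y (- z)) (+-congˡ (sym (-‿distribʳ-* x z)))

  *-telescope : ∀ a b c d → a * b - c * d ≈ a * (b - d) + d * (a - c)
  *-telescope a b c d = trans (telescope (a * b) (a * d) (c * d))
    (+-cong (sym (*-sub a b d))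
      (trans (+-cong (*-comm a d) (-‿cong (*-comm c d))) (sym (*-sub d a c))))

  neg-sub : ∀ p q → - p - - q ≈ - (p - q)
  neg-sub p q = -‿+-comm p (- q)

  sub-flip : ∀ p q → - (p - q) ≈ q - p
  sub-flip p q = trans (sym (neg-sub p q)) (trans (+-comm (- p) (- - q)) (+-congʳ (⁻¹-involutive q)))
    where open import Algebra.Properties.Group +-group using (⁻¹-involutive)

module ℚ-Estimates where
  open import Data.Rational.Base
  open Differences ℚ.+-*-commutativeRing

  ½ε>0 : ∀ {ε} → 0ℚ < ε → 0ℚ < ½ * ε
  ½ε>0 {ε} ε>0 = ℚ.positive⁻¹ (½ * ε) {{ℚ.pos*pos⇒pos ½ ε {{positive ε>0}}}}

  ½ε+½ε : ∀ ε → ½ * ε + ½ * ε ≡ ε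
  ½ε+½ε ε = ≡.trans (≡.sym (ℚ.*-distribʳ-+ ε ½ ½)) (ℚ.*-identityˡ ε)

  split-< : ∀ {p q r ε} → ∣ p - q ∣ < ½ * ε → ∣ q - r ∣ < ½ * ε → ∣ p - r ∣ < ε
  split-< {p} {q} {r} {ε} pq qr = begin-strict
    ∣ p - r ∣                     ≡⟨ ≡.cong ∣_∣ (telescope p q r) ⟩
    ∣ (p - q) + (q - r) ∣         ≤⟨ ℚ.∣p+q∣≤∣p∣+∣q∣ (p - q) (q - r) ⟩
    ∣ p - q ∣ + ∣ q - r ∣         <⟨ ℚ.+-mono-< pq qr ⟩
    ½ * ε + ½ * ε                 ≡⟨ ½ε+½ε ε ⟩
    ε                             ∎
    where open ℚ.≤-Reasoning

  ∣-∣-sym : ∀ p q → ∣ p - q ∣ ≡ ∣ q - p ∣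
  ∣-∣-sym p q = ≡.trans (≡.sym (ℚ.∣-p∣≡∣p∣ (p - q)))
    (≡.cong ∣_∣ (sub-flip p q))

  neg-diff : ∀ p q → ∣ - p - - q ∣ ≡ ∣ p - q ∣
  neg-diff p q = ≡.trans
    (≡.cong ∣_∣ (neg-sub p q))
    (ℚ.∣-p∣≡∣p∣ (p - q))

  self-diff : ∀ {p q} → p ≡ q → ∣ p - q ∣ ≡ 0ℚ
  self-diff {p} ≡.refl = ≡.cong ∣_∣ (ℚ.+-inverseʳ p)

  +-diff : ∀ {a b c d ε} → ∣ a - c ∣ < ½ * ε → ∣ b - d ∣ < ½ * ε →
           ∣ (a + b) - (c + d) ∣ < ε
  +-diff {a} {b} {c} {d} {ε} ac bd = begin-strict
    ∣ (a + b) - (c + d) ∣         ≡⟨ ≡.cong ∣_∣ (+-telescope a b c d) ⟩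
    ∣ (a - c) + (b - d) ∣         ≤⟨ ℚ.∣p+q∣≤∣p∣+∣q∣ (a - c) (b - d) ⟩
    ∣ a - c ∣ + ∣ b - d ∣         <⟨ ℚ.+-mono-< ac bd ⟩
    ½ * ε + ½ * ε                 ≡⟨ ½ε+½ε ε ⟩
    ε                             ∎
    where open ℚ.≤-Reasoning

  module _ (B : ℚ) (B>0 : 0ℚ < B) where
    private
      instance
        B-pos : Positive B
        B-pos = positive B>0

        B≢0 : ℚ.NonZero B
        B≢0 = ℚ.pos⇒nonZero B

        1/B-pos : Positive (1/ B)
        1/B-pos = ℚ.1/pos⇒pos B

    abstract
      scaled : ∀ ε → 0ℚ < ε → ∃ λ δ → 0ℚ < δ × B * δ ≡ ½ * ε
      scaled ε ε>0 =
        1/ B * (½ * ε) ,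
        ℚ.positive⁻¹ (1/ B * (½ * ε))
          {{ℚ.pos*pos⇒pos (1/ B) (½ * ε) {{positive (½ε>0 ε>0)}}}} ,
        (begin
          B * (1/ B * (½ * ε))   ≡⟨ ℚ.*-assoc B (1/ B) (½ * ε) ⟨
          B * 1/ B * (½ * ε)     ≡⟨ ≡.cong (_* (½ * ε)) (ℚ.*-inverseʳ B) ⟩
          1ℚ * (½ * ε)           ≡⟨ ℚ.*-identityˡ (½ * ε) ⟩
          ½ * ε                  ∎)
        where open ≡.≡-Reasoning

  abstract
    *-diff : ∀ {a b c d B δ ε} → 0ℚ < B → B * δ ≡ ½ * ε → ∣ a ∣ ≤ B → ∣ d ∣ ≤ B →
             ∣ a - c ∣ < δ → ∣ b - d ∣ < δ → ∣ a * b - c * d ∣ < ε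
    *-diff {a} {b} {c} {d} {B} {δ} {ε} B>0 Bδ a≤B d≤B ac bd = begin-strict
      ∣ a * b - c * d ∣                   ≡⟨ ≡.cong ∣_∣ (*-telescope a b c d) ⟩
      ∣ a * (b - d) + d * (a - c) ∣       ≤⟨ ℚ.∣p+q∣≤∣p∣+∣q∣ (a * (b - d)) (d * (a - c)) ⟩
      ∣ a * (b - d) ∣ + ∣ d * (a - c) ∣   ≡⟨ ≡.cong₂ _+_ (ℚ.∣p*q∣≡∣p∣*∣q∣ a (b - d)) (ℚ.∣p*q∣≡∣p∣*∣q∣ d (a - c)) ⟩
      ∣ a ∣ * ∣ b - d ∣ + ∣ d ∣ * ∣ a - c ∣
        ≤⟨ ℚ.+-mono-≤ (ℚ.*-monoʳ-≤-nonNeg ∣ b - d ∣ {{ℚ.∣-∣-nonNeg (b - d)}} a≤B)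
                      (ℚ.*-monoʳ-≤-nonNeg ∣ a - c ∣ {{ℚ.∣-∣-nonNeg (a - c)}} d≤B) ⟩
      B * ∣ b - d ∣ + B * ∣ a - c ∣       <⟨ ℚ.+-mono-< (ℚ.*-monoʳ-<-pos B {{positive B>0}} bd) (ℚ.*-monoʳ-<-pos B {{positive B>0}} ac) ⟩
      B * δ + B * δ                       ≡⟨ ≡.cong₂ _+_ Bδ Bδ ⟩
      ½ * ε + ½ * ε                       ≡⟨ ½ε+½ε ε ⟩
      ε                                   ∎
      where open ℚ.≤-Reasoning

  1>0 : 0ℚ < 1ℚ
  1>0 = ℚ.positive⁻¹ 1ℚ

  EventuallyBounded : (ℕ → ℚ) → Set
  EventuallyBounded f = ∃ λ B → 0ℚ < B × ∃ λ k → ∀ n → k ℕ.≤ n → ∣ f n ∣ ≤ B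

  sum-pos : ∀ B C → 0ℚ < B → 0ℚ < C → 0ℚ < B + C
  sum-pos B C B>0 C>0 = ℚ.+-mono-< {0ℚ} {B} {0ℚ} {C} B>0 C>0

  weakenˡ : ∀ p B C → 0ℚ < C → p ≤ B → p ≤ B + C
  weakenˡ p B C C>0 p≤B = begin
    p        ≤⟨ p≤B ⟩
    B        ≡⟨ ℚ.+-identityʳ B ⟨
    B + 0ℚ   ≤⟨ ℚ.+-monoʳ-≤ B (ℚ.<⇒≤ C>0) ⟩
    B + C    ∎
    where open ℚ.≤-Reasoning

  weakenʳ : ∀ p B C → 0ℚ < B → p ≤ C → p ≤ B + C
  weakenʳ p B C B>0 p≤C = begin
    p        ≤⟨ p≤C ⟩
    C        ≡⟨ ℚ.+-identityˡ C ⟨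
    0ℚ + C   ≤⟨ ℚ.+-monoˡ-≤ C (ℚ.<⇒≤ B>0) ⟩
    B + C    ∎
    where open ℚ.≤-Reasoning

  near : ∀ p q → ∣ p - q ∣ < 1ℚ → ∣ p ∣ ≤ 1ℚ + ∣ q ∣
  near p q p~q = begin
    ∣ p ∣                   ≡⟨ ≡.cong ∣_∣ (cancel p q) ⟩
    ∣ (p - q) + q ∣         ≤⟨ ℚ.∣p+q∣≤∣p∣+∣q∣ (p - q) q ⟩
    ∣ p - q ∣ + ∣ q ∣       ≤⟨ ℚ.+-monoˡ-≤ ∣ q ∣ (ℚ.<⇒≤ p~q) ⟩
    1ℚ + ∣ q ∣              ∎
    where open ℚ.≤-Reasoning

  abstract
    bounded : (x : ℝ) → EventuallyBounded (approx x)
    bounded x = let (k , close) = cauchy x 1ℚ 1>0 in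
      1ℚ + ∣ approx x k ∣ , ℚ.+-mono-<-≤ 1>0 (ℚ.0≤∣p∣ (approx x k)) ,
      k , λ n k≤n → near (approx x n) (approx x k) (close n k k≤n ℕ.≤-refl)

    common : (x y : ℝ) → ∃ λ B → 0ℚ < B × ∃ λ k → ∀ n → k ℕ.≤ n →
             ∣ approx x n ∣ ≤ B × ∣ approx y n ∣ ≤ B
    common x y = let (B , B>0 , k , bx) = bounded x
                     (C , C>0 , l , by) = bounded y
                 in B + C , sum-pos B C B>0 C>0 , k ℕ.⊔ l , λ n kl≤n →
                    (weakenˡ (∣ approx x n ∣) B C C>0 (bx n (ℕ.m⊔n≤o⇒m≤o k l kl≤n))) ,
                    (weakenʳ (∣ approx y n ∣) B C B>0 (by n (ℕ.m⊔n≤o⇒n≤o k l kl≤n)))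

open ℚ-Estimates

infixl 6 _+ℝ_
infixl 7 _*ℝ_
infix  8 -ℝ_

fromℚ : ℚ → ℝ
fromℚ p = mkℝ (λ _ → p) λ ε ε>0 → 0 , λ _ _ _ _ →
  ≡.subst (ℚ._< ε) (≡.sym (self-diff {p} ≡.refl)) ε>0

_+ℝ_ : ℝ → ℝ → ℝ
approx (x +ℝ y) n = approx x n ℚ.+ approx y n
cauchy (x +ℝ y) ε ε>0 with cauchy x (½ ℚ.* ε) (½ε>0 ε>0) | cauchy y (½ ℚ.* ε) (½ε>0 ε>0)
... | k , cx | l , cy = k ℕ.⊔ l , λ m n m≥ n≥ →
  +-diff {approx x m} {approx y m}
    (cx m n (ℕ.m⊔n≤o⇒m≤o k l m≥) (ℕ.m⊔n≤o⇒m≤o k l n≥))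
    (cy m n (ℕ.m⊔n≤o⇒n≤o k l m≥) (ℕ.m⊔n≤o⇒n≤o k l n≥))

-ℝ_ : ℝ → ℝ
approx (-ℝ x) n = ℚ.- approx x n
cauchy (-ℝ x) ε ε>0 with cauchy x ε ε>0
... | k , cx = k , λ m n m≥ n≥ →
  ≡.subst (ℚ._< ε) (≡.sym (neg-diff (approx x m) (approx x n))) (cx m n m≥ n≥)

_*ℝ_ : ℝ → ℝ → ℝ
approx (x *ℝ y) n = approx x n ℚ.* approx y n
cauchy (x *ℝ y) ε ε>0 =
  let (B , B>0 , j , bd) = common x y
      (δ , δ>0 , Bδ)     = scaled B B>0 ε ε>0
      (k , cx)           = cauchy x δ δ>0
      (l , cy)           = cauchy y δ δ>0
  in j ℕ.⊔ (k ℕ.⊔ l) , λ m n m≥ n≥ →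
    let mkl≥ = ℕ.m⊔n≤o⇒n≤o j (k ℕ.⊔ l) m≥
        nkl≥ = ℕ.m⊔n≤o⇒n≤o j (k ℕ.⊔ l) n≥
    in *-diff {approx x m} {approx y m} {approx x n} {approx y n} {B} {δ} {ε} B>0 Bδ
         (proj₁ (bd m (ℕ.m⊔n≤o⇒m≤o j (k ℕ.⊔ l) m≥)))
         (proj₂ (bd n (ℕ.m⊔n≤o⇒m≤o j (k ℕ.⊔ l) n≥)))
         (cx m n (ℕ.m⊔n≤o⇒m≤o k l mkl≥) (ℕ.m⊔n≤o⇒m≤o k l nkl≥))
         (cy m n (ℕ.m⊔n≤o⇒n≤o k l mkl≥) (ℕ.m⊔n≤o⇒n≤o k l nkl≥))

pointwise : ∀ {x y} → (∀ n → approx x n ≡ approx y n) → x ≈ℝ y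
pointwise eq ε ε>0 = 0 , λ n _ → ≡.subst (ℚ._< ε) (≡.sym (self-diff (eq n))) ε>0

≈ℝ-sym : ∀ {x y} → x ≈ℝ y → y ≈ℝ x
≈ℝ-sym {x} {y} eq ε ε>0 with eq ε ε>0
... | k , c = k , λ n n≥ → ≡.subst (ℚ._< ε) (∣-∣-sym (approx x n) (approx y n)) (c n n≥)

≈ℝ-trans : ∀ {x y z} → x ≈ℝ y → y ≈ℝ z → x ≈ℝ z
≈ℝ-trans {x} {y} {z} xy yz ε ε>0 with xy (½ ℚ.* ε) (½ε>0 ε>0) | yz (½ ℚ.* ε) (½ε>0 ε>0)
... | k , c | l , d = k ℕ.⊔ l , λ n n≥ →
  split-< {approx x n} {approx y n}
    (c n (ℕ.m⊔n≤o⇒m≤o k l n≥)) (d n (ℕ.m⊔n≤o⇒n≤o k l n≥))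

+ℝ-cong : ∀ {x x′ y y′} → x ≈ℝ x′ → y ≈ℝ y′ → x +ℝ y ≈ℝ x′ +ℝ y′
+ℝ-cong {x} {_} {y} xx yy ε ε>0 with xx (½ ℚ.* ε) (½ε>0 ε>0) | yy (½ ℚ.* ε) (½ε>0 ε>0)
... | k , c | l , d = k ℕ.⊔ l , λ n n≥ →
  +-diff {approx x n} {approx y n}
    (c n (ℕ.m⊔n≤o⇒m≤o k l n≥)) (d n (ℕ.m⊔n≤o⇒n≤o k l n≥))

-ℝ-cong : ∀ {x y} → x ≈ℝ y → -ℝ x ≈ℝ -ℝ y
-ℝ-cong {x} {y} xy ε ε>0 with xy ε ε>0
... | k , c = k , λ n n≥ →
  ≡.subst (ℚ._< ε) (≡.sym (neg-diff (approx x n) (approx y n))) (c n n≥)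

*ℝ-cong : ∀ {x x′ y y′} → x ≈ℝ x′ → y ≈ℝ y′ → x *ℝ y ≈ℝ x′ *ℝ y′
*ℝ-cong {x} {x′} {y} {y′} xx yy ε ε>0 =
  let (B , B>0 , j , bd) = common x y′
      (δ , δ>0 , Bδ)     = scaled B B>0 ε ε>0
      (k , c)            = xx δ δ>0
      (l , d)            = yy δ δ>0
  in j ℕ.⊔ (k ℕ.⊔ l) , λ n n≥ →
    let nj≥  = ℕ.m⊔n≤o⇒m≤o j (k ℕ.⊔ l) n≥
        nkl≥ = ℕ.m⊔n≤o⇒n≤o j (k ℕ.⊔ l) n≥
    in *-diff {approx x n} {approx y n} {approx x′ n} {approx y′ n} {B} {δ} {ε} B>0 Bδ
         (proj₁ (bd n nj≥)) (proj₂ (bd n nj≥))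
         (c n (ℕ.m⊔n≤o⇒m≤o k l nkl≥)) (d n (ℕ.m⊔n≤o⇒n≤o k l nkl≥))

ℝ-commutativeRing : CommutativeRing 0ℓ 0ℓ
ℝ-commutativeRing = record
  { Carrier = ℝ ; _≈_ = _≈ℝ_ ; _+_ = _+ℝ_ ; _*_ = _*ℝ_ ; -_ = -ℝ_
  ; 0# = fromℚ 0ℚ ; 1# = fromℚ 1ℚ
  ; isCommutativeRing = record
    { isRing = record
      { +-isAbelianGroup = record
        { isGroup = record
          { isMonoid = record
            { isSemigroup = record
              { isMagma = record
                { isEquivalence = record
                  { refl = λ {x} → pointwise {x} {x} λ _ → ≡.refl
                  ; sym = λ {x} {y} → ≈ℝ-sym {x} {y}
                  ; trans = λ {x} {y} {z} → ≈ℝ-trans {x} {y} {z} }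
                ; ∙-cong = λ {x} {x′} {y} {y′} → +ℝ-cong {x} {x′} {y} {y′} }
              ; assoc = λ x y z → pointwise {x +ℝ y +ℝ z} {x +ℝ (y +ℝ z)}
                  λ n → ℚ.+-assoc (approx x n) (approx y n) (approx z n) }
            ; identity = (λ x → pointwise {fromℚ 0ℚ +ℝ x} {x} λ n → ℚ.+-identityˡ (approx x n))
                       , (λ x → pointwise {x +ℝ fromℚ 0ℚ} {x} λ n → ℚ.+-identityʳ (approx x n)) }
          ; inverse = (λ x → pointwise { -ℝ x +ℝ x} {fromℚ 0ℚ} λ n → ℚ.+-inverseˡ (approx x n))
                    , (λ x → pointwise {x +ℝ -ℝ x} {fromℚ 0ℚ} λ n → ℚ.+-inverseʳ (approx x n))
          ; ⁻¹-cong = λ {x} {y} → -ℝ-cong {x} {y} }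
        ; comm = λ x y → pointwise {x +ℝ y} {y +ℝ x} λ n → ℚ.+-comm (approx x n) (approx y n) }
      ; *-cong = λ {x} {x′} {y} {y′} → *ℝ-cong {x} {x′} {y} {y′}
      ; *-assoc = λ x y z → pointwise {x *ℝ y *ℝ z} {x *ℝ (y *ℝ z)}
          λ n → ℚ.*-assoc (approx x n) (approx y n) (approx z n)
      ; *-identity = (λ x → pointwise {fromℚ 1ℚ *ℝ x} {x} λ n → ℚ.*-identityˡ (approx x n))
                   , (λ x → pointwise {x *ℝ fromℚ 1ℚ} {x} λ n → ℚ.*-identityʳ (approx x n))
      ; distrib = (λ x y z → pointwise {x *ℝ (y +ℝ z)} {x *ℝ y +ℝ x *ℝ z}
                    λ n → ℚ.*-distribˡ-+ (approx x n) (approx y n) (approx z n))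
                , (λ x y z → pointwise {(y +ℝ z) *ℝ x} {y *ℝ x +ℝ z *ℝ x}
                    λ n → ℚ.*-distribʳ-+ (approx x n) (approx y n) (approx z n)) }
    ; *-comm = λ x y → pointwise {x *ℝ y} {y *ℝ x} λ n → ℚ.*-comm (approx x n) (approx y n) } }

------------------------------------------------------------------------
-- Complex numbers

-- R[i], where i² = -1; the pair (a , b) stands for a + b i.
module AdjoinI {c ℓ} (R : CommutativeRing c ℓ) where
  open CommutativeRing R
  open import Algebra.Properties.Ring ring using (-0#≈0#; -‿distribˡ-*; -‿distribʳ-*; -‿+-comm)
  open import Algebra.Properties.CommutativeSemigroup +-commutativeSemigroup using (interchange)
  open import Relation.Binary.Reasoning.Setoid setoid

  private
    *-sub : ∀ x y z → x * (y + - z) ≈ x * y + - (x * z)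
    *-sub x y z = trans (distribˡ x y (- z)) (+-congˡ (sym (-‿distribʳ-* x z)))

    sub-* : ∀ x y z → (y + - z) * x ≈ y * x + - (z * x)
    sub-* x y z = trans (distribʳ x y (- z)) (+-congˡ (sym (-‿distribˡ-* z x)))

    assoc-re : ∀ a b c d e f →
      (a * c + - (b * d)) * e + - ((a * d + b * c) * f) ≈
      a * (c * e + - (d * f)) + - (b * (c * f + d * e))
    assoc-re a b c d e f = begin
      (a * c + - (b * d)) * e + - ((a * d + b * c) * f)
        ≈⟨ +-cong (sub-* e (a * c) (b * d)) (-‿cong (distribʳ f (a * d) (b * c))) ⟩
      (a * c * e + - (b * d * e)) + - (a * d * f + b * c * f)
        ≈⟨ +-cong (+-cong (*-assoc a c e) (-‿cong (*-assoc b d e)))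
                  (-‿cong (+-cong (*-assoc a d f) (*-assoc b c f))) ⟩
      (a * (c * e) + - (b * (d * e))) + - (a * (d * f) + b * (c * f))
        ≈⟨ +-congˡ (sym (-‿+-comm (a * (d * f)) (b * (c * f)))) ⟩
      (a * (c * e) + - (b * (d * e))) + (- (a * (d * f)) + - (b * (c * f)))
        ≈⟨ interchange _ _ _ _ ⟩
      (a * (c * e) + - (a * (d * f))) + (- (b * (d * e)) + - (b * (c * f)))
        ≈⟨ +-cong (sym (*-sub a (c * e) (d * f))) (-‿+-comm (b * (d * e)) (b * (c * f))) ⟩
      a * (c * e + - (d * f)) + - (b * (d * e) + b * (c * f))
        ≈⟨ +-congˡ (-‿cong (sym (distribˡ b (d * e) (c * f)))) ⟩
      a * (c * e + - (d * f)) + - (b * (d * e + c * f))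
        ≈⟨ +-congˡ (-‿cong (*-congˡ (+-comm (d * e) (c * f)))) ⟩
      a * (c * e + - (d * f)) + - (b * (c * f + d * e)) ∎

    assoc-im : ∀ a b c d e f →
      (a * c + - (b * d)) * f + (a * d + b * c) * e ≈
      a * (c * f + d * e) + b * (c * e + - (d * f))
    assoc-im a b c d e f = begin
      (a * c + - (b * d)) * f + (a * d + b * c) * e
        ≈⟨ +-cong (sub-* f (a * c) (b * d)) (distribʳ e (a * d) (b * c)) ⟩
      (a * c * f + - (b * d * f)) + (a * d * e + b * c * e)
        ≈⟨ +-cong (+-cong (*-assoc a c f) (-‿cong (*-assoc b d f)))
                  (+-cong (*-assoc a d e) (*-assoc b c e)) ⟩
      (a * (c * f) + - (b * (d * f))) + (a * (d * e) + b * (c * e))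
        ≈⟨ interchange _ _ _ _ ⟩
      (a * (c * f) + a * (d * e)) + (- (b * (d * f)) + b * (c * e))
        ≈⟨ +-cong (sym (distribˡ a (c * f) (d * e))) (+-comm (- (b * (d * f))) (b * (c * e))) ⟩
      a * (c * f + d * e) + (b * (c * e) + - (b * (d * f)))
        ≈⟨ +-congˡ (sym (*-sub b (c * e) (d * f))) ⟩
      a * (c * f + d * e) + b * (c * e + - (d * f)) ∎

    comm-re : ∀ a b c d → a * c + - (b * d) ≈ c * a + - (d * b)
    comm-re a b c d = +-cong (*-comm a c) (-‿cong (*-comm b d))

    comm-im : ∀ a b c d → a * d + b * c ≈ c * b + d * a
    comm-im a b c d = trans (+-cong (*-comm a d) (*-comm b c)) (+-comm (d * a) (c * b))

    distrib-re : ∀ a b c d e f →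
      a * (c + e) + - (b * (d + f)) ≈ (a * c + - (b * d)) + (a * e + - (b * f))
    distrib-re a b c d e f = begin
      a * (c + e) + - (b * (d + f))
        ≈⟨ +-cong (distribˡ a c e) (-‿cong (distribˡ b d f)) ⟩
      (a * c + a * e) + - (b * d + b * f)
        ≈⟨ +-congˡ (sym (-‿+-comm (b * d) (b * f))) ⟩
      (a * c + a * e) + (- (b * d) + - (b * f))
        ≈⟨ interchange _ _ _ _ ⟩
      (a * c + - (b * d)) + (a * e + - (b * f)) ∎

    distrib-im : ∀ a b c d e f →
      a * (d + f) + b * (c + e) ≈ (a * d + b * c) + (a * f + b * e)
    distrib-im a b c d e f =
      trans (+-cong (distribˡ a d f) (distribˡ b c e)) (interchange _ _ _ _)

    ident-re : ∀ a b → 1# * a + - (0# * b) ≈ a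
    ident-re a b = trans
      (+-cong (*-identityˡ a) (trans (-‿cong (zeroˡ b)) -0#≈0#)) (+-identityʳ a)

    ident-im : ∀ a b → 1# * b + 0# * a ≈ b
    ident-im a b = trans (+-cong (*-identityˡ b) (zeroˡ a)) (+-identityʳ b)

  _≋_ : Carrier × Carrier → Carrier × Carrier → Set ℓ
  (a , b) ≋ (c , d) = a ≈ c × b ≈ d

  _⊕_ _⊗_ : Carrier × Carrier → Carrier × Carrier → Carrier × Carrier
  (a , b) ⊕ (c , d) = (a + c) , (b + d)
  (a , b) ⊗ (c , d) = (a * c + - (b * d)) , (a * d + b * c)

  private
    ⊗-comm : ∀ x y → (x ⊗ y) ≋ (y ⊗ x)
    ⊗-comm (a , b) (c , d) = comm-re a b c d , comm-im a b c d

    ⊗-identityˡ : ∀ x → ((1# , 0#) ⊗ x) ≋ x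
    ⊗-identityˡ (a , b) = ident-re a b , ident-im a b

    ≋-trans : ∀ {x y z} → x ≋ y → y ≋ z → x ≋ z
    ≋-trans (p , q) (r , s) = trans p r , trans q s

    ⊕-cong : ∀ {x y u v} → x ≋ y → u ≋ v → (x ⊕ u) ≋ (y ⊕ v)
    ⊕-cong (p , q) (r , s) = +-cong p r , +-cong q s

    ⊗-distribˡ : ∀ x y z → (x ⊗ (y ⊕ z)) ≋ ((x ⊗ y) ⊕ (x ⊗ z))
    ⊗-distribˡ (a , b) (c , d) (e , f) = distrib-re a b c d e f , distrib-im a b c d e f

  commutativeRing[i] : CommutativeRing c ℓ
  commutativeRing[i] = record
    { Carrier = Carrier × Carrier
    ; _≈_ = _≋_ ; _+_ = _⊕_ ; _*_ = _⊗_
    ; -_ = λ (a , b) → (- a) , (- b)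
    ; 0# = 0# , 0# ; 1# = 1# , 0#
    ; isCommutativeRing = record
      { isRing = record
        { +-isAbelianGroup = record
          { isGroup = record
            { isMonoid = record
              { isSemigroup = record
                { isMagma = record
                  { isEquivalence = record
                    { refl = refl , refl
                    ; sym = λ (p , q) → sym p , sym q
                    ; trans = ≋-trans }
                  ; ∙-cong = ⊕-cong }
                ; assoc = λ (a , b) (c , d) (e , f) → +-assoc a c e , +-assoc b d f }
              ; identity = (λ (a , b) → +-identityˡ a , +-identityˡ b)
                         , (λ (a , b) → +-identityʳ a , +-identityʳ b) }
            ; inverse = (λ (a , b) → -‿inverseˡ a , -‿inverseˡ b)
                      , (λ (a , b) → -‿inverseʳ a , -‿inverseʳ b)
            ; ⁻¹-cong = λ (p , q) → -‿cong p , -‿cong q }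
          ; comm = λ (a , b) (c , d) → +-comm a c , +-comm b d }
        ; *-cong = λ (p , q) (r , s) →
            +-cong (*-cong p r) (-‿cong (*-cong q s)) , +-cong (*-cong p s) (*-cong q r)
        ; *-assoc = λ (a , b) (c , d) (e , f) → assoc-re a b c d e f , assoc-im a b c d e f
        ; *-identity = ⊗-identityˡ
                     , (λ x → ≋-trans (⊗-comm x (1# , 0#)) (⊗-identityˡ x))
        ; distrib = ⊗-distribˡ
                  , (λ x y z → ≋-trans (⊗-comm (y ⊕ z) x)
                      (≋-trans (⊗-distribˡ x y z) (⊕-cong (⊗-comm x y) (⊗-comm x z)))) }
      ; *-comm = ⊗-comm } }

ℂ : CommutativeRing 0ℓ 0ℓ
ℂ = AdjoinI.commutativeRing[i] ℝ-commutativeRing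

------------------------------------------------------------------------
-- Vector spaces over a finite field

record FiniteField c ℓ : Set (lsuc (c ⊔ ℓ)) where
  field
    commutativeRing : CommutativeRing c ℓ

  open CommutativeRing commutativeRing public

  field
    1≉0         : ¬ 1# ≈ 0#
    invertible  : ∀ x → ¬ x ≈ 0# → ∃ λ y → x * y ≈ 1#
    order       : ℕ
    enumeration : Inverse setoid (≡.setoid (Fin order))

module VectorSpace {c ℓ m ℓm} (F : FiniteField c ℓ)
                   (H : Module (FiniteField.commutativeRing F) m ℓm) where

  open FiniteField F hiding (zero)
  open Module H
  open import Algebra.Properties.CommutativeMonoid.Sum +ᴹ-commutativeMonoid
    using (sum; sum-cong-≋; ∑-distrib-+)

  lincomb : ∀ {d} → Vector Carrier d → Vector Carrierᴹ d → Carrierᴹ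
  lincomb a b = sum λ i → a i *ₗ b i

  -- Membership is Boolean, since H is finite in all that follows.
  record Subspace : Set (c ⊔ m ⊔ ℓm) where
    field
      member    : Carrierᴹ → Bool
      member-≈  : ∀ {u v} → u ≈ᴹ v → T (member u) → T (member v)
      0-member  : T (member 0ᴹ)
      +-closed  : ∀ {u v} → T (member u) → T (member v) → T (member (u +ᴹ v))
      *ₗ-closed : ∀ a {v} → T (member v) → T (member (a *ₗ v))

  open Subspace public

  infix 4 _∈_ _⊆_ _≐_

  _∈_ : Carrierᴹ → Subspace → Set
  v ∈ U = T (member U v)

  _⊆_ _≐_ Disjoint : Subspace → Subspace → Set _
  U ⊆ W = ∀ v → v ∈ U → v ∈ W
  U ≐ W = U ⊆ W × W ⊆ U
  Disjoint U W = ∀ v → v ∈ U → v ∈ W → v ≈ᴹ 0ᴹ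

  whole : Subspace
  whole = record
    { member = λ _ → true ; member-≈ = λ _ _ → _ ; 0-member = _
    ; +-closed = λ _ _ → _ ; *ₗ-closed = λ _ _ → _ }

  Independent : ∀ {d} → Vector Carrierᴹ d → Set _
  Independent b = ∀ a → lincomb a b ≈ᴹ 0ᴹ → ∀ i → a i ≈ 0#

  record IsBasis (U : Subspace) {d} (b : Vector Carrierᴹ d) : Set (c ⊔ ℓ ⊔ m ⊔ ℓm) where
    field
      inside      : ∀ i → b i ∈ U
      independent : Independent b
      spanning    : ∀ v → v ∈ U → ∃ λ a → lincomb a b ≈ᴹ v

  HasDim : Subspace → ℕ → Set _
  HasDim U d = ∃ λ (b : Vector Carrierᴹ d) → IsBasis U b

  module Lincomb where
    open import Relation.Binary.Reasoning.Setoid ≈ᴹ-setoid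

    lincomb-cong : ∀ {d} {a a′ : Vector Carrier d} (b : Vector Carrierᴹ d) →
                   (∀ i → a i ≈ a′ i) → lincomb a b ≈ᴹ lincomb a′ b
    lincomb-cong b eq = sum-cong-≋ λ i → *ₗ-congʳ (eq i)

    lincomb-0 : ∀ {d} (b : Vector Carrierᴹ d) → lincomb (λ _ → 0#) b ≈ᴹ 0ᴹ
    lincomb-0 {zero}  b = ≈ᴹ-refl
    lincomb-0 {suc d} b =
      ≈ᴹ-trans (+ᴹ-cong (*ₗ-zeroˡ (b zero)) (lincomb-0 (b ∘ suc))) (+ᴹ-identityˡ 0ᴹ)

    lincomb-+ : ∀ {d} (a a′ : Vector Carrier d) (b : Vector Carrierᴹ d) →
                lincomb (λ i → a i + a′ i) b ≈ᴹ lincomb a b +ᴹ lincomb a′ b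
    lincomb-+ a a′ b = ≈ᴹ-trans (sum-cong-≋ λ i → *ₗ-distribʳ (b i) (a i) (a′ i))
      (∑-distrib-+ (λ i → a i *ₗ b i) (λ i → a′ i *ₗ b i))

    lincomb-* : ∀ {d} x (a : Vector Carrier d) (b : Vector Carrierᴹ d) →
                lincomb (λ i → x * a i) b ≈ᴹ x *ₗ lincomb a b
    lincomb-* {zero}  x a b = ≈ᴹ-sym (*ₗ-zeroʳ x)
    lincomb-* {suc d} x a b = ≈ᴹ-trans
      (+ᴹ-cong (*ₗ-assoc x (a zero) (b zero)) (lincomb-* x (a ∘ suc) (b ∘ suc)))
      (≈ᴹ-sym (*ₗ-distribˡ x _ _))

    lincomb-generator : ∀ {d} (b : Vector Carrierᴹ d) i → ∃ λ a → lincomb a b ≈ᴹ b i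
    lincomb-generator b zero = 1# ∷ (λ _ → 0#) ,
      ≈ᴹ-trans (+ᴹ-cong (*ₗ-identityˡ (b zero)) (lincomb-0 (b ∘ suc))) (+ᴹ-identityʳ (b zero))
    lincomb-generator b (suc i) = let (a , eq) = lincomb-generator (b ∘ suc) i in
      0# ∷ a , ≈ᴹ-trans (+ᴹ-cong (*ₗ-zeroˡ (b zero)) eq) (+ᴹ-identityˡ (b (suc i)))

    lincomb-member : ∀ U {d} (a : Vector Carrier d) (b : Vector Carrierᴹ d) →
                     (∀ i → b i ∈ U) → lincomb a b ∈ U
    lincomb-member U {zero}  a b b∈U = 0-member U
    lincomb-member U {suc d} a b b∈U =
      +-closed U (*ₗ-closed U (a zero) (b∈U zero))
                 (lincomb-member U (a ∘ suc) (b ∘ suc) (b∈U ∘ suc))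

    solve-for-head : ∀ x y v w → x * y ≈ 1# → x *ₗ v +ᴹ w ≈ᴹ 0ᴹ → (- y) *ₗ w ≈ᴹ v
    solve-for-head x y v w xy≈1 eq = begin
      (- y) *ₗ w                              ≈⟨ +ᴹ-identityʳ _ ⟨
      (- y) *ₗ w +ᴹ 0ᴹ                        ≈⟨ +ᴹ-congˡ (*ₗ-zeroʳ y) ⟨
      (- y) *ₗ w +ᴹ y *ₗ 0ᴹ                   ≈⟨ +ᴹ-congˡ (*ₗ-congˡ eq) ⟨
      (- y) *ₗ w +ᴹ y *ₗ (x *ₗ v +ᴹ w)        ≈⟨ +ᴹ-congˡ (*ₗ-congˡ (+ᴹ-comm (x *ₗ v) w)) ⟩
      (- y) *ₗ w +ᴹ y *ₗ (w +ᴹ x *ₗ v)        ≈⟨ +ᴹ-congˡ (*ₗ-distribˡ y w (x *ₗ v)) ⟩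
      (- y) *ₗ w +ᴹ (y *ₗ w +ᴹ y *ₗ x *ₗ v)   ≈⟨ +ᴹ-assoc _ _ _ ⟨
      (- y) *ₗ w +ᴹ y *ₗ w +ᴹ y *ₗ x *ₗ v     ≈⟨ +ᴹ-congʳ (*ₗ-distribʳ w (- y) y) ⟨
      (- y + y) *ₗ w +ᴹ y *ₗ x *ₗ v           ≈⟨ +ᴹ-congʳ (*ₗ-congʳ (-‿inverseˡ y)) ⟩
      0# *ₗ w +ᴹ y *ₗ x *ₗ v                  ≈⟨ +ᴹ-congʳ (*ₗ-zeroˡ w) ⟩
      0ᴹ +ᴹ y *ₗ x *ₗ v                       ≈⟨ +ᴹ-identityˡ _ ⟩
      y *ₗ x *ₗ v                             ≈⟨ *ₗ-assoc y x v ⟨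
      (y * x) *ₗ v                            ≈⟨ *ₗ-congʳ (trans (*-comm y x) xy≈1) ⟩
      1# *ₗ v                                 ≈⟨ *ₗ-identityˡ v ⟩
      v                                       ∎

  open Lincomb

  infix 4 _≟_

  _≟_ : ∀ x y → Dec (x ≈ y)
  x ≟ y = map′ injective to-cong (to x Fin.≟ to y)
    where
    open Inverse enumeration
    injective : to x ≡ to y → x ≈ y
    injective eq = trans (sym (strictlyInverseʳ x)) (trans (from-cong eq) (strictlyInverseʳ y))

  scalars : ∀ d → Fin (order ℕ.^ d) → Vector Carrier d
  scalars d k i = Inverse.from enumeration (Fin.finToFun k i)

  scalars-surjective : ∀ {d} (a : Vector Carrier d) → ∃ λ k → ∀ i → scalars d k i ≈ a i
  scalars-surjective a = Fin.funToFin (to ∘ a) , λ i → trans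
    (from-cong (Fin.finToFun-funToFin (to ∘ a) i)) (strictlyInverseʳ (a i))
    where open Inverse enumeration

  module FiniteDimensional {n} (dimH : HasDim whole n) where

    private
      open IsBasis (proj₂ dimH)

      coords : Carrierᴹ → Vector Carrier n
      coords v = proj₁ (spanning v _)

    ∣H∣ : ℕ
    ∣H∣ = order ℕ.^ n

    point : Fin ∣H∣ → Carrierᴹ
    point k = lincomb (scalars n k) (proj₁ dimH)

    point-surjective : ∀ v → ∃ λ k → point k ≈ᴹ v
    point-surjective v = let (k , eq) = scalars-surjective (coords v) in
      k , ≈ᴹ-trans (lincomb-cong (proj₁ dimH) eq) (proj₂ (spanning v _))

    infix 4 _≟ᴹ_

    _≟ᴹ_ : ∀ u v → Dec (u ≈ᴹ v)
    u ≟ᴹ v = map′ vanish⇒≈ ≈⇒vanish (Fin.all? λ i → coords w i ≟ 0#)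
      where
      open import Algebra.Properties.Group +ᴹ-group using (inverseʳ-unique; ⁻¹-involutive)
      w : Carrierᴹ
      w = u +ᴹ -ᴹ v
      w≈ : lincomb (coords w) (proj₁ dimH) ≈ᴹ w
      w≈ = proj₂ (spanning w _)
      vanish⇒≈ : (∀ i → coords w i ≈ 0#) → u ≈ᴹ v
      vanish⇒≈ z = ≈ᴹ-sym (≈ᴹ-trans (≈ᴹ-sym (⁻¹-involutive v)) (≈ᴹ-trans (-ᴹ‿cong
        (inverseʳ-unique u (-ᴹ v) (≈ᴹ-trans (≈ᴹ-sym w≈)
          (≈ᴹ-trans (lincomb-cong (proj₁ dimH) z) (lincomb-0 (proj₁ dimH))))))
        (⁻¹-involutive u)))
      ≈⇒vanish : u ≈ᴹ v → ∀ i → coords w i ≈ 0#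
      ≈⇒vanish eq = independent (coords w)
        (≈ᴹ-trans w≈ (≈ᴹ-trans (+ᴹ-congʳ eq) (-ᴹ‿inverseʳ v)))

    span? : ∀ {d} (b : Vector Carrierᴹ d) v → Dec (∃ λ a → lincomb a b ≈ᴹ v)
    span? {d} b v = map′
      (λ (k , eq) → scalars d k , eq)
      (λ (a , eq) → let (k , k≈) = scalars-surjective a in
        k , ≈ᴹ-trans (lincomb-cong b k≈) eq)
      (Fin.any? λ k → lincomb (scalars d k) b ≟ᴹ v)

    span : ∀ {d} → Vector Carrierᴹ d → Subspace
    span b = record
      { member    = λ v → ⌊ span? b v ⌋
      ; member-≈  = λ {u} {v} u≈v p → let (a , eq) = toWitness {a? = span? b u} p in
          fromWitness {a? = span? b v} (a , ≈ᴹ-trans eq u≈v)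
      ; 0-member  = fromWitness {a? = span? b 0ᴹ} ((λ _ → 0#) , lincomb-0 b)
      ; +-closed  = λ {u} {v} p q →
          let (a , eq) = toWitness {a? = span? b u} p ; (a′ , eq′) = toWitness {a? = span? b v} q in
          fromWitness {a? = span? b (u +ᴹ v)}
            ((λ i → a i + a′ i) , ≈ᴹ-trans (lincomb-+ a a′ b) (+ᴹ-cong eq eq′))
      ; *ₗ-closed = λ x {v} p → let (a , eq) = toWitness {a? = span? b v} p in
          fromWitness {a? = span? b (x *ₗ v)}
            ((λ i → x * a i) , ≈ᴹ-trans (lincomb-* x a b) (*ₗ-congˡ eq)) }

    private
      record PartialBasis (U : Subspace) (vs : List Carrierᴹ) : Set (c ⊔ ℓ ⊔ m ⊔ ℓm) where
        field
          size : ℕ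
          vec  : Vector Carrierᴹ size
          vec∈ : ∀ i → vec i ∈ U
          free : Independent vec
          gen  : ∀ {v} → v ∈ₗ vs → v ∈ U → ∃ λ a → lincomb a vec ≈ᴹ v

      skip : ∀ {U v vs} (B : PartialBasis U vs) →
             (v ∈ U → ∃ λ a → lincomb a (PartialBasis.vec B) ≈ᴹ v) → PartialBasis U (v ∷ₗ vs)
      skip B v-gen = record { PartialBasis B hiding (gen) ; gen = λ where
        (here ≡.refl) v∈U → v-gen v∈U
        (there v∈vs)  v∈U → PartialBasis.gen B v∈vs v∈U }

      extend : ∀ {U v vs} (B : PartialBasis U vs) → v ∈ U →
               ¬ (∃ λ a → lincomb a (PartialBasis.vec B) ≈ᴹ v) → PartialBasis U (v ∷ₗ vs)
      extend {U} {v} {vs} B v∈U v∉span = record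
        { size = suc size ; vec = v ∷ vec
        ; vec∈ = λ { zero → v∈U ; (suc i) → vec∈ i }
        ; free = free′ ; gen = gen′ }
        where
        open PartialBasis B
        free′ : Independent (v ∷ vec)
        free′ a eq = case a zero ≟ 0# of λ where
          (yes a₀≈0) → λ where
            zero    → a₀≈0
            (suc i) → free (a ∘ suc) (≈ᴹ-trans (≈ᴹ-sym (+ᴹ-identityˡ _))
              (≈ᴹ-trans (+ᴹ-congʳ (≈ᴹ-sym (≈ᴹ-trans (*ₗ-congʳ a₀≈0) (*ₗ-zeroˡ v)))) eq)) i
          (no a₀≉0) → let (y , a₀y≈1) = invertible (a zero) a₀≉0 in
            contradiction
              ((λ i → (- y) * a (suc i)) ,
               ≈ᴹ-trans (lincomb-* (- y) (a ∘ suc) vec)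
                 (solve-for-head (a zero) y v (lincomb (a ∘ suc) vec) a₀y≈1 eq))
              v∉span
        gen′ : ∀ {u} → u ∈ₗ (v ∷ₗ vs) → u ∈ U → ∃ λ a → lincomb a (v ∷ vec) ≈ᴹ u
        gen′ (here ≡.refl) _ = lincomb-generator (v ∷ vec) zero
        gen′ (there u∈vs) u∈U = let (a , eq) = gen u∈vs u∈U in
          0# ∷ a , ≈ᴹ-trans (+ᴹ-congʳ (*ₗ-zeroˡ v)) (≈ᴹ-trans (+ᴹ-identityˡ _) eq)

      partialBasis : ∀ U vs → PartialBasis U vs
      partialBasis U [] = record
        { size = 0 ; vec = λ () ; vec∈ = λ () ; free = λ _ _ () ; gen = λ () }
      partialBasis U (v ∷ₗ vs) = step (partialBasis U vs)
        where
        step : PartialBasis U vs → PartialBasis U (v ∷ₗ vs)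
        step B = case T? (member U v) of λ where
          (no v∉U)  → skip B λ v∈U → contradiction v∈U v∉U
          (yes v∈U) → case span? (PartialBasis.vec B) v of λ where
            (yes v∈span) → skip B λ _ → v∈span
            (no v∉span)  → extend B v∈U v∉span

    hasDim : ∀ U → ∃ (HasDim U)
    hasDim U = size , vec , record
      { inside = vec∈ ; independent = free ; spanning = λ v v∈U →
          let (k , k≈v) = point-surjective v
              (a , eq)  = gen (∈-map⁺ point (∈-allFin k)) (member-≈ U (≈ᴹ-sym k≈v) v∈U)
          in a , ≈ᴹ-trans eq k≈v }
      where open PartialBasis (partialBasis U (map point (allFin ∣H∣)))

    dim : Subspace → ℕ
    dim U = proj₁ (hasDim U)

    infix 4 _⊆?_ _≐?_

    _⊆?_ : ∀ U W → Dec (U ⊆ W)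
    U ⊆? W = map′
      (λ p v v∈U → let (k , k≈v) = point-surjective v in
        member-≈ W k≈v (p k (member-≈ U (≈ᴹ-sym k≈v) v∈U)))
      (λ p k → p (point k))
      (Fin.all? λ k → T? (member U (point k)) →-dec T? (member W (point k)))

    _≐?_ : ∀ U W → Dec (U ≐ W)
    U ≐? W = (U ⊆? W) ×-dec (W ⊆? U)

    disjoint? : ∀ U W → Dec (Disjoint U W)
    disjoint? U W = map′
      (λ p v v∈U v∈W → let (k , k≈v) = point-surjective v in
        ≈ᴹ-trans (≈ᴹ-sym k≈v)
          (p k (member-≈ U (≈ᴹ-sym k≈v) v∈U) (member-≈ W (≈ᴹ-sym k≈v) v∈W)))
      (λ p k → p (point k))
      (Fin.all? λ k → T? (member U (point k)) →-dec
                      (T? (member W (point k)) →-dec (point k ≟ᴹ 0ᴹ)))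

    subspaceDecSetoid : DecSetoid (c ⊔ m ⊔ ℓm) m
    subspaceDecSetoid = record
      { Carrier = Subspace ; _≈_ = _≐_
      ; isDecEquivalence = record
        { isEquivalence = record
          { refl  = (λ _ p → p) , (λ _ p → p)
          ; sym   = λ (p , q) → q , p
          ; trans = λ (p , q) (r , s) → (λ v → r v ∘ p v) , (λ v → q v ∘ s v) }
        ; _≟_ = _≐?_ } }

    spanOf : Fin (∣H∣ ℕ.^ ∣H∣) → Subspace
    spanOf k = span (point ∘ Fin.finToFun {∣H∣} {∣H∣} k)

    -- Every subspace is spanned by a family of ∣H∣ vectors, so none is missed.
    subspaces : List Subspace
    subspaces = deduplicate _≐?_ (map spanOf (allFin (∣H∣ ℕ.^ ∣H∣)))

    spanOf-surjective : ∀ U → ∃ λ k → U ≐ spanOf k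
    spanOf-surjective U = code , swap eq
      where
      o : Fin ∣H∣
      o = proj₁ (point-surjective 0ᴹ)
      g : Fin ∣H∣ → Fin ∣H∣
      g k = if member U (point k) then k else o
      g∈ : ∀ k → point (g k) ∈ U
      g∈ k with member U (point k) in eq
      ... | true  = ≡.subst T (≡.sym eq) _
      ... | false = member-≈ U (≈ᴹ-sym (proj₂ (point-surjective 0ᴹ))) (0-member U)
      g-fix : ∀ k → point k ∈ U → g k ≡ k
      g-fix k p with member U (point k)
      ... | true = ≡.refl
      code : Fin (∣H∣ ℕ.^ ∣H∣)
      code = Fin.funToFin g
      f : Fin ∣H∣ → Carrierᴹ
      f = point ∘ Fin.finToFun code
      f≡ : ∀ k → f k ≡ point (g k)
      f≡ k = ≡.cong point (Fin.finToFun-funToFin g k)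
      eq : span f ≐ U
      eq = (λ v v∈ → let (a , a≈v) = toWitness {a? = span? f v} v∈ in
              member-≈ U a≈v (lincomb-member U a f λ k → ≡.subst (_∈ U) (≡.sym (f≡ k)) (g∈ k)))
         , (λ v v∈U →
              let (k , k≈v) = point-surjective v
                  (a , a≈)  = lincomb-generator f k
                  fk≈v = ≈ᴹ-trans (≈ᴹ-reflexive (≡.trans (f≡ k)
                           (≡.cong point (g-fix k (member-≈ U (≈ᴹ-sym k≈v) v∈U))))) k≈v
              in fromWitness {a? = span? f v} (a , ≈ᴹ-trans a≈ fk≈v))

    Unique : List Subspace → Set _
    Unique = AllPairs λ U W → ¬ U ≐ W

    subspaces-unique : Unique subspaces
    subspaces-unique = deduplicate-! subspaceDecSetoid (map spanOf (allFin (∣H∣ ℕ.^ ∣H∣)))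

    subspaces-complete : ∀ U → Any (U ≐_) subspaces
    subspaces-complete U = let (k , U≐) = spanOf-surjective U in
      ∈-deduplicate⁺ subspaceSetoid _≐?_ (λ {U} {V} {W} p q → ≐-trans {U} {V} {W} q (≐-sym {W} {V} p))
        {xs = map spanOf (allFin (∣H∣ ℕ.^ ∣H∣))} {z = U}
        (Any.map (λ { ≡.refl → U≐ }) (∈-map⁺ spanOf (∈-allFin k)))
      where open DecSetoid subspaceDecSetoid renaming (setoid to subspaceSetoid; sym to ≐-sym; trans to ≐-trans) using ()

    lookup-injective : ∀ {Us} → Unique Us → ∀ i j → lookup Us i ≐ lookup Us j → i ≡ j
    lookup-injective (_ ∷ₚ _)  zero    zero    _  = ≡.refl
    lookup-injective (p ∷ₚ _)  zero    (suc j) eq = contradiction eq (All.lookup p (∈-lookup j))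
    lookup-injective (p ∷ₚ _)  (suc i) zero    eq = contradiction (swap eq) (All.lookup p (∈-lookup i))
    lookup-injective (_ ∷ₚ ps) (suc i) (suc j) eq = ≡.cong suc (lookup-injective ps i j eq)

    module Avoiding (h : Subspace) where

      private
        avoiding : List Subspace
        avoiding = filter (λ y → disjoint? y h) subspaces

      -- The set X of subspaces y with y ∩ h = 0, listed without repetition;
      -- i : Fin ∣X∣ stands for the subspace vertex i.
      ∣X∣ : ℕ
      ∣X∣ = length avoiding

      vertex : Fin ∣X∣ → Subspace
      vertex = lookup avoiding

      vertex-disjoint : ∀ i → Disjoint (vertex i) h
      vertex-disjoint i = proj₂ (∈-filter⁻ (λ y → disjoint? y h) {xs = subspaces} (∈-lookup i))

      vertex-injective : ∀ i j → vertex i ≐ vertex j → i ≡ j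
      vertex-injective = lookup-injective (AllPairs.filter⁺ (λ y → disjoint? y h) subspaces-unique)

      vertex-surjective : ∀ y → Disjoint y h → ∃ λ i → y ≐ vertex i
      vertex-surjective y y∩h = index y∈ , lookup-index y∈
        where
        y∈ : Any (y ≐_) avoiding
        y∈ = SetoidMembership.∈-filter⁺ (DecSetoid.setoid subspaceDecSetoid) (λ y → disjoint? y h)
          (λ (_ , W⊆U) U∩h v v∈W → U∩h v (W⊆U v v∈W)) {v = y} {xs = subspaces}
          (subspaces-complete y) y∩h

------------------------------------------------------------------------
-- Q-polynomial matrices

module Matrices {c ℓ} (K : CommutativeRing c ℓ) where

  open CommutativeRing K
  open import Algebra.Properties.CommutativeMonoid.Sum +-commutativeMonoid using (sum)

  Matrix : ℕ → Set c
  Matrix n = Fin n → Fin n → Carrier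

  infix 4 _≈ᵐ_ _≈ᵛ_

  _≈ᵐ_ : ∀ {n} → Matrix n → Matrix n → Set ℓ
  A ≈ᵐ B = ∀ y z → A y z ≈ B y z

  _≈ᵛ_ : ∀ {n} → Vector Carrier n → Vector Carrier n → Set ℓ
  u ≈ᵛ v = ∀ y → u y ≈ v y

  0ᵛ : ∀ {n} → Vector Carrier n
  0ᵛ _ = 0#

  identity : ∀ {n} → Matrix n
  identity y z = if does (y Fin.≟ z) then 1# else 0#

  infixl 7 _·_ _·ᵛ_ _*ᵛ_ _*ᵐ_
  infixl 6 _+ᵐ_ _+ᵛ_

  _+ᵐ_ _·_ : ∀ {n} → Matrix n → Matrix n → Matrix n
  (A +ᵐ B) y z = A y z + B y z
  (A · B) y z  = sum λ x → A y x * B x z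

  _*ᵐ_ : ∀ {n} → Carrier → Matrix n → Matrix n
  (a *ᵐ A) y z = a * A y z

  _+ᵛ_ : ∀ {n} → Vector Carrier n → Vector Carrier n → Vector Carrier n
  (u +ᵛ v) y = u y + v y

  _*ᵛ_ : ∀ {n} → Carrier → Vector Carrier n → Vector Carrier n
  (a *ᵛ v) y = a * v y

  _·ᵛ_ : ∀ {n} → Matrix n → Vector Carrier n → Vector Carrier n
  (A ·ᵛ v) y = sum λ z → A y z * v z

  -- The unital subalgebra generated by B.
  data Generated {n} (B : Matrix n) : Pred (Matrix n) (c ⊔ ℓ) where
    generator : Generated B B
    one       : Generated B identity
    add       : ∀ {C D} → Generated B C → Generated B D → Generated B (C +ᵐ D)
    scale     : ∀ a {C} → Generated B C → Generated B (a *ᵐ C)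
    mul       : ∀ {C D} → Generated B C → Generated B D → Generated B (C · D)
    resp      : ∀ {C D} → C ≈ᵐ D → Generated B C → Generated B D

  Span : ∀ {n k} → (Fin k → Matrix n) → Pred (Matrix n) (c ⊔ ℓ)
  Span E C = ∃ λ (a : Fin _ → Carrier) → C ≈ᵐ λ y z → sum λ i → a i * E i y z

  Eigenspace : ∀ {n} → Matrix n → Carrier → Pred (Vector Carrier n) ℓ
  Eigenspace A θ v = A ·ᵛ v ≈ᵛ θ *ᵛ v

  IsEigenvalue : ∀ {n} → Matrix n → Carrier → Set (c ⊔ ℓ)
  IsEigenvalue A θ = ∃ λ v → ¬ v ≈ᵛ 0ᵛ × Eigenspace A θ v

  infixl 6 _⊞_

  _⊞_ : ∀ {n p q} → Pred (Vector Carrier n) p → Pred (Vector Carrier n) q →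
        Pred (Vector Carrier n) (c ⊔ ℓ ⊔ p ⊔ q)
  (U ⊞ W) v = ∃ λ u → ∃ λ w → U u × W w × v ≈ᵛ u +ᵛ w

  -- The eigenspaces in order, V i being the eigenspace for θ i; V at i is V i
  -- for 0 ≤ i ≤ D and zero for every other integer i.
  record EigenspaceOrdering {n} (A : Matrix n) (D : ℕ) : Set (c ⊔ ℓ) where
    field
      θ          : Fin (suc D) → Carrier
      eigenvalue : ∀ i → IsEigenvalue A (θ i)
      distinct   : ∀ i j → θ i ≈ θ j → i ≡ j
      exhaustive : ∀ μ → IsEigenvalue A μ → ∃ λ i → μ ≈ θ i

    V : Fin (suc D) → Pred (Vector Carrier n) ℓ
    V i = Eigenspace A (θ i)

    V⟨_⟩ : ℤ → Pred (Vector Carrier n) ℓ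
    V⟨ -[1+ _ ] ⟩ = _≈ᵛ 0ᵛ
    V⟨ + k ⟩ with k ℕ.<? suc D
    ... | yes k≤D = V (fromℕ< k≤D)
    ... | no  _   = _≈ᵛ 0ᵛ

  open EigenspaceOrdering public

  record IsDualAdjacency {n k D} {A : Matrix n} (E* : Fin k → Matrix n)
                         (O : EigenspaceOrdering A D) (A* : Matrix n) : Set (c ⊔ ℓ) where
    field
      generates   : ∀ C → Generated A* C ⇔ Span E* C
      tridiagonal : ∀ i v → V O i v →
                    (V⟨ O ⟩ (ℤ.pred (+ toℕ i)) ⊞ V O i ⊞ V⟨ O ⟩ (ℤ.suc (+ toℕ i))) (A* ·ᵛ v)

  IsQPolynomialOrdering : ∀ {n k D} {A : Matrix n} → (Fin k → Matrix n) →
                          EigenspaceOrdering A D → Set (c ⊔ ℓ)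
  IsQPolynomialOrdering E* O = ∃ λ A* → IsDualAdjacency E* O A*

------------------------------------------------------------------------
-- The Attenuated Space poset

module AttenuatedSpace
  {c ℓ m ℓm} (F : FiniteField c ℓ) (H : Module (FiniteField.commutativeRing F) m ℓm)
  (N M : ℕ) (dimH : VectorSpace.HasDim F H (VectorSpace.whole F H) (N ℕ.+ M))
  (h : VectorSpace.Subspace F H) where

  open VectorSpace F H
  open FiniteDimensional dimH
  open Avoiding h public

  private
    q : ℕ
    q = FiniteField.order F

  dimension : Fin ∣X∣ → ℕ
  dimension y = dim (vertex y)

  Covers : Fin ∣X∣ → Fin ∣X∣ → Set m
  Covers z y = vertex y ⊆ vertex z × dimension z ≡ suc (dimension y)

  covers? : ∀ z y → Dec (Covers z y)
  covers? z y = (vertex y ⊆? vertex z) ×-dec (dimension z ℕ.≟ suc (dimension y))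

  module _ {k ℓk} (K : CommutativeRing k ℓk) where

    open CommutativeRing K using (0#; 1#; +-rawMonoid)
    open import Algebra.Definitions.RawMonoid +-rawMonoid using () renaming (_×_ to _ℕ×_)
    open Matrices K

    qAdjacency : Matrix ∣X∣
    qAdjacency y z =
      if does (covers? y z) then 1# else
      if does (covers? z y) then (q ℕ.^ dimension y) ℕ× 1# else
      0#

    E* : Fin (suc N) → Matrix ∣X∣
    E* i y z = if does (y Fin.≟ z) ∧ does (dimension y ℕ.≟ toℕ i) then 1# else 0#

    IsQPolynomial : Matrix ∣X∣ → Set _
    IsQPolynomial A = ∃ λ (O : EigenspaceOrdering A (2 ℕ.* N)) → IsQPolynomialOrdering E* O

{-# OPTIONS --safe #-}
-- Write A = U + L, where U sums a function over the elements covered by y, and L is q^dim y times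
-- the sum over the elements covering y. Counting flags in the poset gives the down-up relations
--   L²U - q(q+1) LUL + q³ UL² = -(q+1) q^(N+M) L,   LU² - q(q+1) ULU + q³ U²L = -(q+1) q^(N+M) U,
-- and these, with B = diag(q^(-dim y)), give the tridiagonal relation
--   A³B - (β+1) A²BA + (β+1) ABA² - BA³ = ρ (AB - BA),   β = q + 1/q,  ρ = (q+1)² q^(N+M-2).
-- So if Av = θv, then Bv is killed by (A - θ)(A - θ₊)(A - θ₋), where θ₊ and θ₋ are the roots of
-- x² - βθx + θ² - ρ, and Lagrange interpolation splits Bv into eigenvectors for θ₋, θ and θ₊.
--
-- Put θ(k) = q^((N+M)/2) (q^(k/2) - q^(-k/2)) / (q-1); then θ₊ and θ₋ are θ(k+2) and θ(k-2) for θ = θ(k).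
-- The eigenvalues are the θ(k) with -N ≤ k ≤ N, ordered as k = N, N-2, ..., -N, N-1, N-3, ..., 1-N.
-- Each of them occurs: if Lu = 0 and LUu = τu, then u, Uu, U²u, ... span an A-stable space on which A is
-- tridiagonal, and it suffices to take for u the indicator of the zero subspace and the difference
-- of the indicators of two points of H with the same image in H/h. There are no others: if Av = μv
-- and v vanishes below level r, then applying L^(m+n) Uⁿ to v shows that polynomials in LU with no
-- common root kill the level r part of v, unless μ is some θ(k).
module Submission where

open import Defs
open import Level using (_⊔_)
open import Algebra.Bundles using (CommutativeRing; module CommutativeMonoid)
open import Algebra.Module.Bundles using (Module)
import Algebra.Solver.Ring
open import Algebra.Solver.Ring.AlmostCommutativeRing using (AlmostCommutativeRing; fromCommutativeRing; _-Raw-AlmostCommutative⟶_)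
open import Data.Bool.Base using (Bool; true; false; T; _∧_; if_then_else_)
open import Data.Bool.Properties using (T?; T-∧)
open import Data.Fin.Base using (Fin; zero; suc; toℕ; fromℕ<)
import Data.Fin.Base as Fin using (funToFin; combine)
import Data.Fin.Properties as Fin
open import Data.Integer.Base as ℤ using (ℤ; +_; -[1+_]; _⊖_)
import Data.Integer.Properties as ℤ
open import Data.Maybe.Base using (map)
open import Data.Nat.Base as ℕ using (ℕ; zero; suc; s≤s)
import Data.Nat.Properties as ℕ
open import Data.Nat.Solver using (module +-*-Solver)
open import Data.Product.Base using (∃; _×_; _,_; proj₁; proj₂)
open import Data.Rational.Base as ℚ using (ℚ; 0ℚ; 1ℚ; ½; ∣_∣)
import Data.Rational.Properties as ℚ
open import Data.Rational.Unnormalised.Base as ℚᵘ using (mkℚᵘ)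
import Data.Rational.Unnormalised.Properties as ℚᵘ
open import Data.Sum.Base using (_⊎_; inj₁; inj₂)
open import Data.Unit.Base using (⊤; tt)
open import Data.Vec.Functional using (Vector; _∷_)
open import Function.Base using (_∘_; case_of_)
open import Function.Bundles using (Inverse; Equivalence; mk⇔)
open import Relation.Binary.Definitions using (Tri; tri<; tri≈; tri>)
open import Relation.Binary.PropositionalEquality as ≡ using (_≡_; _≢_)
open import Relation.Nullary.Decidable as Dec
  using (Dec; yes; no; does; ⌊_⌋; dec-true; dec-false; toWitness; fromWitness; from-no; dec⇒maybe; isYes≗does; _×-dec_; ¬?)
open import Relation.Nullary.Negation using (¬_; contradiction)

module IntegerSolver {k ℓk} (K : CommutativeRing k ℓk) where
  open CommutativeRing K hiding (zero)
  open import Algebra.Properties.Ring ring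
  open import Algebra.Properties.Group +-group using (⁻¹-involutive)
  open import Algebra.Properties.AbelianGroup +-abelianGroup using (⁻¹-∙-comm)
  open import Algebra.Properties.Semiring.Mult.TCOptimised semiring using (1+×; ×-homo-+; ×1-homo-*) renaming (_×_ to _ℕ×_)
  open import Relation.Binary.Reasoning.Setoid setoid

  fromℤ : ℤ → Carrier
  fromℤ (+ n)    = n ℕ× 1#
  fromℤ -[1+ n ] = - (suc n ℕ× 1#)

  fromℤ-⊖ : ∀ m n → fromℤ (m ⊖ n) ≈ m ℕ× 1# - n ℕ× 1#
  fromℤ-⊖ zero    zero    = sym (-‿inverseʳ 0#)
  fromℤ-⊖ zero    (suc n) = sym (+-identityˡ _)
  fromℤ-⊖ (suc m) zero    = begin
    suc m ℕ× 1#           ≈⟨ +-identityʳ _ ⟨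
    suc m ℕ× 1# + 0#      ≈⟨ +-congˡ -0#≈0# ⟨
    suc m ℕ× 1# - 0#      ∎
  fromℤ-⊖ (suc m) (suc n) = begin
    fromℤ (suc m ⊖ suc n)                  ≡⟨ ≡.cong fromℤ (ℤ.[1+m]⊖[1+n]≡m⊖n m n) ⟩
    fromℤ (m ⊖ n)                          ≈⟨ fromℤ-⊖ m n ⟩
    m ℕ× 1# - n ℕ× 1#                        ≈⟨ +-congʳ (+-identityˡ _) ⟨
    0# + m ℕ× 1# - n ℕ× 1#                   ≈⟨ +-congʳ (+-congʳ (-‿inverseʳ 1#)) ⟨
    1# - 1# + m ℕ× 1# - n ℕ× 1#              ≈⟨ +-congʳ (trans (+-assoc _ _ _) (trans (+-congˡ (+-comm _ _)) (sym (+-assoc _ _ _)))) ⟩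
    1# + m ℕ× 1# - 1# - n ℕ× 1#              ≈⟨ +-assoc _ _ _ ⟩
    1# + m ℕ× 1# + (- 1# - n ℕ× 1#)          ≈⟨ +-congˡ (⁻¹-∙-comm _ _) ⟩
    1# + m ℕ× 1# - (1# + n ℕ× 1#)            ≈⟨ +-cong (1+× m 1#) (-‿cong (1+× n 1#)) ⟨
    suc m ℕ× 1# - suc n ℕ× 1#                ∎

  fromℤ-neg : ∀ i → fromℤ (ℤ.- i) ≈ - fromℤ i
  fromℤ-neg (+ zero)  = sym -0#≈0#
  fromℤ-neg (+ suc n) = refl
  fromℤ-neg -[1+ n ]  = sym (⁻¹-involutive _)

  fromℤ-+ : ∀ i j → fromℤ (i ℤ.+ j) ≈ fromℤ i + fromℤ j
  fromℤ-+ (+ m)    (+ n)    = ×-homo-+ 1# m n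
  fromℤ-+ (+ m)    -[1+ n ] = fromℤ-⊖ m (suc n)
  fromℤ-+ -[1+ m ] (+ n)    = trans (fromℤ-⊖ n (suc m)) (+-comm _ _)
  fromℤ-+ -[1+ m ] -[1+ n ] = begin
    - (suc (suc (m ℕ.+ n)) ℕ× 1#)           ≡⟨ ≡.cong (λ k → - (suc k ℕ× 1#)) (≡.sym (ℕ.+-suc m n)) ⟩
    - ((suc m ℕ.+ suc n) ℕ× 1#)             ≈⟨ -‿cong (×-homo-+ 1# (suc m) (suc n)) ⟩
    - (suc m ℕ× 1# + suc n ℕ× 1#)            ≈⟨ ⁻¹-∙-comm _ _ ⟨
    - (suc m ℕ× 1#) - suc n ℕ× 1#            ∎

  fromℤ-*⁺ : ∀ m j → fromℤ (+ m ℤ.* j) ≈ m ℕ× 1# * fromℤ j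
  fromℤ-*⁺ m (+ n) = trans (reflexive (≡.cong fromℤ (≡.sym (ℤ.pos-* m n)))) (×1-homo-* m n)
  fromℤ-*⁺ m -[1+ n ] = begin
    fromℤ (+ m ℤ.* -[1+ n ])               ≡⟨ ≡.cong fromℤ (ℤ.neg-distribʳ-* (+ m) (+ suc n)) ⟨
    fromℤ (ℤ.- (+ m ℤ.* + suc n))          ≈⟨ fromℤ-neg (+ m ℤ.* + suc n) ⟩
    - fromℤ (+ m ℤ.* + suc n)              ≈⟨ -‿cong (fromℤ-*⁺ m (+ suc n)) ⟩
    - (m ℕ× 1# * (suc n ℕ× 1#))              ≈⟨ -‿distribʳ-* _ _ ⟩
    m ℕ× 1# * - (suc n ℕ× 1#)                ∎

  fromℤ-* : ∀ i j → fromℤ (i ℤ.* j) ≈ fromℤ i * fromℤ j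
  fromℤ-* (+ m)    j = fromℤ-*⁺ m j
  fromℤ-* -[1+ m ] j = begin
    fromℤ (-[1+ m ] ℤ.* j)                 ≡⟨ ≡.cong fromℤ (ℤ.neg-distribˡ-* (+ suc m) j) ⟨
    fromℤ (ℤ.- (+ suc m ℤ.* j))            ≈⟨ fromℤ-neg (+ suc m ℤ.* j) ⟩
    - fromℤ (+ suc m ℤ.* j)                ≈⟨ -‿cong (fromℤ-*⁺ (suc m) j) ⟩
    - (suc m ℕ× 1# * fromℤ j)               ≈⟨ -‿distribˡ-* _ _ ⟩
    - (suc m ℕ× 1#) * fromℤ j               ∎

  private
    almost : AlmostCommutativeRing _ _
    almost = fromCommutativeRing K

    morphism : ℤ.+-*-rawRing -Raw-AlmostCommutative⟶ almost
    morphism = record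
      { ⟦_⟧ = fromℤ ; +-homo = fromℤ-+ ; *-homo = fromℤ-* ; -‿homo = fromℤ-neg
      ; 0-homo = refl ; 1-homo = refl }

  open Algebra.Solver.Ring ℤ.+-*-rawRing almost morphism
    (λ i j → map (λ eq → reflexive (≡.cong fromℤ eq)) (dec⇒maybe (i ℤ.≟ j))) public
    using (solve; _:=_; _:+_; _:*_; _:-_; :-_; con; _:^_)

module RingLemmas {k ℓk} (K : CommutativeRing k ℓk) where
  open CommutativeRing K hiding (zero)
  open IntegerSolver K
  open import Algebra.Properties.Ring ring using (-0#≈0#; x∙y⁻¹≈ε⇒x≈y)

  Cancellable : Carrier → Set _
  Cancellable a = ∀ x → a * x ≈ 0# → x ≈ 0#

  Invertible : Carrier → Set _
  Invertible a = ∃ λ b → a * b ≈ 1#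

  ≈⇒-≈0 : ∀ {x y} → x ≈ y → x - y ≈ 0#
  ≈⇒-≈0 {x} {y} x≈y = trans (+-congʳ x≈y) (-‿inverseʳ y)

  -≈0⇒≈ : ∀ {x y} → x - y ≈ 0# → x ≈ y
  -≈0⇒≈ = x∙y⁻¹≈ε⇒x≈y _ _

  modulo : ∀ {x y e} z → e ≈ 0# → x ≈ y + z * e → x ≈ y
  modulo z e≈0 eq = trans eq (trans (+-congˡ (trans (*-congˡ e≈0) (zeroʳ z))) (+-identityʳ _))

  Invertible⇒Cancellable : ∀ {a} → Invertible a → Cancellable a
  Invertible⇒Cancellable {a} (b , ab≈1) x ax≈0 = modulo (- x) (≈⇒-≈0 ab≈1) (modulo b ax≈0
    (solve 3 (λ a b x → x := con (+ 0) :+ (:- x) :* (a :* b :- con (+ 1)) :+ b :* (a :* x)) refl a b x))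

  Cancellable-resp : ∀ {a b} → a ≈ b → Cancellable a → Cancellable b
  Cancellable-resp a≈b canc x bx≈0 = canc x (trans (*-congʳ a≈b) bx≈0)

  Cancellable-* : ∀ {a b} → Cancellable a → Cancellable b → Cancellable (a * b)
  Cancellable-* a b x abx≈0 = b x (a _ (trans (sym (*-assoc _ _ _)) abx≈0))

  Cancellable-factorˡ : ∀ {a} b → Cancellable (a * b) → Cancellable a
  Cancellable-factorˡ {a} b canc x ax≈0 = canc x
    (trans (solve 3 (λ a b x → a :* b :* x := b :* (a :* x)) refl a b x) (trans (*-congˡ ax≈0) (zeroʳ b)))

  Cancellable-neg : ∀ {a} → Cancellable a → Cancellable (- a)
  Cancellable-neg {a} canc x eq = canc x
    (trans (solve 2 (λ a x → a :* x := :- ((:- a) :* x)) refl a x) (trans (-‿cong eq) -0#≈0#))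

  Invertible-resp : ∀ {a b} → a ≈ b → Invertible a → Invertible b
  Invertible-resp a≈b (c , eq) = c , trans (*-congʳ (sym a≈b)) eq

  Invertible-* : ∀ {a b} → Invertible a → Invertible b → Invertible (a * b)
  Invertible-* {a} {b} (x , ax≈1) (y , by≈1) = x * y , trans
    (solve 4 (λ a b x y → a :* b :* (x :* y) := a :* x :* (b :* y)) refl a b x y)
    (trans (*-cong ax≈1 by≈1) (*-identityˡ 1#))

  Invertible-factorˡ : ∀ {a} b → Invertible (a * b) → Invertible a
  Invertible-factorˡ {a} b (c , eq) = b * c , trans (sym (*-assoc a b c)) eq

  Invertible-neg : ∀ {a} → Invertible a → Invertible (- a)
  Invertible-neg {a} (b , eq) = - b , trans (solve 2 (λ a b → (:- a) :* (:- b) := a :* b) refl a b) eq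

module Operators {k ℓk} (K : CommutativeRing k ℓk) {i} (I : Set i) where
  open CommutativeRing K hiding (zero)
  open IntegerSolver K

  Fun : Set _
  Fun = I → Carrier

  Agree : ∀ {s} → (I → Set s) → Fun → Fun → Set _
  Agree S f g = ∀ y → S y → f y ≈ g y

  record LinearOn {s} (S : I → Set s) (Φ : Fun → Fun) : Set (i ⊔ s ⊔ k ⊔ ℓk) where
    field
      cong   : ∀ {f g} → Agree S f g → Agree S (Φ f) (Φ g)
      linear : ∀ a f b g → Agree S (Φ λ y → a * f y + b * g y) (λ y → a * Φ f y + b * Φ g y)

    homogeneous : ∀ a f → Agree S (Φ λ y → a * f y) (λ y → a * Φ f y)
    homogeneous a f y Sy = trans
      (cong (λ x _ → solve 2 (λ a u → a :* u := a :* u :+ con (+ 0) :* u) refl a (f x)) y Sy)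
      (trans (linear a f 0# f y Sy) (solve 2 (λ a u → a :* u :+ con (+ 0) :* u := a :* u) refl a (Φ f y)))

    zero⇒zero : ∀ {f} → Agree S f (λ _ → 0#) → Agree S (Φ f) (λ _ → 0#)
    zero⇒zero {f} f≈0 y Sy = trans
      (cong (λ x Sx → trans (f≈0 x Sx) (sym (zeroˡ (f x)))) y Sy)
      (trans (homogeneous 0# f y Sy) (zeroˡ (Φ f y)))

  module Polynomials {s} (S : I → Set s) (Y : Fun → Fun) (Y-linear : LinearOn S Y) where
    open LinearOn

    infixl 6 _⊕_
    infixl 7 _⊗_

    data Poly : Set k where
      X       : Poly
      const   : Carrier → Poly
      _⊕_ _⊗_ : Poly → Poly → Poly

    act : Poly → Fun → Fun
    act X         f   = Y f
    act (const a) f y = a * f y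
    act (P ⊕ R)   f y = act P f y + act R f y
    act (P ⊗ R)   f   = act P (act R f)

    eval : Poly → Carrier → Carrier
    eval X         τ = τ
    eval (const a) τ = a
    eval (P ⊕ R)   τ = eval P τ + eval R τ
    eval (P ⊗ R)   τ = eval P τ * eval R τ

    act-linear : ∀ P → LinearOn S (act P)
    act-linear X = Y-linear
    act-linear (const c) = record
      { cong   = λ f≈g y Sy → *-congˡ (f≈g y Sy)
      ; linear = λ a f b g y _ → solve 5 (λ c a f b g →
          c :* (a :* f :+ b :* g) := a :* (c :* f) :+ b :* (c :* g)) refl c a (f y) b (g y) }
    act-linear (P ⊕ R) = record
      { cong   = λ f≈g y Sy → +-cong (cong (act-linear P) f≈g y Sy) (cong (act-linear R) f≈g y Sy)
      ; linear = λ a f b g y Sy → trans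
          (+-cong (linear (act-linear P) a f b g y Sy) (linear (act-linear R) a f b g y Sy))
          (solve 6 (λ a b u v w x → a :* u :+ b :* v :+ (a :* w :+ b :* x) :=
             a :* (u :+ w) :+ b :* (v :+ x)) refl a b _ _ _ _) }
    act-linear (P ⊗ R) = record
      { cong   = λ f≈g → cong (act-linear P) (cong (act-linear R) f≈g)
      ; linear = λ a f b g y Sy → trans
          (cong (act-linear P) (linear (act-linear R) a f b g) y Sy)
          (linear (act-linear P) a (act R f) b (act R g) y Sy) }

    Commutes : (Fun → Fun) → Poly → Set _
    Commutes Φ P = ∀ f → Agree S (act P (Φ f)) (Φ (act P f))

    commutes : ∀ {Φ} → LinearOn S Φ → Commutes Φ X → ∀ P → Commutes Φ P
    commutes Φ-lin base X = base
    commutes Φ-lin base (const a) f y Sy = sym (homogeneous Φ-lin a f y Sy)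
    commutes {Φ} Φ-lin base (P ⊕ R) f y Sy = trans
      (+-cong (commutes Φ-lin base P f y Sy) (commutes Φ-lin base R f y Sy))
      (trans (sym (trans (linear Φ-lin 1# (act P f) 1# (act R f) y Sy) one))
             (cong Φ-lin (λ _ _ → one) y Sy))
      where
      one : ∀ {u v} → 1# * u + 1# * v ≈ u + v
      one = +-cong (*-identityˡ _) (*-identityˡ _)
    commutes Φ-lin base (P ⊗ R) f y Sy = trans
      (cong (act-linear P) (commutes Φ-lin base R f) y Sy)
      (commutes Φ-lin base P (act R f) y Sy)

    act-comm : ∀ P R → Commutes (act R) P
    act-comm P R = commutes (act-linear R)
      (λ f y Sy → sym (commutes Y-linear (λ _ _ _ → refl) R f y Sy)) P

    act-eigen : ∀ {τ f} → Agree S (Y f) (λ y → τ * f y) → ∀ P → Agree S (act P f) (λ y → eval P τ * f y)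
    act-eigen Yf X = Yf
    act-eigen Yf (const a) y Sy = refl
    act-eigen Yf (P ⊕ R) y Sy = trans
      (+-cong (act-eigen Yf P y Sy) (act-eigen Yf R y Sy)) (sym (distribʳ _ _ _))
    act-eigen {τ} {f} Yf (P ⊗ R) y Sy = trans
      (cong (act-linear P) (act-eigen Yf R) y Sy)
      (trans (homogeneous (act-linear P) (eval R τ) f y Sy)
      (trans (*-congˡ (act-eigen Yf P y Sy))
      (solve 3 (λ a b c → a :* (b :* c) := b :* a :* c) refl (eval R τ) (eval P τ) (f y))))

-- The down-up algebra

-- Q stands for q^(N+M).
record Parameters {k ℓk} (K : CommutativeRing k ℓk) : Set (k ⊔ ℓk) where
  open CommutativeRing K hiding (zero)
  field
    q r ω Q : Carrier
    qr≈1    : q * r ≈ 1#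
    ω[q-1]≈1 : ω * (q - 1#) ≈ 1#

  open import Algebra.Properties.Semiring.Exp semiring using (_^_)
  open RingLemmas K
  open IntegerSolver K

  -- τ d is the eigenvalue of LU on a vector u with Lu = 0 and U^(d+1) u = 0 ≠ U^d u, and
  -- α j (τ d - τ j) is the eigenvalue of LU on U^j u.
  τ α β γ : ℕ → Carrier
  τ j = ω * Q * (1# - r ^ j)
  α j = ω * q ^ j * (q * q ^ j - 1#)
  β j = ω * q * q * q ^ j * (q ^ j - 1#)
  γ j = ω * ω * Q * (q * q ^ j - 1#) * (q ^ j - 1#)

  q^r^≈1 : ∀ j → q ^ j * r ^ j ≈ 1#
  q^r^≈1 zero    = *-identityˡ 1#
  q^r^≈1 (suc j) = trans
    (solve 4 (λ q r x y → q :* x :* (r :* y) := q :* r :* (x :* y)) refl q r (q ^ j) (r ^ j))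
    (trans (*-cong qr≈1 (q^r^≈1 j)) (*-identityˡ 1#))

  γ≈ατ : ∀ j → γ j ≈ α j * τ j
  γ≈ατ j = modulo (ω * ω * Q * (q * q ^ j - 1#)) (≈⇒-≈0 (q^r^≈1 j))
    (solve 5 (λ q ω Q g s →
      ω :* ω :* Q :* (q :* g :- con (+ 1)) :* (g :- con (+ 1)) :=
      ω :* g :* (q :* g :- con (+ 1)) :* (ω :* Q :* (con (+ 1) :- s)) :+
      ω :* ω :* Q :* (q :* g :- con (+ 1)) :* (g :* s :- con (+ 1))) refl q ω Q (q ^ j) (r ^ j))

  q-invertible : Invertible q
  q-invertible = r , qr≈1

  q^-invertible : ∀ j → Invertible (q ^ j)
  q^-invertible j = r ^ j , q^r^≈1 j

  continuant : Carrier → Carrier → ℕ → Carrier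
  continuant t μ zero          = 1#
  continuant t μ (suc zero)    = μ
  continuant t μ (suc (suc j)) = μ * continuant t μ (suc j) + (- 1#) * (α j * (t + - τ j) * continuant t μ j)

  ω-invertible : Invertible ω
  ω-invertible = (q - 1#) , ω[q-1]≈1

module DownUp {k ℓk} (K : CommutativeRing k ℓk) (P : Parameters K)
  {i} (I : Set i) (dim : I → ℕ) (N : ℕ) (dim≤N : ∀ y → dim y ℕ.≤ N) where

  open CommutativeRing K hiding (zero)
  open IntegerSolver K
  open RingLemmas K
  open Operators K I
  open Parameters P
  open import Algebra.Properties.Semiring.Exp semiring using (_^_)
  open import Relation.Binary.Reasoning.Setoid setoid

  Everywhere : I → Set
  Everywhere _ = ⊤

  Level : ℕ → I → Set
  Level s y = dim y ≡ s

  record GradedPair (U L : Fun → Fun) : Set (i ⊔ k ⊔ ℓk) where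
    field
      U-linear : LinearOn Everywhere U
      L-linear : LinearOn Everywhere L
      U-local  : ∀ f y → (∀ z → dim y ≡ suc (dim z) → f z ≈ 0#) → U f y ≈ 0#
      L-local  : ∀ f y → (∀ z → dim z ≡ suc (dim y) → f z ≈ 0#) → L f y ≈ 0#
      relation₁ : ∀ f y → L (L (U f)) y + q * q * q * U (L (L f)) y + (q + 1#) * Q * L f y ≈
                          q * (q + 1#) * L (U (L f)) y
      relation₂ : ∀ f y → L (U (U f)) y + q * q * q * U (U (L f)) y + (q + 1#) * Q * U f y ≈
                          q * (q + 1#) * U (L (U f)) y

  module Exhaustion {U L : Fun → Fun} (pair : GradedPair U L)
    (r-distinct : ∀ i j → ¬ i ≡ j → Cancellable (r ^ i - r ^ j)) (Q-cancellable : Cancellable Q) where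
    open GradedPair pair
    open LinearOn

    infixr 9 L^ U^

    L^ U^ : ℕ → Fun → Fun
    L^ zero    f = f
    L^ (suc j) f = L (L^ j f)
    U^ zero    f = f
    U^ (suc j) f = U (U^ j f)

    L-cong : ∀ {f g} → (∀ y → f y ≈ g y) → ∀ y → L f y ≈ L g y
    L-cong f≈g y = cong L-linear (λ z _ → f≈g z) y tt

    L-linear₃ : ∀ a f b g c h y →
      L (λ x → a * f x + b * g x + c * h x) y ≈ a * L f y + b * L g y + c * L h y
    L-linear₃ a f b g c h y = begin
      L (λ x → a * f x + b * g x + c * h x) y
        ≈⟨ L-cong (λ x → +-congʳ (sym (*-identityˡ _))) y ⟩
      L (λ x → 1# * (a * f x + b * g x) + c * h x) y
        ≈⟨ linear L-linear 1# _ c h y tt ⟩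
      1# * L (λ x → a * f x + b * g x) y + c * L h y
        ≈⟨ +-congʳ (trans (*-identityˡ _) (linear L-linear a f b g y tt)) ⟩
      a * L f y + b * L g y + c * L h y ∎

    L^-U : ∀ j f y → L^ (suc j) (U f) y ≈
           α j * L (U (L^ j f)) y + (- β j) * U (L^ (suc j) f) y + (- γ j) * L^ j f y
    L^-U zero f y = modulo (- L (U f) y) (≈⇒-≈0 ω[q-1]≈1)
      (solve 6 (λ q ω Q a b c →
        a := (ω :* con (+ 1) :* (q :* con (+ 1) :- con (+ 1))) :* a
             :+ (:- (ω :* q :* q :* con (+ 1) :* (con (+ 1) :- con (+ 1)))) :* b
             :+ (:- (ω :* ω :* Q :* (q :* con (+ 1) :- con (+ 1)) :* (con (+ 1) :- con (+ 1)))) :* c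
             :+ (:- a) :* (ω :* (q :- con (+ 1)) :- con (+ 1)))
        refl q ω Q (L (U f) y) (U (L f) y) (f y))
    L^-U (suc j) f y = begin
      L (L^ (suc j) (U f)) y
        ≈⟨ L-cong (L^-U j f) y ⟩
      L (λ x → α j * L (U (L^ j f)) x + (- β j) * U (L^ (suc j) f) x + (- γ j) * L^ j f x) y
        ≈⟨ L-linear₃ (α j) _ (- β j) _ (- γ j) _ y ⟩
      α j * L (L (U (L^ j f))) y + (- β j) * L (U (L^ (suc j) f)) y + (- γ j) * L^ (suc j) f y
        ≈⟨ modulo (α j) (≈⇒-≈0 (relation₁ (L^ j f) y))
           (modulo (Q * ω * (q * q ^ j - 1#) * (q + 1#) * q ^ j * L^ (suc j) f y) (≈⇒-≈0 ω[q-1]≈1)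
           (solve 8 (λ q ω Q g a u v w →
             ω :* g :* (q :* g :- con (+ 1)) :* a
               :+ (:- (ω :* q :* q :* g :* (g :- con (+ 1)))) :* u
               :+ (:- (ω :* ω :* Q :* (q :* g :- con (+ 1)) :* (g :- con (+ 1)))) :* w :=
             ω :* (q :* g) :* (q :* (q :* g) :- con (+ 1)) :* u
               :+ (:- (ω :* q :* q :* (q :* g) :* (q :* g :- con (+ 1)))) :* v
               :+ (:- (ω :* ω :* Q :* (q :* (q :* g) :- con (+ 1)) :* (q :* g :- con (+ 1)))) :* w
               :+ ω :* g :* (q :* g :- con (+ 1)) :*
                  (a :+ q :* q :* q :* v :+ (q :+ con (+ 1)) :* Q :* w :- q :* (q :+ con (+ 1)) :* u)
               :+ Q :* ω :* (q :* g :- con (+ 1)) :* (q :+ con (+ 1)) :* g :* w :*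
                  (ω :* (q :- con (+ 1)) :- con (+ 1)))
             refl q ω Q (q ^ j) (L (L (U (L^ j f))) y) (L (U (L^ (suc j) f)) y)
                  (U (L^ (suc (suc j)) f) y) (L^ (suc j) f y))) ⟩
      α (suc j) * L (U (L^ (suc j) f)) y + (- β (suc j)) * U (L^ (suc (suc j)) f) y
        + (- γ (suc j)) * L^ (suc j) f y ∎

    U-cong : ∀ {f g} → (∀ y → f y ≈ g y) → ∀ y → U f y ≈ U g y
    U-cong f≈g y = cong U-linear (λ z _ → f≈g z) y tt

    L^-cong : ∀ j {f g} → (∀ y → f y ≈ g y) → ∀ y → L^ j f y ≈ L^ j g y
    L^-cong zero    f≈g = f≈g
    L^-cong (suc j) f≈g = L-cong (L^-cong j f≈g)

    L^-linear : ∀ j a f b g y → L^ j (λ x → a * f x + b * g x) y ≈ a * L^ j f y + b * L^ j g y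
    L^-linear zero    a f b g y = refl
    L^-linear (suc j) a f b g y =
      trans (L-cong (L^-linear j a f b g) y) (linear L-linear a (L^ j f) b (L^ j g) y tt)

    L^-shift : ∀ j f → L^ (suc j) f ≡ L^ j (L f)
    L^-shift zero    f = ≡.refl
    L^-shift (suc j) f = ≡.cong L (L^-shift j f)

    L^-beyond : ∀ j f y → N ℕ.< dim y ℕ.+ j → L^ j f y ≈ 0#
    L^-beyond zero    f y N<y+0 =
      contradiction (dim≤N y) (ℕ.<⇒≱ (≡.subst (N ℕ.<_) (ℕ.+-identityʳ _) N<y+0))
    L^-beyond (suc j) f y N<y+j = L-local (L^ j f) y λ z z≡ →
      L^-beyond j f z (≡.subst (N ℕ.<_) (≡.trans (ℕ.+-suc _ j) (≡.cong (ℕ._+ j) (≡.sym z≡))) N<y+j)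

    Y : Fun → Fun
    Y f = L (U f)

    Y-linear : ∀ s → LinearOn (Level s) Y
    Y-linear s = record { cong = Y-cong ; linear = λ a f b g y _ → lin a f b g y }
      where
      lin : ∀ a f b g y → Y (λ x → a * f x + b * g x) y ≈ a * Y f y + b * Y g y
      lin a f b g y = trans (L-cong (λ z → linear U-linear a f b g z tt) y)
                            (linear L-linear a (U f) b (U g) y tt)
      Y-cong : ∀ {f g} → Agree (Level s) f g → Agree (Level s) (Y f) (Y g)
      Y-cong {f} {g} f≈g y y≡s = modulo 1#
        (trans (sym (lin 1# f (- 1#) g y))
          (L-local (U λ x → 1# * f x + (- 1#) * g x) y λ z z≡ → U-local _ z λ x zx → trans
            (+-congʳ (*-congˡ (f≈g x (≡.trans (ℕ.suc-injective (≡.trans (≡.sym zx) z≡)) y≡s))))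
            (solve 1 (λ u → con (+ 1) :* u :+ (:- con (+ 1)) :* u := con (+ 0)) refl (g x))))
        (solve 2 (λ u v → u := v :+ con (+ 1) :* (con (+ 1) :* u :+ (:- con (+ 1)) :* v)) refl (Y f y) (Y g y))

    module AtLevel (s : ℕ) where
      open Polynomials (Level s) Y (Y-linear s) public

      Below : Fun → Set _
      Below f = ∀ z → s ≡ suc (dim z) → f z ≈ 0#

      factor : ℕ → Poly
      factor j = const (α j) ⊗ (X ⊕ const (- τ j))

      product : ℕ → ℕ → Poly
      product m zero    = const 1#
      product m (suc n) = factor (m ℕ.+ n) ⊗ product m n

      L^-U-step : ∀ j f → Below (L^ (suc j) f) → Agree (Level s) (L^ (suc j) (U f)) (act (factor j) (L^ j f))
      L^-U-step j f below y ≡.refl = begin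
        L^ (suc j) (U f) y
          ≈⟨ L^-U j f y ⟩
        α j * Y (L^ j f) y + (- β j) * U (L^ (suc j) f) y + (- γ j) * L^ j f y
          ≈⟨ +-cong (+-congˡ (*-congˡ (U-local _ y below))) (*-congʳ (-‿cong (γ≈ατ j))) ⟩
        α j * Y (L^ j f) y + (- β j) * 0# + (- (α j * τ j)) * L^ j f y
          ≈⟨ solve 5 (λ a b t u v → a :* u :+ (:- b) :* con (+ 0) :+ (:- (a :* t)) :* v :=
               a :* (u :+ (:- t) :* v)) refl (α j) (β j) (τ j) _ _ ⟩
        act (factor j) (L^ j f) y ∎

      L^-U^-step : ∀ m n f → (∀ i k → k ℕ.≤ i → Below (L^ i (U^ k f))) →
                   Agree (Level s) (L^ (m ℕ.+ n) (U^ n f)) (act (product m n) (L^ m f))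
      L^-U^-step m zero    f below y y≡s rewrite ℕ.+-identityʳ m = sym (*-identityˡ _)
      L^-U^-step m (suc n) f below y y≡s rewrite ℕ.+-suc m n = trans
        (L^-U-step (m ℕ.+ n) (U^ n f) (below _ n (ℕ.m≤n⇒m≤1+n (ℕ.m≤n+m n m))) y y≡s)
        (LinearOn.cong (act-linear (factor (m ℕ.+ n))) (L^-U^-step m n f below) y y≡s)

      module Eigenvector (μ : Carrier) (v : Fun) (eigen : ∀ y → U v y + L v y ≈ μ * v y)
                         (below : ∀ i k → k ℕ.≤ i → Below (L^ i (U^ k v))) where

        continuantₚ : ℕ → Poly
        continuantₚ zero          = const 1#
        continuantₚ (suc zero)    = const μ
        continuantₚ (suc (suc j)) = const μ ⊗ continuantₚ (suc j) ⊕ const (- 1#) ⊗ (factor j ⊗ continuantₚ j)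

        eval-continuant : ∀ t j → eval (continuantₚ j) t ≈ continuant t μ j
        eval-continuant t zero          = refl
        eval-continuant t (suc zero)    = refl
        eval-continuant t (suc (suc j)) =
          +-cong (*-congˡ (eval-continuant t (suc j))) (*-congˡ (*-congˡ (eval-continuant t j)))

        L^-step : ∀ j → Agree (Level s) (L^ (suc (suc j)) v)
                  (λ y → μ * L^ (suc j) v y + (- 1#) * act (factor j) (L^ j v) y)
        L^-step j y y≡s = begin
          L^ (suc (suc j)) v y
            ≡⟨ ≡.cong (λ f → f y) (L^-shift (suc j) v) ⟩
          L^ (suc j) (L v) y
            ≈⟨ L^-cong (suc j) (λ z → modulo 1# (≈⇒-≈0 (eigen z))
                 (solve 4 (λ m v u l → l := m :* v :+ (:- con (+ 1)) :* u :+ con (+ 1) :* (u :+ l :- m :* v))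
                   refl μ (v z) (U v z) (L v z))) y ⟩
          L^ (suc j) (λ z → μ * v z + (- 1#) * U v z) y
            ≈⟨ L^-linear (suc j) μ v (- 1#) (U v) y ⟩
          μ * L^ (suc j) v y + (- 1#) * L^ (suc j) (U v) y
            ≈⟨ +-congˡ (*-congˡ (L^-U-step j v (below (suc j) 0 ℕ.z≤n) y y≡s)) ⟩
          μ * L^ (suc j) v y + (- 1#) * act (factor j) (L^ j v) y ∎

        L^-continuant : ∀ j → Agree (Level s) (L^ j v) (act (continuantₚ j) v)
        L^-continuant zero       y y≡s = sym (*-identityˡ _)
        L^-continuant (suc zero) y ≡.refl = modulo (- 1#) (U-local v y (below 0 0 ℕ.z≤n))
          (modulo 1# (≈⇒-≈0 (eigen y)) (solve 4 (λ m v u l →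
            l := m :* v :+ (:- con (+ 1)) :* u :+ con (+ 1) :* (u :+ l :- m :* v)) refl μ (v y) (U v y) (L v y)))
        L^-continuant (suc (suc j)) y y≡s = trans (L^-step j y y≡s)
          (+-cong (*-congˡ (L^-continuant (suc j) y y≡s))
                  (*-congˡ (LinearOn.cong (act-linear (factor j)) (L^-continuant j) y y≡s)))

        L^-U^-continuant : ∀ m n → Agree (Level s) (L^ (m ℕ.+ n) (U^ n v)) (act (product m n ⊗ continuantₚ m) v)
        L^-U^-continuant m n y y≡s = trans (L^-U^-step m n v below y y≡s)
          (LinearOn.cong (act-linear (product m n)) (L^-continuant m) y y≡s)

        α-cancellable : ∀ j → Cancellable (α j)
        α-cancellable j = Cancellable-* (Invertible⇒Cancellable (Invertible-* ω-invertible (q^-invertible j)))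
          (Cancellable-resp
            (modulo (- 1#) (≈⇒-≈0 (q^r^≈1 (suc j))) (solve 2 (λ g s →
              g :* (con (+ 1) :- s) := g :- con (+ 1) :+ (:- con (+ 1)) :* (g :* s :- con (+ 1))) refl (q ^ suc j) (r ^ suc j)))
            (Cancellable-* (Invertible⇒Cancellable (q^-invertible (suc j))) (r-distinct 0 (suc j) λ ())))

        product-cancellable : ∀ e m n → e ℕ.< m → Cancellable (eval (product m n) (τ e))
        product-cancellable e m zero    e<m = Invertible⇒Cancellable (1# , *-identityˡ 1#)
        product-cancellable e m (suc n) e<m = Cancellable-*
          (Cancellable-* (α-cancellable j) difference)
          (product-cancellable e m n e<m)
          where
          j : ℕ
          j = m ℕ.+ n
          difference : Cancellable (τ e + - τ j)
          difference = Cancellable-resp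
            (solve 4 (λ w Q s u → w :* (Q :* (s :- u)) := w :* Q :* (con (+ 1) :- u) :- w :* Q :* (con (+ 1) :- s))
              refl ω Q (r ^ j) (r ^ e))
            (Cancellable-* (Invertible⇒Cancellable ω-invertible)
              (Cancellable-* Q-cancellable (r-distinct j e λ j≡e → ℕ.<⇒≢ (ℕ.≤-trans e<m (ℕ.m≤m+n m n)) (≡.sym j≡e))))

        annihilated : ∀ m n → s ℕ.+ (m ℕ.+ n) ≡ suc N →
                      Agree (Level s) (act (product m n ⊗ continuantₚ m) v) (λ _ → 0#)
        annihilated m n eq y y≡s = trans (sym (L^-U^-continuant m n y y≡s))
          (L^-beyond (m ℕ.+ n) (U^ n v) y
            (ℕ.≤-reflexive (≡.sym (≡.trans (≡.cong (ℕ._+ (m ℕ.+ n)) y≡s) eq))))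

        module _ (nonroot : ∀ e → e ℕ.≤ N → Cancellable (continuant (τ e) μ (suc e))) where

          Vanishes : ℕ → Set _
          Vanishes e = Agree (Level s) (act (product 0 e) v) (λ _ → 0#)

          descend : ∀ e n → s ℕ.+ (suc e ℕ.+ n) ≡ suc N → Vanishes (suc e) → Vanishes e
          descend e n eq vanishes y y≡s = Cancellable-*
            (product-cancellable e (suc e) n ℕ.≤-refl)
            (Cancellable-resp (sym (eval-continuant (τ e) (suc e))) (nonroot e e≤N))
            (z y)
            (trans (sym (act-eigen Yz (product (suc e) n ⊗ continuantₚ (suc e)) y y≡s))
              (trans (act-comm (product (suc e) n ⊗ continuantₚ (suc e)) (product 0 e) v y y≡s)
                (LinearOn.zero⇒zero (act-linear (product 0 e)) (annihilated (suc e) n eq) y y≡s)))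
            where
            z : Fun
            z = act (product 0 e) v
            Yz : Agree (Level s) (Y z) (λ x → τ e * z x)
            Yz x x≡s = modulo 1# (α-cancellable e _ (vanishes x x≡s))
              (solve 3 (λ y t z → y := t :* z :+ con (+ 1) :* (y :+ (:- t) :* z)) refl (Y z x) (τ e) (z x))
            e≤N : e ℕ.≤ N
            e≤N = ℕ.s≤s⁻¹ (≡.subst (suc e ℕ.≤_) eq (ℕ.≤-trans (ℕ.m≤m+n (suc e) n) (ℕ.m≤n+m _ s)))

          vanishes-0 : ∀ e n → s ℕ.+ (e ℕ.+ n) ≡ suc N → Vanishes e → Vanishes 0
          vanishes-0 zero    n eq vanishes = vanishes
          vanishes-0 (suc e) n eq vanishes = vanishes-0 e (suc n)
            (≡.trans (≡.cong (s ℕ.+_) (ℕ.+-suc e n)) eq) (descend e n eq vanishes)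

          v-vanishes : Agree (Level s) v (λ _ → 0#)
          v-vanishes y y≡s = trans (sym (*-identityˡ _)) (vanishes-0 n 0
            (≡.trans (≡.cong (s ℕ.+_) (ℕ.+-identityʳ n)) eq)
            (λ x x≡s → trans (LinearOn.cong (act-linear (product 0 n)) (λ z _ → sym (*-identityˡ (v z))) x x≡s)
              (annihilated 0 n eq x x≡s)) y y≡s)
            where
            n : ℕ
            n = suc (N ℕ.∸ s)
            eq : s ℕ.+ n ≡ suc N
            eq = ≡.trans (ℕ.+-suc s _) (≡.cong suc (ℕ.m+[n∸m]≡n (≡.subst (ℕ._≤ N) y≡s (dim≤N y))))

          all-vanish : ∀ i k → k ℕ.≤ i → Agree (Level s) (L^ i (U^ k v)) (λ _ → 0#)
          all-vanish i k k≤i y y≡s =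
            ≡.subst (λ j → L^ j (U^ k v) y ≈ 0#) (ℕ.m∸n+n≡m k≤i)
              (trans (L^-U^-continuant (i ℕ.∸ k) k y y≡s)
                (LinearOn.zero⇒zero (act-linear (product (i ℕ.∸ k) k ⊗ continuantₚ (i ℕ.∸ k))) v-vanishes y y≡s))

    module _ (μ : Carrier) (nonroot : ∀ e → e ℕ.≤ N → Cancellable (continuant (τ e) μ (suc e)))
             (v : Fun) (eigen : ∀ y → U v y + L v y ≈ μ * v y) where

      level-vanishes : ∀ s i k → k ℕ.≤ i → Agree (Level s) (L^ i (U^ k v)) (λ _ → 0#)
      level-vanishes zero    = AtLevel.Eigenvector.all-vanish 0 μ v eigen (λ _ _ _ _ ()) nonroot
      level-vanishes (suc s) = AtLevel.Eigenvector.all-vanish (suc s) μ v eigen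
        (λ i k k≤i z s≡z → level-vanishes s i k k≤i z (≡.sym (ℕ.suc-injective s≡z))) nonroot

      eigenvector-zero : ∀ y → v y ≈ 0#
      eigenvector-zero y = level-vanishes (dim y) 0 0 ℕ.z≤n y ≡.refl

-- Factorisation of the continuant

module FactorTheorem {k ℓk} (K : CommutativeRing k ℓk) where
  open CommutativeRing K hiding (zero)
  open IntegerSolver K
  open RingLemmas K

  -- f is a polynomial function of degree at most n whose coefficient of xⁿ is c.
  Degree : ℕ → Carrier → (Carrier → Carrier) → Set (k ⊔ ℓk)
  Degree zero    c f = ∀ x → f x ≈ c
  Degree (suc n) c f = ∀ a → ∃ λ g → Degree n c g × (∀ x → f x - f a ≈ (x - a) * g x)

  degree-resp : ∀ n {c d f} → c ≈ d → Degree n c f → Degree n d f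
  degree-resp zero    c≈d f≈c x = trans (f≈c x) c≈d
  degree-resp (suc n) c≈d deg a = let (g , deg-g , eq) = deg a in g , degree-resp n c≈d deg-g , eq

  degree-+ : ∀ n {c d f g} → Degree n c f → Degree n d g → Degree n (c + d) (λ x → f x + g x)
  degree-+ zero    f≈c g≈d x = +-cong (f≈c x) (g≈d x)
  degree-+ (suc n) {f = f} {g} deg-f deg-g a =
    let (f′ , deg-f′ , eq-f) = deg-f a
        (g′ , deg-g′ , eq-g) = deg-g a
    in (λ x → f′ x + g′ x) , degree-+ n deg-f′ deg-g′ , λ x →
      modulo 1# (≈⇒-≈0 (eq-f x)) (modulo 1# (≈⇒-≈0 (eq-g x))
        (solve 8 (λ fx fa gx ga x a u v → fx :+ gx :- (fa :+ ga) := (x :- a) :* (u :+ v)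
            :+ con (+ 1) :* (fx :- fa :- (x :- a) :* u) :+ con (+ 1) :* (gx :- ga :- (x :- a) :* v))
          refl (f x) (f a) (g x) (g a) x a (f′ x) (g′ x)))

  degree-* : ∀ n b {c f} → Degree n c f → Degree n (b * c) (λ x → b * f x)
  degree-* zero    b f≈c x = *-congˡ (f≈c x)
  degree-* (suc n) b {f = f} deg a = let (g , deg-g , eq) = deg a in
    (λ x → b * g x) , degree-* n b deg-g , λ x → modulo b (≈⇒-≈0 (eq x))
      (solve 6 (λ b fx fa x a u → b :* fx :- b :* fa := (x :- a) :* (b :* u)
         :+ b :* (fx :- fa :- (x :- a) :* u)) refl b (f x) (f a) x a (g x))

  degree-raise : ∀ n {c f} → Degree n c f → Degree (suc n) 0# f
  degree-raise zero    {c} {f} f≈c a = (λ _ → 0#) , (λ _ → refl) , λ x →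
    trans (≈⇒-≈0 (trans (f≈c x) (sym (f≈c a)))) (sym (zeroʳ _))
  degree-raise (suc n) deg a = let (g , deg-g , eq) = deg a in g , degree-raise n deg-g , eq

  degree-x* : ∀ n {c f} → Degree n c f → Degree (suc n) c (λ x → x * f x)
  degree-x* zero    {c} {f} f≈c a = f , f≈c , λ x →
    modulo (- a) (≈⇒-≈0 (trans (f≈c a) (sym (f≈c x))))
      (solve 4 (λ x a u v → x :* u :- a :* v := (x :- a) :* u :+ (:- a) :* (v :- u)) refl x a (f x) (f a))
  degree-x* (suc n) {c} {f} deg a = let (g , deg-g , eq) = deg a in
    (λ x → x * g x + f a) ,
    degree-resp (suc n) (+-identityʳ c) (degree-+ (suc n) (degree-x* n deg-g) (constant n (f a))) ,
    λ x → modulo x (≈⇒-≈0 (eq x))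
      (solve 5 (λ x a u v w → x :* u :- a :* v := (x :- a) :* (x :* w :+ v)
         :+ x :* (u :- v :- (x :- a) :* w)) refl x a (f x) (f a) (g x))
    where
    constant : ∀ n b → Degree (suc n) 0# (λ _ → b)
    constant zero    b = degree-raise zero λ _ → refl
    constant (suc n) b = degree-raise (suc n) (constant n b)

  factor-theorem : ∀ n {c f} → Degree n c f → Cancellable c → (ρ : ℕ → Carrier) →
    (∀ i → i ℕ.< n → f (ρ i) ≈ 0#) → (∀ i j → i ℕ.< j → j ℕ.< n → Cancellable (ρ j - ρ i)) →
    ∀ μ → (∀ i → i ℕ.< n → Cancellable (μ - ρ i)) → Cancellable (f μ)
  factor-theorem zero    deg c-canc ρ root distinct μ apart = Cancellable-resp (sym (deg μ)) c-canc
  factor-theorem (suc n) {f = f} deg c-canc ρ root distinct μ apart =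
    let (g , deg-g , eq) = deg (ρ 0)
        f≈ : ∀ x → f x ≈ (x - ρ 0) * g x
        f≈ x = modulo 1# (root 0 ℕ.z<s) (modulo 1# (≈⇒-≈0 (eq x))
          (solve 3 (λ a b c → a := c :+ con (+ 1) :* b :+ con (+ 1) :* (a :- b :- c)) refl _ _ _))
    in Cancellable-resp (sym (f≈ μ)) (Cancellable-* (apart 0 ℕ.z<s)
      (factor-theorem n deg-g c-canc (ρ ∘ suc)
        (λ i i<n → distinct 0 (suc i) ℕ.z<s (ℕ.s<s i<n) _
          (trans (sym (f≈ _)) (root (suc i) (ℕ.s<s i<n))))
        (λ i j i<j j<n → distinct (suc i) (suc j) (ℕ.s<s i<j) (ℕ.s<s j<n))
        μ (λ i i<n → apart (suc i) (ℕ.s<s i<n))))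

-- The zeros of the continuant come from the polynomials
-- f(y) = ∏_{i<m} (1 - qⁱ y) ∏_{i<n} (1 + qⁱ y), which satisfy
-- (1 - qᵐ y) (1 + qⁿ y) f(y) = (1 - y) (1 + y) f(q y).
module QBinomial {k ℓk} (K : CommutativeRing k ℓk) (q : CommutativeRing.Carrier K) where
  open CommutativeRing K hiding (zero)
  open IntegerSolver K
  open import Algebra.Properties.Semiring.Exp semiring using (_^_; ^-homo-*)
  open RingLemmas K
  open import Relation.Binary.Reasoning.Setoid setoid

  Coefficients : Set k
  Coefficients = ℕ → Carrier

  infixr 7 [1+_y]_

  [1+_y]_ : Carrier → Coefficients → Coefficients
  ([1+ a y] f) zero    = f zero
  ([1+ a y] f) (suc j) = f (suc j) + a * f j

  dilate : Coefficients → Coefficients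
  dilate f j = q ^ j * f j

  one : Coefficients
  one zero    = 1#
  one (suc j) = 0#

  F : ℕ → ℕ → Coefficients
  F zero    zero    = one
  F zero    (suc n) = [1+ q ^ n y] F zero n
  F (suc m) n       = [1+ - (q ^ m) y] F m n

  mul-cong : ∀ a {f g} → (∀ j → f j ≈ g j) → ∀ j → ([1+ a y] f) j ≈ ([1+ a y] g) j
  mul-cong a f≈g zero    = f≈g zero
  mul-cong a f≈g (suc j) = +-cong (f≈g (suc j)) (*-congˡ (f≈g j))

  mul-comm : ∀ a b f j → ([1+ a y] [1+ b y] f) j ≈ ([1+ b y] [1+ a y] f) j
  mul-comm a b f zero          = refl
  mul-comm a b f (suc zero)    = solve 4 (λ a b u v → u :+ b :* v :+ a :* v := u :+ a :* v :+ b :* v)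
    refl a b (f 1) (f 0)
  mul-comm a b f (suc (suc j)) = solve 5 (λ a b u v w →
    u :+ b :* v :+ a :* (v :+ b :* w) := u :+ a :* v :+ b :* (v :+ a :* w)) refl a b _ _ _

  dilate-mul : ∀ a f j → dilate ([1+ a y] f) j ≈ ([1+ q * a y] dilate f) j
  dilate-mul a f zero    = refl
  dilate-mul a f (suc j) = solve 5 (λ q g a u v →
    q :* g :* (u :+ a :* v) := q :* g :* u :+ q :* a :* (g :* v)) refl q (q ^ j) a _ _

  vanishes-above : ∀ m n j → m ℕ.+ n ℕ.< j → F m n j ≈ 0#
  vanishes-above zero    zero    (suc j) _ = refl
  vanishes-above zero    (suc n) (suc j) (ℕ.s≤s n<j) = trans
    (+-cong (vanishes-above zero n (suc j) (ℕ.m<n⇒m<1+n n<j)) (*-congˡ (vanishes-above zero n j n<j)))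
    (solve 1 (λ a → con (+ 0) :+ a :* con (+ 0) := con (+ 0)) refl (q ^ n))
  vanishes-above (suc m) n (suc j) (ℕ.s≤s n<j) = trans
    (+-cong (vanishes-above m n (suc j) (ℕ.m<n⇒m<1+n n<j)) (*-congˡ (vanishes-above m n j n<j)))
    (solve 1 (λ a → con (+ 0) :+ a :* con (+ 0) := con (+ 0)) refl (- (q ^ m)))

  functional-equation : ∀ m n j →
    ([1+ - (q ^ m) y] [1+ q ^ n y] F m n) j ≈ ([1+ - 1# y] [1+ 1# y] dilate (F m n)) j
  functional-equation zero zero j = mul-cong (- 1#) (mul-cong 1# λ
    { zero → sym (*-identityˡ 1#) ; (suc j) → sym (zeroʳ _) }) j
  functional-equation zero (suc n) j = begin
    ([1+ - 1# y] [1+ b′ y] [1+ b y] f) j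
      ≈⟨ mul-comm (- 1#) b′ ([1+ b y] f) j ⟩
    ([1+ b′ y] [1+ - 1# y] [1+ b y] f) j
      ≈⟨ mul-cong b′ (functional-equation zero n) j ⟩
    ([1+ b′ y] [1+ - 1# y] [1+ 1# y] dilate f) j
      ≈⟨ mul-comm b′ (- 1#) ([1+ 1# y] dilate f) j ⟩
    ([1+ - 1# y] [1+ b′ y] [1+ 1# y] dilate f) j
      ≈⟨ mul-cong (- 1#) (mul-comm b′ 1# (dilate f)) j ⟩
    ([1+ - 1# y] [1+ 1# y] [1+ b′ y] dilate f) j
      ≈⟨ mul-cong (- 1#) (mul-cong 1# (dilate-mul b f)) j ⟨
    ([1+ - 1# y] [1+ 1# y] dilate ([1+ b y] f)) j ∎
    where
    f = F zero n
    b = q ^ n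
    b′ = q ^ suc n
  functional-equation (suc m) n j = begin
    ([1+ - a′ y] [1+ q ^ n y] [1+ - a y] f) j
      ≈⟨ mul-cong (- a′) (mul-comm (q ^ n) (- a) f) j ⟩
    ([1+ - a′ y] [1+ - a y] [1+ q ^ n y] f) j
      ≈⟨ mul-cong (- a′) (functional-equation m n) j ⟩
    ([1+ - a′ y] [1+ - 1# y] [1+ 1# y] dilate f) j
      ≈⟨ mul-comm (- a′) (- 1#) ([1+ 1# y] dilate f) j ⟩
    ([1+ - 1# y] [1+ - a′ y] [1+ 1# y] dilate f) j
      ≈⟨ mul-cong (- 1#) (mul-comm (- a′) 1# (dilate f)) j ⟩
    ([1+ - 1# y] [1+ 1# y] [1+ - a′ y] dilate f) j
      ≈⟨ mul-cong (- 1#) (mul-cong 1# λ j → trans (dilate-mul (- a) f j) (shift j)) j ⟨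
    ([1+ - 1# y] [1+ 1# y] dilate ([1+ - a y] f)) j ∎
    where
    f = F m n
    a = q ^ m
    a′ = q ^ suc m
    shift : ∀ j → ([1+ q * - a y] dilate f) j ≈ ([1+ - a′ y] dilate f) j
    shift zero    = refl
    shift (suc j) = +-congˡ (*-congʳ (solve 2 (λ q a → q :* (:- a) := :- (q :* a)) refl q a))

  F-zero : ∀ m n → F m n 0 ≈ 1#
  F-zero zero    zero    = refl
  F-zero zero    (suc n) = F-zero zero n
  F-zero (suc m) n       = F-zero m n

  F-one : ∀ m n → (q - 1#) * F m n 1 ≈ (q ^ n - q ^ m) * F m n 0
  F-one m n = modulo (- 1#) (≈⇒-≈0 (functional-equation m n 1))
    (solve 5 (λ q a b u v →
      (q :- con (+ 1)) :* u := (b :- a) :* v :+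
        (:- con (+ 1)) :* (u :+ b :* v :+ (:- a) :* v :-
          (q :* con (+ 1) :* u :+ con (+ 1) :* (con (+ 1) :* v) :+ (:- con (+ 1)) :* (con (+ 1) :* v))))
      refl q (q ^ m) (q ^ n) (F m n 1) (F m n 0))

  F-recurrence : ∀ m n j → (q * (q * q ^ j) - 1#) * F m n (suc (suc j)) ≈
    (q ^ n - q ^ m) * F m n (suc j) - (q ^ (m ℕ.+ n) - q ^ j) * F m n j
  F-recurrence m n j = modulo (- 1#) (≈⇒-≈0 (functional-equation m n (suc (suc j))))
    (modulo (F m n j) (≈⇒-≈0 (^-homo-* q m n))
    (solve 8 (λ q a b c g u v w →
      (q :* (q :* g) :- con (+ 1)) :* u := (b :- a) :* v :- (c :- g) :* w :+
        (:- con (+ 1)) :* (u :+ b :* v :+ (:- a) :* (v :+ b :* w) :-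
          (q :* (q :* g) :* u :+ con (+ 1) :* (q :* g :* v) :+
           (:- con (+ 1)) :* (q :* g :* v :+ con (+ 1) :* (g :* w)))) :+
        w :* (c :- a :* b))
      refl q (q ^ m) (q ^ n) (q ^ (m ℕ.+ n)) (q ^ j) (F m n (suc (suc j))) (F m n (suc j)) (F m n j)))

module Continuants {k ℓk} (K : CommutativeRing k ℓk) (P : Parameters K) where
  open CommutativeRing K hiding (zero)
  open IntegerSolver K
  open RingLemmas K
  open Parameters P
  open FactorTheorem K
  open QBinomial K q
  open import Algebra.Properties.Semiring.Exp semiring using (_^_)

  continuant-degree : ∀ t j → Degree j 1# (λ μ → continuant t μ j)
  continuant-degree t zero          = λ _ → refl
  continuant-degree t (suc zero)    = λ a → (λ _ → 1#) , (λ _ → refl) , λ x → sym (*-identityʳ _)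
  continuant-degree t (suc (suc j)) = degree-resp (suc (suc j)) (+-identityʳ 1#)
    (degree-+ (suc (suc j)) (degree-x* (suc j) (continuant-degree t (suc j)))
      (degree-raise (suc j) (degree-resp (suc j) refl (degree-raise j
        (degree-* j (- 1#) (degree-* j (α j * (t + - τ j)) (continuant-degree t j)))))))

  α[τ-τ] : ∀ {T} d j → T * T ≈ Q * r ^ d →
           α j * (τ d + - τ j) ≈ T * ω * (T * ω) * (q * q ^ j - 1#) * (q ^ d - q ^ j)
  α[τ-τ] {T} d j T²≈ =
    modulo (ω * ω * Q * (q * q ^ j - 1#)) (≈⇒-≈0 (q^r^≈1 j))
    (modulo (- (ω * ω * (q * q ^ j - 1#) * (q ^ d - q ^ j))) (≈⇒-≈0 T²≈)
    (modulo (- (ω * ω * Q * (q * q ^ j - 1#))) (≈⇒-≈0 (q^r^≈1 d))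
    (solve 8 (λ q ω Q T g s h u →
      ω :* g :* (q :* g :- con (+ 1)) :* (ω :* Q :* (con (+ 1) :- u) :+ (:- (ω :* Q :* (con (+ 1) :- s)))) :=
      T :* ω :* (T :* ω) :* (q :* g :- con (+ 1)) :* (h :- g)
        :+ ω :* ω :* Q :* (q :* g :- con (+ 1)) :* (g :* s :- con (+ 1))
        :+ (:- (ω :* ω :* (q :* g :- con (+ 1)) :* (h :- g))) :* (T :* T :- Q :* u)
        :+ (:- (ω :* ω :* Q :* (q :* g :- con (+ 1)))) :* (h :* u :- con (+ 1)))
      refl q ω Q T (q ^ j) (r ^ j) (q ^ d) (r ^ d))))

  module _ {T} m n (T²≈ : T * T ≈ Q * r ^ (m ℕ.+ n)) where

    root : Carrier
    root = T * (ω * (q ^ n - q ^ m))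

    weight : ℕ → Carrier
    weight zero    = 1#
    weight (suc j) = T * ω * (q * q ^ j - 1#) * weight j

    continuant-root : ∀ j → continuant (τ (m ℕ.+ n)) root j ≈ weight j * F m n j
    continuant-root zero          = sym (trans (*-identityˡ _) (F-zero m n))
    continuant-root (suc zero)    = modulo (- (T * ω * (q ^ n - q ^ m))) (≈⇒-≈0 (F-zero m n))
      (modulo (- (T * ω)) (≈⇒-≈0 (F-one m n)) (solve 7 (λ q T ω a b u v →
        T :* (ω :* (b :- a)) := T :* ω :* (q :* con (+ 1) :- con (+ 1)) :* con (+ 1) :* u
          :+ (:- (T :* ω :* (b :- a))) :* (v :- con (+ 1))
          :+ (:- (T :* ω)) :* ((q :- con (+ 1)) :* u :- (b :- a) :* v))
        refl q T ω (q ^ m) (q ^ n) (F m n 1) (F m n 0)))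
    continuant-root (suc (suc j)) = trans
      (+-cong (*-congˡ (continuant-root (suc j)))
              (*-congˡ (*-cong (α[τ-τ] (m ℕ.+ n) j T²≈) (continuant-root j))))
      (modulo (- (T * ω * (T * ω * (q * q ^ j - 1#) * weight j))) (≈⇒-≈0 (F-recurrence m n j))
      (solve 11 (λ q T ω g a b h w u v x →
        T :* (ω :* (b :- a)) :* (T :* ω :* (q :* g :- con (+ 1)) :* w :* v)
          :+ (:- con (+ 1)) :* (T :* ω :* (T :* ω) :* (q :* g :- con (+ 1)) :* (h :- g) :* (w :* x)) :=
        T :* ω :* (q :* (q :* g) :- con (+ 1)) :* (T :* ω :* (q :* g :- con (+ 1)) :* w) :* u
          :+ (:- (T :* ω :* (T :* ω :* (q :* g :- con (+ 1)) :* w))) :*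
             ((q :* (q :* g) :- con (+ 1)) :* u :- ((b :- a) :* v :- (h :- g) :* x)))
        refl q T ω (q ^ j) (q ^ m) (q ^ n) (q ^ (m ℕ.+ n)) (weight j)
          (F m n (suc (suc j))) (F m n (suc j)) (F m n j)))

    continuant-root-zero : continuant (τ (m ℕ.+ n)) root (suc (m ℕ.+ n)) ≈ 0#
    continuant-root-zero = trans (continuant-root (suc (m ℕ.+ n)))
      (trans (*-congˡ (vanishes-above m n _ ℕ.≤-refl)) (zeroʳ _))

  roots : Carrier → ℕ → ℕ → Carrier
  roots T d m = T * (ω * (q ^ (d ℕ.∸ m) - q ^ m))

  continuant-cancellable : ∀ {T} d → T * T ≈ Q * r ^ d →
    (∀ i j → i ℕ.< j → j ℕ.≤ d → Cancellable (roots T d j - roots T d i)) →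
    ∀ μ → (∀ m → m ℕ.≤ d → Cancellable (μ - roots T d m)) →
    Cancellable (continuant (τ d) μ (suc d))
  continuant-cancellable {T} d T²≈ distinct μ apart = factor-theorem (suc d)
    (continuant-degree (τ d) (suc d)) (Invertible⇒Cancellable (1# , *-identityˡ 1#)) (roots T d)
    (λ m m<d → is-root m (ℕ.s≤s⁻¹ m<d)) (λ i j i<j j<d → distinct i j i<j (ℕ.s≤s⁻¹ j<d))
    μ (λ m m<d → apart m (ℕ.s≤s⁻¹ m<d))
    where
    is-root : ∀ m → m ℕ.≤ d → continuant (τ d) (roots T d m) (suc d) ≈ 0#
    is-root m m≤d = ≡.subst (λ e → continuant (τ e) (roots T d m) (suc e) ≈ 0#) m+n≡d
      (continuant-root-zero m (d ℕ.∸ m) (trans T²≈ (*-congˡ (reflexive (≡.cong (r ^_) (≡.sym m+n≡d))))))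
      where
      m+n≡d : m ℕ.+ (d ℕ.∸ m) ≡ d
      m+n≡d = ℕ.m+[n∸m]≡n m≤d

-- The tridiagonal relation and eigenvectors

module Tridiagonal {k ℓk} (K : CommutativeRing k ℓk) (P : Parameters K)
  {i} (I : Set i) (dim : I → ℕ) (N : ℕ) (dim≤N : ∀ y → dim y ℕ.≤ N) where

  open CommutativeRing K hiding (zero)
  open IntegerSolver K
  open RingLemmas K
  open Operators K I
  open Parameters P
  open DownUp K P I dim N dim≤N
  open import Algebra.Properties.Semiring.Exp semiring using (_^_)
  open import Relation.Binary.Reasoning.Setoid setoid

  module _ {U L : Fun → Fun} (pair : GradedPair U L) where
    open GradedPair pair
    open LinearOn

    A B : Fun → Fun
    A f y = U f y + L f y
    B f y = r ^ dim y * f y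

    A-cong : ∀ {f g} → (∀ y → f y ≈ g y) → ∀ y → A f y ≈ A g y
    A-cong f≈g y = +-cong (cong U-linear (λ z _ → f≈g z) y tt) (cong L-linear (λ z _ → f≈g z) y tt)

    A-linear : LinearOn Everywhere A
    A-linear = record
      { cong = λ f≈g y _ → A-cong (λ z → f≈g z tt) y
      ; linear = λ a f b g y _ → trans
          (+-cong (linear U-linear a f b g y tt) (linear L-linear a f b g y tt))
          (solve 6 (λ a b u v w x → a :* u :+ b :* v :+ (a :* w :+ b :* x) :=
             a :* (u :+ w) :+ b :* (v :+ x)) refl a b _ _ _ _) }

    local-eq : ∀ {Φ} → LinearOn Everywhere Φ → (R : I → I → Set) →
      (∀ f y → (∀ z → R y z → f z ≈ 0#) → Φ f y ≈ 0#) →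
      ∀ c f g y → (∀ z → R y z → f z ≈ c * g z) → Φ f y ≈ c * Φ g y
    local-eq {Φ} Φ-linear R local c f g y f≈cg = modulo 1#
      (trans (sym (linear Φ-linear 1# f (- c) g y tt))
        (local _ y λ z Ryz → trans (+-congʳ (*-congˡ (f≈cg z Ryz)))
          (solve 2 (λ c u → con (+ 1) :* (c :* u) :+ (:- c) :* u := con (+ 0)) refl c (g z))))
      (solve 3 (λ c u v → u := c :* v :+ con (+ 1) :* (con (+ 1) :* u :+ (:- c) :* v)) refl c _ _)

    U-B : ∀ f y → U (B f) y ≈ r ^ dim y * (q * U f y)
    U-B f y = trans (local-eq U-linear (λ y z → dim y ≡ suc (dim z)) U-local (q * r ^ dim y) (B f) f y λ z eq →
        *-congʳ (trans (modulo (- (r ^ dim z)) (≈⇒-≈0 qr≈1)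
          (solve 3 (λ q r s → s := q :* (r :* s) :+ (:- s) :* (q :* r :- con (+ 1))) refl q r (r ^ dim z)))
          (*-congˡ (reflexive (≡.cong (r ^_) (≡.sym eq))))))
      (solve 3 (λ q s u → q :* s :* u := s :* (q :* u)) refl q _ _)

    L-B : ∀ f y → L (B f) y ≈ r ^ dim y * (r * L f y)
    L-B f y = trans (local-eq L-linear (λ y z → dim z ≡ suc (dim y)) L-local (r * r ^ dim y) (B f) f y λ z eq →
        *-congʳ (reflexive (≡.cong (r ^_) eq)))
      (solve 3 (λ q s u → q :* s :* u := s :* (q :* u)) refl r _ _)

    A-B : ∀ f y → A (B f) y ≈ B (λ x → q * U f x + r * L f x) y
    A-B f y = trans (+-cong (U-B f y) (L-B f y)) (sym (distribˡ _ _ _))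

    A-A-B : ∀ f y → A (A (B f)) y ≈
      B (λ x → q * (q * U (U f) x + r * U (L f) x) + r * (q * L (U f) x + r * L (L f) x)) y
    A-A-B f y = trans (A-cong (A-B f) y) (trans (A-B _ y)
      (*-congˡ (+-cong (*-congˡ (linear U-linear q (U f) r (L f) y tt))
                       (*-congˡ (linear L-linear q (U f) r (L f) y tt)))))

    A-A-A-B : ∀ f y → A (A (A (B f))) y ≈ B (λ x →
      q * (q * (q * U (U (U f)) x + r * U (U (L f)) x) + r * (q * U (L (U f)) x + r * U (L (L f)) x)) +
      r * (q * (q * L (U (U f)) x + r * L (U (L f)) x) + r * (q * L (L (U f)) x + r * L (L (L f)) x))) y
    A-A-A-B f y = trans (A-cong (A-A-B f) y) (trans (A-B _ y)
      (*-congˡ (+-cong (*-congˡ (expand U-linear)) (*-congˡ (expand L-linear)))))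
      where
      expand : ∀ {Φ} → LinearOn Everywhere Φ →
        Φ (λ x → q * (q * U (U f) x + r * U (L f) x) + r * (q * L (U f) x + r * L (L f) x)) y ≈
        q * (q * Φ (U (U f)) y + r * Φ (U (L f)) y) + r * (q * Φ (L (U f)) y + r * Φ (L (L f)) y)
      expand Φ-linear = trans (linear Φ-linear q _ r _ y tt)
        (+-cong (*-congˡ (linear Φ-linear q _ r _ y tt)) (*-congˡ (linear Φ-linear q _ r _ y tt)))

    ρ : Carrier
    ρ = (q + 1#) * (q + 1#) * Q * r * r

    -- The tridiagonal relation with B moved to the left of every word in U and L.
    tridiagonal-relation : ∀ q r Q uuu uul ulu ull luu lul llu lll u l →
      q * r - 1# ≈ 0# →
      llu + q * q * q * ull + (q + 1#) * Q * l - q * (q + 1#) * lul ≈ 0# →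
      luu + q * q * q * uul + (q + 1#) * Q * u - q * (q + 1#) * ulu ≈ 0# →
      (q * (q * (q * uuu + r * uul) + r * (q * ulu + r * ull)) +
       r * (q * (q * luu + r * lul) + r * (q * llu + r * lll))) -
      (q + 1# + r) * (q * (q * (uuu + uul) + r * (ulu + ull)) + r * (q * (luu + lul) + r * (llu + lll))) +
      (q + 1# + r) * (q * (uuu + uul + (ulu + ull)) + r * (luu + lul + (llu + lll))) -
      (uuu + uul + (ulu + ull) + (luu + lul + (llu + lll))) ≈
      (q + 1#) * (q + 1#) * Q * r * r * (q * u + r * l - (u + l))
    tridiagonal-relation q r Q uuu uul ulu ull luu lul llu lll u l qr≈1 rel₁ rel₂ =
      modulo (r - r * r * r) rel₁ (modulo (r * r - 1#) rel₂ (modulo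
        ((1# - q) * uuu + (1# - q - q * q * r) * uul + (1# + q * r) * ulu +
         (1# - q + q * r - q * q + q * q * r * r) * ull + (- r) * luu +
         (1# - r - r * r - q * r * r) * lul + llu + (1# - r) * lll +
         (- (1# + q + q * r + q * q * r)) * Q * u + (r - r * r + q * r - q * r * r) * Q * l) qr≈1
        (solve 13 (λ q r Q uuu uul ulu ull luu lul llu lll u l →
          (q :* (q :* (q :* uuu :+ r :* uul) :+ r :* (q :* ulu :+ r :* ull)) :+
           r :* (q :* (q :* luu :+ r :* lul) :+ r :* (q :* llu :+ r :* lll))) :-
          (q :+ con (+ 1) :+ r) :* (q :* (q :* (uuu :+ uul) :+ r :* (ulu :+ ull)) :+ r :* (q :* (luu :+ lul) :+ r :* (llu :+ lll))) :+
          (q :+ con (+ 1) :+ r) :* (q :* (uuu :+ uul :+ (ulu :+ ull)) :+ r :* (luu :+ lul :+ (llu :+ lll))) :-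
          (uuu :+ uul :+ (ulu :+ ull) :+ (luu :+ lul :+ (llu :+ lll))) :=
          (q :+ con (+ 1)) :* (q :+ con (+ 1)) :* Q :* r :* r :* (q :* u :+ r :* l :- (u :+ l)) :+
          (r :- r :* r :* r) :* (llu :+ q :* q :* q :* ull :+ (q :+ con (+ 1)) :* Q :* l :- q :* (q :+ con (+ 1)) :* lul) :+
          (r :* r :- con (+ 1)) :* (luu :+ q :* q :* q :* uul :+ (q :+ con (+ 1)) :* Q :* u :- q :* (q :+ con (+ 1)) :* ulu) :+
          ((con (+ 1) :- q) :* uuu :+ (con (+ 1) :- q :- q :* q :* r) :* uul :+ (con (+ 1) :+ q :* r) :* ulu :+
           (con (+ 1) :- q :+ q :* r :- q :* q :+ q :* q :* r :* r) :* ull :+ (:- r) :* luu :+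
           (con (+ 1) :- r :- r :* r :- q :* r :* r) :* lul :+ llu :+ (con (+ 1) :- r) :* lll :+
           (:- (con (+ 1) :+ q :+ q :* r :+ q :* q :* r)) :* Q :* u :+ (r :- r :* r :+ q :* r :- q :* r :* r) :* Q :* l) :*
          (q :* r :- con (+ 1)))
          refl q r Q uuu uul ulu ull luu lul llu lll u l)))

    additive : ∀ {Φ} → LinearOn Everywhere Φ → ∀ f g y → Φ (λ x → f x + g x) y ≈ Φ f y + Φ g y
    additive Φ-linear f g y = trans
      (cong Φ-linear (λ x _ → sym (+-cong (*-identityˡ (f x)) (*-identityˡ (g x)))) y tt)
      (trans (linear Φ-linear 1# f 1# g y tt) (+-cong (*-identityˡ _) (*-identityˡ _)))

    U-A : ∀ f y → U (A f) y ≈ U (U f) y + U (L f) y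
    U-A f = additive U-linear (U f) (L f)

    L-A : ∀ f y → L (A f) y ≈ L (U f) y + L (L f) y
    L-A f = additive L-linear (U f) (L f)

    U-U-A : ∀ f y → U (U (A f)) y ≈ U (U (U f)) y + U (U (L f)) y
    U-U-A f y = trans (cong U-linear (λ x _ → U-A f x) y tt) (additive U-linear _ _ y)

    U-L-A : ∀ f y → U (L (A f)) y ≈ U (L (U f)) y + U (L (L f)) y
    U-L-A f y = trans (cong U-linear (λ x _ → L-A f x) y tt) (additive U-linear _ _ y)

    L-U-A : ∀ f y → L (U (A f)) y ≈ L (U (U f)) y + L (U (L f)) y
    L-U-A f y = trans (cong L-linear (λ x _ → U-A f x) y tt) (additive L-linear _ _ y)

    L-L-A : ∀ f y → L (L (A f)) y ≈ L (L (U f)) y + L (L (L f)) y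
    L-L-A f y = trans (cong L-linear (λ x _ → L-A f x) y tt) (additive L-linear _ _ y)

    U-A-A : ∀ f y → U (A (A f)) y ≈ U (U (U f)) y + U (U (L f)) y + (U (L (U f)) y + U (L (L f)) y)
    U-A-A f y = trans (U-A (A f) y) (+-cong (U-U-A f y) (U-L-A f y))

    L-A-A : ∀ f y → L (A (A f)) y ≈ L (U (U f)) y + L (U (L f)) y + (L (L (U f)) y + L (L (L f)) y)
    L-A-A f y = trans (L-A (A f) y) (+-cong (L-U-A f y) (L-L-A f y))

    module _ {θ v} (eigen : ∀ y → A v y ≈ θ * v y) where

      scale-through : ∀ {Φ} → LinearOn Everywhere Φ → ∀ y → θ * Φ v y ≈ Φ (A v) y
      scale-through Φ-linear y = trans (sym (homogeneous Φ-linear θ v y tt))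
        (cong Φ-linear (λ x _ → sym (eigen x)) y tt)

      B-linear : LinearOn Everywhere B
      B-linear = record
        { cong = λ f≈g y t → *-congˡ (f≈g y t)
        ; linear = λ a f b g y _ → solve 5 (λ s a u b v →
            s :* (a :* u :+ b :* v) := a :* (s :* u) :+ b :* (s :* v)) refl (r ^ dim y) a (f y) b (g y) }

      infixr 9 _⨾_
      _⨾_ : ∀ {Φ Ψ} → LinearOn Everywhere Φ → LinearOn Everywhere Ψ → LinearOn Everywhere (λ f → Ψ (Φ f))
      Φ-linear ⨾ Ψ-linear = record
        { cong = λ f≈g → cong Ψ-linear (cong Φ-linear f≈g)
        ; linear = λ a f b g y _ → trans (cong Ψ-linear (linear Φ-linear a f b g) y tt)
            (linear Ψ-linear a _ b _ y tt) }

      θA²B : ∀ y → θ * A (A (B v)) y ≈ r ^ dim y *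
        (q * (q * (U (U (U v)) y + U (U (L v)) y) + r * (U (L (U v)) y + U (L (L v)) y)) +
         r * (q * (L (U (U v)) y + L (U (L v)) y) + r * (L (L (U v)) y + L (L (L v)) y)))
      θA²B y = trans (scale-through (B-linear ⨾ A-linear ⨾ A-linear) y) (trans (A-A-B (A v) y) (*-congˡ (+-cong
        (*-congˡ (+-cong (*-congˡ (U-U-A v y)) (*-congˡ (U-L-A v y))))
        (*-congˡ (+-cong (*-congˡ (L-U-A v y)) (*-congˡ (L-L-A v y)))))))

      θ²AB : ∀ y → θ * (θ * A (B v) y) ≈ r ^ dim y *
        (q * (U (U (U v)) y + U (U (L v)) y + (U (L (U v)) y + U (L (L v)) y)) +
         r * (L (U (U v)) y + L (U (L v)) y + (L (L (U v)) y + L (L (L v)) y)))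
      θ²AB y = trans (*-congˡ (scale-through (B-linear ⨾ A-linear) y))
        (trans (scale-through (A-linear ⨾ B-linear ⨾ A-linear) y)
        (trans (A-B (A (A v)) y)
          (*-congˡ (+-cong (*-congˡ (U-A-A v y)) (*-congˡ (L-A-A v y))))))

      θ³B : ∀ y → θ * (θ * (θ * B v y)) ≈ r ^ dim y *
        (U (U (U v)) y + U (U (L v)) y + (U (L (U v)) y + U (L (L v)) y) +
         (L (U (U v)) y + L (U (L v)) y + (L (L (U v)) y + L (L (L v)) y)))
      θ³B y = trans (*-congˡ (trans (*-congˡ (scale-through B-linear y)) (scale-through (A-linear ⨾ B-linear) y)))
        (trans (scale-through (A-linear ⨾ A-linear ⨾ B-linear) y)
          (*-congˡ (+-cong (U-A-A v y) (L-A-A v y))))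

      cubic : ∀ y → A (A (A (B v))) y - (q + 1# + r) * (θ * A (A (B v)) y)
        + (q + 1# + r) * (θ * (θ * A (B v) y)) - θ * (θ * (θ * B v y)) ≈ ρ * (A (B v) y - θ * B v y)
      cubic y = trans
        (+-cong (+-cong (+-cong (A-A-A-B v y) (-‿cong (*-congˡ (θA²B y)))) (*-congˡ (θ²AB y))) (-‿cong (θ³B y)))
        (trans (solve 6 (λ s b w x t z →
            s :* w :- b :* (s :* x) :+ b :* (s :* t) :- s :* z := s :* (w :- b :* x :+ b :* t :- z)) refl
              (r ^ dim y) (q + 1# + r) _ _ _ _)
        (trans (*-congˡ (tridiagonal-relation q r Q _ _ _ _ _ _ _ _ _ _ (≈⇒-≈0 qr≈1)
          (≈⇒-≈0 (relation₁ v y)) (≈⇒-≈0 (relation₂ v y))))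
        (trans (solve 4 (λ s ρ a b → s :* (ρ :* (a :- b)) := ρ :* (s :* a :- s :* b)) refl (r ^ dim y) ρ _ _)
          (*-congˡ (+-cong (sym (A-B v y)) (-‿cong (sym (scale-through B-linear y))))))))

      module _ {a b} (sum≈ : a + b ≈ (q + r) * θ) (product≈ : a * b ≈ θ * θ - ρ)
               (apart : Invertible ((a - θ) * (b - θ) * (a - b))) where

        private
          ι : Carrier
          ι = proj₁ apart

          g : Carrier → Carrier → Carrier → Fun
          g c x x′ y = c * (A (A (B v)) y + ((- (x + x′)) * A (B v) y + x * x′ * B v y))

          A-g : ∀ c x x′ y → A (g c x x′) y ≈ c * (A (A (A (B v))) y + ((- (x + x′)) * A (A (B v)) y + x * x′ * A (B v) y))
          A-g c x x′ y = trans (homogeneous A-linear c _ y tt) (*-congˡ (trans (additive A-linear _ _ y)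
            (+-congˡ (linear A-linear (- (x + x′)) _ (x * x′) _ y tt))))

          annihilated : ∀ y → A (A (A (B v))) y - (θ + a + b) * A (A (B v)) y
            + (a * b + θ * (a + b)) * A (B v) y - θ * (a * b) * B v y ≈ 0#
          annihilated y = modulo 1# (≈⇒-≈0 (cubic y)) (modulo (θ * A (B v) y - A (A (B v)) y) (≈⇒-≈0 sum≈)
            (modulo (A (B v) y - θ * B v y) (≈⇒-≈0 product≈)
            (solve 10 (λ q r θ a b ρ u₃ u₂ u₁ u₀ →
              u₃ :- (θ :+ a :+ b) :* u₂ :+ (a :* b :+ θ :* (a :+ b)) :* u₁ :- θ :* (a :* b) :* u₀ :=
              con (+ 0) :+ con (+ 1) :*
                (u₃ :- (q :+ con (+ 1) :+ r) :* (θ :* u₂) :+ (q :+ con (+ 1) :+ r) :* (θ :* (θ :* u₁))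
                  :- θ :* (θ :* (θ :* u₀)) :- ρ :* (u₁ :- θ :* u₀))
                :+ (θ :* u₁ :- u₂) :* (a :+ b :- (q :+ r) :* θ)
                :+ (u₁ :- θ :* u₀) :* (a :* b :- (θ :* θ :- ρ)))
              refl q r θ a b ρ (A (A (A (B v))) y) (A (A (B v)) y) (A (B v) y) (B v y))))

          eigen-g : ∀ c x x′ x″ → (∀ y → (A (A (A (B v))) y - (x″ + x + x′) * A (A (B v)) y
              + (x * x′ + x″ * (x + x′)) * A (B v) y - x″ * (x * x′) * B v y) ≈ 0#) →
            ∀ y → A (g c x x′) y ≈ x″ * g c x x′ y
          eigen-g c x x′ x″ ann y = trans (A-g c x x′ y) (modulo c (ann y)
            (solve 8 (λ c x x′ x″ u₃ u₂ u₁ u₀ →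
              c :* (u₃ :+ ((:- (x :+ x′)) :* u₂ :+ x :* x′ :* u₁)) :=
              x″ :* (c :* (u₂ :+ ((:- (x :+ x′)) :* u₁ :+ x :* x′ :* u₀))) :+
              c :* (u₃ :- (x″ :+ x :+ x′) :* u₂ :+ (x :* x′ :+ x″ :* (x :+ x′)) :* u₁ :- x″ :* (x :* x′) :* u₀))
              refl c x x′ x″ (A (A (A (B v))) y) (A (A (B v)) y) (A (B v) y) (B v y)))

        B-decomposition : ∃ λ u → ∃ λ w → ∃ λ z →
          (∀ y → A u y ≈ a * u y) × (∀ y → A w y ≈ θ * w y) × (∀ y → A z y ≈ b * z y) ×
          (∀ y → B v y ≈ u y + w y + z y)
        B-decomposition = g (ι * (b - θ)) θ b , g (ι * (a - b)) a b , g (- (ι * (a - θ))) θ a ,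
          eigen-g _ θ b a (λ y → trans (solve 7 (λ θ a b u₃ u₂ u₁ u₀ →
              u₃ :- (a :+ θ :+ b) :* u₂ :+ (θ :* b :+ a :* (θ :+ b)) :* u₁ :- a :* (θ :* b) :* u₀ :=
              u₃ :- (θ :+ a :+ b) :* u₂ :+ (a :* b :+ θ :* (a :+ b)) :* u₁ :- θ :* (a :* b) :* u₀)
              refl θ a b _ _ _ _) (annihilated y)) ,
          eigen-g _ a b θ annihilated ,
          eigen-g _ θ a b (λ y → trans (solve 7 (λ θ a b u₃ u₂ u₁ u₀ →
              u₃ :- (b :+ θ :+ a) :* u₂ :+ (θ :* a :+ b :* (θ :+ a)) :* u₁ :- b :* (θ :* a) :* u₀ :=
              u₃ :- (θ :+ a :+ b) :* u₂ :+ (a :* b :+ θ :* (a :+ b)) :* u₁ :- θ :* (a :* b) :* u₀)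
              refl θ a b _ _ _ _) (annihilated y)) ,
          λ y → modulo (- B v y) (≈⇒-≈0 (proj₂ apart))
            (solve 7 (λ ι θ a b u₂ u₁ u₀ → u₀ :=
              ι :* (b :- θ) :* (u₂ :+ ((:- (θ :+ b)) :* u₁ :+ θ :* b :* u₀)) :+
              ι :* (a :- b) :* (u₂ :+ ((:- (a :+ b)) :* u₁ :+ a :* b :* u₀)) :+
              (:- (ι :* (a :- θ))) :* (u₂ :+ ((:- (θ :+ a)) :* u₁ :+ θ :* a :* u₀)) :+
              (:- u₀) :* ((a :- θ) :* (b :- θ) :* (a :- b) :* ι :- con (+ 1)))
              refl ι θ a b (A (A (B v)) y) (A (B v) y) (B v y))

module ChainEigenvector {k ℓk} (K : CommutativeRing k ℓk) (P : Parameters K)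
  {i} (I : Set i) (dim : I → ℕ) (N : ℕ) (dim≤N : ∀ y → dim y ℕ.≤ N) where

  open CommutativeRing K hiding (zero)
  open IntegerSolver K
  open RingLemmas K
  open Operators K I
  open Parameters P
  open DownUp K P I dim N dim≤N
  open import Algebra.Properties.Semiring.Exp semiring using (_^_)
  open import Relation.Binary.Reasoning.Setoid setoid

  module _ {U L : Fun → Fun} (pair : GradedPair U L) (u : Fun) (d s : ℕ) (y₀ : I)
    (Lu≈0 : ∀ y → L u y ≈ 0#) (LUu≈ : ∀ y → L (U u) y ≈ τ d * u y)
    (dim-y₀ : dim y₀ ≡ s) (u-y₀ : u y₀ ≈ 1#) (support : ∀ z → dim z ℕ.< s → u z ≈ 0#)
    (N≤s+d : N ℕ.≤ s ℕ.+ d) (inverse : ℕ → Carrier)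
    (inverse-correct : ∀ j → j ℕ.< d → α j * (τ d + - τ j) * inverse j ≈ 1#) where

    open GradedPair pair
    open LinearOn

    U^ : ℕ → Fun
    U^ zero    = u
    U^ (suc j) = U (U^ j)

    x : ℕ → Carrier
    x j = ω * ω * Q * (q * q ^ j - 1#) * (1# - q ^ j * r ^ d)

    x≈α[τ-τ] : ∀ j → α j * (τ d + - τ j) ≈ x j
    x≈α[τ-τ] j = modulo (ω * ω * Q * (q * q ^ j - 1#)) (≈⇒-≈0 (q^r^≈1 j))
      (solve 6 (λ q ω Q g s u →
        ω :* g :* (q :* g :- con (+ 1)) :* (ω :* Q :* (con (+ 1) :- u) :+ (:- (ω :* Q :* (con (+ 1) :- s)))) :=
        ω :* ω :* Q :* (q :* g :- con (+ 1)) :* (con (+ 1) :- g :* u) :+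
        ω :* ω :* Q :* (q :* g :- con (+ 1)) :* (g :* s :- con (+ 1))) refl q ω Q (q ^ j) (r ^ j) (r ^ d))

    U^-support : ∀ j z → dim z ℕ.< s ℕ.+ j → U^ j z ≈ 0#
    U^-support zero    z z<s   = support z (≡.subst (dim z ℕ.<_) (ℕ.+-identityʳ s) z<s)
    U^-support (suc j) z z<s+j = U-local _ z λ w eq → U^-support j w
      (ℕ.s≤s⁻¹ (≡.subst₂ ℕ._<_ eq (ℕ.+-suc s j) z<s+j))

    U^-top : ∀ z → U^ (suc d) z ≈ 0#
    U^-top z = U^-support (suc d) z (≡.subst (dim z ℕ.<_) (≡.sym (ℕ.+-suc s d))
      (ℕ.s≤s (ℕ.≤-trans (dim≤N z) N≤s+d)))

    U-scale : ∀ c f {g} → (∀ y → g y ≈ c * f y) → ∀ y → U g y ≈ c * U f y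
    U-scale c f g≈ y = trans (cong U-linear (λ z _ → g≈ z) y tt) (homogeneous U-linear c f y tt)

    L-U-U : ∀ f y → L (U (U f)) y ≈
            q * (q + 1#) * U (L (U f)) y - q * q * q * U (U (L f)) y - (q + 1#) * Q * U f y
    L-U-U f y = modulo 1# (≈⇒-≈0 (relation₂ f y)) (solve 6 (λ q Q a b e v →
      a := q :* (q :+ con (+ 1)) :* e :- q :* q :* q :* b :- (q :+ con (+ 1)) :* Q :* v
        :+ con (+ 1) :* (a :+ q :* q :* q :* b :+ (q :+ con (+ 1)) :* Q :* v :- q :* (q :+ con (+ 1)) :* e))
      refl q Q (L (U (U f)) y) (U (U (L f)) y) (U (L (U f)) y) (U f y))

    L-U^ : ∀ j y → L (U^ (suc j)) y ≈ x j * U^ j y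
    L-U^ zero y = trans (LUu≈ y) (modulo (- (ω * Q * (1# - r ^ d) * u y)) (≈⇒-≈0 ω[q-1]≈1)
      (solve 5 (λ q ω Q s u → ω :* Q :* (con (+ 1) :- s) :* u :=
        ω :* ω :* Q :* (q :* con (+ 1) :- con (+ 1)) :* (con (+ 1) :- con (+ 1) :* s) :* u
        :+ (:- (ω :* Q :* (con (+ 1) :- s) :* u)) :* (ω :* (q :- con (+ 1)) :- con (+ 1))) refl q ω Q (r ^ d) (u y)))
    L-U^ (suc zero) y = trans (L-U-U u y) (trans
      (+-congʳ (+-cong (*-congˡ (U-scale (x 0) u (L-U^ 0) y))
        (-‿cong (*-congˡ (zero⇒zero U-linear (zero⇒zero U-linear λ z _ → Lu≈0 z) y tt)))))
      (modulo ((q + 1#) * Q * (ω * (q - 1#) + 1#) * U u y) (≈⇒-≈0 ω[q-1]≈1)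
        (solve 5 (λ q ω Q s v →
          q :* (q :+ con (+ 1)) :* (ω :* ω :* Q :* (q :* con (+ 1) :- con (+ 1)) :* (con (+ 1) :- con (+ 1) :* s) :* v)
            :- q :* q :* q :* con (+ 0) :- (q :+ con (+ 1)) :* Q :* v :=
          ω :* ω :* Q :* (q :* (q :* con (+ 1)) :- con (+ 1)) :* (con (+ 1) :- q :* con (+ 1) :* s) :* v
            :+ (q :+ con (+ 1)) :* Q :* (ω :* (q :- con (+ 1)) :+ con (+ 1)) :* v :*
               (ω :* (q :- con (+ 1)) :- con (+ 1)))
          refl q ω Q (r ^ d) (U u y))))
    L-U^ (suc (suc j)) y = trans (L-U-U (U^ (suc j)) y) (trans
      (+-congʳ (+-cong (*-congˡ (U-scale (x (suc j)) _ (L-U^ (suc j)) y))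
        (-‿cong (*-congˡ (trans (cong U-linear (λ z _ → U-scale (x j) _ (L-U^ j) z) y tt)
                                (homogeneous U-linear (x j) _ y tt))))))
      (modulo ((q + 1#) * Q * (ω * (q - 1#) + 1#) * U^ (suc (suc j)) y) (≈⇒-≈0 ω[q-1]≈1)
        (solve 6 (λ q ω Q g s v →
          q :* (q :+ con (+ 1)) :* (ω :* ω :* Q :* (q :* (q :* g) :- con (+ 1)) :* (con (+ 1) :- q :* g :* s) :* v)
            :- q :* q :* q :* (ω :* ω :* Q :* (q :* g :- con (+ 1)) :* (con (+ 1) :- g :* s) :* v)
            :- (q :+ con (+ 1)) :* Q :* v :=
          ω :* ω :* Q :* (q :* (q :* (q :* g)) :- con (+ 1)) :* (con (+ 1) :- q :* (q :* g) :* s) :* v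
            :+ (q :+ con (+ 1)) :* Q :* (ω :* (q :- con (+ 1)) :+ con (+ 1)) :* v :*
               (ω :* (q :- con (+ 1)) :- con (+ 1)))
          refl q ω Q (q ^ j) (r ^ d) (U^ (suc (suc j)) y))))

    module _ (θ : Carrier) (characteristic : continuant (τ d) θ (suc d) ≈ 0#) where

      p scaling : ℕ → Carrier
      p = continuant (τ d) θ
      scaling zero    = 1#
      scaling (suc j) = scaling j * inverse j

      partial : ℕ → Fun
      partial zero    y = u y
      partial (suc j) y = partial j y + p (suc j) * scaling (suc j) * U^ (suc j) y

      scaling-x : ∀ j → j ℕ.< d → scaling (suc j) * x j ≈ scaling j
      scaling-x j j<d = modulo (scaling j)
        (≈⇒-≈0 (trans (*-congʳ (sym (x≈α[τ-τ] j))) (inverse-correct j j<d)))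
        (solve 3 (λ s i x → s :* i :* x := s :+ s :* (x :* i :- con (+ 1))) refl (scaling j) (inverse j) (x j))

      p-step : ∀ j → p (suc (suc j)) ≈ θ * p (suc j) + (- 1#) * (x j * p j)
      p-step j = +-congˡ (*-congˡ (*-congʳ (x≈α[τ-τ] j)))

      telescope : ∀ j → j ℕ.≤ d → ∀ y → U (partial j) y + L (partial j) y ≈
        θ * partial j y + p j * scaling j * U^ (suc j) y - p (suc j) * scaling j * U^ j y
      telescope zero    _   y = trans (+-congˡ (Lu≈0 y))
        (solve 3 (λ a t u → a :+ con (+ 0) := t :* u :+ con (+ 1) :* con (+ 1) :* a :- t :* con (+ 1) :* u)
          refl (U u y) θ (u y))
      telescope (suc j) j<d y = begin
        U (partial (suc j)) y + L (partial (suc j)) y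
          ≈⟨ +-cong (expand U-linear) (expand L-linear) ⟩
        U (partial j) y + c * U (U^ (suc j)) y + (L (partial j) y + c * L (U^ (suc j)) y)
          ≈⟨ +-congˡ (+-congˡ (*-congˡ (L-U^ j y))) ⟩
        U (partial j) y + c * U^ (suc (suc j)) y + (L (partial j) y + c * (x j * U^ j y))
          ≈⟨ modulo 1# (≈⇒-≈0 (telescope j (ℕ.<⇒≤ j<d) y))
             (modulo (p (suc j) * U^ j y - p j * U^ (suc j) y) (≈⇒-≈0 (scaling-x j j<d))
             (modulo (scaling (suc j) * U^ (suc j) y) (≈⇒-≈0 (p-step j))
             (solve 13 (λ U₀ L₀ θ P₀ p₀ p₁ p₂ s₀ s₁ x u₀ u₁ u₂ →
               U₀ :+ p₁ :* s₁ :* u₂ :+ (L₀ :+ p₁ :* s₁ :* (x :* u₀)) :=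
               θ :* (P₀ :+ p₁ :* s₁ :* u₁) :+ p₁ :* s₁ :* u₂ :- p₂ :* s₁ :* u₁
                 :+ con (+ 1) :* (U₀ :+ L₀ :- (θ :* P₀ :+ p₀ :* s₀ :* u₁ :- p₁ :* s₀ :* u₀))
                 :+ (p₁ :* u₀ :- p₀ :* u₁) :* (s₁ :* x :- s₀)
                 :+ s₁ :* u₁ :* (p₂ :- (θ :* p₁ :+ (:- con (+ 1)) :* (x :* p₀))))
               refl (U (partial j) y) (L (partial j) y) θ (partial j y) (p j) (p (suc j)) (p (suc (suc j)))
                 (scaling j) (scaling (suc j)) (x j) (U^ j y) (U^ (suc j) y) (U^ (suc (suc j)) y)))) ⟩
        θ * partial (suc j) y + c * U^ (suc (suc j)) y - p (suc (suc j)) * scaling (suc j) * U^ (suc j) y ∎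
        where
        c : Carrier
        c = p (suc j) * scaling (suc j)
        expand : ∀ {Φ} → LinearOn Everywhere Φ →
          Φ (partial (suc j)) y ≈ Φ (partial j) y + c * Φ (U^ (suc j)) y
        expand Φ-linear = trans (cong Φ-linear (λ z _ → +-congʳ (sym (*-identityˡ _))) y tt)
          (trans (linear Φ-linear 1# _ c _ y tt) (+-congʳ (*-identityˡ _)))

      partial-y₀ : ∀ j → partial j y₀ ≈ 1#
      partial-y₀ zero    = u-y₀
      partial-y₀ (suc j) = trans (+-cong (partial-y₀ j) (trans (*-congˡ (U^-support (suc j) y₀
        (≡.subst (ℕ._< s ℕ.+ suc j) (≡.sym dim-y₀) (ℕ.m<m+n s ℕ.z<s)))) (zeroʳ _))) (+-identityʳ _)

      eigenvector : ∃ λ w → w y₀ ≈ 1# × (∀ y → U w y + L w y ≈ θ * w y)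
      eigenvector = partial d , partial-y₀ d , λ y → modulo (- (scaling d * U^ d y)) characteristic
        (modulo (p d * scaling d) (U^-top y) (trans (telescope d ℕ.≤-refl y)
          (solve 7 (λ θ P p₀ p₁ s u₀ u₁ → θ :* P :+ p₀ :* s :* u₁ :- p₁ :* s :* u₀ :=
            θ :* P :+ (:- (s :* u₀)) :* p₁ :+ p₀ :* s :* u₁)
            refl θ (partial d y) (p d) (p (suc d)) (scaling d) (U^ d y) (U^ (suc d) y))))

module PowerSums (q : ℕ) (2≤q : 2 ℕ.≤ q) where

  open import Data.Nat.Base using (_+_; _*_; _^_; _≤_; _<_)

  instance
    q-nonZero : ℕ.NonZero q
    q-nonZero = ℕ.>-nonZero (ℕ.≤-trans ℕ.z<s 2≤q)

  ^-mono-< : ∀ {m n} → m < n → q ^ m < q ^ n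
  ^-mono-< = ℕ.^-monoʳ-< q 2≤q

  +-^-< : ∀ u v u′ v′ → u + v ≡ u′ + v′ → u < u′ → u′ ≤ v′ → q ^ u′ + q ^ v′ < q ^ u + q ^ v
  +-^-< u v u′ v′ eq u<u′ u′≤v′ = begin-strict
    q ^ u′ + q ^ v′      ≤⟨ ℕ.+-monoˡ-≤ (q ^ v′) (ℕ.^-monoʳ-≤ q u′≤v′) ⟩
    q ^ v′ + q ^ v′      ≡⟨ ≡.cong (λ w → q ^ v′ + w) (ℕ.+-identityʳ (q ^ v′)) ⟨
    2 * q ^ v′           ≤⟨ ℕ.*-monoˡ-≤ (q ^ v′) 2≤q ⟩
    q ^ suc v′           ≤⟨ ℕ.^-monoʳ-≤ q v′<v ⟩
    q ^ v                <⟨ ℕ.m<n+m (q ^ v) (ℕ.m^n>0 q u) ⟩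
    q ^ u + q ^ v        ∎
    where
    open ℕ.≤-Reasoning
    v′<v : v′ < v
    v′<v = ℕ.+-cancelˡ-< u v′ v (≡.subst (u + v′ <_) (≡.sym eq) (ℕ.+-monoˡ-< v′ u<u′))

  +-^-≢-ordered : ∀ u v u′ v′ → u + v ≡ u′ + v′ → u ≢ u′ → u ≤ v → u′ ≤ v′ → q ^ u + q ^ v ≢ q ^ u′ + q ^ v′
  +-^-≢-ordered u v u′ v′ eq u≢u′ u≤v u′≤v′ with ℕ.<-cmp u u′
  ... | tri< u<u′ _ _ = ℕ.>⇒≢ (+-^-< u v u′ v′ eq u<u′ u′≤v′)
  ... | tri≈ _ u≡u′ _ = contradiction u≡u′ u≢u′
  ... | tri> _ _ u′<u = ℕ.<⇒≢ (+-^-< u′ v′ u v (≡.sym eq) u′<u u≤v)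

  +-^-≢ : ∀ u v u′ v′ → u + v ≡ u′ + v′ → u ≢ u′ → u ≢ v′ → v ≢ u′ → v ≢ v′ → q ^ u + q ^ v ≢ q ^ u′ + q ^ v′
  +-^-≢ u v u′ v′ eq u≢u′ u≢v′ v≢u′ v≢v′ eq^ with ℕ.≤-total u v | ℕ.≤-total u′ v′
  ... | inj₁ u≤v | inj₁ u′≤v′ = +-^-≢-ordered u v u′ v′ eq u≢u′ u≤v u′≤v′ eq^
  ... | inj₁ u≤v | inj₂ v′≤u′ = +-^-≢-ordered u v v′ u′ (≡.trans eq (ℕ.+-comm u′ v′)) u≢v′ u≤v v′≤u′
    (≡.trans eq^ (ℕ.+-comm (q ^ u′) (q ^ v′)))
  ... | inj₂ v≤u | inj₁ u′≤v′ = +-^-≢-ordered v u u′ v′ (≡.trans (ℕ.+-comm v u) eq) v≢u′ v≤u u′≤v′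
    (≡.trans (ℕ.+-comm (q ^ v) (q ^ u)) eq^)
  ... | inj₂ v≤u | inj₂ v′≤u′ = +-^-≢-ordered v u v′ u′
    (≡.trans (ℕ.+-comm v u) (≡.trans eq (ℕ.+-comm u′ v′))) v≢v′ v≤u v′≤u′
    (≡.trans (ℕ.+-comm (q ^ v) (q ^ u)) (≡.trans eq^ (ℕ.+-comm (q ^ u′) (q ^ v′))))

  even≢odd : ∀ m n → m + m ≢ suc (n + n)
  even≢odd zero    n       ()
  even≢odd (suc m) zero    eq = contradiction (≡.trans (≡.sym (ℕ.+-suc m m)) (ℕ.suc-injective eq)) λ ()
  even≢odd (suc m) (suc n) eq = even≢odd m n
    (ℕ.suc-injective (≡.trans (≡.sym (ℕ.+-suc m m)) (≡.trans (ℕ.suc-injective eq) (≡.cong suc (ℕ.+-suc n n)))))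

  even-odd-≢ : ∀ x y x′ y′ → x + y ≡ x′ + y′ + 1 →
    q ^ (x + x) + q ^ (y + y) ≢ q ^ suc (x′ + x′) + q ^ suc (y′ + y′)
  even-odd-≢ x y x′ y′ eq = +-^-≢ (x + x) (y + y) (suc (x′ + x′)) (suc (y′ + y′))
    (≡.trans (solve 2 (λ x y → x :+ x :+ (y :+ y) := (x :+ y) :+ (x :+ y)) ≡.refl x y)
      (≡.trans (≡.cong₂ _+_ eq eq)
        (solve 2 (λ x y → (x :+ y :+ con 1) :+ (x :+ y :+ con 1) := con 1 :+ (x :+ x) :+ (con 1 :+ (y :+ y))) ≡.refl x′ y′)))
    (even≢odd x x′) (even≢odd x y′) (even≢odd y x′) (even≢odd y y′)
    where open +-*-Solver

module Characteristic0 {k ℓk} (K : CommutativeRing k ℓk) where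
  open CommutativeRing K hiding (zero)
  open IntegerSolver K
  open RingLemmas K
  open import Algebra.Properties.Semiring.Mult semiring using (×-homo-+; ×1-homo-*; ×-congˡ) renaming (_×_ to _ℕ×_)
  open import Algebra.Properties.Semiring.Exp semiring using (_^_)

  ι : ℕ → Carrier
  ι n = n ℕ× 1#

  ι-1 : ι 1 ≈ 1#
  ι-1 = +-identityʳ 1#

  ι-+ : ∀ m n → ι (m ℕ.+ n) ≈ ι m + ι n
  ι-+ = ×-homo-+ 1#

  ι-* : ∀ m n → ι (m ℕ.* n) ≈ ι m * ι n
  ι-* = ×1-homo-*

  ι-^ : ∀ m n → ι (m ℕ.^ n) ≈ ι m ^ n
  ι-^ m zero    = ι-1
  ι-^ m (suc n) = trans (ι-* m (m ℕ.^ n)) (*-congˡ (ι-^ m n))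

  record FieldLike : Set (k ⊔ ℓk) where
    field
      nontrivial : ¬ 1# ≈ 0#
      ι-invertible : ∀ n → Invertible (ι (suc n))
      local : ∀ u v → u + v ≈ 1# → Cancellable u ⊎ Cancellable v
      tight : ∀ u → ¬ Cancellable u → u ≈ 0#

    ι-difference : ∀ {m n} → m ≢ n → Invertible (ι m - ι n)
    ι-difference {m} {n} m≢n with ℕ.<-cmp m n
    ... | tri≈ _ m≡n _ = contradiction m≡n m≢n
    ... | tri< m<n _ _ = Invertible-resp (sym negated) (Invertible-neg (ι-invertible (n ℕ.∸ suc m)))
      where
      negated : ι m - ι n ≈ - ι (suc (n ℕ.∸ suc m))
      negated = trans (+-congˡ (-‿cong (trans (×-congˡ (≡.sym (≡.trans (ℕ.+-suc m _) (ℕ.m+[n∸m]≡n m<n)))) (ι-+ m _))))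
        (solve 2 (λ a b → a :- (a :+ b) := :- b) refl _ _)
    ... | tri> _ _ n<m = Invertible-resp (sym positive) (ι-invertible (m ℕ.∸ suc n))
      where
      positive : ι m - ι n ≈ ι (suc (m ℕ.∸ suc n))
      positive = trans (+-congʳ (trans (×-congˡ (≡.sym (≡.trans (ℕ.+-suc n _) (ℕ.m+[n∸m]≡n n<m)))) (ι-+ n _)))
        (solve 2 (λ a b → a :+ b :- a := b) refl _ _)

module Labels {k ℓk} (K : CommutativeRing k ℓk) (F : Characteristic0.FieldLike K)
  (q′ : ℕ) (2≤q : 2 ℕ.≤ q′) (N M : ℕ) (t : CommutativeRing.Carrier K)
  (t²≈q : CommutativeRing._≈_ K (CommutativeRing._*_ K t t) (Characteristic0.ι K q′)) where

  open CommutativeRing K hiding (zero)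
  open IntegerSolver K
  open RingLemmas K
  open Characteristic0 K
  open FieldLike F
  open PowerSums q′ 2≤q
  open import Algebra.Properties.Semiring.Exp semiring using (_^_; ^-homo-*; ^-congʳ)

  private
    q-invertible′ : Invertible (ι q′)
    q-invertible′ = Invertible-resp (×-congˡ (ℕ.suc-pred q′)) (ι-invertible (ℕ.pred q′))
      where open import Algebra.Properties.Semiring.Mult semiring using (×-congˡ)

    q-1-invertible : Invertible (ι q′ - 1#)
    q-1-invertible = Invertible-resp (+-congˡ (-‿cong ι-1)) (ι-difference (ℕ.>⇒≢ 2≤q))

  parameters : Parameters K
  parameters = record
    { q = ι q′ ; r = proj₁ q-invertible′ ; ω = proj₁ q-1-invertible ; Q = ι q′ ^ (N ℕ.+ M)
    ; qr≈1 = proj₂ q-invertible′ ; ω[q-1]≈1 = trans (*-comm _ _) (proj₂ q-1-invertible) }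

  open Parameters parameters

  r-distinct : ∀ i j → i ≢ j → Invertible (r ^ i - r ^ j)
  r-distinct i j i≢j = Invertible-factorˡ (q ^ i * q ^ j) (Invertible-resp
    (sym (modulo (q ^ j) (≈⇒-≈0 (q^r^≈1 i)) (modulo (- (q ^ i)) (≈⇒-≈0 (q^r^≈1 j))
      (trans (solve 4 (λ a b x y → (x :- y) :* (a :* b) :=
          b :- a :+ b :* (a :* x :- con (+ 1)) :+ (:- a) :* (b :* y :- con (+ 1)))
        refl (q ^ i) (q ^ j) (r ^ i) (r ^ j))
        (+-congʳ (+-congʳ (+-cong (sym (ι-^ q′ j)) (-‿cong (sym (ι-^ q′ i))))))))))
    (ι-difference λ eq → i≢j (≡.sym (^-injective eq))))
    where
    ^-injective : ∀ {m n} → q′ ℕ.^ m ≡ q′ ℕ.^ n → m ≡ n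
    ^-injective {m} {n} eq with ℕ.<-cmp m n
    ... | tri< m<n _ _ = contradiction eq (ℕ.<⇒≢ (^-mono-< m<n))
    ... | tri≈ _ m≡n _ = m≡n
    ... | tri> _ _ n<m = contradiction eq (ℕ.>⇒≢ (^-mono-< n<m))

  Q-cancellable : Cancellable Q
  Q-cancellable = Invertible⇒Cancellable (q^-invertible (N ℕ.+ M))

  t-invertible : Invertible t
  t-invertible = Invertible-factorˡ t (Invertible-resp (sym t²≈q) q-invertible)

  ^-invertible : ∀ {a} n → Invertible a → Invertible (a ^ n)
  ^-invertible zero    _   = 1# , *-identityˡ 1#
  ^-invertible (suc n) inv = Invertible-* inv (^-invertible n inv)

  t^² : ∀ n → t ^ n * t ^ n ≈ q ^ n
  t^² zero    = *-identityˡ 1#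
  t^² (suc n) = trans (solve 2 (λ t a → t :* a :* (t :* a) := t :* t :* (a :* a)) refl t (t ^ n)) (*-cong t²≈q (t^² n))

  κ : Carrier
  κ = t ^ M * (r * ω)

  κ-invertible : Invertible κ
  κ-invertible = Invertible-* (^-invertible M t-invertible) (Invertible-* (q , trans (*-comm r q) qr≈1) ω-invertible)

  -- The eigenvalues are the Φ b x y with b ∈ {0 , 1}, x , y ≥ 1 and x + y + b = N + 2: they are θ(k) for
  -- k = x - y, and b is the parity of N - k. Those with x = 0 or y = 0 are the first terms past the ends.
  Φ : ℕ → ℕ → ℕ → Carrier
  Φ b x y = κ * (t ^ b * (q ^ x - q ^ y))

  difference-same : ∀ b {x y x′ y′} → x ℕ.< x′ → y′ ℕ.< y → Invertible (Φ b x y - Φ b x′ y′)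
  difference-same b {x} {y} {x′} {y′} x<x′ y′<y = Invertible-resp
    (trans (*-congˡ (+-cong (trans (ι-+ (q′ ℕ.^ x) (q′ ℕ.^ y′)) (+-cong (ι-^ q′ x) (ι-^ q′ y′)))
        (-‿cong (trans (ι-+ (q′ ℕ.^ x′) (q′ ℕ.^ y)) (+-cong (ι-^ q′ x′) (ι-^ q′ y))))))
      (solve 6 (λ k t a b c d → k :* t :* (a :+ d :- (c :+ b)) := k :* (t :* (a :- b)) :- k :* (t :* (c :- d)))
        refl κ (t ^ b) (q ^ x) (q ^ y) (q ^ x′) (q ^ y′)))
    (Invertible-* (Invertible-* κ-invertible (^-invertible b t-invertible))
      (ι-difference (ℕ.<⇒≢ (ℕ.+-mono-< (^-mono-< x<x′) (^-mono-< y′<y)))))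

  difference-cross : ∀ x y x′ y′ → x ℕ.+ y ≡ x′ ℕ.+ y′ ℕ.+ 1 → Invertible (Φ 0 x y - Φ 1 x′ y′)
  difference-cross x y x′ y′ eq = Invertible-factorˡ (Φ 0 x y + Φ 1 x′ y′) (Invertible-resp
    (sym (modulo (κ * κ * - ((a′ - b′) * (a′ - b′))) (≈⇒-≈0 t²≈q)
      (modulo (κ * κ * (- (1# + 1#))) (≈⇒-≈0 powers)
      (trans (solve 7 (λ k t q a b c d →
          (k :* (con (+ 1) :* (a :- b)) :- k :* (t :* con (+ 1) :* (c :- d))) :*
          (k :* (con (+ 1) :* (a :- b)) :+ k :* (t :* con (+ 1) :* (c :- d))) :=
          k :* k :* (a :* a :+ b :* b :- (q :* (c :* c) :+ q :* (d :* d)))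
            :+ k :* k :* (:- ((c :- d) :* (c :- d))) :* (t :* t :- q)
            :+ k :* k :* (:- (con (+ 1) :+ con (+ 1))) :* (a :* b :- q :* (c :* d)))
          refl κ t q a b a′ b′)
        (+-congʳ (+-congʳ (*-congˡ (sym (+-cong
          (trans (ι-+ (q′ ℕ.^ (x ℕ.+ x)) _) (+-cong (double x) (double y)))
          (-‿cong (trans (ι-+ (q′ ℕ.^ suc (x′ ℕ.+ x′)) _) (+-cong (double′ x′) (double′ y′)))))))))))))
    (Invertible-* (Invertible-* κ-invertible κ-invertible) (ι-difference (even-odd-≢ x y x′ y′ eq))))
    where
    a b a′ b′ : Carrier
    a = q ^ x
    b = q ^ y
    a′ = q ^ x′
    b′ = q ^ y′
    double : ∀ n → ι (q′ ℕ.^ (n ℕ.+ n)) ≈ q ^ n * q ^ n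
    double n = trans (ι-^ q′ (n ℕ.+ n)) (^-homo-* q n n)
    double′ : ∀ n → ι (q′ ℕ.^ suc (n ℕ.+ n)) ≈ q * (q ^ n * q ^ n)
    double′ n = trans (ι-* q′ _) (*-congˡ (double n))
    powers : a * b ≈ q * (a′ * b′)
    powers = trans (sym (^-homo-* q x y)) (trans
      (^-congʳ q (≡.trans eq (ℕ.+-comm (x′ ℕ.+ y′) 1))) (*-congˡ (^-homo-* q x′ y′)))

  Valid : ℕ → ℕ → ℕ → Set
  Valid b x y = b ℕ.≤ 1 × x ℕ.+ y ℕ.+ b ≡ N

  difference : ∀ b x y b′ x′ y′ → b ℕ.≤ 1 → b′ ℕ.≤ 1 → x ℕ.+ y ℕ.+ b ≡ x′ ℕ.+ y′ ℕ.+ b′ →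
               (b ≡ b′ → y ≢ y′) → Invertible (Φ b x y - Φ b′ x′ y′)
  difference b x y b′ x′ y′ b≤1 b′≤1 eq y≢y′ with b ℕ.≟ b′
  ... | yes ≡.refl = same (ℕ.<-cmp y y′)
    where
    sums : x ℕ.+ y ≡ x′ ℕ.+ y′
    sums = ℕ.+-cancelʳ-≡ b _ _ eq
    opposite : ∀ {x y x′ y′} → x ℕ.+ y ≡ x′ ℕ.+ y′ → y ℕ.< y′ → x′ ℕ.< x
    opposite {x} {y} {x′} {y′} eq y<y′ = ℕ.+-cancelʳ-< y x′ x (≡.subst (x′ ℕ.+ y ℕ.<_) (≡.sym eq) (ℕ.+-monoʳ-< x′ y<y′))
    same : Tri (y ℕ.< y′) (y ≡ y′) (y′ ℕ.< y) → Invertible (Φ b x y - Φ b x′ y′)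
    same (tri< y<y′ _ _) = Invertible-resp (solve 2 (λ u v → :- (u :- v) := v :- u) refl _ _)
      (Invertible-neg (difference-same b (opposite sums y<y′) y<y′))
    same (tri≈ _ y≡y′ _) = contradiction y≡y′ (y≢y′ ≡.refl)
    same (tri> _ _ y′<y) = difference-same b (opposite (≡.sym sums) y′<y) y′<y
  difference zero x y (suc zero) x′ y′ _ _ eq _ | no _ =
    difference-cross x y x′ y′ (≡.trans (≡.sym (ℕ.+-identityʳ _)) eq)
  difference (suc zero) x y zero x′ y′ _ _ eq _ | no _ =
    Invertible-resp (solve 2 (λ u v → :- (u :- v) := v :- u) refl _ _)
      (Invertible-neg (difference-cross x′ y′ x y (≡.sym (≡.trans eq (ℕ.+-identityʳ _)))))
  difference zero x y zero x′ y′ _ _ eq _ | no b≢b′ = contradiction ≡.refl b≢b′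
  difference (suc zero) x y (suc zero) x′ y′ _ _ eq _ | no b≢b′ = contradiction ≡.refl b≢b′
  difference (suc (suc b)) x y b′ x′ y′ (ℕ.s≤s ()) _ _ _ | no _
  difference zero x y (suc (suc b′)) x′ y′ _ (ℕ.s≤s ()) _ _ | no _
  difference (suc zero) x y (suc (suc b′)) x′ y′ _ (ℕ.s≤s ()) _ _ | no _

  neighbour-sum : ∀ b x y →
    Φ b (suc (suc x)) y + Φ b x (suc (suc y)) ≈ (q + r) * Φ b (suc x) (suc y)
  neighbour-sum b x y = modulo (- (κ * t ^ b * (q ^ x - q ^ y))) (≈⇒-≈0 qr≈1)
    (solve 6 (λ q r k t a c →
      k :* (t :* (q :* (q :* a) :- c)) :+ k :* (t :* (a :- q :* (q :* c))) :=
      (q :+ r) :* (k :* (t :* (q :* a :- q :* c))) :+ (:- (k :* t :* (a :- c))) :* (q :* r :- con (+ 1)))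
      refl q r κ (t ^ b) (q ^ x) (q ^ y))

  neighbour-product : ∀ b x y → x ℕ.+ y ℕ.+ b ≡ N →
    Φ b (suc (suc x)) y * Φ b x (suc (suc y)) ≈
    Φ b (suc x) (suc y) * Φ b (suc x) (suc y) - (q + 1#) * (q + 1#) * Q * r * r
  neighbour-product b x y eq =
    modulo (- (c * (t ^ b * t ^ b * (q ^ x * q ^ y)))) (≈⇒-≈0 (t^² M))
    (modulo (- (c * (q ^ M * (q ^ x * q ^ y)))) (≈⇒-≈0 (t^² b))
    (modulo (- c) (≈⇒-≈0 powers)
    (modulo (- (r * r * (q + 1#) * (q + 1#) * Q * (ω * (q - 1#) + 1#))) (≈⇒-≈0 ω[q-1]≈1)
    (solve 10 (λ q r ω Q s t a b qM qb →
      s :* (r :* ω) :* (t :* (q :* (q :* a) :- b)) :* (s :* (r :* ω) :* (t :* (a :- q :* (q :* b)))) :=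
      s :* (r :* ω) :* (t :* (q :* a :- q :* b)) :* (s :* (r :* ω) :* (t :* (q :* a :- q :* b)))
        :- (q :+ con (+ 1)) :* (q :+ con (+ 1)) :* Q :* r :* r
        :+ (:- (r :* r :* (q :+ con (+ 1)) :* (q :+ con (+ 1)) :* (ω :* (q :- con (+ 1))) :* (ω :* (q :- con (+ 1))) :* (t :* t :* (a :* b))))
           :* (s :* s :- qM)
        :+ (:- (r :* r :* (q :+ con (+ 1)) :* (q :+ con (+ 1)) :* (ω :* (q :- con (+ 1))) :* (ω :* (q :- con (+ 1))) :* (qM :* (a :* b))))
           :* (t :* t :- qb)
        :+ (:- (r :* r :* (q :+ con (+ 1)) :* (q :+ con (+ 1)) :* (ω :* (q :- con (+ 1))) :* (ω :* (q :- con (+ 1)))))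
           :* (qM :* qb :* (a :* b) :- Q)
        :+ (:- (r :* r :* (q :+ con (+ 1)) :* (q :+ con (+ 1)) :* Q :* (ω :* (q :- con (+ 1)) :+ con (+ 1))))
           :* (ω :* (q :- con (+ 1)) :- con (+ 1)))
      refl q r ω Q (t ^ M) (t ^ b) (q ^ x) (q ^ y) (q ^ M) (q ^ b)))))
    where
    c : Carrier
    c = r * r * (q + 1#) * (q + 1#) * (ω * (q - 1#)) * (ω * (q - 1#))
    powers : q ^ M * q ^ b * (q ^ x * q ^ y) ≈ Q
    powers = trans (*-cong (sym (^-homo-* q M b)) (sym (^-homo-* q x y)))
      (trans (sym (^-homo-* q (M ℕ.+ b) (x ℕ.+ y)))
        (^-congʳ q (≡.trans (ℕS.solve 4 (λ M b x y → M ℕS.:+ b ℕS.:+ (x ℕS.:+ y) ℕS.:= x ℕS.:+ y ℕS.:+ b ℕS.:+ M) ≡.refl M b x y)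
          (≡.cong (ℕ._+ M) eq))))
      where module ℕS = +-*-Solver

  parity : ∀ n → ∃ λ e → ∃ λ b → b ℕ.≤ 1 × n ≡ e ℕ.+ e ℕ.+ b
  parity zero          = 0 , 0 , ℕ.z≤n , ≡.refl
  parity (suc zero)    = 0 , 1 , ℕ.s≤s ℕ.z≤n , ≡.refl
  parity (suc (suc n)) = let (e , b , b≤1 , eq) = parity n in
    suc e , b , b≤1 , ≡.trans (≡.cong (λ m → suc (suc m)) eq) (≡.cong (λ m → suc (m ℕ.+ b)) (≡.sym (ℕ.+-suc e e)))

  open Continuants K parameters

  scale : ℕ → ℕ → Carrier
  scale b e = t ^ M * t ^ b * q ^ e

  scale² : ∀ b e d → d ℕ.+ (e ℕ.+ e ℕ.+ b) ≡ N → scale b e * scale b e ≈ Q * r ^ d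
  scale² b e d eq = trans
    (solve 3 (λ s u v → s :* u :* v :* (s :* u :* v) := s :* s :* (u :* u) :* (v :* v)) refl (t ^ M) (t ^ b) (q ^ e))
    (trans (*-congʳ (*-cong (t^² M) (t^² b)))
    (modulo (- (q ^ M * q ^ b * (q ^ e * q ^ e))) (≈⇒-≈0 (q^r^≈1 d))
    (modulo (- (r ^ d)) (≈⇒-≈0 powers)
    (solve 6 (λ A B C D R Q → A :* B :* C := Q :* R :+
        (:- (A :* B :* C)) :* (D :* R :- con (+ 1)) :+ (:- R) :* (Q :- D :* (A :* B :* C)))
      refl (q ^ M) (q ^ b) (q ^ e * q ^ e) (q ^ d) (r ^ d) Q))))
    where
    module ℕS = +-*-Solver
    powers : Q ≈ q ^ d * (q ^ M * q ^ b * (q ^ e * q ^ e))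
    powers = trans (^-congʳ q (≡.trans (≡.cong (ℕ._+ M) (≡.sym eq))
        (ℕS.solve 4 (λ d e b M → d ℕS.:+ (e ℕS.:+ e ℕS.:+ b) ℕS.:+ M ℕS.:= d ℕS.:+ (M ℕS.:+ b ℕS.:+ (e ℕS.:+ e))) ≡.refl d e b M)))
      (trans (^-homo-* q d (M ℕ.+ b ℕ.+ (e ℕ.+ e))) (*-congˡ
        (trans (^-homo-* q (M ℕ.+ b) (e ℕ.+ e)) (*-cong (^-homo-* q M b) (^-homo-* q e e)))))

  scaled-root : ∀ b e x y → scale b e * (ω * (q ^ x - q ^ y)) ≈ Φ b (suc (x ℕ.+ e)) (suc (y ℕ.+ e))
  scaled-root b e x y = sym (trans
    (*-congˡ (*-congˡ (+-cong (*-congˡ (^-homo-* q x e)) (-‿cong (*-congˡ (^-homo-* q y e))))))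
    (modulo (t ^ M * ω * t ^ b * q ^ e * (q ^ x - q ^ y)) (≈⇒-≈0 qr≈1)
    (solve 8 (λ q r ω s u a b c →
      s :* (r :* ω) :* (u :* (q :* (a :* c) :- q :* (b :* c))) :=
      s :* u :* c :* (ω :* (a :- b)) :+ s :* ω :* u :* c :* (a :- b) :* (q :* r :- con (+ 1)))
      refl q r ω (t ^ M) (t ^ b) (q ^ x) (q ^ y) (q ^ e))))

  continuant-nonzero : ∀ μ → (∀ b x y → Valid b x y → Cancellable (μ - Φ b (suc x) (suc y))) →
    ∀ d → d ℕ.≤ N → Cancellable (continuant (τ d) μ (suc d))
  continuant-nonzero μ apart d d≤N =
    let (e , b , b≤1 , eq) = parity (N ℕ.∸ d)
        total : d ℕ.+ (e ℕ.+ e ℕ.+ b) ≡ N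
        total = ≡.trans (≡.cong (d ℕ.+_) (≡.sym eq)) (ℕ.m+[n∸m]≡n d≤N)
    in continuant-cancellable {scale b e} d (scale² b e d total)
      (λ i j i<j j≤d → Cancellable-resp
        (+-cong (sym (scaled-root b e (d ℕ.∸ j) j)) (-‿cong (sym (scaled-root b e (d ℕ.∸ i) i))))
        (Invertible⇒Cancellable (difference-same b
          (ℕ.s≤s (ℕ.+-monoˡ-< e (ℕ.∸-monoʳ-< i<j j≤d))) (ℕ.s≤s (ℕ.+-monoˡ-< e i<j)))))
      μ (λ m m≤d → Cancellable-resp (+-congˡ (-‿cong (sym (scaled-root b e (d ℕ.∸ m) m))))
        (apart b (d ℕ.∸ m ℕ.+ e) (m ℕ.+ e) (b≤1 , ≡.trans
          (ℕS.solve 4 (λ u m e b → u ℕS.:+ e ℕS.:+ (m ℕS.:+ e) ℕS.:+ b ℕS.:= m ℕS.:+ u ℕS.:+ (e ℕS.:+ e ℕS.:+ b)) ≡.refl (d ℕ.∸ m) m e b)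
          (≡.trans (≡.cong (ℕ._+ (e ℕ.+ e ℕ.+ b)) (ℕ.m+[n∸m]≡n m≤d)) total))))
    where module ℕS = +-*-Solver

  continuant-cong : ∀ s {μ ν} → μ ≈ ν → ∀ j → continuant s μ j ≈ continuant s ν j
  continuant-cong s μ≈ν zero          = refl
  continuant-cong s μ≈ν (suc zero)    = μ≈ν
  continuant-cong s μ≈ν (suc (suc j)) =
    +-cong (*-cong μ≈ν (continuant-cong s μ≈ν (suc j))) (*-congˡ (*-congˡ (continuant-cong s μ≈ν j)))

  private
    total₀ : ∀ {b x y} → x ℕ.+ y ℕ.+ b ≡ N → y ℕ.+ x ℕ.+ (0 ℕ.+ 0 ℕ.+ b) ≡ N
    total₀ {b} {x} {y} eq = ≡.trans (≡.cong (ℕ._+ b) (ℕ.+-comm y x)) eq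

  Φ-characteristic : ∀ b x y → x ℕ.+ y ℕ.+ b ≡ N →
    continuant (τ (y ℕ.+ x)) (Φ b (suc x) (suc y)) (suc (y ℕ.+ x)) ≈ 0#
  Φ-characteristic b x y eq = trans
    (continuant-cong (τ (y ℕ.+ x)) (sym (trans (scaled-root b 0 x y)
      (reflexive (≡.cong₂ (λ u v → Φ b (suc u) (suc v)) (ℕ.+-identityʳ x) (ℕ.+-identityʳ y))))) (suc (y ℕ.+ x)))
    (continuant-root-zero y x (scale² b 0 (y ℕ.+ x) (total₀ {b} {x} {y} eq)))

  α[τ-τ]-invertible : ∀ b d → d ℕ.+ b ≡ N → ∀ j → j ℕ.< d → Invertible (α j * (τ d + - τ j))
  α[τ-τ]-invertible b d eq j j<d = Invertible-resp (sym (α[τ-τ] d j (scale² b 0 d eq)))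
    (Invertible-* (Invertible-* (Invertible-* scale-ω scale-ω)
      (Invertible-resp (+-cong (ι-^ q′ (suc j)) (-‿cong ι-1)) (ι-difference (ℕ.>⇒≢ (^-mono-< {0} {suc j} ℕ.z<s)))))
      (Invertible-resp (+-cong (ι-^ q′ d) (-‿cong (ι-^ q′ j))) (ι-difference (ℕ.>⇒≢ (^-mono-< j<d)))))
    where
    scale-ω : Invertible (scale b 0 * ω)
    scale-ω = Invertible-* (Invertible-* (Invertible-* (^-invertible M t-invertible) (^-invertible b t-invertible))
      (q^-invertible 0)) ω-invertible

-- Operators of the covering relation

module CoverMatrix {n : ℕ} (covers : Fin n → Fin n → Bool) where
  open import Algebra.Properties.Semiring.Sum ℕ.+-*-semiring public using (sum; ∑-comm; sum-cong-≗)

  indicator : Bool → ℕ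
  indicator b = if b then 1 else 0

  c cᵗ : Fin n → Fin n → ℕ
  c y z  = indicator (covers y z)
  cᵗ y z = c z y

  infixr 7 _⊙_
  _⊙_ : (A B : Fin n → Fin n → ℕ) → Fin n → Fin n → ℕ
  (A ⊙ B) y z = sum λ x → A y x ℕ.* B x z

  ⊙-transpose₃ : ∀ A B C y z → (A ⊙ B ⊙ C) y z ≡ ((λ u v → C v u) ⊙ (λ u v → B v u) ⊙ (λ u v → A v u)) z y
  ⊙-transpose₃ A B C y z = begin
    (sum λ w → A y w ℕ.* sum λ x → B w x ℕ.* C x z)
      ≡⟨ sum-cong-≗ (λ w → *-distribˡ-sum (A y w) (λ x → B w x ℕ.* C x z)) ⟩
    (sum λ w → sum λ x → A y w ℕ.* (B w x ℕ.* C x z))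
      ≡⟨ ∑-comm (λ w x → A y w ℕ.* (B w x ℕ.* C x z)) ⟩
    (sum λ x → sum λ w → A y w ℕ.* (B w x ℕ.* C x z))
      ≡⟨ sum-cong-≗ (λ x → sum-cong-≗ λ w → solve 3 (λ a b c → a :* (b :* c) := c :* (b :* a)) ≡.refl (A y w) (B w x) (C x z)) ⟩
    (sum λ x → sum λ w → C x z ℕ.* (B w x ℕ.* A y w))
      ≡⟨ sum-cong-≗ (λ x → *-distribˡ-sum (C x z) (λ w → B w x ℕ.* A y w)) ⟨
    (sum λ x → C x z ℕ.* sum λ w → B w x ℕ.* A y w) ∎
    where
    open ≡.≡-Reasoning
    open +-*-Solver
    open import Algebra.Properties.Semiring.Sum ℕ.+-*-semiring using (*-distribˡ-sum)

-- (cᵗ ⊙ c) y z counts the common covers of y and z.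
record Combinatorics (q N M : ℕ) {n : ℕ} (dim : Fin n → ℕ) (covers : Fin n → Fin n → Bool) : Set where
  open CoverMatrix covers
  field
    dim≤N      : ∀ y → dim y ℕ.≤ N
    covers-dim : ∀ y z → T (covers y z) → dim y ≡ suc (dim z)
    relation₁  : ∀ x y →
      q ℕ.^ suc (dim x) ℕ.* ((cᵗ ⊙ cᵗ ⊙ c) x y ℕ.+ q ℕ.* (c ⊙ cᵗ ⊙ cᵗ) x y) ℕ.+ (q ℕ.+ 1) ℕ.* q ℕ.^ (N ℕ.+ M) ℕ.* cᵗ x y ≡
      (q ℕ.+ 1) ℕ.* q ℕ.^ suc (dim x) ℕ.* (cᵗ ⊙ c ⊙ cᵗ) x y
    relation₂  : ∀ x y →
      q ℕ.^ dim y ℕ.* ((cᵗ ⊙ cᵗ ⊙ c) x y ℕ.+ q ℕ.* (c ⊙ cᵗ ⊙ cᵗ) x y) ℕ.+ (q ℕ.+ 1) ℕ.* q ℕ.^ (N ℕ.+ M) ℕ.* cᵗ x y ≡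
      (q ℕ.+ 1) ℕ.* q ℕ.^ dim y ℕ.* (cᵗ ⊙ c ⊙ cᵗ) x y
    cover-count : ∀ y → q ℕ.* (q ℕ.^ dim y ℕ.* (cᵗ ⊙ c) y y) ℕ.+ q ℕ.^ (dim y ℕ.+ M) ≡ q ℕ.^ dim y ℕ.* (cᵗ ⊙ c) y y ℕ.+ q ℕ.^ (N ℕ.+ M)
    o          : Fin n
    dim-o      : dim o ≡ 0
    o-unique   : ∀ y → dim y ≡ 0 → y ≡ o
    p₁ p₂      : Fin n
    p₁≢p₂      : p₁ ≢ p₂
    dim-p₁     : dim p₁ ≡ 1
    dim-p₂     : dim p₂ ≡ 1
    p-covers   : ∀ y → c p₁ y ≡ c p₂ y
    no-join    : (cᵗ ⊙ c) p₁ p₂ ≡ 0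
    same-joins : ∀ y → dim y ≡ 1 → y ≢ p₁ → y ≢ p₂ → (cᵗ ⊙ c) y p₁ ≡ (cᵗ ⊙ c) y p₂

module CoverOperators {k ℓk} (K : CommutativeRing k ℓk) (F : Characteristic0.FieldLike K)
  (q′ : ℕ) (2≤q : 2 ℕ.≤ q′) (N M : ℕ) (t : CommutativeRing.Carrier K)
  (t²≈q : CommutativeRing._≈_ K (CommutativeRing._*_ K t t) (Characteristic0.ι K q′))
  {n : ℕ} (dim : Fin n → ℕ) (covers : Fin n → Fin n → Bool)
  (comb : Combinatorics q′ N M dim covers) where

  open CommutativeRing K hiding (zero)
  open IntegerSolver K
  open RingLemmas K
  open Characteristic0 K
  open FieldLike F
  open Labels K F q′ 2≤q N M t t²≈q
  open Parameters parameters
  open Combinatorics comb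
  open CoverMatrix covers using (c; cᵗ; _⊙_; ⊙-transpose₃) renaming (sum to sumℕ)
  open Matrices K using (Matrix; _·_; _·ᵛ_)
  open Operators K (Fin n)
  open DownUp K parameters (Fin n) dim N dim≤N
  open import Algebra.Properties.Semiring.Sum semiring using (sum; ∑-comm; sum-cong-≋; *-distribˡ-sum; *-distribʳ-sum; ∑-distrib-+; sum-replicate-zero)
  open import Algebra.Properties.Semiring.Exp semiring using (_^_; ^-congʳ)
  open import Algebra.Properties.Semiring.Mult semiring using (×-congˡ)
  open import Relation.Binary.Reasoning.Setoid setoid

  ι-sum : ∀ {m} (f : Fin m → ℕ) → ι (sumℕ f) ≈ sum (ι ∘ f)
  ι-sum {zero}  f = refl
  ι-sum {suc m} f = trans (ι-+ (f zero) (sumℕ (f ∘ suc))) (+-congˡ (ι-sum (f ∘ suc)))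

  ι-⊙ : ∀ A B y z → ι ((A ⊙ B) y z) ≈ ((λ u v → ι (A u v)) · (λ u v → ι (B u v))) y z
  ι-⊙ A B y z = trans (ι-sum λ x → A y x ℕ.* B x z) (sum-cong-≋ λ x → ι-* (A y x) (B x z))

  ·-·ᵛ : ∀ (A B : Matrix n) f y → ((A · B) ·ᵛ f) y ≈ (A ·ᵛ (B ·ᵛ f)) y
  ·-·ᵛ A B f y = begin
    (sum λ z → (sum λ x → A y x * B x z) * f z)
      ≈⟨ sum-cong-≋ (λ z → *-distribʳ-sum (f z) (λ x → A y x * B x z)) ⟩
    (sum λ z → sum λ x → A y x * B x z * f z)
      ≈⟨ ∑-comm (λ z x → A y x * B x z * f z) ⟩
    (sum λ x → sum λ z → A y x * B x z * f z)
      ≈⟨ sum-cong-≋ (λ x → trans (sum-cong-≋ λ z → *-assoc (A y x) (B x z) (f z))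
           (sym (*-distribˡ-sum (A y x) (λ z → B x z * f z)))) ⟩
    (sum λ x → A y x * sum λ z → B x z * f z) ∎

  ·ᵛ-cong : ∀ {A B : Matrix n} {f g} y → (∀ z → A y z ≈ B y z) → (∀ z → f z ≈ g z) → (A ·ᵛ f) y ≈ (B ·ᵛ g) y
  ·ᵛ-cong y A≈B f≈g = sum-cong-≋ λ z → *-cong (A≈B z) (f≈g z)

  sum-linear : ∀ {m} a (f : Fin m → Carrier) b g → sum (λ z → a * f z + b * g z) ≈ a * sum f + b * sum g
  sum-linear a f b g = trans (∑-distrib-+ (λ z → a * f z) (λ z → b * g z))
    (+-cong (sym (*-distribˡ-sum a f)) (sym (*-distribˡ-sum b g)))

  ·ᵛ-linear : ∀ (A : Matrix n) → LinearOn Everywhere (A ·ᵛ_)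
  ·ᵛ-linear A = record
    { cong = λ f≈g y _ → sum-cong-≋ λ z → *-congˡ (f≈g z tt)
    ; linear = λ a f b g y _ → trans
        (sum-cong-≋ λ z → solve 5 (λ a f b g x → x :* (a :* f :+ b :* g) := a :* (x :* f) :+ b :* (x :* g))
          refl a (f z) b (g z) (A y z))
        (sum-linear a (λ z → A y z * f z) b (λ z → A y z * g z)) }

  ⟦_⟧ : (Fin n → Fin n → ℕ) → Fun → Fun
  ⟦ A ⟧ = (λ y z → ι (A y z)) ·ᵛ_

  ⟦⟧-⊙ : ∀ A B f y → ⟦ A ⊙ B ⟧ f y ≈ ⟦ A ⟧ (⟦ B ⟧ f) y
  ⟦⟧-⊙ A B f y = trans (·ᵛ-cong {A = λ u v → ι ((A ⊙ B) u v)} {B = (λ u v → ι (A u v)) · (λ u v → ι (B u v))} {f = f} y (ι-⊙ A B y) (λ _ → refl))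
    (·-·ᵛ (λ u v → ι (A u v)) (λ u v → ι (B u v)) f y)

  ⟦⟧-⊙₃ : ∀ A B C f y → ⟦ A ⊙ B ⊙ C ⟧ f y ≈ ⟦ A ⟧ (⟦ B ⟧ (⟦ C ⟧ f)) y
  ⟦⟧-⊙₃ A B C f y = trans (⟦⟧-⊙ A (B ⊙ C) f y)
    (LinearOn.cong (·ᵛ-linear λ u v → ι (A u v)) (λ z _ → ⟦⟧-⊙ B C f z) y tt)

  U D L : Fun → Fun
  U = ⟦ c ⟧
  D = ⟦ cᵗ ⟧
  L f y = q ^ dim y * D f y

  U-linear : LinearOn Everywhere U
  U-linear = ·ᵛ-linear λ y z → ι (c y z)

  D-linear : LinearOn Everywhere D
  D-linear = ·ᵛ-linear λ y z → ι (cᵗ y z)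

  U-cong : ∀ {f g} → (∀ y → f y ≈ g y) → ∀ y → U f y ≈ U g y
  U-cong f≈g y = LinearOn.cong U-linear (λ z _ → f≈g z) y tt

  D-cong : ∀ {f g} → (∀ y → f y ≈ g y) → ∀ y → D f y ≈ D g y
  D-cong f≈g y = LinearOn.cong D-linear (λ z _ → f≈g z) y tt

  L-linear : LinearOn Everywhere L
  L-linear = record
    { cong = λ f≈g y _ → *-congˡ (LinearOn.cong D-linear f≈g y tt)
    ; linear = λ a f b g y _ → trans (*-congˡ (LinearOn.linear D-linear a f b g y tt))
        (solve 5 (λ s a u b v → s :* (a :* u :+ b :* v) := a :* (s :* u) :+ b :* (s :* v))
          refl (q ^ dim y) a (D f y) b (D g y)) }

  sum-zero : ∀ {m} (f : Fin m → Carrier) → (∀ z → f z ≈ 0#) → sum f ≈ 0#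
  sum-zero {m} f f≈0 = trans (sum-cong-≋ f≈0) (sum-replicate-zero m)

  c-term : ∀ y z x → (dim y ≡ suc (dim z) → x ≈ 0#) → ι (c y z) * x ≈ 0#
  c-term y z x x≈0 with covers y z in eq
  ... | false = zeroˡ x
  ... | true  = trans (*-congˡ (x≈0 (covers-dim y z (≡.subst T (≡.sym eq) tt)))) (zeroʳ _)

  U-local : ∀ f y → (∀ z → dim y ≡ suc (dim z) → f z ≈ 0#) → U f y ≈ 0#
  U-local f y f≈0 = sum-zero (λ z → ι (c y z) * f z) λ z → c-term y z (f z) (f≈0 z)

  D-local : ∀ f y → (∀ z → dim z ≡ suc (dim y) → f z ≈ 0#) → D f y ≈ 0#
  D-local f y f≈0 = sum-zero (λ z → ι (c z y) * f z) λ z → c-term z y (f z) (f≈0 z)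

  L-local : ∀ f y → (∀ z → dim z ≡ suc (dim y) → f z ≈ 0#) → L f y ≈ 0#
  L-local f y f≈0 = trans (*-congˡ (D-local f y f≈0)) (zeroʳ _)

  c-scale : ∀ y z {a b} x → (dim y ≡ suc (dim z) → a ≈ b) → ι (c y z) * (a * x) ≈ b * (ι (c y z) * x)
  c-scale y z {a} {b} x a≈b = modulo 1#
    (c-term y z ((a - b) * x) λ eq → trans (*-congʳ (≈⇒-≈0 (a≈b eq))) (zeroˡ x))
    (solve 4 (λ i a b x → i :* (a :* x) := b :* (i :* x) :+ con (+ 1) :* (i :* ((a :- b) :* x))) refl (ι (c y z)) a b x)

  D-scale : ∀ f y → D (λ z → q ^ dim z * f z) y ≈ q * q ^ dim y * D f y
  D-scale f y = trans (sum-cong-≋ λ z → c-scale z y (f z) λ eq → ^-congʳ q eq)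
    (sym (*-distribˡ-sum (q * q ^ dim y) (λ z → ι (c z y) * f z)))

  U-scale : ∀ f y → U (λ z → q ^ dim z * f z) y ≈ r * q ^ dim y * U f y
  U-scale f y = trans (sum-cong-≋ λ z → c-scale y z (f z) λ eq →
      modulo (- (q ^ dim z)) (≈⇒-≈0 qr≈1) (trans
        (solve 3 (λ q r g → g := r :* (q :* g) :+ (:- g) :* (q :* r :- con (+ 1))) refl q r (q ^ dim z))
        (+-congʳ (*-congˡ (^-congʳ q (≡.sym eq))))))
    (sym (*-distribˡ-sum (r * q ^ dim y) (λ z → ι (c y z) * f z)))

  counting : ∀ (S T E R : Fin n → Fin n → ℕ) a b e d y →
    (∀ z → a ℕ.* (S y z ℕ.+ b ℕ.* T y z) ℕ.+ e ℕ.* E y z ≡ d ℕ.* R y z) → ∀ f →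
    ι a * (⟦ S ⟧ f y + ι b * ⟦ T ⟧ f y) + ι e * ⟦ E ⟧ f y ≈ ι d * ⟦ R ⟧ f y
  counting S T E R a b e d y eq f = begin
    ι a * (⟦ S ⟧ f y + ι b * ⟦ T ⟧ f y) + ι e * ⟦ E ⟧ f y
      ≈⟨ +-congʳ (*-congˡ (trans (sum-linear 1# (s′ S) (ι b) (s′ T)) (+-congʳ (*-identityˡ _)))) ⟨
    ι a * sum (λ z → 1# * (ι (S y z) * f z) + ι b * (ι (T y z) * f z)) + ι e * ⟦ E ⟧ f y
      ≈⟨ sum-linear (ι a) (λ z → 1# * s′ S z + ι b * s′ T z) (ι e) (s′ E) ⟨
    sum (λ z → ι a * (1# * (ι (S y z) * f z) + ι b * (ι (T y z) * f z)) + ι e * (ι (E y z) * f z))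
      ≈⟨ sum-cong-≋ (λ z → trans
           (solve 7 (λ a b e s t x f → a :* (con (+ 1) :* (s :* f) :+ b :* (t :* f)) :+ e :* (x :* f) :=
             (a :* (s :+ b :* t) :+ e :* x) :* f) refl (ι a) (ι b) (ι e) (ι (S y z)) (ι (T y z)) (ι (E y z)) (f z))
           (trans (*-congʳ (at z)) (*-assoc _ _ _))) ⟩
    sum (λ z → ι d * (ι (R y z) * f z))
      ≈⟨ *-distribˡ-sum (ι d) (λ z → ι (R y z) * f z) ⟨
    ι d * ⟦ R ⟧ f y ∎
    where
    s′ : (Fin n → Fin n → ℕ) → Fin n → Carrier
    s′ A z = ι (A y z) * f z
    at : ∀ z → ι a * (ι (S y z) + ι b * ι (T y z)) + ι e * ι (E y z) ≈ ι d * ι (R y z)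
    at z = sym (trans (sym (ι-* d (R y z))) (trans (×-congˡ (≡.sym (eq z)))
      (trans (ι-+ (a ℕ.* (S y z ℕ.+ b ℕ.* T y z)) (e ℕ.* E y z)) (+-cong
        (trans (ι-* a _) (*-congˡ (trans (ι-+ (S y z) _) (+-congˡ (ι-* b (T y z))))))
        (ι-* e (E y z))))))

  private
    ι-q+1 : ι (q′ ℕ.+ 1) ≈ q + 1#
    ι-q+1 = trans (ι-+ q′ 1) (+-congˡ ι-1)

  D-relation : ∀ f y → q ^ suc (dim y) * (D (D (U f)) y + q * U (D (D f)) y) + (q + 1#) * Q * D f y ≈
                       (q + 1#) * q ^ suc (dim y) * D (U (D f)) y
  D-relation f y = begin
    q ^ suc (dim y) * (D (D (U f)) y + q * U (D (D f)) y) + (q + 1#) * Q * D f y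
      ≈⟨ +-cong (*-cong (ι-^ q′ (suc (dim y))) (+-cong (⟦⟧-⊙₃ cᵗ cᵗ c f y) (*-congˡ (⟦⟧-⊙₃ c cᵗ cᵗ f y))))
           (*-congʳ (trans (ι-* (q′ ℕ.+ 1) (q′ ℕ.^ (N ℕ.+ M))) (*-cong ι-q+1 (ι-^ q′ (N ℕ.+ M))))) ⟨
    ι (q′ ℕ.^ suc (dim y)) * (⟦ cᵗ ⊙ cᵗ ⊙ c ⟧ f y + q * ⟦ c ⊙ cᵗ ⊙ cᵗ ⟧ f y)
      + ι ((q′ ℕ.+ 1) ℕ.* q′ ℕ.^ (N ℕ.+ M)) * ⟦ cᵗ ⟧ f y
      ≈⟨ counting (cᵗ ⊙ cᵗ ⊙ c) (c ⊙ cᵗ ⊙ cᵗ) cᵗ (cᵗ ⊙ c ⊙ cᵗ) (q′ ℕ.^ suc (dim y)) q′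
           ((q′ ℕ.+ 1) ℕ.* q′ ℕ.^ (N ℕ.+ M)) ((q′ ℕ.+ 1) ℕ.* q′ ℕ.^ suc (dim y)) y (relation₁ y) f ⟩
    ι ((q′ ℕ.+ 1) ℕ.* q′ ℕ.^ suc (dim y)) * ⟦ cᵗ ⊙ c ⊙ cᵗ ⟧ f y
      ≈⟨ *-cong (trans (ι-* (q′ ℕ.+ 1) _) (*-cong ι-q+1 (ι-^ q′ (suc (dim y))))) (⟦⟧-⊙₃ cᵗ c cᵗ f y) ⟩
    (q + 1#) * q ^ suc (dim y) * D (U (D f)) y ∎

  U-relation : ∀ f y → q ^ dim y * (D (U (U f)) y + q * U (U (D f)) y) + (q + 1#) * Q * U f y ≈
                       (q + 1#) * q ^ dim y * U (D (U f)) y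
  U-relation f y = begin
    q ^ dim y * (D (U (U f)) y + q * U (U (D f)) y) + (q + 1#) * Q * U f y
      ≈⟨ +-cong (*-cong (ι-^ q′ (dim y)) (+-cong (⟦⟧-⊙₃ cᵗ c c f y) (*-congˡ (⟦⟧-⊙₃ c c cᵗ f y))))
           (*-congʳ (trans (ι-* (q′ ℕ.+ 1) (q′ ℕ.^ (N ℕ.+ M))) (*-cong ι-q+1 (ι-^ q′ (N ℕ.+ M))))) ⟨
    ι (q′ ℕ.^ dim y) * (⟦ cᵗ ⊙ c ⊙ c ⟧ f y + q * ⟦ c ⊙ c ⊙ cᵗ ⟧ f y)
      + ι ((q′ ℕ.+ 1) ℕ.* q′ ℕ.^ (N ℕ.+ M)) * ⟦ c ⟧ f y
      ≈⟨ counting (cᵗ ⊙ c ⊙ c) (c ⊙ c ⊙ cᵗ) c (c ⊙ cᵗ ⊙ c) (q′ ℕ.^ dim y) q′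
           ((q′ ℕ.+ 1) ℕ.* q′ ℕ.^ (N ℕ.+ M)) ((q′ ℕ.+ 1) ℕ.* q′ ℕ.^ dim y) y
           (λ x → ≡.trans (≡.cong (ℕ._+ (q′ ℕ.+ 1) ℕ.* q′ ℕ.^ (N ℕ.+ M) ℕ.* c y x)
               (≡.cong (q′ ℕ.^ dim y ℕ.*_) (≡.cong₂ (λ u v → u ℕ.+ q′ ℕ.* v)
                 (⊙-transpose₃ cᵗ c c y x) (⊙-transpose₃ c c cᵗ y x))))
             (≡.trans (relation₂ x y)
               (≡.cong ((q′ ℕ.+ 1) ℕ.* q′ ℕ.^ dim y ℕ.*_) (≡.sym (⊙-transpose₃ c cᵗ c y x))))) f ⟩
    ι ((q′ ℕ.+ 1) ℕ.* q′ ℕ.^ dim y) * ⟦ c ⊙ cᵗ ⊙ c ⟧ f y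
      ≈⟨ *-cong (trans (ι-* (q′ ℕ.+ 1) _) (*-cong ι-q+1 (ι-^ q′ (dim y)))) (⟦⟧-⊙₃ c cᵗ c f y) ⟩
    (q + 1#) * q ^ dim y * U (D (U f)) y ∎

module CoverEigenvectors {k ℓk} (K : CommutativeRing k ℓk) (F : Characteristic0.FieldLike K)
  (q′ : ℕ) (2≤q : 2 ℕ.≤ q′) (N M : ℕ) (t : CommutativeRing.Carrier K)
  (t²≈q : CommutativeRing._≈_ K (CommutativeRing._*_ K t t) (Characteristic0.ι K q′))
  {n : ℕ} (dim : Fin n → ℕ) (covers : Fin n → Fin n → Bool)
  (comb : Combinatorics q′ N M dim covers) where

  open CommutativeRing K hiding (zero)
  open IntegerSolver K
  open RingLemmas K
  open Characteristic0 K
  open FieldLike F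
  open Labels K F q′ 2≤q N M t t²≈q
  open Parameters parameters
  open Combinatorics comb
  open CoverMatrix covers using (c; cᵗ; _⊙_)
  open Operators K (Fin n)
  open DownUp K parameters (Fin n) dim N dim≤N
  open CoverOperators K F q′ 2≤q N M t t²≈q dim covers comb
  open import Algebra.Properties.Semiring.Sum semiring using (sum)
  open import Algebra.Properties.Semiring.Exp semiring using (_^_; ^-homo-*; ^-congʳ)
  open import Algebra.Properties.Semiring.Mult semiring using (×-congˡ)
  open import Relation.Binary.Reasoning.Setoid setoid

  U-homogeneous : ∀ a f {g} → (∀ y → g y ≈ a * f y) → ∀ y → U g y ≈ a * U f y
  U-homogeneous a f g≈ y = trans (U-cong g≈ y) (LinearOn.homogeneous U-linear a f y tt)

  D-homogeneous : ∀ a f {g} → (∀ y → g y ≈ a * f y) → ∀ y → D g y ≈ a * D f y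
  D-homogeneous a f g≈ y = trans (D-cong g≈ y) (LinearOn.homogeneous D-linear a f y tt)

  U-L : ∀ f y → U (L f) y ≈ r * (q ^ dim y * U (D f) y)
  U-L f y = trans (U-scale (D f) y) (*-assoc _ _ _)

  D-L : ∀ f y → D (L f) y ≈ q * (q ^ dim y * D (D f) y)
  D-L f y = trans (D-scale (D f) y) (*-assoc _ _ _)

  pair : GradedPair U L
  pair = record
    { U-linear = U-linear ; L-linear = L-linear ; U-local = U-local ; L-local = L-local
    ; relation₁ = down ; relation₂ = up }
    where
    down : ∀ f y → L (L (U f)) y + q * q * q * U (L (L f)) y + (q + 1#) * Q * L f y ≈
                   q * (q + 1#) * L (U (L f)) y
    down f y = trans
      (+-congʳ (+-cong (*-congˡ (D-L (U f) y))
        (*-congˡ (trans (U-L (L f) y) (*-congˡ (trans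
          (*-congˡ (U-homogeneous q (λ z → q ^ dim z * D (D f) z) (D-L f) y))
          (*-congˡ (*-congˡ (U-scale (D (D f)) y)))))))))
      (trans
        (modulo (q ^ dim y) (≈⇒-≈0 (D-relation f y))
        (modulo (q * q * (q ^ dim y * q ^ dim y) * U (D (D f)) y * (q * r + 1#)
                 - q * (q + 1#) * (q ^ dim y * q ^ dim y) * D (U (D f)) y) (≈⇒-≈0 qr≈1)
        (solve 8 (λ q r Q g a b d e →
          g :* (q :* (g :* a)) :+ q :* q :* q :* (r :* (g :* (q :* (r :* g :* b)))) :+ (q :+ con (+ 1)) :* Q :* (g :* d) :=
          q :* (q :+ con (+ 1)) :* (g :* (r :* (q :* g :* e)))
            :+ g :* (q :* g :* (a :+ q :* b) :+ (q :+ con (+ 1)) :* Q :* d :- (q :+ con (+ 1)) :* (q :* g) :* e)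
            :+ (q :* q :* (g :* g) :* b :* (q :* r :+ con (+ 1)) :- q :* (q :+ con (+ 1)) :* (g :* g) :* e) :* (q :* r :- con (+ 1)))
          refl q r Q (q ^ dim y) (D (D (U f)) y) (U (D (D f)) y) (D f y) (D (U (D f)) y))))
        (*-congˡ (*-congˡ (sym (trans (D-homogeneous r (λ z → q ^ dim z * U (D f) z) (U-L f) y)
          (*-congˡ (D-scale (U (D f)) y)))))))
    up : ∀ f y → L (U (U f)) y + q * q * q * U (U (L f)) y + (q + 1#) * Q * U f y ≈
                 q * (q + 1#) * U (L (U f)) y
    up f y = trans
      (+-congʳ (+-congˡ (*-congˡ (trans (U-homogeneous r (λ z → q ^ dim z * U (D f) z) (U-L f) y)
        (*-congˡ (U-scale (U (D f)) y))))))
      (trans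
        (modulo 1# (≈⇒-≈0 (U-relation f y))
        (modulo (q * q ^ dim y * U (U (D f)) y * (q * r + 1#) - (q + 1#) * q ^ dim y * U (D (U f)) y) (≈⇒-≈0 qr≈1)
        (solve 8 (λ q r Q g a b d e →
          g :* a :+ q :* q :* q :* (r :* (r :* g :* b)) :+ (q :+ con (+ 1)) :* Q :* d :=
          q :* (q :+ con (+ 1)) :* (r :* (g :* e))
            :+ con (+ 1) :* (g :* (a :+ q :* b) :+ (q :+ con (+ 1)) :* Q :* d :- (q :+ con (+ 1)) :* g :* e)
            :+ (q :* g :* b :* (q :* r :+ con (+ 1)) :- (q :+ con (+ 1)) :* g :* e) :* (q :* r :- con (+ 1)))
          refl q r Q (q ^ dim y) (D (U (U f)) y) (U (U (D f)) y) (U f y) (U (D (U f)) y))))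
        (*-congˡ (sym (U-L (U f) y))))

  δ : ∀ {m} → Fin m → Fin m → Carrier
  δ i j = if does (j Fin.≟ i) then 1# else 0#

  sum-δ : ∀ {m} (a : Fin m → Carrier) i → sum (λ j → a j * δ i j) ≈ a i
  sum-δ a zero    = trans (+-cong (*-identityʳ _) (sum-zero _ λ j → zeroʳ (a (suc j)))) (+-identityʳ _)
  sum-δ a (suc i) = trans (+-cong (zeroʳ _) (sum-δ (a ∘ suc) i)) (+-identityˡ _)

  δ-same : ∀ {m} (i : Fin m) → δ i i ≈ 1#
  δ-same i rewrite dec-true (i Fin.≟ i) ≡.refl = refl

  δ-other : ∀ {m} {i j : Fin m} → j ≢ i → δ i j ≈ 0#
  δ-other {i = i} {j} j≢i rewrite dec-false (j Fin.≟ i) j≢i = refl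

  ⟦⟧-δ : ∀ A y z → ⟦ A ⟧ (δ z) y ≈ ι (A y z)
  ⟦⟧-δ A y z = sum-δ (λ x → ι (A y x)) z

  ⟦⟧-δ-δ : ∀ A y z w → ⟦ A ⟧ (λ x → δ z x - δ w x) y ≈ ι (A y z) - ι (A y w)
  ⟦⟧-δ-δ A y z w = begin
    ⟦ A ⟧ (λ x → δ z x - δ w x) y
      ≈⟨ LinearOn.cong A-linear (λ x _ → solve 2 (λ u v → u :- v := con (+ 1) :* u :+ (:- con (+ 1)) :* v) refl (δ z x) (δ w x)) y tt ⟩
    ⟦ A ⟧ (λ x → 1# * δ z x + (- 1#) * δ w x) y
      ≈⟨ LinearOn.linear A-linear 1# (δ z) (- 1#) (δ w) y tt ⟩
    1# * ⟦ A ⟧ (δ z) y + (- 1#) * ⟦ A ⟧ (δ w) y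
      ≈⟨ +-cong (*-congˡ (⟦⟧-δ A y z)) (*-congˡ (⟦⟧-δ A y w)) ⟩
    1# * ι (A y z) + (- 1#) * ι (A y w)
      ≈⟨ solve 2 (λ u v → con (+ 1) :* u :+ (:- con (+ 1)) :* v := u :- v) refl _ _ ⟩
    ι (A y z) - ι (A y w) ∎
    where
    A-linear : LinearOn Everywhere ⟦ A ⟧
    A-linear = ·ᵛ-linear λ u v → ι (A u v)

  c-zero : ∀ y z → dim y ≢ suc (dim z) → c y z ≡ 0
  c-zero y z dim≢ with covers y z in eq
  ... | false = ≡.refl
  ... | true  = contradiction (covers-dim y z (≡.subst T (≡.sym eq) tt)) dim≢

  joins-zero : ∀ y z → dim y ≢ dim z → ι ((cᵗ ⊙ c) y z) ≈ 0#
  joins-zero y z dim≢ = trans (sym (⟦⟧-δ (cᵗ ⊙ c) y z)) (trans (⟦⟧-⊙ cᵗ c (δ z) y)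
    (D-local (U (δ z)) y λ x x≡ → trans (⟦⟧-δ c x z) (×-congˡ (c-zero x z λ x≡′ →
      dim≢ (ℕ.suc-injective (≡.trans (≡.sym x≡) x≡′))))))

  τ-count : ∀ b d X → d ℕ.+ b ≡ N → q′ ℕ.* X ℕ.+ q′ ℕ.^ (b ℕ.+ M) ≡ X ℕ.+ q′ ℕ.^ (N ℕ.+ M) → ι X ≈ τ d
  τ-count b d X d+b≡N count = modulo (- ι X) (≈⇒-≈0 ω[q-1]≈1) (modulo ω (≈⇒-≈0 count′)
    (modulo (ω * r ^ d) (≈⇒-≈0 powers) (modulo (ω * q ^ (b ℕ.+ M)) (≈⇒-≈0 (q^r^≈1 d))
    (solve 7 (λ q ω Q h s B X → X := ω :* Q :* (con (+ 1) :- s) :+ (:- X) :* (ω :* (q :- con (+ 1)) :- con (+ 1))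
      :+ ω :* (q :* X :+ B :- (X :+ Q)) :+ ω :* s :* (Q :- h :* B) :+ ω :* B :* (h :* s :- con (+ 1)))
      refl q ω Q (q ^ d) (r ^ d) (q ^ (b ℕ.+ M)) (ι X)))))
    where
    count′ : q * ι X + q ^ (b ℕ.+ M) ≈ ι X + Q
    count′ = trans (sym (trans (ι-+ (q′ ℕ.* X) _) (+-cong (ι-* q′ X) (ι-^ q′ (b ℕ.+ M)))))
      (trans (×-congˡ count) (trans (ι-+ X _) (+-congˡ (ι-^ q′ (N ℕ.+ M)))))
    powers : Q ≈ q ^ d * q ^ (b ℕ.+ M)
    powers = trans (^-congʳ q (≡.trans (≡.cong (ℕ._+ M) (≡.sym d+b≡N)) (ℕ.+-assoc d b M))) (^-homo-* q d (b ℕ.+ M))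

  Start : ℕ → ℕ → Set _
  Start b d = ∃ λ (u : Fun) → ∃ λ y₀ → (∀ y → L u y ≈ 0#) × (∀ y → L (U u) y ≈ τ d * u y) ×
    dim y₀ ≡ b × u y₀ ≈ 1# × (∀ z → dim z ℕ.< b → u z ≈ 0#)

  joins-τ : ∀ {b d} → d ℕ.+ b ≡ N → ∀ y → dim y ≡ b → q ^ dim y * ι ((cᵗ ⊙ c) y y) ≈ τ d
  joins-τ {b} {d} d+b≡N y ≡.refl = trans
    (trans (*-congʳ (sym (ι-^ q′ (dim y)))) (sym (ι-* (q′ ℕ.^ dim y) _)))
    (τ-count b d (q′ ℕ.^ dim y ℕ.* (cᵗ ⊙ c) y y) d+b≡N (cover-count y))

  start₀ : ∀ d → d ℕ.+ 0 ≡ N → Start 0 d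
  start₀ d d+0≡N = δ o , o ,
    (λ y → trans (*-congˡ (trans (⟦⟧-δ cᵗ y o) (×-congˡ (c-zero o y λ eq → contradiction (≡.trans (≡.sym dim-o) eq) λ ()))))
      (zeroʳ _)) ,
    (λ y → trans (*-congˡ (trans (sym (⟦⟧-⊙ cᵗ c (δ o) y)) (⟦⟧-δ (cᵗ ⊙ c) y o))) (at y)) ,
    dim-o , δ-same o , λ _ ()
    where
    at : ∀ y → q ^ dim y * ι ((cᵗ ⊙ c) y o) ≈ τ d * δ o y
    at y with y Fin.≟ o
    ... | yes ≡.refl = trans (joins-τ d+0≡N o dim-o) (sym (*-identityʳ _))
    ... | no y≢o = trans (*-congˡ (joins-zero y o λ eq → y≢o (o-unique y (≡.trans eq dim-o))))
      (trans (zeroʳ _) (sym (zeroʳ _)))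

  start₁ : ∀ d → d ℕ.+ 1 ≡ N → Start 1 d
  start₁ d d+1≡N = u , p₁ ,
    (λ y → trans (*-congˡ (trans (⟦⟧-δ-δ cᵗ y p₁ p₂) (≈⇒-≈0 (×-congˡ (p-covers y))))) (zeroʳ _)) ,
    (λ y → trans (*-congˡ (trans (sym (⟦⟧-⊙ cᵗ c u y)) (⟦⟧-δ-δ (cᵗ ⊙ c) y p₁ p₂))) (at y)) ,
    dim-p₁ , trans (+-cong (δ-same p₁) (-‿cong (δ-other p₁≢p₂))) (solve 1 (λ x → x :- con (+ 0) := x) refl 1#) ,
    λ z z<1 → trans (+-cong (δ-other (z≢ p₁ dim-p₁ z<1)) (-‿cong (δ-other (z≢ p₂ dim-p₂ z<1)))) (-‿inverseʳ 0#)
    where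
    u : Fun
    u z = δ p₁ z - δ p₂ z
    z≢ : ∀ {z} p → dim p ≡ 1 → dim z ℕ.< 1 → z ≢ p
    z≢ p dim-p z<1 ≡.refl = ℕ.<-irrefl dim-p z<1
    no-join′ : (cᵗ ⊙ c) p₂ p₁ ≡ 0
    no-join′ = ≡.trans (sum-cong-≗ λ x → ℕ.*-comm (c x p₂) (c x p₁)) no-join
      where open CoverMatrix covers using (sum-cong-≗)
    at : ∀ y → q ^ dim y * (ι ((cᵗ ⊙ c) y p₁) - ι ((cᵗ ⊙ c) y p₂)) ≈ τ d * (δ p₁ y - δ p₂ y)
    at y with dim y ℕ.≟ 1
    ... | no dim≢1 = trans
      (*-congˡ (≈⇒-≈0 (trans (joins-zero y p₁ λ eq → dim≢1 (≡.trans eq dim-p₁))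
        (sym (joins-zero y p₂ λ eq → dim≢1 (≡.trans eq dim-p₂))))))
      (trans (zeroʳ _) (sym (trans (*-congˡ (≈⇒-≈0 (trans (δ-other {i = p₁} {y} λ { ≡.refl → dim≢1 dim-p₁ })
        (sym (δ-other {i = p₂} {y} λ { ≡.refl → dim≢1 dim-p₂ }))))) (zeroʳ _))))
    ... | yes dim≡1 with y Fin.≟ p₁ | y Fin.≟ p₂
    ...   | yes ≡.refl | yes p₁≡p₂ = contradiction p₁≡p₂ p₁≢p₂
    ...   | yes ≡.refl | no _ = trans (*-congˡ (+-congˡ (-‿cong (×-congˡ no-join))))
      (trans (solve 2 (λ a b → a :* (b :- con (+ 0)) := a :* b) refl _ _)
      (trans (joins-τ d+1≡N p₁ dim-p₁) (solve 1 (λ a → a := a :* (con (+ 1) :- con (+ 0))) refl (τ d))))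
    ...   | no _ | yes ≡.refl = trans (*-congˡ (+-congʳ (×-congˡ no-join′)))
      (trans (solve 2 (λ a b → a :* (con (+ 0) :- b) := :- (a :* b)) refl _ _)
      (trans (-‿cong (joins-τ d+1≡N p₂ dim-p₂)) (solve 1 (λ a → :- a := a :* (con (+ 0) :- con (+ 1))) refl (τ d))))
    ...   | no y≢p₁ | no y≢p₂ = trans (*-congˡ (≈⇒-≈0 (×-congˡ (same-joins y dim≡1 y≢p₁ y≢p₂))))
      (solve 2 (λ a b → a :* con (+ 0) := b :* (con (+ 0) :- con (+ 0))) refl _ _)

  startVector : ∀ b d → b ℕ.≤ 1 → d ℕ.+ b ≡ N → Start b d
  startVector zero          d _ eq = start₀ d eq
  startVector (suc zero)    d _ eq = start₁ d eq
  startVector (suc (suc b)) d (ℕ.s≤s ()) _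

  inverses : ∀ b d → d ℕ.+ b ≡ N → ℕ → Carrier
  inverses b d eq j with j ℕ.<? d
  ... | yes j<d = proj₁ (α[τ-τ]-invertible b d eq j j<d)
  ... | no  _   = 0#

  inverses-correct : ∀ b d eq j → j ℕ.< d → α j * (τ d + - τ j) * inverses b d eq j ≈ 1#
  inverses-correct b d eq j j<d with j ℕ.<? d
  ... | yes j<d′ = proj₂ (α[τ-τ]-invertible b d eq j j<d′)
  ... | no  j≮d  = contradiction j<d j≮d

  Φ-eigenvector : ∀ b x y → Valid b x y →
    ∃ λ y₀ → ∃ λ w → w y₀ ≈ 1# × (∀ z → U w z + L w z ≈ Φ b (suc x) (suc y) * w z)
  Φ-eigenvector b x y (b≤1 , eq) =
    let d+b≡N = ≡.trans (≡.cong (ℕ._+ b) (ℕ.+-comm y x)) eq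
        (u , y₀ , Lu≈0 , LUu≈ , dim-y₀ , u-y₀ , support) = startVector b (y ℕ.+ x) b≤1 d+b≡N
    in y₀ , ChainEigenvector.eigenvector K parameters (Fin n) dim N dim≤N pair u (y ℕ.+ x) b y₀
      Lu≈0 LUu≈ dim-y₀ u-y₀ support (ℕ.≤-reflexive (≡.trans (≡.sym d+b≡N) (ℕ.+-comm (y ℕ.+ x) b)))
      (inverses b (y ℕ.+ x) d+b≡N) (inverses-correct b (y ℕ.+ x) d+b≡N)
      (Φ b (suc x) (suc y)) (Φ-characteristic b x y eq)

  not-eigenvalue : ∀ μ → (∀ b x y → Valid b x y → Cancellable (μ - Φ b (suc x) (suc y))) →
    ∀ v → (∀ y → U v y + L v y ≈ μ * v y) → ∀ y → v y ≈ 0#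
  not-eigenvalue μ apart = Exhaustion.eigenvector-zero pair
    (λ i j i≢j → Invertible⇒Cancellable (r-distinct i j i≢j)) Q-cancellable μ (continuant-nonzero μ apart)

module QPolynomial {k ℓk} (K : CommutativeRing k ℓk) (F : Characteristic0.FieldLike K)
  (q′ : ℕ) (2≤q : 2 ℕ.≤ q′) (N M : ℕ) (t : CommutativeRing.Carrier K)
  (t²≈q : CommutativeRing._≈_ K (CommutativeRing._*_ K t t) (Characteristic0.ι K q′))
  {n : ℕ} (dim : Fin n → ℕ) (covers : Fin n → Fin n → Bool)
  (comb : Combinatorics q′ N M dim covers) where

  open CommutativeRing K hiding (zero)
  open IntegerSolver K
  open RingLemmas K
  open Characteristic0 K
  open FieldLike F
  open Labels K F q′ 2≤q N M t t²≈q hiding (scale)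
  open Parameters parameters
  open Combinatorics comb
  open CoverMatrix covers using (c)
  open Matrices K hiding (θ)
  open CoverOperators K F q′ 2≤q N M t t²≈q dim covers comb using (U; L; sum-zero; sum-linear)
  open CoverEigenvectors K F q′ 2≤q N M t t²≈q dim covers comb
    using (pair; δ; sum-δ; δ-same; δ-other; Φ-eigenvector; not-eigenvalue)
  open import Algebra.Properties.Semiring.Sum semiring using (sum; sum-cong-≋)
  open import Algebra.Properties.Semiring.Exp semiring using (_^_)
  open import Relation.Binary.Reasoning.Setoid setoid

  adjacency : Matrix n
  adjacency y z =
    if covers y z then 1# else
    if covers z y then ι (q′ ℕ.^ dim y) else
    0#

  dualIdempotent : Fin (suc N) → Matrix n
  dualIdempotent i y z = if does (y Fin.≟ z) ∧ does (dim y ℕ.≟ toℕ i) then 1# else 0#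

  adjacency-entry : ∀ y z → adjacency y z ≈ 1# * ι (c y z) + q ^ dim y * ι (c z y)
  adjacency-entry y z with covers y z in yz | covers z y in zy
  ... | true  | true  = contradiction
    (≡.trans (covers-dim y z (≡.subst T (≡.sym yz) tt)) (≡.cong suc (covers-dim z y (≡.subst T (≡.sym zy) tt))))
    (ℕ.<⇒≢ (ℕ.m<n⇒m<1+n ℕ.≤-refl))
  ... | true  | false = solve 1 (λ g → con (+ 1) := con (+ 1) :* (con (+ 1) :+ con (+ 0)) :+ g :* con (+ 0)) refl (q ^ dim y)
  ... | false | true  = trans (ι-^ q′ (dim y))
    (solve 1 (λ g → g := con (+ 1) :* con (+ 0) :+ g :* (con (+ 1) :+ con (+ 0))) refl (q ^ dim y))
  ... | false | false = solve 1 (λ g → con (+ 0) := con (+ 1) :* con (+ 0) :+ g :* con (+ 0)) refl (q ^ dim y)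

  adjacency-·ᵛ : ∀ v y → (adjacency ·ᵛ v) y ≈ U v y + L v y
  adjacency-·ᵛ v y = trans
    (sum-cong-≋ λ z → trans (*-congʳ (adjacency-entry y z))
      (solve 4 (λ a g b v → (con (+ 1) :* a :+ g :* b) :* v := con (+ 1) :* (a :* v) :+ g :* (b :* v))
        refl (ι (c y z)) (q ^ dim y) (ι (c z y)) (v z)))
    (trans (sum-linear 1# (λ z → ι (c y z) * v z) (q ^ dim y) (λ z → ι (c z y) * v z)) (+-congʳ (*-identityˡ _)))

  D′ : ℕ
  D′ = 2 ℕ.* N

  -- The position of Φ b (x + 1) (y + 1) in the ordering.
  index : ℕ → ℕ → ℕ
  index b y = b ℕ.* suc N ℕ.+ y

  θ′ : ℕ → Carrier
  θ′ m with m ℕ.≤? N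
  ... | yes _ = Φ 0 (suc (N ℕ.∸ m)) (suc m)
  ... | no  _ = Φ 1 (suc (N ℕ.∸ suc (m ℕ.∸ suc N))) (suc (m ℕ.∸ suc N))

  Labelled : ℕ → Set k
  Labelled m = ∃ λ b → ∃ λ x → ∃ λ y → Valid b x y × m ≡ index b y × θ′ m ≡ Φ b (suc x) (suc y)

  label : ∀ m → m ℕ.< suc D′ → Labelled m
  label m m<D with m ℕ.≤? N
  ... | yes m≤N = 0 , N ℕ.∸ m , m ,
    (ℕ.z≤n , ≡.trans (ℕ.+-identityʳ _) (ℕ.m∸n+n≡m m≤N)) , ≡.refl , ≡.refl
  ... | no m≰N = 1 , N ℕ.∸ suc y , y ,
    (ℕ.≤-refl , ≡.trans (ℕ.+-assoc _ y 1) (≡.trans (≡.cong (λ z → N ℕ.∸ suc y ℕ.+ z) (ℕ.+-comm y 1)) (ℕ.m∸n+n≡m y<N))) ,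
    ≡.sym (≡.trans (≡.cong (ℕ._+ y) (ℕ.+-identityʳ (suc N))) eq) , ≡.refl
    where
    y : ℕ
    y = m ℕ.∸ suc N
    eq : suc N ℕ.+ y ≡ m
    eq = ℕ.m+[n∸m]≡n (ℕ.≰⇒> m≰N)
    y<N : y ℕ.< N
    y<N = ℕ.+-cancelˡ-< (suc N) y N (≡.subst₂ ℕ._<_ (≡.sym eq)
      (≡.cong (λ z → suc (N ℕ.+ z)) (ℕ.+-identityʳ N)) m<D)

  θ′-index : ∀ b x y → Valid b x y → θ′ (index b y) ≡ Φ b (suc x) (suc y)
  θ′-index zero x y (_ , eq) with y ℕ.≤? N
  ... | yes _   = ≡.cong (λ z → Φ 0 (suc z) (suc y))
    (≡.trans (≡.cong (ℕ._∸ y) (≡.sym (≡.trans (≡.sym (ℕ.+-identityʳ _)) eq))) (ℕ.m+n∸n≡m x y))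
  ... | no y≰N = contradiction (≡.subst (y ℕ.≤_) (≡.trans (≡.sym (ℕ.+-identityʳ _)) eq) (ℕ.m≤n+m y x)) y≰N
  θ′-index (suc zero) x y (_ , eq) with index 1 y ℕ.≤? N
  ... | yes i≤N = contradiction (ℕ.≤-trans (ℕ.≤-trans (ℕ.m≤m+n (suc N) 0) (ℕ.m≤m+n _ y)) i≤N) (ℕ.<-irrefl ≡.refl)
  ... | no  _   = ≡.cong₂ (λ u v → Φ 1 (suc u) (suc v))
    (≡.trans (≡.cong (λ z → N ℕ.∸ suc z) y≡)
      (≡.trans (≡.cong (ℕ._∸ suc y) (≡.sym (≡.trans (ℕ.+-suc x y) (≡.trans (ℕ.+-comm 1 _) eq)))) (ℕ.m+n∸n≡m x (suc y)))) y≡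
    where
    y≡ : index 1 y ℕ.∸ suc N ≡ y
    y≡ = ≡.trans (≡.cong (λ z → z ℕ.+ y ℕ.∸ suc N) (ℕ.+-identityʳ (suc N))) (ℕ.m+n∸m≡n (suc N) y)
  θ′-index (suc (suc b)) x y (ℕ.s≤s () , _)

  index-< : ∀ b x y → Valid b x y → index b y ℕ.< suc D′
  index-< zero x y (_ , eq) = ℕ.s≤s (ℕ.≤-trans
    (≡.subst (y ℕ.≤_) (≡.trans (≡.sym (ℕ.+-identityʳ _)) eq) (ℕ.m≤n+m y x)) (ℕ.m≤m+n N _))
  index-< (suc zero) x y (_ , eq) = ℕ.s≤s (≡.subst₂ ℕ._≤_
    (≡.trans (ℕ.+-suc N y) (≡.cong (ℕ._+ y) (≡.sym (ℕ.+-identityʳ (suc N)))))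
    (≡.cong (λ z → N ℕ.+ z) (≡.sym (ℕ.+-identityʳ N)))
    (ℕ.+-monoʳ-≤ N (≡.subst (suc y ℕ.≤_) (≡.trans (ℕ.+-suc x y) (≡.trans (ℕ.+-comm 1 _) eq)) (ℕ.m≤n+m (suc y) x))))
  index-< (suc (suc b)) x y (ℕ.s≤s () , _)

  labels-apart : ∀ {b x y b′ x′ y′} → Valid b x y → Valid b′ x′ y′ → index b y ≢ index b′ y′ →
    Invertible (Φ b (suc x) (suc y) - Φ b′ (suc x′) (suc y′))
  labels-apart {b} {x} {y} {b′} {x′} {y′} (b≤1 , eq) (b′≤1 , eq′) i≢i′ =
    difference b (suc x) (suc y) b′ (suc x′) (suc y′) b≤1 b′≤1
      (≡.trans (shift x y b) (≡.trans (≡.cong (λ z → suc (suc z)) (≡.trans eq (≡.sym eq′))) (≡.sym (shift x′ y′ b′))))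
      λ { ≡.refl y≡y′ → i≢i′ (≡.cong (index b) (ℕ.suc-injective y≡y′)) }
    where
    shift : ∀ x y b → suc x ℕ.+ suc y ℕ.+ b ≡ suc (suc (x ℕ.+ y ℕ.+ b))
    shift x y b = ≡.cong (λ z → suc (z ℕ.+ b)) (ℕ.+-suc x y)

  θ : Fin (suc D′) → Carrier
  θ i = θ′ (toℕ i)

  θ-apart : ∀ i j → i ≢ j → Invertible (θ i - θ j)
  θ-apart i j i≢j =
    let (b , x , y , valid , i≡ , θi≡) = label (toℕ i) (Fin.toℕ<n i)
        (b′ , x′ , y′ , valid′ , j≡ , θj≡) = label (toℕ j) (Fin.toℕ<n j)
    in Invertible-resp (+-cong (reflexive (≡.sym θi≡)) (-‿cong (reflexive (≡.sym θj≡))))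
         (labels-apart valid valid′ λ eq → i≢j (Fin.toℕ-injective (≡.trans i≡ (≡.trans eq (≡.sym j≡)))))

  tournament : ∀ m (ϑ : Fin (suc m) → Carrier) → (∀ i j → i ≢ j → Invertible (ϑ i - ϑ j)) → ∀ μ →
    ∃ λ i → ∀ j → j ≢ i → Cancellable (μ - ϑ j)
  tournament zero    ϑ apart μ = zero , λ { zero 0≢0 → contradiction ≡.refl 0≢0 }
  tournament (suc m) ϑ apart μ with tournament m (ϑ ∘ suc) (λ i j i≢j → apart (suc i) (suc j) (i≢j ∘ Fin.suc-injective)) μ
  ... | i , others with apart zero (suc i) (λ ())
  ...   | w , inverse with local ((μ - ϑ (suc i)) * w) ((ϑ zero - μ) * w)
    (trans (solve 4 (λ m a b w → (m :- b) :* w :+ (a :- m) :* w := (a :- b) :* w) refl μ (ϑ zero) (ϑ (suc i)) w) inverse)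
  ...     | inj₁ canc = zero , λ where
    zero    0≢0 → contradiction ≡.refl 0≢0
    (suc j) _   → case j Fin.≟ i of λ where
      (yes ≡.refl) → Cancellable-factorˡ w canc
      (no j≢i)     → others j j≢i
  ...     | inj₂ canc = suc i , λ where
    zero    _     → Cancellable-resp (solve 2 (λ m a → :- (a :- m) := m :- a) refl μ (ϑ zero))
      (Cancellable-neg (Cancellable-factorˡ w canc))
    (suc j) j≢i → others j (j≢i ∘ ≡.cong suc)

  no-eigenvector : ∀ μ → (∀ i → Cancellable (μ - θ i)) → ∀ v → Eigenspace adjacency μ v → v ≈ᵛ 0ᵛ
  no-eigenvector μ apart v eigen = not-eigenvalue μ
    (λ b x y valid → Cancellable-resp
      (+-congˡ (-‿cong (reflexive (≡.trans (≡.cong θ′ (Fin.toℕ-fromℕ< (index-< b x y valid))) (θ′-index b x y valid)))))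
      (apart (fromℕ< (index-< b x y valid))))
    v (λ y → trans (sym (adjacency-·ᵛ v y)) (eigen y))

  ordering : EigenspaceOrdering adjacency D′
  ordering = record
    { θ = θ
    ; eigenvalue = λ i →
        let (b , x , y , valid , _ , θ≡) = label (toℕ i) (Fin.toℕ<n i)
            (y₀ , w , w≈1 , eigen) = Φ-eigenvector b x y valid
        in w , (λ w≈0 → nontrivial (trans (sym w≈1) (w≈0 y₀))) ,
           λ z → trans (adjacency-·ᵛ w z) (trans (eigen z) (*-congʳ (reflexive (≡.sym θ≡))))
    ; distinct = λ i j θi≈θj → case i Fin.≟ j of λ where
        (yes i≡j) → i≡j
        (no i≢j)  → contradiction
          (trans (sym (proj₂ (θ-apart i j i≢j))) (trans (*-congʳ (≈⇒-≈0 θi≈θj)) (zeroˡ _))) nontrivial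
    ; exhaustive = λ μ (v , v≉0 , eigen) →
        let (i , others) = tournament D′ θ θ-apart μ
        in i , -≈0⇒≈ (tight (μ - θ i) λ canc → v≉0 (no-eigenvector μ
          (λ j → case j Fin.≟ i of λ { (yes ≡.refl) → canc ; (no j≢i) → others j j≢i }) v eigen))
    }

  diagonal : (Fin n → Carrier) → Matrix n
  diagonal a y z = if does (y Fin.≟ z) then a y else 0#

  diagonal≈δ : ∀ a y z → diagonal a y z ≈ a y * δ y z
  diagonal≈δ a y z with y Fin.≟ z
  ... | yes ≡.refl = trans (sym (*-identityʳ _)) (*-congˡ (sym (δ-same y)))
  ... | no y≢z     = trans (sym (zeroʳ _)) (*-congˡ (sym (δ-other (y≢z ∘ ≡.sym))))

  diagonal-cong : ∀ {a b : Fin n → Carrier} → (∀ y → a y ≈ b y) → diagonal a ≈ᵐ diagonal b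
  diagonal-cong a≈b y z with does (y Fin.≟ z)
  ... | true  = a≈b y
  ... | false = refl

  diagonal-·ᵛ : ∀ a v y → (diagonal a ·ᵛ v) y ≈ a y * v y
  diagonal-·ᵛ a v y = trans
    (sum-cong-≋ λ z → trans (*-congʳ (diagonal≈δ a y z))
      (solve 3 (λ a d v → a :* d :* v := a :* v :* d) refl (a y) (δ y z) (v z)))
    (sum-δ (λ z → a y * v z) y)

  diagonal-· : ∀ a b → diagonal a · diagonal b ≈ᵐ diagonal (λ y → a y * b y)
  diagonal-· a b y z = trans (diagonal-·ᵛ a (λ x → diagonal b x z) y) (trans (*-congˡ (diagonal≈δ b y z))
    (trans (sym (*-assoc _ _ _)) (sym (diagonal≈δ (λ y → a y * b y) y z))))

  diagonal-+ : ∀ a b → diagonal a +ᵐ diagonal b ≈ᵐ diagonal (λ y → a y + b y)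
  diagonal-+ a b y z with does (y Fin.≟ z)
  ... | true  = refl
  ... | false = +-identityˡ 0#

  diagonal-* : ∀ a b → a *ᵐ diagonal b ≈ᵐ diagonal (λ y → a * b y)
  diagonal-* a b y z with does (y Fin.≟ z)
  ... | true  = refl
  ... | false = zeroʳ a

  dualAdjacency : Matrix n
  dualAdjacency = diagonal λ y → r ^ dim y

  module _ (O : EigenspaceOrdering adjacency D′) where

    V⟨⟩-zero : ∀ j v → v ≈ᵛ 0ᵛ → V⟨ O ⟩ j v
    V⟨⟩-zero -[1+ _ ] v v≈0 = v≈0
    V⟨⟩-zero (+ j)    v v≈0 with j ℕ.<? suc D′
    ... | yes _ = λ y → trans (sum-zero (λ z → adjacency y z * v z) λ z → trans (*-congˡ (v≈0 z)) (zeroʳ _)) (sym (trans (*-congˡ (v≈0 y)) (zeroʳ _)))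
    ... | no  _ = v≈0

  V⟨⟩-eigen : ∀ b x y → Valid b x y → ∀ v → (∀ z → U v z + L v z ≈ Φ b (suc x) (suc y) * v z) →
              V⟨ ordering ⟩ (+ index b y) v
  V⟨⟩-eigen b x y valid v eigen with index b y ℕ.<? suc D′
  ... | yes i<D = λ z → trans (adjacency-·ᵛ v z) (trans (eigen z)
    (*-congʳ (reflexive (≡.sym (≡.trans (≡.cong θ′ (Fin.toℕ-fromℕ< i<D)) (θ′-index b x y valid))))))
  ... | no  i≮D = contradiction (index-< b x y valid) i≮D

  end-not-eigenvalue : ∀ b x y → b ℕ.≤ 1 → x ℕ.+ y ℕ.+ b ≡ suc (suc N) → x ≡ 0 ⊎ y ≡ 0 →
    ∀ v → (∀ z → U v z + L v z ≈ Φ b x y * v z) → v ≈ᵛ 0ᵛ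
  end-not-eigenvalue b x y b≤1 eq end = not-eigenvalue (Φ b x y) λ b′ x′ y′ (b′≤1 , eq′) →
    Invertible⇒Cancellable (difference b x y b′ (suc x′) (suc y′) b≤1 b′≤1
      (total b′ x′ y′ eq′) λ { ≡.refl → different x′ y′ (ℕ.+-cancelʳ-≡ b _ _ (total b x′ y′ eq′)) end })
    where
    total : ∀ b′ x′ y′ → x′ ℕ.+ y′ ℕ.+ b′ ≡ N → x ℕ.+ y ℕ.+ b ≡ suc x′ ℕ.+ suc y′ ℕ.+ b′
    total b′ x′ y′ eq′ = ≡.trans eq (≡.sym (≡.trans (≡.cong (λ z → suc (z ℕ.+ b′)) (ℕ.+-suc x′ y′))
      (≡.cong (λ z → suc (suc z)) eq′)))
    different : ∀ x′ y′ → x ℕ.+ y ≡ suc x′ ℕ.+ suc y′ → x ≡ 0 ⊎ y ≡ 0 → y ≢ suc y′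
    different x′ y′ sum (inj₁ ≡.refl) y≡ = ℕ.m≢1+n+m (suc y′) (≡.trans (≡.sym y≡) sum)
    different x′ y′ sum (inj₂ ≡.refl) ()

  below : ∀ b x y → Valid b x y → ∀ v → (∀ z → U v z + L v z ≈ Φ b (suc (suc x)) y * v z) →
          V⟨ ordering ⟩ (ℤ.pred (+ index b y)) v
  below b x zero (b≤1 , eq) v eigen = V⟨⟩-zero ordering (ℤ.pred (+ index b 0)) v
    (end-not-eigenvalue b (suc (suc x)) 0 b≤1 (≡.cong (λ z → suc (suc z)) eq) (inj₂ ≡.refl) v eigen)
  below b x (suc y) (b≤1 , eq) v eigen = ≡.subst (λ j → V⟨ ordering ⟩ (ℤ.pred (+ j)) v)
    (≡.sym (ℕ.+-suc (b ℕ.* suc N) y))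
    (V⟨⟩-eigen b (suc x) y (b≤1 , ≡.trans (≡.cong (ℕ._+ b) (≡.sym (ℕ.+-suc x y))) eq) v eigen)

  above : ∀ b x y → Valid b x y → ∀ v → (∀ z → U v z + L v z ≈ Φ b x (suc (suc y)) * v z) →
          V⟨ ordering ⟩ (ℤ.suc (+ index b y)) v
  above b zero y (b≤1 , eq) v eigen = V⟨⟩-zero ordering (ℤ.suc (+ index b y)) v
    (end-not-eigenvalue b 0 (suc (suc y)) b≤1 (≡.cong (λ z → suc (suc z)) eq) (inj₁ ≡.refl) v eigen)
  above b (suc x) y (b≤1 , eq) v eigen = ≡.subst (λ j → V⟨ ordering ⟩ (+ j) v)
    (ℕ.+-suc (b ℕ.* suc N) y)
    (V⟨⟩-eigen b x (suc y) (b≤1 , ≡.trans (≡.cong (ℕ._+ b) (ℕ.+-suc x y)) eq) v eigen)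

  tridiagonal-at : ∀ i v → V ordering i v →
    (V⟨ ordering ⟩ (ℤ.pred (+ toℕ i)) ⊞ V ordering i ⊞ V⟨ ordering ⟩ (ℤ.suc (+ toℕ i))) (dualAdjacency ·ᵛ v)
  tridiagonal-at i v v∈V =
    let (b , x , y , valid@(b≤1 , total) , i≡ , θ≡) = label (toℕ i) (Fin.toℕ<n i)
        eigen = λ z → trans (sym (adjacency-·ᵛ v z)) (trans (v∈V z) (*-congʳ (reflexive θ≡)))
        (u , w , z , Au , Aw , Az , eq) = Tridiagonal.B-decomposition K parameters (Fin n) dim N dim≤N pair
          eigen (neighbour-sum b x y) (neighbour-product b x y total) (apart b x y total b≤1)
    in (λ p → u p + w p) , z ,
       (u , w , ≡.subst (λ j → V⟨ ordering ⟩ (ℤ.pred (+ j)) u) (≡.sym i≡) (below b x y valid u Au) ,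
         (λ p → trans (adjacency-·ᵛ w p) (trans (Aw p) (*-congʳ (reflexive (≡.sym θ≡))))) ,
         λ p → refl) ,
       ≡.subst (λ j → V⟨ ordering ⟩ (ℤ.suc (+ j)) z) (≡.sym i≡) (above b x y valid z Az) ,
       λ p → trans (diagonal-·ᵛ (λ p → r ^ dim p) v p) (eq p)
    where
    apart : ∀ b x y → x ℕ.+ y ℕ.+ b ≡ N → b ℕ.≤ 1 → Invertible
      ((Φ b (suc (suc x)) y - Φ b (suc x) (suc y)) * (Φ b x (suc (suc y)) - Φ b (suc x) (suc y)) *
       (Φ b (suc (suc x)) y - Φ b x (suc (suc y))))
    apart b x y total b≤1 = Invertible-* (Invertible-*
      (difference b (suc (suc x)) y b (suc x) (suc y) b≤1 b≤1
        (≡.cong (ℕ._+ b) (≡.sym (≡.cong suc (ℕ.+-suc x y)))) λ _ → ℕ.m≢1+n+m y {0})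
      (difference b x (suc (suc y)) b (suc x) (suc y) b≤1 b≤1
        (≡.cong (ℕ._+ b) (ℕ.+-suc x (suc y))) λ _ eq → ℕ.m≢1+n+m (suc y) {0} (≡.sym eq)))
      (difference b (suc (suc x)) y b x (suc (suc y)) b≤1 b≤1
        (≡.cong (ℕ._+ b) (≡.sym (≡.trans (ℕ.+-suc x (suc y)) (≡.cong suc (ℕ.+-suc x y))))) λ _ → ℕ.m≢1+n+m y {1})

  generated-diagonal : (ℕ → Carrier) → Set _
  generated-diagonal a = Generated dualAdjacency (diagonal (a ∘ dim))

  private
    lagrange-term : ℕ → ℕ → ℕ → Carrier
    lagrange-term i j d with j ℕ.≟ i
    ... | yes _   = 1#
    ... | no  j≢i = proj₁ (r-distinct i j (j≢i ∘ ≡.sym)) * (r ^ d + (- r ^ j) * 1#)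

    lagrange : ℕ → ℕ → ℕ → Carrier
    lagrange i zero    d = 1#
    lagrange i (suc j) d = lagrange-term i j d * lagrange i j d

    generated-one : generated-diagonal (λ _ → 1#)
    generated-one = one

    generated-term : ∀ i j → generated-diagonal (lagrange-term i j)
    generated-term i j with j ℕ.≟ i
    ... | yes _ = generated-one
    ... | no  _ = resp (diagonal-* _ _) (scale _ (resp (diagonal-+ _ _)
      (add generator (resp (diagonal-* _ _) (scale (- r ^ j) generated-one)))))

    generated-lagrange : ∀ i j → generated-diagonal (lagrange i j)
    generated-lagrange i zero    = generated-one
    generated-lagrange i (suc j) = resp (diagonal-· _ _) (mul (generated-term i j) (generated-lagrange i j))

    lagrange-one : ∀ i j → lagrange i j i ≈ 1#
    lagrange-one i zero    = refl
    lagrange-one i (suc j) = trans (*-cong (term-one j) (lagrange-one i j)) (*-identityˡ 1#)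
      where
      term-one : ∀ j → lagrange-term i j i ≈ 1#
      term-one j with j ℕ.≟ i
      ... | yes _   = refl
      ... | no  j≢i = trans (solve 3 (λ w a b → w :* (a :+ (:- b) :* con (+ 1)) := (a :- b) :* w) refl _ (r ^ i) (r ^ j))
        (proj₂ (r-distinct i j (j≢i ∘ ≡.sym)))

    lagrange-zero : ∀ i j d → d ℕ.< j → d ≢ i → lagrange i j d ≈ 0#
    lagrange-zero i (suc j) d d≤j d≢i with j ℕ.≟ d
    ... | yes ≡.refl = trans (*-congʳ term-zero) (zeroˡ _)
      where
      term-zero : lagrange-term i j j ≈ 0#
      term-zero with j ℕ.≟ i
      ... | yes j≡i = contradiction j≡i d≢i
      ... | no  _   = solve 2 (λ w a → w :* (a :+ (:- a) :* con (+ 1)) := con (+ 0)) refl _ (r ^ j)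
    ... | no j≢d = trans (*-congˡ (lagrange-zero i j d (ℕ.≤∧≢⇒< (ℕ.s≤s⁻¹ d≤j) (j≢d ∘ ≡.sym)) d≢i)) (zeroʳ _)

  private
    if-yes : ∀ {d i} → d ≡ i → (if does (d ℕ.≟ i) then 1# else 0#) ≡ 1#
    if-yes {d} {i} eq = ≡.cong (λ b → if b then 1# else 0#) (dec-true (d ℕ.≟ i) eq)

    if-no : ∀ {d i} → d ≢ i → (if does (d ℕ.≟ i) then 1# else 0#) ≡ 0#
    if-no {d} {i} neq = ≡.cong (λ b → if b then 1# else 0#) (dec-false (d ℕ.≟ i) neq)

  dualIdempotent≈diagonal : ∀ i → diagonal (λ y → if does (dim y ℕ.≟ toℕ i) then 1# else 0#) ≈ᵐ dualIdempotent i
  dualIdempotent≈diagonal i y z with does (y Fin.≟ z)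
  ... | true  = refl
  ... | false = refl

  generated-dualIdempotent : ∀ i → Generated dualAdjacency (dualIdempotent i)
  generated-dualIdempotent i = resp (λ y z → trans (diagonal-cong at y z) (dualIdempotent≈diagonal i y z))
    (generated-lagrange (toℕ i) (suc N))
    where
    at : ∀ y → lagrange (toℕ i) (suc N) (dim y) ≈ (if does (dim y ℕ.≟ toℕ i) then 1# else 0#)
    at y with dim y ℕ.≟ toℕ i
    ... | yes eq = trans (reflexive (≡.cong (lagrange (toℕ i) (suc N)) eq))
      (trans (lagrange-one (toℕ i) (suc N)) (reflexive (≡.sym (if-yes eq))))
    ... | no dim≢i = trans (lagrange-zero (toℕ i) (suc N) (dim y) (ℕ.s≤s (dim≤N y)) dim≢i)
      (reflexive (≡.sym (if-no dim≢i)))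

  generated-sum : ∀ {m} (E : Fin m → Matrix n) → (∀ i → Generated dualAdjacency (E i)) → ∀ (a : Fin m → Carrier) →
    Generated dualAdjacency (λ y z → sum λ i → a i * E i y z)
  generated-sum {zero}  E gen a = resp (λ y z → zeroˡ _) (scale 0# one)
  generated-sum {suc m} E gen a = add (scale (a zero) (gen zero)) (generated-sum (E ∘ suc) (gen ∘ suc) (a ∘ suc))

  diagonal-span : ∀ (a : ℕ → Carrier) → diagonal (a ∘ dim) ≈ᵐ λ y z → sum λ i → a (toℕ i) * dualIdempotent i y z
  diagonal-span a y z with does (y Fin.≟ z)
  ... | false = sym (sum-zero {suc N} (λ i → a (toℕ i) * 0#) λ i → zeroʳ (a (toℕ i)))
  ... | true  = sym (trans (sum-cong-≋ λ i → *-congˡ {a (toℕ i)} (same i)) (trans (sum-δ (a ∘ toℕ) d)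
      (reflexive (≡.cong a (Fin.toℕ-fromℕ< (ℕ.s≤s (dim≤N y)))))))
    where
    d : Fin (suc N)
    d = fromℕ< (ℕ.s≤s (dim≤N y))
    same : ∀ i → (if does (dim y ℕ.≟ toℕ i) then 1# else 0#) ≈ δ d i
    same i with dim y ℕ.≟ toℕ i
    ... | yes eq = trans (reflexive (if-yes eq)) (trans (sym (δ-same d)) (reflexive (≡.cong (δ d)
      (Fin.toℕ-injective (≡.trans (Fin.toℕ-fromℕ< (ℕ.s≤s (dim≤N y))) eq)))))
    ... | no neq = trans (reflexive (if-no neq)) (sym (δ-other {i = d} {i} λ { ≡.refl → neq (≡.sym (Fin.toℕ-fromℕ< (ℕ.s≤s (dim≤N y)))) }))

  generated⇒diagonal : ∀ {C} → Generated dualAdjacency C → ∃ λ (a : ℕ → Carrier) → C ≈ᵐ diagonal (a ∘ dim)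
  generated⇒diagonal generator = (r ^_) , λ y z → refl
  generated⇒diagonal one = (λ _ → 1#) , λ y z → refl
  generated⇒diagonal (add C D) =
    let (a , C≈) = generated⇒diagonal C
        (b , D≈) = generated⇒diagonal D
    in (λ d → a d + b d) , λ y z → trans (+-cong (C≈ y z) (D≈ y z)) (diagonal-+ (a ∘ dim) (b ∘ dim) y z)
  generated⇒diagonal (scale x C) = let (a , C≈) = generated⇒diagonal C in
    (λ d → x * a d) , λ y z → trans (*-congˡ (C≈ y z)) (diagonal-* x (a ∘ dim) y z)
  generated⇒diagonal (mul C D) =
    let (a , C≈) = generated⇒diagonal C
        (b , D≈) = generated⇒diagonal D
    in (λ d → a d * b d) , λ y z → trans (sum-cong-≋ λ x → *-cong (C≈ y x) (D≈ x z)) (diagonal-· (a ∘ dim) (b ∘ dim) y z)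
  generated⇒diagonal (resp C≈D C) = let (a , C≈) = generated⇒diagonal C in
    a , λ y z → trans (sym (C≈D y z)) (C≈ y z)

  qPolynomial : ∃ λ (O : EigenspaceOrdering adjacency D′) → IsQPolynomialOrdering dualIdempotent O
  qPolynomial = ordering , dualAdjacency , record
    { generates = λ C → mk⇔
        (λ gen → let (a , C≈) = generated⇒diagonal gen in
          a ∘ toℕ , λ y z → trans (C≈ y z) (diagonal-span a y z))
        (λ (a , C≈) → resp (λ y z → sym (C≈ y z)) (generated-sum dualIdempotent generated-dualIdempotent a))
    ; tridiagonal = tridiagonal-at }

-- Counting subspaces

module Counting where
  open import Algebra.Properties.Semiring.Sum ℕ.+-*-semiring public
    using (sum; ∑-comm; ∑-distrib-+; sum-cong-≗; sum-replicate-zero; *-distribˡ-sum; *-distribʳ-sum)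

  ⟨_⟩ : ∀ {p} {P : Set p} → Dec P → ℕ
  ⟨ P? ⟩ = if does P? then 1 else 0

  ⟨⟩-yes : ∀ {p} {P : Set p} (P? : Dec P) → P → ⟨ P? ⟩ ≡ 1
  ⟨⟩-yes P? p = ≡.cong (λ b → if b then 1 else 0) (dec-true P? p)

  ⟨⟩-no : ∀ {p} {P : Set p} (P? : Dec P) → ¬ P → ⟨ P? ⟩ ≡ 0
  ⟨⟩-no P? ¬p = ≡.cong (λ b → if b then 1 else 0) (dec-false P? ¬p)

  ⟨⟩-cong : ∀ {p r} {P : Set p} {R : Set r} (P? : Dec P) (R? : Dec R) → (P → R) → (R → P) → ⟨ P? ⟩ ≡ ⟨ R? ⟩
  ⟨⟩-cong (yes p) R? f g = ≡.sym (⟨⟩-yes R? (f p))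
  ⟨⟩-cong (no ¬p) R? f g = ≡.sym (⟨⟩-no R? (¬p ∘ g))

  ⟨⟩-≤ : ∀ {p r} {P : Set p} {R : Set r} (P? : Dec P) (R? : Dec R) → (P → R) → ⟨ P? ⟩ ℕ.≤ ⟨ R? ⟩
  ⟨⟩-≤ (yes p) R? f = ℕ.≤-reflexive (≡.sym (⟨⟩-yes R? (f p)))
  ⟨⟩-≤ (no ¬p) R? f = ℕ.z≤n

  ⟨⟩-*-zero : ∀ {p} {P : Set p} (P? : Dec P) {x} → (P → x ≡ 0) → ⟨ P? ⟩ ℕ.* x ≡ 0
  ⟨⟩-*-zero (yes p) x≡0 = ≡.trans (ℕ.+-identityʳ _) (x≡0 p)
  ⟨⟩-*-zero (no ¬p) x≡0 = ≡.refl

  ⟨⟩-*-cong : ∀ {p} {P : Set p} (P? : Dec P) {x y} → (P → x ≡ y) → ⟨ P? ⟩ ℕ.* x ≡ ⟨ P? ⟩ ℕ.* y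
  ⟨⟩-*-cong (yes p) x≡y = ≡.cong (ℕ._+ 0) (x≡y p)
  ⟨⟩-*-cong (no ¬p) x≡y = ≡.refl

  sum-zero : ∀ {m} (f : Fin m → ℕ) → (∀ i → f i ≡ 0) → sum f ≡ 0
  sum-zero {m} f f≡0 = ≡.trans (sum-cong-≗ f≡0) (sum-replicate-zero m)

  sum-single : ∀ {m} (f : Fin m → ℕ) i {v} → f i ≡ v → (∀ j → j ≢ i → f j ≡ 0) → sum f ≡ v
  sum-single f zero    fi others = ≡.trans (≡.cong₂ ℕ._+_ fi (sum-zero (f ∘ suc) λ j → others (suc j) λ ())) (ℕ.+-identityʳ _)
  sum-single f (suc i) fi others = ≡.cong₂ ℕ._+_ (others zero λ ())
    (sum-single (f ∘ suc) i fi λ j j≢i → others (suc j) (j≢i ∘ Fin.suc-injective))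

  sum-mono : ∀ {m} (f g : Fin m → ℕ) → (∀ i → f i ℕ.≤ g i) → sum f ℕ.≤ sum g
  sum-mono {zero}  f g f≤g = ℕ.z≤n
  sum-mono {suc m} f g f≤g = ℕ.+-mono-≤ (f≤g zero) (sum-mono (f ∘ suc) (g ∘ suc) (f≤g ∘ suc))

  sum-mono-< : ∀ {m} (f g : Fin m → ℕ) → (∀ i → f i ℕ.≤ g i) → ∀ i → f i ℕ.< g i → sum f ℕ.< sum g
  sum-mono-< f g f≤g zero    lt = ℕ.+-mono-<-≤ lt (sum-mono (f ∘ suc) (g ∘ suc) (f≤g ∘ suc))
  sum-mono-< f g f≤g (suc i) lt = ℕ.+-mono-≤-< (f≤g zero) (sum-mono-< (f ∘ suc) (g ∘ suc) (f≤g ∘ suc) i lt)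

  sum-one : ∀ m → sum {m} (λ _ → 1) ≡ m
  sum-one zero    = ≡.refl
  sum-one (suc m) = ≡.cong suc (sum-one m)

  double-count : ∀ {m n} (R : Fin m → Fin n → ℕ) (u : Fin m → ℕ) (w : Fin n → ℕ) →
    (∀ i → sum (R i) ≡ u i) → (∀ j → sum (λ i → R i j) ≡ w j) → sum u ≡ sum w
  double-count R u w rows columns =
    ≡.trans (≡.sym (sum-cong-≗ rows)) (≡.trans (∑-comm R) (sum-cong-≗ columns))

module LinearAlgebra {c ℓ m ℓm} (F : FiniteField c ℓ) (H : Module (FiniteField.commutativeRing F) m ℓm)
  {n : ℕ} (dimH : VectorSpace.HasDim F H (VectorSpace.whole F H) n) where

  open FiniteField F hiding (zero)
  open Module H
  open VectorSpace F H
  open Lincomb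
  open FiniteDimensional dimH
  open Counting hiding (sum)
  open Counting using (sum)
  open import Algebra.Properties.Ring ring using (-1*x≈-x)
  open import Algebra.Module.Properties H using () renaming (inverseˡ-uniqueᴹ to module-inverse)
  open import Relation.Binary.Reasoning.Setoid ≈ᴹ-setoid

  q : ℕ
  q = order

  -1*ₗ : ∀ v → (- 1#) *ₗ v ≈ᴹ -ᴹ v
  -1*ₗ v = module-inverse _ _ (begin
    (- 1#) *ₗ v +ᴹ v          ≈⟨ +ᴹ-congˡ (*ₗ-identityˡ v) ⟨
    (- 1#) *ₗ v +ᴹ 1# *ₗ v    ≈⟨ *ₗ-distribʳ v (- 1#) 1# ⟨
    (- 1# + 1#) *ₗ v          ≈⟨ *ₗ-congʳ (-‿inverseˡ 1#) ⟩
    0# *ₗ v                   ≈⟨ *ₗ-zeroˡ v ⟩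
    0ᴹ                        ∎)

  neg-closed : ∀ U {v} → v ∈ U → -ᴹ v ∈ U
  neg-closed U {v} v∈U = member-≈ U (-1*ₗ v) (*ₗ-closed U (- 1#) v∈U)

  isolateʳ : ∀ {w u v} → w ≈ᴹ u +ᴹ v → v ≈ᴹ w +ᴹ -ᴹ u
  isolateʳ {w} {u} {v} eq = begin
    v                     ≈⟨ +ᴹ-identityʳ v ⟨
    v +ᴹ 0ᴹ               ≈⟨ +ᴹ-congˡ (-ᴹ‿inverseʳ u) ⟨
    v +ᴹ (u +ᴹ -ᴹ u)      ≈⟨ +ᴹ-assoc _ _ _ ⟨
    v +ᴹ u +ᴹ -ᴹ u        ≈⟨ +ᴹ-congʳ (≈ᴹ-trans (+ᴹ-comm v u) (≈ᴹ-sym eq)) ⟩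
    w +ᴹ -ᴹ u             ∎

  right∈ : ∀ U {w u v} → w ≈ᴹ u +ᴹ v → w ∈ U → u ∈ U → v ∈ U
  right∈ U eq w∈U u∈U = member-≈ U (≈ᴹ-sym (isolateʳ eq)) (+-closed U w∈U (neg-closed U u∈U))

  left∈ : ∀ U {w u v} → w ≈ᴹ u +ᴹ v → w ∈ U → v ∈ U → u ∈ U
  left∈ U eq = right∈ U (≈ᴹ-trans eq (+ᴹ-comm _ _))

  sum∈ : ∀ U {w u v} → w ≈ᴹ u +ᴹ v → u ∈ U → v ∈ U → w ∈ U
  sum∈ U eq u∈U v∈U = member-≈ U (≈ᴹ-sym eq) (+-closed U u∈U v∈U)

  unscale : ∀ U {a v} → ¬ a ≈ 0# → a *ₗ v ∈ U → v ∈ U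
  unscale U {a} {v} a≉0 av∈U = let (b , ab≈1) = invertible a a≉0 in
    member-≈ U (≈ᴹ-trans (≈ᴹ-sym (*ₗ-assoc b a v))
      (≈ᴹ-trans (*ₗ-congʳ (trans (*-comm b a) ab≈1)) (*ₗ-identityˡ v))) (*ₗ-closed U b av∈U)

  lincomb-injective : ∀ {d} {b : Vector Carrierᴹ d} → Independent b → ∀ a a′ →
    lincomb a b ≈ᴹ lincomb a′ b → ∀ i → a i ≈ a′ i
  lincomb-injective {b = b} independent a a′ eq i = x-y≈0⇒x≈y
    (independent (λ i → a i + (- 1#) * a′ i) (begin
      lincomb (λ i → a i + (- 1#) * a′ i) b
        ≈⟨ lincomb-+ a (λ i → (- 1#) * a′ i) b ⟩
      lincomb a b +ᴹ lincomb (λ i → (- 1#) * a′ i) b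
        ≈⟨ +ᴹ-cong eq (≈ᴹ-trans (lincomb-* (- 1#) a′ b) (-1*ₗ _)) ⟩
      lincomb a′ b +ᴹ -ᴹ lincomb a′ b
        ≈⟨ -ᴹ‿inverseʳ _ ⟩
      0ᴹ ∎) i)
    where
    x-y≈0⇒x≈y : ∀ {x y} → x + (- 1#) * y ≈ 0# → x ≈ y
    x-y≈0⇒x≈y eq = x∙y⁻¹≈ε⇒x≈y′ _ _ (trans (+-congˡ (sym (-1*x≈-x _))) eq)
      where open import Algebra.Properties.Group +-group using () renaming (x∙y⁻¹≈ε⇒x≈y to x∙y⁻¹≈ε⇒x≈y′)

  funToFin-cong : ∀ {k j} {f g : Fin k → Fin j} → (∀ i → f i ≡ g i) → Fin.funToFin f ≡ Fin.funToFin g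
  funToFin-cong {zero}  f≗g = ≡.refl
  funToFin-cong {suc k} f≗g = ≡.cong₂ Fin.combine (f≗g zero) (funToFin-cong (f≗g ∘ suc))

  scalars-injective : ∀ d k l → (∀ i → scalars d k i ≈ scalars d l i) → k ≡ l
  scalars-injective d k l eq = ≡.trans (≡.sym (Fin.funToFin-finToFin {d} k))
    (≡.trans (funToFin-cong λ i → from-injective (eq i)) (Fin.funToFin-finToFin {d} l))
    where
    open Inverse enumeration
    from-injective : ∀ {i j} → from i ≈ from j → i ≡ j
    from-injective {i} {j} eq = ≡.trans (≡.sym (strictlyInverseˡ i)) (≡.trans (to-cong eq) (strictlyInverseˡ j))

  code : Carrierᴹ → Fin ∣H∣
  code v = proj₁ (point-surjective v)

  point-code : ∀ v → point (code v) ≈ᴹ v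
  point-code v = proj₂ (point-surjective v)

  point-injective : ∀ k l → point k ≈ᴹ point l → k ≡ l
  point-injective k l eq = scalars-injective n k l (lincomb-injective (IsBasis.independent (proj₂ dimH)) _ _ eq)

  # : Subspace → ℕ
  # U = sum λ k → ⟨ T? (member U (point k)) ⟩

  #-basis : ∀ {U d} → HasDim U d → # U ≡ q ℕ.^ d
  #-basis {U} {d} (b , basis) = ≡.trans
    (double-count (λ k l → ⟨ hits k l ⟩) (λ k → ⟨ T? (member U (point k)) ⟩) (λ _ → 1) row column)
    (sum-one (q ℕ.^ d))
    where
    open IsBasis basis
    abstract
      hits : ∀ k l → Dec (lincomb (scalars d l) b ≈ᴹ point k)
      hits k l = lincomb (scalars d l) b ≟ᴹ point k
    row : ∀ k → (sum λ l → ⟨ hits k l ⟩) ≡ ⟨ T? (member U (point k)) ⟩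
    row k = case T? (member U (point k)) of λ where
      (yes k∈U) →
        let (a , a≈) = spanning (point k) k∈U
            (l , l≈) = scalars-surjective a
            l-eq     = ≈ᴹ-trans (lincomb-cong b l≈) a≈
        in ≡.trans
          (sum-single (λ l → ⟨ hits k l ⟩) l (⟨⟩-yes (hits k l) l-eq) λ l′ l′≢l → ⟨⟩-no (hits k l′) λ eq′ → l′≢l
            (scalars-injective d l′ l (lincomb-injective independent _ _ (≈ᴹ-trans eq′ (≈ᴹ-sym l-eq)))))
          (≡.sym (⟨⟩-yes (T? (member U (point k))) k∈U))
      (no k∉U) → ≡.trans
        (sum-zero (λ l → ⟨ hits k l ⟩) λ l → ⟨⟩-no (hits k l) λ eq′ →
          k∉U (member-≈ U eq′ (lincomb-member U (scalars d l) b inside)))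
        (≡.sym (⟨⟩-no (T? (member U (point k))) k∉U))
    column : ∀ l → (sum λ k → ⟨ hits k l ⟩) ≡ 1
    column l = sum-single (λ k → ⟨ hits k l ⟩) (code v) (⟨⟩-yes (hits (code v) l) (≈ᴹ-sym (point-code v))) λ k k≢ →
      ⟨⟩-no (hits k l) λ eq → k≢ (point-injective k (code v) (≈ᴹ-trans (≈ᴹ-sym eq) (≈ᴹ-sym (point-code v))))
      where
      v : Carrierᴹ
      v = lincomb (scalars d l) b

  #-dim : ∀ U → # U ≡ q ℕ.^ dim U
  #-dim U = #-basis {U} (proj₂ (hasDim U))

  2≤q : 2 ℕ.≤ q
  2≤q = two order (Inverse.to enumeration 0#) (Inverse.to enumeration 1#) λ eq →
    1≉0 (trans (sym (strictlyInverseʳ 1#)) (trans (from-cong (≡.sym eq)) (strictlyInverseʳ 0#)))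
    where
    open Inverse enumeration
    two : ∀ k (i j : Fin k) → i ≢ j → 2 ℕ.≤ k
    two (suc zero)    zero zero i≢j = contradiction ≡.refl i≢j
    two (suc (suc k)) _    _    _   = ℕ.s≤s (ℕ.s≤s ℕ.z≤n)

  q^-injective : ∀ {a b} → q ℕ.^ a ≡ q ℕ.^ b → a ≡ b
  q^-injective {a} {b} eq with ℕ.<-cmp a b
  ... | tri< a<b _ _ = contradiction eq (ℕ.<⇒≢ (ℕ.^-monoʳ-< q 2≤q a<b))
  ... | tri≈ _ a≡b _ = a≡b
  ... | tri> _ _ b<a = contradiction eq (ℕ.>⇒≢ (ℕ.^-monoʳ-< q 2≤q b<a))

  dim-unique : ∀ {U d} → HasDim U d → dim U ≡ d
  dim-unique {U} hd = q^-injective (≡.trans (≡.sym (#-dim U)) (#-basis {U} hd))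

  #-mono : ∀ {U W} → U ⊆ W → # U ℕ.≤ # W
  #-mono U⊆W = sum-mono _ _ λ k → ⟨⟩-≤ (T? _) (T? _) (U⊆W (point k))

  #-cong : ∀ {U W} → U ≐ W → # U ≡ # W
  #-cong {U} {W} (U⊆W , W⊆U) = ℕ.≤-antisym (#-mono {U} {W} U⊆W) (#-mono {W} {U} W⊆U)

  #-strict : ∀ {U W v} → U ⊆ W → v ∈ W → ¬ v ∈ U → # U ℕ.< # W
  #-strict {U} {W} {v} U⊆W v∈W v∉U = sum-mono-< _ _ (λ k → ⟨⟩-≤ (T? _) (T? _) (U⊆W (point k))) (code v)
    (≡.subst₂ ℕ._<_ (≡.sym (⟨⟩-no (T? _) λ p → v∉U (member-≈ U (point-code v) p)))
      (≡.sym (⟨⟩-yes (T? _) (member-≈ W (≈ᴹ-sym (point-code v)) v∈W))) (ℕ.s≤s ℕ.z≤n))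

  dim-cong : ∀ {U W} → U ≐ W → dim U ≡ dim W
  dim-cong {U} {W} eq = q^-injective (≡.trans (≡.sym (#-dim U)) (≡.trans (#-cong {U} {W} eq) (#-dim W)))

  q^-cancel-≤ : ∀ {a b} → q ℕ.^ a ℕ.≤ q ℕ.^ b → a ℕ.≤ b
  q^-cancel-≤ {a} {b} le = ℕ.≮⇒≥ λ b<a → ℕ.<⇒≱ (ℕ.^-monoʳ-< q 2≤q b<a) le

  dim-mono : ∀ {U W} → U ⊆ W → dim U ℕ.≤ dim W
  dim-mono {U} {W} U⊆W = q^-cancel-≤ (≡.subst₂ ℕ._≤_ (#-dim U) (#-dim W) (#-mono {U} {W} U⊆W))

  dim-strict : ∀ {U W v} → U ⊆ W → v ∈ W → ¬ v ∈ U → dim U ℕ.< dim W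
  dim-strict {U} {W} U⊆W v∈W v∉U = ℕ.≤∧≢⇒< (dim-mono {U} {W} U⊆W) λ eq →
    ℕ.<⇒≢ (#-strict {U} {W} U⊆W v∈W v∉U) (≡.trans (#-dim U) (≡.trans (≡.cong (q ℕ.^_) eq) (≡.sym (#-dim W))))

  ⊆∧dim≡⇒⊇ : ∀ {U W} → U ⊆ W → dim U ≡ dim W → W ⊆ U
  ⊆∧dim≡⇒⊇ {U} {W} U⊆W eq v v∈W with T? (member U v)
  ... | yes v∈U = v∈U
  ... | no  v∉U = contradiction eq (ℕ.<⇒≢ (dim-strict {U} {W} U⊆W v∈W v∉U))

  extBasis : ∀ U → Carrierᴹ → Vector Carrierᴹ (suc (dim U))
  extBasis U v = v ∷ proj₁ (proj₂ (hasDim U))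

  abstract
    ext : Subspace → Carrierᴹ → Subspace
    ext U v = span (extBasis U v)

    ∈-ext⇒ : ∀ U v {w} → w ∈ ext U v → ∃ λ a → lincomb a (extBasis U v) ≈ᴹ w
    ∈-ext⇒ U v {w} w∈ = toWitness {a? = span? (extBasis U v) w} w∈

    ∈-ext⇐ : ∀ U v {w} a → lincomb a (extBasis U v) ≈ᴹ w → w ∈ ext U v
    ∈-ext⇐ U v {w} a eq = fromWitness {a? = span? (extBasis U v) w} (a , eq)

  ext-elim : ∀ U v {w} → w ∈ ext U v → ∃ λ a → ∃ λ u → u ∈ U × w ≈ᴹ a *ₗ v +ᴹ u
  ext-elim U v {w} w∈ = let (a , eq) = ∈-ext⇒ U v w∈ in
    a zero , lincomb (a ∘ suc) b , lincomb-member U (a ∘ suc) b (IsBasis.inside (proj₂ (proj₂ (hasDim U)))) , ≈ᴹ-sym eq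
    where
    b : Vector Carrierᴹ (dim U)
    b = proj₁ (proj₂ (hasDim U))

  ext-intro : ∀ U v {w u} a → u ∈ U → w ≈ᴹ a *ₗ v +ᴹ u → w ∈ ext U v
  ext-intro U v {w} {u} a u∈U eq = let (a′ , eq′) = IsBasis.spanning (proj₂ (proj₂ (hasDim U))) u u∈U in
    ∈-ext⇐ U v (a ∷ a′) (≈ᴹ-trans (+ᴹ-congˡ eq′) (≈ᴹ-sym eq))

  ⊆-ext : ∀ U v → U ⊆ ext U v
  ⊆-ext U v u u∈U = ext-intro U v 0# u∈U (≈ᴹ-sym (≈ᴹ-trans (+ᴹ-congʳ (*ₗ-zeroˡ v)) (+ᴹ-identityˡ u)))

  ∈-ext : ∀ U v → v ∈ ext U v
  ∈-ext U v = ext-intro U v 1# (0-member U) (≈ᴹ-sym (≈ᴹ-trans (+ᴹ-congʳ (*ₗ-identityˡ v)) (+ᴹ-identityʳ v)))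

  ext-⊆ : ∀ U v W → U ⊆ W → v ∈ W → ext U v ⊆ W
  ext-⊆ U v W U⊆W v∈W w w∈ = let (a , u , u∈U , eq) = ext-elim U v w∈ in
    sum∈ W eq (*ₗ-closed W a v∈W) (U⊆W u u∈U)

  dim-ext : ∀ U v → ¬ v ∈ U → dim (ext U v) ≡ suc (dim U)
  dim-ext U v v∉U = dim-unique {ext U v} (extBasis U v , record
    { inside = λ i → let (a , eq) = lincomb-generator (extBasis U v) i in ∈-ext⇐ U v a eq
    ; independent = independent′
    ; spanning = λ w w∈ → ∈-ext⇒ U v w∈ })
    where
    b : Vector Carrierᴹ (dim U)
    b = proj₁ (proj₂ (hasDim U))
    open IsBasis (proj₂ (proj₂ (hasDim U)))
    independent′ : Independent (extBasis U v)
    independent′ a eq = case a zero ≟ 0# of λ where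
      (yes a₀≈0) → λ where
        zero    → a₀≈0
        (suc i) → independent (a ∘ suc) (≈ᴹ-trans (≈ᴹ-sym (+ᴹ-identityˡ _))
          (≈ᴹ-trans (+ᴹ-congʳ (≈ᴹ-sym (≈ᴹ-trans (*ₗ-congʳ a₀≈0) (*ₗ-zeroˡ v)))) eq)) i
      (no a₀≉0) → contradiction
        (unscale U a₀≉0 (left∈ U (≈ᴹ-sym eq) (0-member U) (lincomb-member U (a ∘ suc) b inside))) v∉U

  infixr 7 _∩_
  _∩_ : Subspace → Subspace → Subspace
  U ∩ W = record
    { member    = λ v → member U v ∧ member W v
    ; member-≈  = λ u≈v p → let (a , b) = to p in from (member-≈ U u≈v a , member-≈ W u≈v b)
    ; 0-member  = from (0-member U , 0-member W)
    ; +-closed  = λ p p′ → let (a , b) = to p ; (a′ , b′) = to p′ in from (+-closed U a a′ , +-closed W b b′)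
    ; *ₗ-closed = λ x p → let (a , b) = to p in from (*ₗ-closed U x a , *ₗ-closed W x b) }
    where
    to : ∀ {x y} → T (x ∧ y) → T x × T y
    to = Equivalence.to T-∧
    from : ∀ {x y} → T x × T y → T (x ∧ y)
    from = Equivalence.from T-∧

  ∩-intro : ∀ U W {v} → v ∈ U → v ∈ W → v ∈ U ∩ W
  ∩-intro U W v∈U v∈W = Equivalence.from T-∧ (v∈U , v∈W)

  ∩-elim : ∀ U W {v} → v ∈ U ∩ W → v ∈ U × v ∈ W
  ∩-elim U W = Equivalence.to T-∧

  witness : ∀ {U W} → ¬ U ⊆ W → ∃ λ v → v ∈ U × ¬ v ∈ W
  witness {U} {W} U⊈W with Fin.any? (λ k → T? (member U (point k)) ×-dec ¬? (T? (member W (point k))))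
    where open import Relation.Nullary.Decidable using (¬?)
  ... | yes (k , k∈U , k∉W) = point k , k∈U , k∉W
  ... | no  none = contradiction (λ v v∈U → case T? (member W v) of λ where
      (yes v∈W) → v∈W
      (no v∉W)  → contradiction
        (code v , member-≈ U (≈ᴹ-sym (point-code v)) v∈U , λ p → v∉W (member-≈ W (point-code v) p)) none)
    U⊈W

module CountingArithmetic where
  open import Data.Nat.Base
  open +-*-Solver

  interval-count : ∀ {q} → 2 ≤ q → ∀ n p .{{_ : NonZero p}} → n * (q * p) + p ≡ n * p + q * (q * p) → n ≡ q + 1
  interval-count {suc zero} (s≤s ())
  interval-count {suc k@(suc _)} _ n p eq = ℕ.*-cancelʳ-≡ n (suc k + 1) (k * p) {{ℕ.m*n≢0 k p}}
    (ℕ.+-cancelʳ-≡ (n * p + p) _ _ (≡.trans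
      (solve 3 (λ n k p → n :* (k :* p) :+ (n :* p :+ p) := n :* ((con 1 :+ k) :* p) :+ p) ≡.refl n k p)
      (≡.trans eq (solve 3 (λ n k p → n :* p :+ (con 1 :+ k) :* ((con 1 :+ k) :* p) :=
        (con 1 :+ k :+ con 1) :* (k :* p) :+ (n :* p :+ p)) ≡.refl n k p))))

  bad-interval-count : ∀ {q} → 2 ≤ q → ∀ n p .{{_ : NonZero p}} → n * (q * p) + q * p ≡ n * p + q * (q * p) → n ≡ q
  bad-interval-count {suc zero} (s≤s ())
  bad-interval-count {suc k@(suc _)} _ n p eq = ℕ.*-cancelʳ-≡ n (suc k) (k * p) {{ℕ.m*n≢0 k p}}
    (ℕ.+-cancelʳ-≡ (n * p + suc k * p) _ _ (≡.trans
      (solve 3 (λ n k p → n :* (k :* p) :+ (n :* p :+ (con 1 :+ k) :* p) := n :* ((con 1 :+ k) :* p) :+ (con 1 :+ k) :* p) ≡.refl n k p)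
      (≡.trans eq (solve 3 (λ n k p → n :* p :+ (con 1 :+ k) :* ((con 1 :+ k) :* p) :=
        (con 1 :+ k) :* (k :* p) :+ (n :* p :+ (con 1 :+ k) :* p)) ≡.refl n k p))))

  successive-counts : ∀ {q} → 2 ≤ q → ∀ a b B Q → q * a + B ≡ a + Q → q * b + q * B ≡ b + Q → b + Q ≡ q * a
  successive-counts {suc zero} (s≤s ())
  successive-counts {suc k@(suc _)} _ a b B Q eq-a eq-b = ℕ.*-cancelˡ-≡ (b + Q) (suc k * a) k
    (ℕ.+-cancelʳ-≡ (suc k * B) _ _ (≡.trans
      (solve 4 (λ k b B Q → k :* (b :+ Q) :+ (con 1 :+ k) :* B := k :* b :+ (con 1 :+ k) :* B :+ k :* Q) ≡.refl k b B Q)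
      (≡.trans (≡.cong (_+ k * Q) kb)
      (≡.trans (≡.cong (λ z → z + k * z) (≡.sym ka))
        (solve 3 (λ k a B → (k :* a :+ B) :+ k :* (k :* a :+ B) := k :* ((con 1 :+ k) :* a) :+ (con 1 :+ k) :* B) ≡.refl k a B)))))
    where
    ka : k * a + B ≡ Q
    ka = ℕ.+-cancelˡ-≡ a _ _ (≡.trans (≡.sym (ℕ.+-assoc a (k * a) B)) eq-a)
    kb : k * b + suc k * B ≡ Q
    kb = ℕ.+-cancelˡ-≡ b _ _ (≡.trans (≡.sym (ℕ.+-assoc b (k * b) (suc k * B))) eq-b)

module Poset {k ℓ m ℓm} (F : FiniteField k ℓ) (H : Module (FiniteField.commutativeRing F) m ℓm)
  (N M : ℕ) (dimH : VectorSpace.HasDim F H (VectorSpace.whole F H) (N ℕ.+ M))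
  (h : VectorSpace.Subspace F H) (dim-h : VectorSpace.HasDim F H h M)
  {∣X∣ : ℕ} (vertex : Fin ∣X∣ → VectorSpace.Subspace F H)
  (vertex-disjoint : ∀ i → VectorSpace.Disjoint F H (vertex i) h)
  (vertex-injective : ∀ i j → VectorSpace._≐_ F H (vertex i) (vertex j) → i ≡ j)
  (vertex-surjective : ∀ y → VectorSpace.Disjoint F H y h → ∃ λ i → VectorSpace._≐_ F H y (vertex i)) where

  open FiniteField F hiding (zero)
  open Module H
  open VectorSpace F H
  open Lincomb
  open FiniteDimensional dimH
  open LinearAlgebra F H dimH
  open Counting
  open import Relation.Binary.Reasoning.Setoid ≈ᴹ-setoid

  _-ᴹ_ : Carrierᴹ → Carrierᴹ → Carrierᴹ
  v -ᴹ u = v +ᴹ -ᴹ u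

  split : ∀ v u → v ≈ᴹ u +ᴹ (v -ᴹ u)
  split v u = begin
    v                     ≈⟨ +ᴹ-identityˡ v ⟨
    0ᴹ +ᴹ v               ≈⟨ +ᴹ-congʳ (-ᴹ‿inverseʳ u) ⟨
    u +ᴹ -ᴹ u +ᴹ v        ≈⟨ +ᴹ-assoc u (-ᴹ u) v ⟩
    u +ᴹ (-ᴹ u +ᴹ v)      ≈⟨ +ᴹ-congˡ (+ᴹ-comm (-ᴹ u) v) ⟩
    u +ᴹ (v -ᴹ u)         ∎

  +-interchange : ∀ {a b a′ b′} → (a +ᴹ b) +ᴹ (a′ +ᴹ b′) ≈ᴹ (a +ᴹ a′) +ᴹ (b +ᴹ b′)
  +-interchange = interchange _ _ _ _
    where
    open import Algebra.Bundles using (module CommutativeMonoid)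
    open import Algebra.Properties.CommutativeSemigroup (CommutativeMonoid.commutativeSemigroup +ᴹ-commutativeMonoid)
      using (interchange)

  Sum : Subspace → Subspace → Carrierᴹ → Set _
  Sum U W v = ∃ λ u → ∃ λ w → u ∈ U × w ∈ W × v ≈ᴹ u +ᴹ w

  sum? : ∀ U W v → Dec (Sum U W v)
  sum? U W v = Dec.map′
    (λ (k , k∈U , v-k∈W) → point k , v -ᴹ point k , k∈U , v-k∈W , split v (point k))
    (λ (u , w , u∈U , w∈W , eq) → code u , member-≈ U (≈ᴹ-sym (point-code u)) u∈U ,
      member-≈ W (≈ᴹ-trans (isolateʳ eq) (+ᴹ-congˡ (-ᴹ‿cong (≈ᴹ-sym (point-code u))))) w∈W)
    (Fin.any? λ k → T? (member U (point k)) ×-dec T? (member W (v -ᴹ point k)))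
    where import Relation.Nullary.Decidable as Dec

  infixl 6 _⊕_
  abstract
    _⊕_ : Subspace → Subspace → Subspace
    U ⊕ W = record
      { member    = λ v → ⌊ sum? U W v ⌋
      ; member-≈  = λ {u} {v} u≈v p → let (a , b , a∈ , b∈ , eq) = toWitness {a? = sum? U W u} p in
          fromWitness {a? = sum? U W v} (a , b , a∈ , b∈ , ≈ᴹ-trans (≈ᴹ-sym u≈v) eq)
      ; 0-member  = fromWitness {a? = sum? U W 0ᴹ} (0ᴹ , 0ᴹ , 0-member U , 0-member W , ≈ᴹ-sym (+ᴹ-identityˡ 0ᴹ))
      ; +-closed  = λ {u} {v} p p′ →
          let (a , b , a∈ , b∈ , eq) = toWitness {a? = sum? U W u} p
              (a′ , b′ , a′∈ , b′∈ , eq′) = toWitness {a? = sum? U W v} p′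
          in fromWitness {a? = sum? U W (u +ᴹ v)} (a +ᴹ a′ , b +ᴹ b′ , +-closed U a∈ a′∈ , +-closed W b∈ b′∈ ,
               ≈ᴹ-trans (+ᴹ-cong eq eq′) +-interchange)
      ; *ₗ-closed = λ x {v} p → let (a , b , a∈ , b∈ , eq) = toWitness {a? = sum? U W v} p in
          fromWitness {a? = sum? U W (x *ₗ v)} (x *ₗ a , x *ₗ b , *ₗ-closed U x a∈ , *ₗ-closed W x b∈ ,
            ≈ᴹ-trans (*ₗ-congˡ eq) (*ₗ-distribˡ x a b)) }

    ⊕-elim : ∀ U W {v} → v ∈ U ⊕ W → Sum U W v
    ⊕-elim U W {v} = toWitness {a? = sum? U W v}

    ⊕-intro : ∀ U W {v} → Sum U W v → v ∈ U ⊕ W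
    ⊕-intro U W {v} = fromWitness {a? = sum? U W v}

  ⊆-⊕ˡ : ∀ U W → U ⊆ U ⊕ W
  ⊆-⊕ˡ U W u u∈U = ⊕-intro U W (u , 0ᴹ , u∈U , 0-member W , ≈ᴹ-sym (+ᴹ-identityʳ u))

  ⊕-unique : ∀ {U W} → Disjoint U W → ∀ {u w u′ w′} → u ∈ U → w ∈ W → u′ ∈ U → w′ ∈ W →
    u +ᴹ w ≈ᴹ u′ +ᴹ w′ → u′ ≈ᴹ u × w′ ≈ᴹ w
  ⊕-unique {U} {W} disjoint {u} {w} {u′} {w′} u∈ w∈ u′∈ w′∈ eq =
    ≈ᴹ-trans u′≈ (≈ᴹ-trans (+ᴹ-congˡ d≈0) (+ᴹ-identityʳ u)) ,
    ≈ᴹ-sym (≈ᴹ-trans w≈ (≈ᴹ-trans (+ᴹ-congʳ d≈0) (+ᴹ-identityˡ w′)))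
    where
    open import Algebra.Properties.Group +ᴹ-group using (∙-cancelˡ)
    d : Carrierᴹ
    d = u′ -ᴹ u
    u′≈ : u′ ≈ᴹ u +ᴹ d
    u′≈ = split u′ u
    w≈ : w ≈ᴹ d +ᴹ w′
    w≈ = ∙-cancelˡ u w (d +ᴹ w′) (≈ᴹ-trans eq (≈ᴹ-trans (+ᴹ-congʳ u′≈) (+ᴹ-assoc u d w′)))
    d≈0 : d ≈ᴹ 0ᴹ
    d≈0 = disjoint d (right∈ U u′≈ u′∈ u∈) (left∈ W w≈ w∈ w′∈)

  #-⊕ : ∀ {U W} → Disjoint U W → # (U ⊕ W) ≡ # U ℕ.* # W
  #-⊕ {U} {W} disjoint = ≡.sym (≡.trans (≡.sym columns) (≡.trans (≡.sym swap) (sum-cong-≗ row)))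
    where
    in-U in-W : Fin ∣H∣ → ℕ
    in-U k = ⟨ T? (member U (point k)) ⟩
    in-W l = ⟨ T? (member W (point l)) ⟩
    abstract
      hits : ∀ v k l → Dec (point v ≈ᴹ point k +ᴹ point l)
      hits v k l = point v ≟ᴹ point k +ᴹ point l
    term : Fin ∣H∣ → Fin ∣H∣ → Fin ∣H∣ → ℕ
    term v k l = in-U k ℕ.* (in-W l ℕ.* ⟨ hits v k l ⟩)
    row : ∀ v → (sum λ k → sum λ l → term v k l) ≡ ⟨ T? (member (U ⊕ W) (point v)) ⟩
    row v = case T? (member (U ⊕ W) (point v)) of λ where
      (yes v∈) →
        let (u , w , u∈ , w∈ , eq) = ⊕-elim U W v∈
            u∈′ = member-≈ U (≈ᴹ-sym (point-code u)) u∈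
            w∈′ = member-≈ W (≈ᴹ-sym (point-code w)) w∈
            eq′ = ≈ᴹ-trans eq (+ᴹ-cong (≈ᴹ-sym (point-code u)) (≈ᴹ-sym (point-code w)))
            unique : ∀ k l → point k ∈ U → point l ∈ W → point v ≈ᴹ point k +ᴹ point l → k ≡ code u × l ≡ code w
            unique k l k∈ l∈ vkl = let (k≈ , l≈) = ⊕-unique {U} {W} disjoint u∈′ w∈′ k∈ l∈ (≈ᴹ-trans (≈ᴹ-sym eq′) vkl) in
              point-injective k (code u) k≈ , point-injective l (code w) l≈
        in ≡.trans
          (sum-single (λ k → sum (term v k)) (code u)
            (sum-single (term v (code u)) (code w)
              (≡.cong₂ ℕ._*_ (⟨⟩-yes (T? (member U (point (code u)))) u∈′)
                (≡.cong₂ ℕ._*_ (⟨⟩-yes (T? (member W (point (code w)))) w∈′) (⟨⟩-yes (hits v (code u) (code w)) eq′)))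
              λ l l≢ → ⟨⟩-*-zero (T? (member U (point (code u)))) λ k∈ → ⟨⟩-*-zero (T? (member W (point l))) λ l∈ →
                ⟨⟩-no (hits v (code u) l) λ eq″ → l≢ (proj₂ (unique (code u) l k∈ l∈ eq″)))
            λ k k≢ → sum-zero (term v k) λ l →
              ⟨⟩-*-zero (T? (member U (point k))) λ k∈ → ⟨⟩-*-zero (T? (member W (point l))) λ l∈ →
                ⟨⟩-no (hits v k l) λ eq″ → k≢ (proj₁ (unique k l k∈ l∈ eq″)))
          (≡.sym (⟨⟩-yes (T? (member (U ⊕ W) (point v))) v∈))
      (no v∉) → ≡.trans
        (sum-zero (λ k → sum (term v k)) λ k → sum-zero (term v k) λ l →
          ⟨⟩-*-zero (T? (member U (point k))) λ k∈ → ⟨⟩-*-zero (T? (member W (point l))) λ l∈ →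
            ⟨⟩-no (hits v k l) λ eq → v∉ (⊕-intro U W (point k , point l , k∈ , l∈ , eq)))
        (≡.sym (⟨⟩-no (T? (member (U ⊕ W) (point v))) v∉))
    swap : (sum λ v → sum λ k → sum λ l → term v k l) ≡ (sum λ k → sum λ l → sum λ v → term v k l)
    swap = ≡.trans (∑-comm λ v k → sum (term v k)) (sum-cong-≗ λ k → ∑-comm λ v l → term v k l)
    columns : (sum λ k → sum λ l → sum λ v → term v k l) ≡ # U ℕ.* # W
    columns = ≡.trans
      (sum-cong-≗ λ k → ≡.trans
        (sum-cong-≗ λ l → ≡.trans (≡.sym (*-distribˡ-sum (in-U k) λ v → in-W l ℕ.* ⟨ hits v k l ⟩))
          (≡.cong (in-U k ℕ.*_) (≡.trans (≡.sym (*-distribˡ-sum (in-W l) λ v → ⟨ hits v k l ⟩))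
            (≡.trans (≡.cong (in-W l ℕ.*_)
              (sum-single (λ v → ⟨ hits v k l ⟩) (code (point k +ᴹ point l))
                (⟨⟩-yes (hits (code (point k +ᴹ point l)) k l) (point-code _))
                λ v v≢ → ⟨⟩-no (hits v k l) λ eq → v≢ (point-injective v (code (point k +ᴹ point l))
                  (≈ᴹ-trans eq (≈ᴹ-sym (point-code _))))))
              (ℕ.*-identityʳ (in-W l))))))
        (≡.sym (*-distribˡ-sum (in-U k) in-W)))
      (≡.sym (*-distribʳ-sum (# W) in-U))

  #-⊕h : ∀ {U} → Disjoint U h → # (U ⊕ h) ≡ q ℕ.^ (dim U ℕ.+ M)
  #-⊕h {U} disjoint = ≡.trans (#-⊕ {U} {h} disjoint)
    (≡.trans (≡.cong₂ ℕ._*_ (#-dim U) (#-basis {h} dim-h)) (≡.sym (ℕ.^-distribˡ-+-* q (dim U) M)))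

  #-whole : # whole ≡ q ℕ.^ (N ℕ.+ M)
  #-whole = #-basis {whole} dimH

  dim≤N : ∀ {U} → Disjoint U h → dim U ℕ.≤ N
  dim≤N {U} disjoint = ℕ.+-cancelʳ-≤ M (dim U) N
    (q^-cancel-≤ (≡.subst₂ ℕ._≤_ (#-⊕h {U} disjoint) #-whole (#-mono {U ⊕ h} {whole} λ _ _ → tt)))

  dimension : Fin ∣X∣ → ℕ
  dimension y = dim (vertex y)

  Covers : Fin ∣X∣ → Fin ∣X∣ → Set m
  Covers z y = vertex y ⊆ vertex z × dimension z ≡ suc (dimension y)

  module Covering (covers? : ∀ z y → Dec (Covers z y)) where

    abstract
      within? : ∀ U W → Dec (U ⊆ W)
      within? = _⊆?_

    ∩-disjoint : ∀ {U W} → U ⊆ W → Disjoint W h → Disjoint U h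
    ∩-disjoint U⊆W disjoint v v∈U = disjoint v (U⊆W v v∈U)

    vertex-eq : ∀ {i j} → vertex i ⊆ vertex j → dimension i ≡ dimension j → i ≡ j
    vertex-eq {i} {j} i⊆j eq = vertex-injective i j (i⊆j , ⊆∧dim≡⇒⊇ {vertex i} {vertex j} i⊆j eq)

    cover⊆ext : ∀ {w x v} → Covers w x → v ∈ vertex w → ¬ v ∈ vertex x → vertex w ⊆ ext (vertex x) v
    cover⊆ext {w} {x} {v} (x⊆w , dim-w) v∈w v∉x = ⊆∧dim≡⇒⊇ {ext (vertex x) v} {vertex w}
      (ext-⊆ (vertex x) v (vertex w) x⊆w v∈w) (≡.trans (dim-ext (vertex x) v v∉x) (≡.sym dim-w))

    ext-cover : ∀ x v → ¬ v ∈ vertex x → Disjoint (ext (vertex x) v) h →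
                ∃ λ w → Covers w x × ext (vertex x) v ≐ vertex w
    ext-cover x v v∉x disjoint =
      let (w , eq@(e⊆w , w⊆e)) = vertex-surjective (ext (vertex x) v) disjoint
      in w , ((λ u u∈x → e⊆w u (⊆-ext (vertex x) v u u∈x)) ,
              ≡.trans (dim-cong {vertex w} {ext (vertex x) v} (w⊆e , e⊆w)) (dim-ext (vertex x) v v∉x)) , eq

    ∉⊕h⇒ext-disjoint : ∀ x v → ¬ v ∈ vertex x ⊕ h → Disjoint (ext (vertex x) v) h
    ∉⊕h⇒ext-disjoint x v v∉ w w∈ext w∈h =
      let (a , u , u∈x , eq) = ext-elim (vertex x) v w∈ext in case a ≟ 0# of λ where
        (yes a≈0) →
          let w≈u = ≈ᴹ-trans eq (≈ᴹ-trans (+ᴹ-congʳ (≈ᴹ-trans (*ₗ-congʳ a≈0) (*ₗ-zeroˡ v))) (+ᴹ-identityˡ u))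
          in vertex-disjoint x w (member-≈ (vertex x) (≈ᴹ-sym w≈u) u∈x) w∈h
        (no a≉0) → contradiction (unscale (vertex x ⊕ h) a≉0
          (left∈ (vertex x ⊕ h) eq (⊕-intro (vertex x) h (0ᴹ , w , 0-member (vertex x) , w∈h , ≈ᴹ-sym (+ᴹ-identityˡ w)))
            (⊆-⊕ˡ (vertex x) h u u∈x))) v∉

    ∩⊕h≐ : ∀ x {Z} → vertex x ⊆ Z → Disjoint Z h → Z ∩ (vertex x ⊕ h) ≐ vertex x
    ∩⊕h≐ x {Z} x⊆Z disjoint =
      (λ v v∈ →
        let (v∈Z , v∈x⊕h) = ∩-elim Z (vertex x ⊕ h) v∈
            (u , η , u∈x , η∈h , eq) = ⊕-elim (vertex x) h v∈x⊕h
            η≈0 = disjoint η (right∈ Z eq v∈Z (x⊆Z u u∈x)) η∈h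
        in member-≈ (vertex x) (≈ᴹ-sym (≈ᴹ-trans eq (≈ᴹ-trans (+ᴹ-congˡ η≈0) (+ᴹ-identityʳ u)))) u∈x) ,
      λ v v∈x → ∩-intro Z (vertex x ⊕ h) (x⊆Z v v∈x) (⊆-⊕ˡ (vertex x) h v v∈x)

    cover∩⊕h : ∀ {w x v} → Covers w x → v ∈ vertex w → v ∈ vertex x ⊕ h → v ∈ vertex x
    cover∩⊕h {w} {x} {v} (x⊆w , _) v∈w v∈x⊕h =
      proj₁ (∩⊕h≐ x {vertex w} x⊆w (vertex-disjoint w)) v (∩-intro (vertex w) (vertex x ⊕ h) v∈w v∈x⊕h)

    module _ (x : Fin ∣X∣) (Z : Subspace) where

      coversIn : ℕ
      coversIn = sum λ w → ⟨ covers? w x ⟩ ℕ.* ⟨ within? (vertex w) Z ⟩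

      -- Counts in two ways the pairs (w , v) such that w covers x, w ⊆ Z and v ∈ w \ x.
      cover-count-in : vertex x ⊆ Z →
        coversIn ℕ.* q ℕ.^ suc (dimension x) ℕ.+ # (Z ∩ (vertex x ⊕ h)) ≡ coversIn ℕ.* q ℕ.^ dimension x ℕ.+ # Z
      cover-count-in x⊆Z = total
        where
        e : ℕ
        e = dimension x
        new? : ∀ w k → Dec (point k ∈ vertex w × ¬ point k ∈ vertex x)
        new? w k = T? (member (vertex w) (point k)) ×-dec ¬? (T? (member (vertex x) (point k)))
        free? : ∀ k → Dec (point k ∈ Z × ¬ point k ∈ vertex x ⊕ h)
        free? k = T? (member Z (point k)) ×-dec ¬? (T? (member (vertex x ⊕ h) (point k)))
        new : Fin ∣X∣ → Fin ∣H∣ → ℕ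
        new w k = ⟨ new? w k ⟩
        cov inZ : Fin ∣X∣ → ℕ
        cov w = ⟨ covers? w x ⟩
        inZ w = ⟨ within? (vertex w) Z ⟩
        partition : ∀ {U W} → U ⊆ W → ∀ k →
          ⟨ T? (member W (point k)) ×-dec ¬? (T? (member U (point k))) ⟩ ℕ.+ ⟨ T? (member U (point k)) ⟩ ≡
          ⟨ T? (member W (point k)) ⟩
        partition {U} {W} U⊆W k with member W (point k) | member U (point k) | U⊆W (point k)
        ... | true  | true  | _ = ≡.refl
        ... | true  | false | _ = ≡.refl
        ... | false | true  | f = contradiction (f tt) λ ()
        ... | false | false | _ = ≡.refl
        partition-∩ : ∀ {U W} → ∀ k →
          ⟨ T? (member W (point k)) ×-dec ¬? (T? (member U (point k))) ⟩ ℕ.+ ⟨ T? (member (W ∩ U) (point k)) ⟩ ≡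
          ⟨ T? (member W (point k)) ⟩
        partition-∩ {U} {W} k with member W (point k) | member U (point k)
        ... | true  | true  = ≡.refl
        ... | true  | false = ≡.refl
        ... | false | _     = ≡.refl
        #new : ∀ w → Covers w x → q ℕ.^ e ℕ.+ sum (new w) ≡ q ℕ.^ suc e
        #new w (x⊆w , dim-w) = ≡.trans (≡.cong (ℕ._+ sum (new w)) (≡.sym (#-dim (vertex x))))
          (≡.trans (ℕ.+-comm (# (vertex x)) (sum (new w)))
          (≡.trans (≡.sym (∑-distrib-+ (new w) λ k → ⟨ T? (member (vertex x) (point k)) ⟩))
          (≡.trans (sum-cong-≗ (partition {vertex x} {vertex w} x⊆w))
          (≡.trans (#-dim (vertex w)) (≡.cong (q ℕ.^_) dim-w)))))
        rows : coversIn ℕ.* q ℕ.^ e ℕ.+ (sum λ w → sum λ k → cov w ℕ.* (inZ w ℕ.* new w k)) ≡ coversIn ℕ.* q ℕ.^ suc e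
        rows = ≡.trans (≡.cong₂ ℕ._+_ (*-distribʳ-sum (q ℕ.^ e) λ w → cov w ℕ.* inZ w)
            (sum-cong-≗ λ w → ≡.trans (≡.sym (*-distribˡ-sum (cov w) λ k → inZ w ℕ.* new w k))
              (≡.cong (cov w ℕ.*_) (≡.sym (*-distribˡ-sum (inZ w) (new w))))))
          (≡.trans (≡.sym (∑-distrib-+ (λ w → cov w ℕ.* inZ w ℕ.* q ℕ.^ e) λ w → cov w ℕ.* (inZ w ℕ.* sum (new w))))
          (≡.trans (sum-cong-≗ at) (≡.sym (*-distribʳ-sum (q ℕ.^ suc e) λ w → cov w ℕ.* inZ w))))
          where
          open +-*-Solver
          at : ∀ w → cov w ℕ.* inZ w ℕ.* q ℕ.^ e ℕ.+ cov w ℕ.* (inZ w ℕ.* sum (new w)) ≡ cov w ℕ.* inZ w ℕ.* q ℕ.^ suc e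
          at w = ≡.trans (solve 4 (λ a b p s → a :* b :* p :+ a :* (b :* s) := a :* (b :* (p :+ s))) ≡.refl (cov w) (inZ w) (q ℕ.^ e) (sum (new w)))
            (≡.trans (⟨⟩-*-cong (covers? w x) λ w⋗x → ≡.cong (inZ w ℕ.*_) (#new w w⋗x))
              (≡.sym (ℕ.*-assoc (cov w) (inZ w) (q ℕ.^ suc e))))
        column : ∀ k → (sum λ w → cov w ℕ.* (inZ w ℕ.* new w k)) ≡ ⟨ free? k ⟩
        column k = case free? k of λ where
          (yes free@(k∈Z , k∉)) →
            let k∉x = λ k∈x → k∉ (⊆-⊕ˡ (vertex x) h (point k) k∈x)
                (w , w⋗x , e⊆w , w⊆e) = ext-cover x (point k) k∉x (∉⊕h⇒ext-disjoint x (point k) k∉)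
                k∈w = e⊆w (point k) (∈-ext (vertex x) (point k))
                w⊆Z = λ v v∈w → ext-⊆ (vertex x) (point k) Z x⊆Z k∈Z v (w⊆e v v∈w)
            in ≡.trans
              (sum-single (λ w → cov w ℕ.* (inZ w ℕ.* new w k)) w
                (≡.cong₂ ℕ._*_ (⟨⟩-yes (covers? w x) w⋗x)
                  (≡.cong₂ ℕ._*_ (⟨⟩-yes (within? (vertex w) Z) w⊆Z) (⟨⟩-yes (new? w k) (k∈w , k∉x))))
                λ w′ w′≢w → ⟨⟩-*-zero (covers? w′ x) λ w′⋗x → ⟨⟩-*-zero (within? (vertex w′) Z) λ _ →
                  ⟨⟩-no (new? w′ k) λ (k∈w′ , _) → w′≢w (vertex-eq {w′} {w}
                    (λ v v∈w′ → e⊆w v (cover⊆ext {w′} {x} w′⋗x k∈w′ k∉x v v∈w′))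
                    (≡.trans (proj₂ w′⋗x) (≡.sym (proj₂ w⋗x)))))
              (≡.sym (⟨⟩-yes (free? k) free))
          (no ¬free) → ≡.trans
            (sum-zero (λ w → cov w ℕ.* (inZ w ℕ.* new w k)) λ w →
              ⟨⟩-*-zero (covers? w x) λ w⋗x → ⟨⟩-*-zero (within? (vertex w) Z) λ w⊆Z →
                ⟨⟩-no (new? w k) λ (k∈w , k∉x) → ¬free (w⊆Z (point k) k∈w , λ k∈ → k∉x (cover∩⊕h {w} {x} w⋗x k∈w k∈)))
            (≡.sym (⟨⟩-no (free? k) ¬free))
        columns : (sum λ w → sum λ k → cov w ℕ.* (inZ w ℕ.* new w k)) ℕ.+ # (Z ∩ (vertex x ⊕ h)) ≡ # Z
        columns = ≡.trans (≡.cong (ℕ._+ # (Z ∩ (vertex x ⊕ h)))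
            (≡.trans (∑-comm λ w k → cov w ℕ.* (inZ w ℕ.* new w k)) (sum-cong-≗ column)))
          (≡.trans (≡.sym (∑-distrib-+ (λ k → ⟨ free? k ⟩) λ k → ⟨ T? (member (Z ∩ (vertex x ⊕ h)) (point k)) ⟩))
            (sum-cong-≗ (partition-∩ {vertex x ⊕ h} {Z})))
        total : coversIn ℕ.* q ℕ.^ suc e ℕ.+ # (Z ∩ (vertex x ⊕ h)) ≡ coversIn ℕ.* q ℕ.^ e ℕ.+ # Z
        total = ≡.trans (≡.cong (ℕ._+ # (Z ∩ (vertex x ⊕ h))) (≡.sym rows))
          (≡.trans (ℕ.+-assoc (coversIn ℕ.* q ℕ.^ e) _ _) (≡.cong (λ s → coversIn ℕ.* q ℕ.^ e ℕ.+ s) columns))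

    covers : Fin ∣X∣ → Fin ∣X∣ → Bool
    covers z y = does (covers? z y)

    open CoverMatrix covers using (c; cᵗ; _⊙_)
    open CountingArithmetic

    c-yes : ∀ {z y} → Covers z y → c z y ≡ 1
    c-yes {z} {y} = ⟨⟩-yes (covers? z y)

    c-no : ∀ {z y} → ¬ Covers z y → c z y ≡ 0
    c-no {z} {y} = ⟨⟩-no (covers? z y)

    given : ∀ {z y a b} → (Covers z y → a ≡ b) → c z y ℕ.* a ≡ c z y ℕ.* b
    given {z} {y} = ⟨⟩-*-cong (covers? z y)

    given₀ : ∀ {z y a} → (Covers z y → a ≡ 0) → c z y ℕ.* a ≡ 0
    given₀ {z} {y} = ⟨⟩-*-zero (covers? z y)

    instance
      q-nonZero : ℕ.NonZero q
      q-nonZero = ℕ.>-nonZero (ℕ.≤-trans (ℕ.s≤s ℕ.z≤n) 2≤q)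

    upper : Fin ∣X∣ → ℕ
    upper x = (cᵗ ⊙ c) x x

    upper≡coversIn : ∀ x → upper x ≡ coversIn x whole
    upper≡coversIn x = sum-cong-≗ λ w → given {w} {x} λ w⋗x →
      ≡.trans (c-yes {w} {x} w⋗x) (≡.sym (⟨⟩-yes (within? (vertex w) whole) λ _ _ → tt))

    upper-count : ∀ x → q ℕ.* (q ℕ.^ dimension x ℕ.* upper x) ℕ.+ q ℕ.^ (dimension x ℕ.+ M) ≡
                        q ℕ.^ dimension x ℕ.* upper x ℕ.+ q ℕ.^ (N ℕ.+ M)
    upper-count x = ≡.subst (λ n → q ℕ.* (p ℕ.* n) ℕ.+ q ℕ.^ (dimension x ℕ.+ M) ≡ p ℕ.* n ℕ.+ q ℕ.^ (N ℕ.+ M))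
      (≡.sym (upper≡coversIn x))
      (≡.trans (≡.cong₂ ℕ._+_ (solve 3 (λ q p n → q :* (p :* n) := n :* (q :* p)) ≡.refl q p n)
          (≡.sym (≡.trans (#-cong {whole ∩ (vertex x ⊕ h)} {vertex x ⊕ h}
            ((λ v v∈ → v∈) , λ v v∈ → v∈)) (#-⊕h {vertex x} (vertex-disjoint x)))))
        (≡.trans (cover-count-in x whole λ _ _ → tt) (≡.cong₂ ℕ._+_ (ℕ.*-comm n p) #-whole)))
      where
      open +-*-Solver
      p n : ℕ
      p = q ℕ.^ dimension x
      n = coversIn x whole

    interval : ∀ x z → vertex x ⊆ vertex z → dimension z ≡ suc (suc (dimension x)) → (cᵗ ⊙ cᵗ) x z ≡ q ℕ.+ 1
    interval x z x⊆z dim-z = ≡.trans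
      (sum-cong-≗ λ w → given {w} {x} λ w⋗x → ⟨⟩-cong (covers? z w) (within? (vertex w) (vertex z)) proj₁
        λ w⊆z → w⊆z , ≡.trans dim-z (≡.cong suc (≡.sym (proj₂ w⋗x))))
      (interval-count 2≤q (coversIn x (vertex z)) (q ℕ.^ dimension x) {{ℕ.m^n≢0 q (dimension x)}}
        (≡.trans (≡.cong (λ s → coversIn x (vertex z) ℕ.* q ℕ.^ suc (dimension x) ℕ.+ s)
            (≡.sym (≡.trans (#-cong {vertex z ∩ (vertex x ⊕ h)} {vertex x} (∩⊕h≐ x {vertex z} x⊆z (vertex-disjoint z))) (#-dim (vertex x)))))
          (≡.trans (cover-count-in x (vertex z) x⊆z)
            (≡.cong (λ s → coversIn x (vertex z) ℕ.* q ℕ.^ dimension x ℕ.+ s)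
              (≡.trans (#-dim (vertex z)) (≡.cong (q ℕ.^_) dim-z))))))

    interval-empty : ∀ x z → ¬ vertex x ⊆ vertex z → (cᵗ ⊙ cᵗ) x z ≡ 0
    interval-empty x z x⊈z = sum-zero (λ w → c w x ℕ.* c z w) λ w → given₀ {w} {x} λ w⋗x →
      c-no {z} {w} λ z⋗w → x⊈z λ v v∈x → proj₁ z⋗w v (proj₁ w⋗x v v∈x)

    interval-indicator : ∀ x z → dimension z ≡ suc (suc (dimension x)) →
      (cᵗ ⊙ cᵗ) x z ≡ (q ℕ.+ 1) ℕ.* ⟨ within? (vertex x) (vertex z) ⟩
    interval-indicator x z dim-z = case within? (vertex x) (vertex z) of λ where
      (yes x⊆z) → ≡.trans (interval x z x⊆z dim-z) (≡.sym (≡.trans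
        (≡.cong ((q ℕ.+ 1) ℕ.*_) (⟨⟩-yes (within? (vertex x) (vertex z)) x⊆z)) (ℕ.*-identityʳ _)))
      (no x⊈z)  → ≡.trans (interval-empty x z x⊈z) (≡.sym (≡.trans
        (≡.cong ((q ℕ.+ 1) ℕ.*_) (⟨⟩-no (within? (vertex x) (vertex z)) x⊈z)) (ℕ.*-zeroʳ (q ℕ.+ 1))))

    hyperplane-∩ : ∀ {Y Z X v} → Y ⊆ Z → dim Z ≡ suc (dim Y) → X ⊆ Z → v ∈ X → ¬ v ∈ Y → dim X ≡ suc (dim (X ∩ Y))
    hyperplane-∩ {Y} {Z} {X} {v} Y⊆Z dim-Z X⊆Z v∈X v∉Y = ≡.trans (dim-cong {X} {ext (X ∩ Y) v} (X⊆ , ⊆X))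
      (dim-ext (X ∩ Y) v λ v∈ → v∉Y (proj₂ (∩-elim X Y v∈)))
      where
      Z⊆ : Z ⊆ ext Y v
      Z⊆ = ⊆∧dim≡⇒⊇ {ext Y v} {Z} (ext-⊆ Y v Z Y⊆Z (X⊆Z v v∈X)) (≡.trans (dim-ext Y v v∉Y) (≡.sym dim-Z))
      X⊆ : X ⊆ ext (X ∩ Y) v
      X⊆ e e∈X = let (a , u , u∈Y , eq) = ext-elim Y v (Z⊆ e (X⊆Z e e∈X)) in
        ext-intro (X ∩ Y) v a (∩-intro X Y (right∈ X eq e∈X (*ₗ-closed X a v∈X)) u∈Y) eq
      ⊆X : ext (X ∩ Y) v ⊆ X
      ⊆X = ext-⊆ (X ∩ Y) v X (λ u u∈ → proj₁ (∩-elim X Y u∈)) v∈X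

    meet : ∀ x y → ∃ λ s → vertex x ∩ vertex y ≐ vertex s
    meet x y = vertex-surjective (vertex x ∩ vertex y)
      (∩-disjoint {vertex x ∩ vertex y} {vertex x} (λ v v∈ → proj₁ (∩-elim (vertex x) (vertex y) v∈)) (vertex-disjoint x))

    meet-cover : ∀ {x y Z v} → vertex y ⊆ Z → dim Z ≡ suc (dimension y) → vertex x ⊆ Z → v ∈ vertex x → ¬ v ∈ vertex y →
      ∃ λ s → Covers x s × vertex s ⊆ vertex y
    meet-cover {x} {y} {Z} y⊆Z dim-Z x⊆Z v∈x v∉y =
      let (s , ∩⊆s , s⊆∩) = meet x y
      in s , ((λ u u∈s → proj₁ (∩-elim (vertex x) (vertex y) (s⊆∩ u u∈s))) ,
              ≡.trans (hyperplane-∩ {vertex y} {Z} {vertex x} y⊆Z dim-Z x⊆Z v∈x v∉y)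
                (≡.cong suc (dim-cong {vertex x ∩ vertex y} {vertex s} (∩⊆s , s⊆∩)))) ,
         λ u u∈s → proj₂ (∩-elim (vertex x) (vertex y) (s⊆∩ u u∈s))

    distinct-witness : ∀ {x u} → x ≢ u → dimension x ≡ dimension u → ∃ λ v → v ∈ vertex x × ¬ v ∈ vertex u
    distinct-witness {x} {u} x≢u eq = witness {vertex x} {vertex u} λ x⊆u → x≢u (vertex-eq {x} {u} x⊆u eq)

    -- The only common lower cover is x ∩ u.
    common-lower-cover : ∀ {x u Z} → x ≢ u → dimension x ≡ dimension u → vertex x ⊆ Z → vertex u ⊆ Z →
      dim Z ≡ suc (dimension u) → (c ⊙ cᵗ) x u ≡ 1
    common-lower-cover {x} {u} {Z} x≢u eq x⊆Z u⊆Z dim-Z =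
      let (v , v∈x , v∉u) = distinct-witness {x} {u} x≢u eq
          (s , x⋗s@(s⊆x , dim-x) , s⊆u) = meet-cover {x} {u} {Z} u⊆Z dim-Z x⊆Z v∈x v∉u
          u⋗s = s⊆u , ≡.trans (≡.sym eq) dim-x
      in sum-single (λ s → c x s ℕ.* c u s) s
        (≡.cong₂ ℕ._*_ (c-yes {x} {s} x⋗s) (c-yes {u} {s} u⋗s))
        λ s′ s′≢s → given₀ {x} {s′} λ x⋗s′ → c-no {u} {s′} λ u⋗s′ → s′≢s
          (≡.sym (vertex-eq {s} {s′} (λ w w∈s → s⊆∩s′ s s′ x⋗s u⋗s x⋗s′ u⋗s′ v v∈x v∉u w w∈s)
            (ℕ.suc-injective (≡.trans (≡.sym dim-x) (proj₂ x⋗s′)))))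
      where
      s⊆∩s′ : ∀ s s′ → Covers x s → Covers u s → Covers x s′ → Covers u s′ → ∀ v → v ∈ vertex x → ¬ v ∈ vertex u → vertex s ⊆ vertex s′
      s⊆∩s′ s s′ (s⊆x , _) (s⊆u , _) (s′⊆x , dim-x) (s′⊆u , _) v v∈x v∉u w w∈s =
        ⊆∧dim≡⇒⊇ {vertex s′} {vertex x ∩ vertex u} (λ w w∈ → ∩-intro (vertex x) (vertex u) (s′⊆x w w∈) (s′⊆u w w∈))
          (ℕ.suc-injective (≡.trans (≡.sym dim-x) (hyperplane-∩ {vertex u} {Z} {vertex x} u⊆Z dim-Z x⊆Z v∈x v∉u)))
          w (∩-intro (vertex x) (vertex u) (s⊆x w w∈s) (s⊆u w w∈s))

    sum-swap : ∀ {i j} (a : Fin i → ℕ) (b : Fin i → Fin j → ℕ) (d : Fin j → ℕ) →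
      (sum λ k → a k ℕ.* sum λ l → b k l ℕ.* d l) ≡ (sum λ l → d l ℕ.* sum λ k → a k ℕ.* b k l)
    sum-swap a b d = ≡.trans
      (sum-cong-≗ λ k → *-distribˡ-sum (a k) λ l → b k l ℕ.* d l)
      (≡.trans (∑-comm λ k l → a k ℕ.* (b k l ℕ.* d l))
        (sum-cong-≗ λ l → ≡.trans
          (sum-cong-≗ λ k → solve 3 (λ a b d → a :* (b :* d) := d :* (a :* b)) ≡.refl (a k) (b k l) (d l))
          (≡.sym (*-distribˡ-sum (d l) λ k → a k ℕ.* b k l))))
      where open +-*-Solver

    pull : ∀ {n} m (a b : Fin n → ℕ) → (sum λ i → a i ℕ.* (m ℕ.* b i)) ≡ m ℕ.* sum λ i → a i ℕ.* b i
    pull m a b = ≡.trans (sum-cong-≗ λ i → solve 3 (λ m a b → a :* (m :* b) := m :* (a :* b)) ≡.refl m (a i) (b i))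
      (≡.sym (*-distribˡ-sum m λ i → a i ℕ.* b i))
      where open +-*-Solver

    module _ (x y : Fin ∣X∣) where

      S₁ S₂ S₃ s₁ s₃ : ℕ
      S₁ = (cᵗ ⊙ cᵗ ⊙ c) x y
      S₂ = (cᵗ ⊙ c ⊙ cᵗ) x y
      S₃ = (c ⊙ cᵗ ⊙ cᵗ) x y
      s₁ = sum λ z → c z y ℕ.* ⟨ within? (vertex x) (vertex z) ⟩
      s₃ = sum λ u → c x u ℕ.* ⟨ within? (vertex u) (vertex y) ⟩

      S₁-zero : dimension y ≢ suc (dimension x) → S₁ ≡ 0
      S₁-zero dim≢ = sum-zero (λ w → c w x ℕ.* sum λ z → c z w ℕ.* c z y) λ w → given₀ {w} {x} λ (_ , dim-w) →
        sum-zero (λ z → c z w ℕ.* c z y) λ z → given₀ {z} {w} λ (_ , dim-z) → c-no {z} {y} λ (_ , dim-z′) →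
          dim≢ (≡.trans (ℕ.suc-injective (≡.trans (≡.sym dim-z′) dim-z)) dim-w)

      S₂-zero : dimension y ≢ suc (dimension x) → S₂ ≡ 0
      S₂-zero dim≢ = sum-zero (λ w → c w x ℕ.* sum λ u → c w u ℕ.* c y u) λ w → given₀ {w} {x} λ (_ , dim-w) →
        sum-zero (λ u → c w u ℕ.* c y u) λ u → given₀ {w} {u} λ (_ , dim-w′) → c-no {y} {u} λ (_ , dim-y) →
          dim≢ (≡.trans dim-y (≡.trans (≡.sym dim-w′) dim-w))

      S₃-zero : dimension y ≢ suc (dimension x) → S₃ ≡ 0
      S₃-zero dim≢ = sum-zero (λ u → c x u ℕ.* sum λ w → c w u ℕ.* c y w) λ u → given₀ {x} {u} λ (_ , dim-x) →
        sum-zero (λ w → c w u ℕ.* c y w) λ w → given₀ {w} {u} λ (_ , dim-w) → c-no {y} {w} λ (_ , dim-y) →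
          dim≢ (≡.trans dim-y (≡.cong suc (≡.trans dim-w (≡.sym dim-x))))

      module _ (dim-y : dimension y ≡ suc (dimension x)) where

        S₁≡ : S₁ ≡ (q ℕ.+ 1) ℕ.* s₁
        S₁≡ = ≡.trans (sum-swap (λ w → c w x) (λ w z → c z w) (λ z → c z y))
          (≡.trans (sum-cong-≗ λ z → given {z} {y} λ (_ , dim-z) → interval-indicator x z (≡.trans dim-z (≡.cong suc dim-y)))
            (pull (q ℕ.+ 1) (λ z → c z y) λ z → ⟨ within? (vertex x) (vertex z) ⟩))

        S₃≡ : S₃ ≡ (q ℕ.+ 1) ℕ.* s₃
        S₃≡ = ≡.trans (sum-cong-≗ λ u → given {x} {u} λ (_ , dim-x) → interval-indicator u y (≡.trans dim-y (≡.cong suc dim-x)))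
          (pull (q ℕ.+ 1) (λ u → c x u) λ u → ⟨ within? (vertex u) (vertex y) ⟩)

        module _ (x⊆y : vertex x ⊆ vertex y) where

          private
            lower R : ℕ
            lower = (c ⊙ cᵗ) x x
            R = sum λ u → c y u ℕ.* ⟨ ¬? (u Fin.≟ x) ⟩

            isolate : ∀ (f : Fin ∣X∣ → ℕ) → (∀ u → u ≢ x → Covers y u → f u ≡ 1) →
              (sum λ u → c y u ℕ.* f u) ≡ f x ℕ.+ R
            isolate f f≡1 = ≡.trans (sum-cong-≗ at)
              (≡.trans (∑-distrib-+ (λ u → ⟨ u Fin.≟ x ⟩ ℕ.* f x) λ u → c y u ℕ.* ⟨ ¬? (u Fin.≟ x) ⟩)
                (≡.cong (ℕ._+ R) (sum-single (λ u → ⟨ u Fin.≟ x ⟩ ℕ.* f x) x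
                  (≡.trans (≡.cong (ℕ._* f x) (⟨⟩-yes (x Fin.≟ x) ≡.refl)) (ℕ.+-identityʳ (f x)))
                  λ u u≢x → ≡.cong (ℕ._* f x) (⟨⟩-no (u Fin.≟ x) u≢x))))
              where
              at : ∀ u → c y u ℕ.* f u ≡ ⟨ u Fin.≟ x ⟩ ℕ.* f x ℕ.+ c y u ℕ.* ⟨ ¬? (u Fin.≟ x) ⟩
              at u = case u Fin.≟ x of λ where
                (yes ≡.refl) → ≡.trans (≡.cong (ℕ._* f x) (c-yes {y} {x} (x⊆y , dim-y)))
                  (≡.sym (≡.trans (≡.cong₂ ℕ._+_ (≡.cong (ℕ._* f x) (⟨⟩-yes (x Fin.≟ x) ≡.refl))
                    (≡.trans (≡.cong (c y x ℕ.*_) (⟨⟩-no (¬? (x Fin.≟ x)) λ x≢x → x≢x ≡.refl)) (ℕ.*-zeroʳ (c y x))))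
                    (ℕ.+-identityʳ (1 ℕ.* f x))))
                (no u≢x) → ≡.trans (given {y} {u} λ y⋗u → ≡.trans (f≡1 u u≢x y⋗u) (≡.sym (⟨⟩-yes (¬? (u Fin.≟ x)) u≢x)))
                  (≡.cong (λ s → s ℕ.* f x ℕ.+ c y u ℕ.* ⟨ ¬? (u Fin.≟ x) ⟩) (≡.sym (⟨⟩-no (u Fin.≟ x) u≢x)))

            common-upper-cover : ∀ u → u ≢ x → Covers y u → (cᵗ ⊙ c) x u ≡ 1
            common-upper-cover u u≢x (u⊆y , dim-y′) =
              let (v , v∈u , v∉x) = distinct-witness {u} {x} u≢x (ℕ.suc-injective (≡.trans (≡.sym dim-y′) dim-y))
              in sum-single (λ w → c w x ℕ.* c w u) y
                (≡.cong₂ ℕ._*_ (c-yes {y} {x} (x⊆y , dim-y)) (c-yes {y} {u} (u⊆y , dim-y′)))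
                λ w w≢y → given₀ {w} {x} λ w⋗x → c-no {w} {u} λ w⋗u → w≢y (vertex-eq {w} {y}
                  (λ e e∈w → ext-⊆ (vertex x) v (vertex y) x⊆y (u⊆y v v∈u) e
                    (cover⊆ext {w} {x} w⋗x (proj₁ w⋗u v v∈u) v∉x e e∈w))
                  (≡.trans (proj₂ w⋗x) (≡.sym dim-y)))

          S₂≡upper+R : S₂ ≡ upper x ℕ.+ R
          S₂≡upper+R = ≡.trans (sum-swap (λ w → c w x) (λ w u → c w u) (λ u → c y u))
            (isolate (λ u → (cᵗ ⊙ c) x u) common-upper-cover)

          S₃≡lower+R : S₃ ≡ lower ℕ.+ R
          S₃≡lower+R = ≡.trans (sum-swap (λ s → c x s) (λ s u → c u s) (λ u → c y u))
            (isolate (λ u → (c ⊙ cᵗ) x u) λ u u≢x (u⊆y , dim-y′) → common-lower-cover {x} {u} {vertex y}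
              (u≢x ∘ ≡.sym) (ℕ.suc-injective (≡.trans (≡.sym dim-y) dim-y′)) x⊆y u⊆y dim-y′)

          s₁≡upper : s₁ ≡ upper y
          s₁≡upper = sum-cong-≗ λ z → given {z} {y} λ z⋗y → ≡.trans
            (⟨⟩-yes (within? (vertex x) (vertex z)) λ v v∈x → proj₁ z⋗y v (x⊆y v v∈x)) (≡.sym (c-yes {z} {y} z⋗y))

          s₃≡lower : s₃ ≡ lower
          s₃≡lower = sum-cong-≗ λ u → given {x} {u} λ x⋗u → ≡.trans
            (⟨⟩-yes (within? (vertex u) (vertex y)) λ v v∈u → x⊆y v (proj₁ x⋗u v v∈u)) (≡.sym (c-yes {x} {u} x⋗u))

          R≡ : R ≡ q ℕ.* s₃
          R≡ = ≡.trans (ℕ.+-cancelˡ-≡ lower R (q ℕ.* lower) (≡.trans (≡.sym S₃≡lower+R)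
              (≡.trans S₃≡ (≡.trans (≡.cong ((q ℕ.+ 1) ℕ.*_) s₃≡lower)
                (solve 2 (λ q f → (q :+ con 1) :* f := f :+ q :* f) ≡.refl q lower)))))
            (≡.cong (q ℕ.*_) (≡.sym s₃≡lower))
            where open +-*-Solver

          S₂≡ : q ℕ.^ suc (dimension x) ℕ.* S₂ ≡ q ℕ.^ suc (dimension x) ℕ.* (s₁ ℕ.+ q ℕ.* s₃) ℕ.+ q ℕ.^ (N ℕ.+ M)
          S₂≡ = ≡.trans
            (≡.cong (q ℕ.* p ℕ.*_) (≡.trans S₂≡upper+R (≡.cong (upper x ℕ.+_) R≡)))
            (≡.trans (solve 4 (λ q p g s → q :* p :* (g :+ q :* s) := q :* (p :* g) :+ q :* p :* (q :* s)) ≡.refl q p (upper x) s₃)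
            (≡.trans (≡.cong (ℕ._+ q ℕ.* p ℕ.* (q ℕ.* s₃)) (≡.sym difference))
            (≡.trans (≡.cong (λ g → q ℕ.* p ℕ.* g ℕ.+ q ℕ.^ (N ℕ.+ M) ℕ.+ q ℕ.* p ℕ.* (q ℕ.* s₃)) (≡.sym s₁≡upper))
              (solve 5 (λ q p s Q t → q :* p :* s :+ Q :+ q :* p :* (q :* t) := q :* p :* (s :+ q :* t) :+ Q) ≡.refl
                q p s₁ (q ℕ.^ (N ℕ.+ M)) s₃))))
            where
            open +-*-Solver
            p : ℕ
            p = q ℕ.^ dimension x
            difference : q ℕ.* p ℕ.* upper y ℕ.+ q ℕ.^ (N ℕ.+ M) ≡ q ℕ.* (p ℕ.* upper x)
            difference = successive-counts 2≤q (p ℕ.* upper x) (q ℕ.* p ℕ.* upper y) (q ℕ.^ (dimension x ℕ.+ M)) (q ℕ.^ (N ℕ.+ M))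
              (upper-count x)
              (≡.subst (λ d → q ℕ.* (q ℕ.^ d ℕ.* upper y) ℕ.+ q ℕ.^ (d ℕ.+ M) ≡ q ℕ.^ d ℕ.* upper y ℕ.+ q ℕ.^ (N ℕ.+ M))
                dim-y (upper-count y))

        module _ (x⊈y : ¬ vertex x ⊆ vertex y) where

          no-lower : (∀ u → Covers x u → ¬ vertex u ⊆ vertex y) → S₂ ≡ s₁ ℕ.+ q ℕ.* s₃
          no-lower none = ≡.trans S₂≡0 (≡.sym (≡.cong₂ ℕ._+_ s₁≡0 (≡.trans (≡.cong (q ℕ.*_) s₃≡0) (ℕ.*-zeroʳ q))))
            where
            s₃≡0 : s₃ ≡ 0
            s₃≡0 = sum-zero (λ u → c x u ℕ.* ⟨ within? (vertex u) (vertex y) ⟩) λ u → given₀ {x} {u} λ x⋗u →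
              ⟨⟩-no (within? (vertex u) (vertex y)) (none u x⋗u)
            s₁≡0 : s₁ ≡ 0
            s₁≡0 = sum-zero (λ z → c z y ℕ.* ⟨ within? (vertex x) (vertex z) ⟩) λ z → given₀ {z} {y} λ (y⊆z , dim-z) →
              ⟨⟩-no (within? (vertex x) (vertex z)) λ x⊆z →
                let (v , v∈x , v∉y) = witness {vertex x} {vertex y} x⊈y
                    (s , x⋗s , s⊆y) = meet-cover {x} {y} {vertex z} y⊆z dim-z x⊆z v∈x v∉y
                in none s x⋗s s⊆y
            S₂≡0 : S₂ ≡ 0
            S₂≡0 = sum-zero (λ w → c w x ℕ.* sum λ u → c w u ℕ.* c y u) λ w → given₀ {w} {x} λ (x⊆w , dim-w) →
              sum-zero (λ u → c w u ℕ.* c y u) λ u → given₀ {w} {u} λ (u⊆w , dim-w′) → c-no {y} {u} λ (u⊆y , _) →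
                let (v , v∈x , v∉u) = distinct-witness {x} {u} (λ { ≡.refl → x⊈y u⊆y })
                                        (ℕ.suc-injective (≡.trans (≡.sym dim-w) dim-w′))
                    (s , x⋗s , s⊆u) = meet-cover {x} {u} {vertex w} u⊆w dim-w′ x⊆w v∈x v∉u
                in none s x⋗s λ e e∈s → u⊆y e (s⊆u e e∈s)

          module _ (u₀ : Fin ∣X∣) (x⋗u₀ : Covers x u₀) (u₀⊆y : vertex u₀ ⊆ vertex y) where

            private
              v : Carrierᴹ
              v = proj₁ (witness {vertex x} {vertex y} x⊈y)
              v∈x : v ∈ vertex x
              v∈x = proj₁ (proj₂ (witness {vertex x} {vertex y} x⊈y))
              v∉y : ¬ v ∈ vertex y
              v∉y = proj₂ (proj₂ (witness {vertex x} {vertex y} x⊈y))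

              -- Z = x + y
              Z : Subspace
              Z = ext (vertex y) v

              y⊆Z : vertex y ⊆ Z
              y⊆Z = ⊆-ext (vertex y) v

              dim-Z : dim Z ≡ suc (dimension y)
              dim-Z = dim-ext (vertex y) v v∉y

              x⊆Z : vertex x ⊆ Z
              x⊆Z e e∈x = ext-⊆ (vertex u₀) v Z (λ u u∈u₀ → y⊆Z u (u₀⊆y u u∈u₀)) (∈-ext (vertex y) v) e
                (cover⊆ext {x} {u₀} x⋗u₀ v∈x (λ v∈u₀ → v∉y (u₀⊆y v v∈u₀)) e e∈x)

              Z⊆ : ∀ {z} → vertex y ⊆ vertex z → vertex x ⊆ vertex z → Z ⊆ vertex z
              Z⊆ {z} y⊆z x⊆z = ext-⊆ (vertex y) v (vertex z) y⊆z (x⊆z v v∈x)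

              s₃≡1 : s₃ ≡ 1
              s₃≡1 = sum-single (λ u → c x u ℕ.* ⟨ within? (vertex u) (vertex y) ⟩) u₀
                (≡.cong₂ ℕ._*_ (c-yes {x} {u₀} x⋗u₀) (⟨⟩-yes (within? (vertex u₀) (vertex y)) u₀⊆y))
                λ u u≢u₀ → given₀ {x} {u} λ x⋗u → ⟨⟩-no (within? (vertex u) (vertex y)) λ u⊆y →
                  u≢u₀ (vertex-eq {u} {u₀} (u⊆u₀ u x⋗u u⊆y) (ℕ.suc-injective (≡.trans (≡.sym (proj₂ x⋗u)) (proj₂ x⋗u₀))))
                where
                u⊆u₀ : ∀ u → Covers x u → vertex u ⊆ vertex y → vertex u ⊆ vertex u₀
                u⊆u₀ u (u⊆x , _) u⊆y e e∈u =
                  ⊆∧dim≡⇒⊇ {vertex u₀} {vertex x ∩ vertex y}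
                    (λ e e∈ → ∩-intro (vertex x) (vertex y) (proj₁ x⋗u₀ e e∈) (u₀⊆y e e∈))
                    (ℕ.suc-injective (≡.trans (≡.sym (proj₂ x⋗u₀))
                      (hyperplane-∩ {vertex y} {Z} {vertex x} y⊆Z dim-Z x⊆Z v∈x v∉y)))
                    e (∩-intro (vertex x) (vertex y) (u⊆x e e∈u) (u⊆y e e∈u))

              lower-covers : ∀ w → Covers w x → (c ⊙ cᵗ) w y ≡ ⟨ within? (vertex w) Z ⟩
              lower-covers w (x⊆w , dim-w) = case within? (vertex w) Z of λ where
                (yes w⊆Z) → ≡.trans
                  (common-lower-cover {w} {y} {Z} (λ { ≡.refl → x⊈y x⊆w }) (≡.trans dim-w (≡.sym dim-y)) w⊆Z y⊆Z dim-Z)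
                  (≡.sym (⟨⟩-yes (within? (vertex w) Z) w⊆Z))
                (no w⊈Z) → ≡.trans
                  (sum-zero (λ u → c w u ℕ.* c y u) λ u → given₀ {w} {u} λ (u⊆w , dim-w′) → c-no {y} {u} λ (u⊆y , _) →
                    let (e , e∈u , e∉x) = distinct-witness {u} {x} (λ { ≡.refl → x⊈y u⊆y })
                                            (ℕ.suc-injective (≡.trans (≡.sym dim-w′) dim-w))
                    in w⊈Z λ f f∈w → ext-⊆ (vertex x) e Z x⊆Z (y⊆Z e (u⊆y e e∈u)) f
                      (cover⊆ext {w} {x} (x⊆w , dim-w) (u⊆w e e∈u) e∉x f f∈w))
                  (≡.sym (⟨⟩-no (within? (vertex w) Z) w⊈Z))

              S₂≡coversIn : S₂ ≡ coversIn x Z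
              S₂≡coversIn = sum-cong-≗ λ w → given {w} {x} (lower-covers w)

              count : ∀ {a} → # (Z ∩ (vertex x ⊕ h)) ≡ a →
                S₂ ℕ.* (q ℕ.* q ℕ.^ dimension x) ℕ.+ a ≡ S₂ ℕ.* q ℕ.^ dimension x ℕ.+ q ℕ.* (q ℕ.* q ℕ.^ dimension x)
              count ≡.refl = ≡.subst
                (λ n → n ℕ.* q ℕ.^ suc (dimension x) ℕ.+ # (Z ∩ (vertex x ⊕ h)) ≡ n ℕ.* q ℕ.^ dimension x ℕ.+ q ℕ.^ suc (suc (dimension x)))
                (≡.sym S₂≡coversIn)
                (≡.trans (cover-count-in x Z x⊆Z) (≡.cong (λ s → coversIn x Z ℕ.* q ℕ.^ dimension x ℕ.+ s)
                  (≡.trans (#-dim Z) (≡.cong (q ℕ.^_) (≡.trans dim-Z (≡.cong suc dim-y))))))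

              p-nonZero : ℕ.NonZero (q ℕ.^ dimension x)
              p-nonZero = ℕ.m^n≢0 q (dimension x)

            join-good : Disjoint Z h → S₂ ≡ s₁ ℕ.+ q ℕ.* s₃
            join-good disjoint = ≡.trans
              (interval-count 2≤q S₂ (q ℕ.^ dimension x) {{p-nonZero}} (count
                (≡.trans (#-cong {Z ∩ (vertex x ⊕ h)} {vertex x} (∩⊕h≐ x {Z} x⊆Z disjoint)) (#-dim (vertex x)))))
              (≡.sym (≡.trans (≡.cong₂ (λ a b → a ℕ.+ q ℕ.* b) s₁≡1 s₃≡1)
                (≡.trans (≡.cong (1 ℕ.+_) (ℕ.*-identityʳ q)) (ℕ.+-comm 1 q))))
              where
              s₁≡1 : s₁ ≡ 1
              s₁≡1 =
                let (z , z⋗y , Z⊆z , z⊆Z) = ext-cover y v v∉y disjoint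
                in sum-single (λ z → c z y ℕ.* ⟨ within? (vertex x) (vertex z) ⟩) z
                  (≡.cong₂ ℕ._*_ (c-yes {z} {y} z⋗y)
                    (⟨⟩-yes (within? (vertex x) (vertex z)) λ e e∈x → Z⊆z e (x⊆Z e e∈x)))
                  λ z′ z′≢z → given₀ {z′} {y} λ z′⋗y → ⟨⟩-no (within? (vertex x) (vertex z′)) λ x⊆z′ →
                    z′≢z (≡.sym (vertex-eq {z} {z′} (λ e e∈z → Z⊆ {z′} (proj₁ z′⋗y) x⊆z′ e (z⊆Z e e∈z))
                      (≡.trans (proj₂ z⋗y) (≡.sym (proj₂ z′⋗y)))))

            join-bad : ∀ η → η ∈ Z → η ∈ h → ¬ η ≈ᴹ 0ᴹ → S₂ ≡ s₁ ℕ.+ q ℕ.* s₃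
            join-bad η η∈Z η∈h η≉0 = ≡.trans
              (bad-interval-count 2≤q S₂ (q ℕ.^ dimension x) {{p-nonZero}} (count
                (≡.trans (#-cong {Z ∩ (vertex x ⊕ h)} {ext (vertex x) η} (⊆ext , ext⊆))
                  (≡.trans (#-dim (ext (vertex x) η)) (≡.cong (q ℕ.^_) (dim-ext (vertex x) η (η∉ x)))))))
              (≡.sym (≡.trans (≡.cong₂ (λ a b → a ℕ.+ q ℕ.* b) s₁≡0 s₃≡1) (ℕ.*-identityʳ q)))
              where
              η∉ : ∀ x → ¬ η ∈ vertex x
              η∉ x η∈x = η≉0 (vertex-disjoint x η η∈x η∈h)
              Z⊆ext : Z ⊆ ext (vertex y) η
              Z⊆ext = ⊆∧dim≡⇒⊇ {ext (vertex y) η} {Z} (ext-⊆ (vertex y) η Z y⊆Z η∈Z)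
                (≡.trans (dim-ext (vertex y) η (η∉ y)) (≡.sym dim-Z))
              ⊆ext : Z ∩ (vertex x ⊕ h) ⊆ ext (vertex x) η
              ⊆ext e e∈ =
                let (e∈Z , e∈x⊕h) = ∩-elim Z (vertex x ⊕ h) e∈
                    (u , b , u∈x , b∈h , eq) = ⊕-elim (vertex x) h e∈x⊕h
                    (a , w , w∈y , b≈) = ext-elim (vertex y) η (Z⊆ext b (right∈ Z eq e∈Z (x⊆Z u u∈x)))
                    w≈0 = vertex-disjoint y w w∈y (right∈ h b≈ b∈h (*ₗ-closed h a η∈h))
                in ext-intro (vertex x) η a u∈x (≈ᴹ-trans eq (≈ᴹ-trans (+ᴹ-comm u b)
                     (+ᴹ-congʳ (≈ᴹ-trans b≈ (≈ᴹ-trans (+ᴹ-congˡ w≈0) (+ᴹ-identityʳ (a *ₗ η)))))))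
              ext⊆ : ext (vertex x) η ⊆ Z ∩ (vertex x ⊕ h)
              ext⊆ = ext-⊆ (vertex x) η (Z ∩ (vertex x ⊕ h))
                (λ e e∈x → ∩-intro Z (vertex x ⊕ h) (x⊆Z e e∈x) (⊆-⊕ˡ (vertex x) h e e∈x))
                (∩-intro Z (vertex x ⊕ h) η∈Z (⊕-intro (vertex x) h (0ᴹ , η , 0-member (vertex x) , η∈h , ≈ᴹ-sym (+ᴹ-identityˡ η))))
              s₁≡0 : s₁ ≡ 0
              s₁≡0 = sum-zero (λ z → c z y ℕ.* ⟨ within? (vertex x) (vertex z) ⟩) λ z → given₀ {z} {y} λ (y⊆z , _) →
                ⟨⟩-no (within? (vertex x) (vertex z)) λ x⊆z → η∉ z (Z⊆ {z} y⊆z x⊆z η η∈Z)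

            one-lower : S₂ ≡ s₁ ℕ.+ q ℕ.* s₃
            one-lower = case Fin.any? bad? of λ where
                (yes (k , k∈Z , k∈h , k≉0)) → join-bad (point k) k∈Z k∈h k≉0
                (no none) → join-good λ e e∈Z e∈h → case e ≟ᴹ 0ᴹ of λ where
                  (yes e≈0) → e≈0
                  (no e≉0)  → contradiction
                    (code e , member-≈ Z (≈ᴹ-sym (point-code e)) e∈Z , member-≈ h (≈ᴹ-sym (point-code e)) e∈h ,
                      λ k≈0 → e≉0 (≈ᴹ-trans (≈ᴹ-sym (point-code e)) k≈0))
                    none
              where
              abstract
                bad? : ∀ k → Dec (point k ∈ Z × point k ∈ h × ¬ point k ≈ᴹ 0ᴹ)
                bad? k = T? (member Z (point k)) ×-dec T? (member h (point k)) ×-dec ¬? (point k ≟ᴹ 0ᴹ)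

          S₂≡s₁+qs₃ : S₂ ≡ s₁ ℕ.+ q ℕ.* s₃
          S₂≡s₁+qs₃ = case Fin.any? (λ u → covers? x u ×-dec within? (vertex u) (vertex y)) of λ where
            (yes (u , x⋗u , u⊆y)) → one-lower u x⋗u u⊆y
            (no none)             → no-lower λ u x⋗u u⊆y → none (u , x⋗u , u⊆y)

      relation : dimension y ≡ suc (dimension x) →
        q ℕ.^ suc (dimension x) ℕ.* (S₁ ℕ.+ q ℕ.* S₃) ℕ.+ (q ℕ.+ 1) ℕ.* q ℕ.^ (N ℕ.+ M) ℕ.* c y x ≡
        (q ℕ.+ 1) ℕ.* q ℕ.^ suc (dimension x) ℕ.* S₂
      relation dim-y = ≡.trans
        (≡.cong₂ (λ a b → P ℕ.* (a ℕ.+ q ℕ.* b) ℕ.+ (q ℕ.+ 1) ℕ.* Q ℕ.* c y x) (S₁≡ dim-y) (S₃≡ dim-y))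
        (≡.trans (solve 6 (λ P q s₁ s₃ Q i →
            P :* ((q :+ con 1) :* s₁ :+ q :* ((q :+ con 1) :* s₃)) :+ (q :+ con 1) :* Q :* i :=
            (q :+ con 1) :* (P :* (s₁ :+ q :* s₃) :+ Q :* i)) ≡.refl P q s₁ s₃ Q (c y x))
          (≡.trans (≡.cong ((q ℕ.+ 1) ℕ.*_) main) (≡.sym (ℕ.*-assoc (q ℕ.+ 1) P S₂))))
        where
        open +-*-Solver
        P Q : ℕ
        P = q ℕ.^ suc (dimension x)
        Q = q ℕ.^ (N ℕ.+ M)
        main : P ℕ.* (s₁ ℕ.+ q ℕ.* s₃) ℕ.+ Q ℕ.* c y x ≡ P ℕ.* S₂
        main = case within? (vertex x) (vertex y) of λ where
          (yes x⊆y) → ≡.trans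
            (≡.cong (λ i → P ℕ.* (s₁ ℕ.+ q ℕ.* s₃) ℕ.+ i)
              (≡.trans (≡.cong (Q ℕ.*_) (c-yes {y} {x} (x⊆y , dim-y))) (ℕ.*-identityʳ Q)))
            (≡.sym (S₂≡ dim-y x⊆y))
          (no x⊈y) → ≡.trans
            (≡.cong (λ i → P ℕ.* (s₁ ℕ.+ q ℕ.* s₃) ℕ.+ i)
              (≡.trans (≡.cong (Q ℕ.*_) (c-no {y} {x} λ (x⊆y , _) → x⊈y x⊆y)) (ℕ.*-zeroʳ Q)))
            (≡.trans (ℕ.+-identityʳ _) (≡.cong (P ℕ.*_) (≡.sym (S₂≡s₁+qs₃ dim-y x⊈y))))

      relation-off : ∀ P → dimension y ≢ suc (dimension x) →
        P ℕ.* (S₁ ℕ.+ q ℕ.* S₃) ℕ.+ (q ℕ.+ 1) ℕ.* q ℕ.^ (N ℕ.+ M) ℕ.* c y x ≡ (q ℕ.+ 1) ℕ.* P ℕ.* S₂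
      relation-off P dim≢ = ≡.trans
        (≡.cong₂ ℕ._+_
          (≡.trans (≡.cong₂ (λ a b → P ℕ.* (a ℕ.+ q ℕ.* b)) (S₁-zero dim≢) (S₃-zero dim≢))
            (≡.trans (≡.cong (P ℕ.*_) (ℕ.*-zeroʳ q)) (ℕ.*-zeroʳ P)))
          (≡.trans (≡.cong ((q ℕ.+ 1) ℕ.* q ℕ.^ (N ℕ.+ M) ℕ.*_) (c-no {y} {x} λ (_ , dim-y) → dim≢ dim-y))
            (ℕ.*-zeroʳ ((q ℕ.+ 1) ℕ.* q ℕ.^ (N ℕ.+ M)))))
        (≡.sym (≡.trans (≡.cong ((q ℕ.+ 1) ℕ.* P ℕ.*_) (S₂-zero dim≢)) (ℕ.*-zeroʳ ((q ℕ.+ 1) ℕ.* P))))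

    private
      abstract
        zeroSpace : Subspace
        zeroSpace = span {0} λ ()

        zeroSpace-≈0 : ∀ {v} → v ∈ zeroSpace → v ≈ᴹ 0ᴹ
        zeroSpace-≈0 {v} v∈ = ≈ᴹ-sym (proj₂ (toWitness {a? = span? {0} (λ ()) v} v∈))

        dim-zeroSpace : dim zeroSpace ≡ 0
        dim-zeroSpace = dim-unique {zeroSpace} ((λ ()) , record
          { inside = λ () ; independent = λ _ _ ()
          ; spanning = λ v v∈ → toWitness {a? = span? {0} (λ ()) v} v∈ })

      zero-vertex : ∃ λ i → zeroSpace ≐ vertex i
      zero-vertex = vertex-surjective zeroSpace λ v v∈ _ → zeroSpace-≈0 v∈

    o : Fin ∣X∣
    o = proj₁ zero-vertex

    o-≈0 : ∀ {v} → v ∈ vertex o → v ≈ᴹ 0ᴹ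
    o-≈0 {v} v∈o = zeroSpace-≈0 (proj₂ (proj₂ zero-vertex) v v∈o)

    o⊆ : ∀ U → vertex o ⊆ U
    o⊆ U v v∈o = member-≈ U (≈ᴹ-sym (o-≈0 v∈o)) (0-member U)

    dim-o : dimension o ≡ 0
    dim-o = ≡.trans (≡.sym (dim-cong {zeroSpace} {vertex o} (proj₂ zero-vertex))) dim-zeroSpace

    o-unique : ∀ y → dimension y ≡ 0 → y ≡ o
    o-unique y dim-y = ≡.sym (vertex-eq {o} {y} (o⊆ (vertex y)) (≡.trans dim-o (≡.sym dim-y)))

    module Line (a : Carrierᴹ) (a∉h : ¬ a ∈ h) where

      private
        line : ∃ λ w → Covers w o × ext (vertex o) a ≐ vertex w
        line = ext-cover o a (λ a∈o → a∉h (o⊆ h a a∈o)) (∉⊕h⇒ext-disjoint o a λ a∈ →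
          let (u , η , u∈o , η∈h , eq) = ⊕-elim (vertex o) h a∈ in a∉h (sum∈ h eq (o⊆ h u u∈o) η∈h))

      p : Fin ∣X∣
      p = proj₁ line

      p⋗o : Covers p o
      p⋗o = proj₁ (proj₂ line)

      dim-p : dimension p ≡ 1
      dim-p = ≡.trans (proj₂ p⋗o) (≡.cong suc dim-o)

      a∈p : a ∈ vertex p
      a∈p = proj₁ (proj₂ (proj₂ line)) a (∈-ext (vertex o) a)

      p⊆ : ∀ U → a ∈ U → vertex p ⊆ U
      p⊆ U a∈U v v∈p = ext-⊆ (vertex o) a U (o⊆ U) a∈U v (proj₂ (proj₂ (proj₂ line)) v v∈p)

      module _ (y : Fin ∣X∣) (dim-y : dimension y ≡ 1) (y≢p : y ≢ p) where

        a∉y : ¬ a ∈ vertex y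
        a∉y a∈y = y≢p (≡.sym (vertex-eq {p} {y} (p⊆ (vertex y) a∈y) (≡.trans dim-p (≡.sym dim-y))))

        joins-good : Disjoint (ext (vertex y) a) h → (cᵗ ⊙ c) y p ≡ 1
        joins-good disjoint =
          let (z , z⋗y , e⊆z , z⊆e) = ext-cover y a a∉y disjoint
          in sum-single (λ z → c z y ℕ.* c z p) z
            (≡.cong₂ ℕ._*_ (c-yes {z} {y} z⋗y) (c-yes {z} {p}
              (p⊆ (vertex z) (e⊆z a (∈-ext (vertex y) a)) , ≡.trans (proj₂ z⋗y) (≡.cong suc (≡.trans dim-y (≡.sym dim-p))))))
            λ z′ z′≢z → given₀ {z′} {y} λ z′⋗y → c-no {z′} {p} λ z′⋗p → z′≢z (vertex-eq {z′} {z}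
              (λ e e∈z′ → e⊆z e (cover⊆ext {z′} {y} z′⋗y (proj₁ z′⋗p a a∈p) a∉y e e∈z′))
              (≡.trans (proj₂ z′⋗y) (≡.sym (proj₂ z⋗y))))

        joins-bad : ¬ Disjoint (ext (vertex y) a) h → (cᵗ ⊙ c) y p ≡ 0
        joins-bad ¬disjoint = sum-zero (λ z → c z y ℕ.* c z p) λ z → given₀ {z} {y} λ (y⊆z , _) → c-no {z} {p} λ (p⊆z , _) →
          ¬disjoint (∩-disjoint {ext (vertex y) a} {vertex z} (ext-⊆ (vertex y) a (vertex z) y⊆z (p⊆z a a∈p)) (vertex-disjoint z))

    translate-disjoint : ∀ y {a a′ η} → η ∈ h → a′ ≈ᴹ a +ᴹ η → ¬ a ∈ vertex y →
      Disjoint (ext (vertex y) a) h → Disjoint (ext (vertex y) a′) h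
    translate-disjoint y {a} {a′} {η} η∈h a′≈ a∉y disjoint w w∈ext w∈h =
      let (b , u , u∈y , eq) = ext-elim (vertex y) a′ w∈ext
          w≈ : w ≈ᴹ (b *ₗ a +ᴹ u) +ᴹ b *ₗ η
          w≈ = ≈ᴹ-trans eq (≈ᴹ-trans (+ᴹ-congʳ (≈ᴹ-trans (*ₗ-congˡ a′≈) (*ₗ-distribˡ b a η)))
            (≈ᴹ-trans (+ᴹ-assoc (b *ₗ a) (b *ₗ η) u)
            (≈ᴹ-trans (+ᴹ-congˡ (+ᴹ-comm (b *ₗ η) u)) (≈ᴹ-sym (+ᴹ-assoc (b *ₗ a) u (b *ₗ η))))))
          ba+u≈0 = disjoint (b *ₗ a +ᴹ u) (ext-intro (vertex y) a b u∈y ≈ᴹ-refl) (left∈ h w≈ w∈h (*ₗ-closed h b η∈h))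
      in case b ≟ 0# of λ where
        (no b≉0)  → contradiction (unscale (vertex y) b≉0 (left∈ (vertex y) (≈ᴹ-sym ba+u≈0) (0-member (vertex y)) u∈y)) a∉y
        (yes b≈0) → vertex-disjoint y w (member-≈ (vertex y)
          (≈ᴹ-sym (≈ᴹ-trans eq (≈ᴹ-trans (+ᴹ-congʳ (≈ᴹ-trans (*ₗ-congʳ b≈0) (*ₗ-zeroˡ a′))) (+ᴹ-identityˡ u)))) u∈y) w∈h

    module _ (0<N : 0 ℕ.< N) (0<M : 0 ℕ.< M) where

      private
        outside : ∃ λ a → a ∈ whole × ¬ a ∈ h
        outside = witness {whole} {h} λ whole⊆h → ℕ.<⇒≱ (ℕ.+-monoˡ-< M 0<N)
          (q^-cancel-≤ (≡.subst₂ ℕ._≤_ #-whole (#-basis {h} dim-h) (#-mono {whole} {h} whole⊆h)))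

        inside : ∃ λ η → η ∈ h × ¬ η ∈ vertex o
        inside = witness {h} {vertex o} λ h⊆o → ℕ.<⇒≱ 0<M
          (q^-cancel-≤ (≡.subst₂ ℕ._≤_ (#-basis {h} dim-h) (≡.trans (#-dim (vertex o)) (≡.cong (q ℕ.^_) dim-o))
            (#-mono {h} {vertex o} h⊆o)))

        a η : Carrierᴹ
        a = proj₁ outside
        η = proj₁ inside

        a∉h : ¬ a ∈ h
        a∉h = proj₂ (proj₂ outside)

        η∈h : η ∈ h
        η∈h = proj₁ (proj₂ inside)

        module P₁ = Line a a∉h
        module P₂ = Line (a +ᴹ η) (λ a+η∈h → a∉h (left∈ h ≈ᴹ-refl a+η∈h η∈h))

        not-both : ∀ z → a ∈ vertex z → ¬ a +ᴹ η ∈ vertex z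
        not-both z a∈z a+η∈z = proj₂ (proj₂ inside) (member-≈ (vertex o)
          (≈ᴹ-sym (vertex-disjoint z η (right∈ (vertex z) ≈ᴹ-refl a+η∈z a∈z) η∈h)) (0-member (vertex o)))

        only-o : ∀ {p y} → dimension p ≡ 1 → Covers p y → y ≡ o
        only-o {y = y} dim-p (_ , dim-p′) = o-unique y (ℕ.suc-injective (≡.trans (≡.sym dim-p′) dim-p))

        p-covers : ∀ y → c P₁.p y ≡ c P₂.p y
        p-covers y = ⟨⟩-cong (covers? P₁.p y) (covers? P₂.p y)
          (λ p⋗y → ≡.subst (Covers P₂.p) (≡.sym (only-o {P₁.p} P₁.dim-p p⋗y)) P₂.p⋗o)
          (λ p⋗y → ≡.subst (Covers P₁.p) (≡.sym (only-o {P₂.p} P₂.dim-p p⋗y)) P₁.p⋗o)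

        a≈ : a ≈ᴹ (a +ᴹ η) +ᴹ -ᴹ η
        a≈ = isolateʳ (+ᴹ-comm a η)

        same-joins : ∀ y → dimension y ≡ 1 → y ≢ P₁.p → y ≢ P₂.p → (cᵗ ⊙ c) y P₁.p ≡ (cᵗ ⊙ c) y P₂.p
        same-joins y dim-y y≢p₁ y≢p₂ = case disjoint? (ext (vertex y) a) h of λ where
          (yes disjoint) → ≡.trans (P₁.joins-good y dim-y y≢p₁ disjoint)
            (≡.sym (P₂.joins-good y dim-y y≢p₂ (translate-disjoint y η∈h ≈ᴹ-refl (P₁.a∉y y dim-y y≢p₁) disjoint)))
          (no ¬disjoint) → ≡.trans (P₁.joins-bad y dim-y y≢p₁ ¬disjoint)
            (≡.sym (P₂.joins-bad y dim-y y≢p₂ λ disjoint → ¬disjoint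
              (translate-disjoint y (neg-closed h η∈h) a≈ (P₂.a∉y y dim-y y≢p₂) disjoint)))

        covers⇒Covers : ∀ z y → T (covers z y) → Covers z y
        covers⇒Covers z y = toWitness {a? = covers? z y} ∘ ≡.subst T (≡.sym (isYes≗does (covers? z y)))
          where open import Relation.Nullary.Decidable using (isYes≗does)

      combinatorics : Combinatorics q N M dimension covers
      combinatorics = record
        { dim≤N       = λ y → dim≤N {vertex y} (vertex-disjoint y)
        ; covers-dim  = λ z y z⋗y → proj₂ (covers⇒Covers z y z⋗y)
        ; relation₁   = λ x y → case dimension y ℕ.≟ suc (dimension x) of λ where
            (yes dim-y) → relation x y dim-y
            (no dim≢)   → relation-off x y (q ℕ.^ suc (dimension x)) dim≢
        ; relation₂   = λ x y → case dimension y ℕ.≟ suc (dimension x) of λ where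
            (yes dim-y) → ≡.subst (λ d → q ℕ.^ d ℕ.* (S₁ x y ℕ.+ q ℕ.* S₃ x y) ℕ.+ (q ℕ.+ 1) ℕ.* q ℕ.^ (N ℕ.+ M) ℕ.* c y x ≡
                                         (q ℕ.+ 1) ℕ.* q ℕ.^ d ℕ.* S₂ x y) (≡.sym dim-y) (relation x y dim-y)
            (no dim≢)   → relation-off x y (q ℕ.^ dimension y) dim≢
        ; cover-count = upper-count
        ; o = o ; dim-o = dim-o ; o-unique = o-unique
        ; p₁ = P₁.p ; p₂ = P₂.p
        ; p₁≢p₂ = λ p₁≡p₂ → not-both P₁.p P₁.a∈p (≡.subst (λ p → a +ᴹ η ∈ vertex p) (≡.sym p₁≡p₂) P₂.a∈p)
        ; dim-p₁ = P₁.dim-p ; dim-p₂ = P₂.dim-p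
        ; p-covers = p-covers
        ; no-join = sum-zero (λ z → c z P₁.p ℕ.* c z P₂.p) λ z → given₀ {z} {P₁.p} λ (p₁⊆z , _) →
            c-no {z} {P₂.p} λ (p₂⊆z , _) → not-both z (p₁⊆z a P₁.a∈p) (p₂⊆z (a +ᴹ η) P₂.a∈p)
        ; same-joins = same-joins }

-- Apartness and square roots in ℂ

module RingIdentities {k ℓk} (K : CommutativeRing k ℓk) where
  open CommutativeRing K hiding (zero)
  open IntegerSolver K
  open RingLemmas K

  norm-re : ∀ a b c d → a * c + - (b * d) ≈ 0# → a * d + b * c ≈ 0# → (a * a + b * b) * c ≈ 0#
  norm-re a b c d re≈0 im≈0 = modulo a re≈0 (modulo b im≈0
    (solve 4 (λ a b c d → (a :* a :+ b :* b) :* c := con (+ 0) :+ a :* (a :* c :+ :- (b :* d)) :+ b :* (a :* d :+ b :* c)) refl a b c d))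

  norm-im : ∀ a b c d → a * c + - (b * d) ≈ 0# → a * d + b * c ≈ 0# → (a * a + b * b) * d ≈ 0#
  norm-im a b c d re≈0 im≈0 = modulo (- b) re≈0 (modulo a im≈0
    (solve 4 (λ a b c d → (a :* a :+ b :* b) :* d := con (+ 0) :+ (:- b) :* (a :* c :+ :- (b :* d)) :+ a :* (a :* d :+ b :* c)) refl a b c d))

  embed-* : ∀ x y → x * y + - (0# * 0#) ≈ x * y
  embed-* x y = solve 2 (λ x y → x :* y :+ :- (con (+ 0) :* con (+ 0)) := x :* y) refl x y

  embed-*-im : ∀ x y → x * 0# + 0# * y ≈ 0#
  embed-*-im x y = solve 2 (λ x y → x :* con (+ 0) :+ con (+ 0) :* y := con (+ 0)) refl x y

  square-difference : ∀ x w → (x + w) * (x + w) ≈ x * x + w * (x + (x + w))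
  square-difference = solve 2 (λ x w → (x :+ w) :* (x :+ w) := x :* x :+ w :* (x :+ (x :+ w))) refl

module ℚ-Lemmas where
  open import Data.Rational.Base

  ∣∣-bound : ∀ {p b} → p ≤ b → - p ≤ b → ∣ p ∣ ≤ b
  ∣∣-bound {p} p≤b -p≤b = case ℚ.∣p∣≡p∨∣p∣≡-p p of λ where
    (inj₁ eq) → ≡.subst (_≤ _) (≡.sym eq) p≤b
    (inj₂ eq) → ≡.subst (_≤ _) (≡.sym eq) -p≤b

  neg*neg : ∀ p → - p * - p ≡ p * p
  neg*neg p = ≡.trans (≡.sym (ℚ.neg-distribˡ-* p (- p))) (≡.trans (≡.cong -_ (≡.sym (ℚ.neg-distribʳ-* p p)))
    (neg-involutive (p * p)))
    where open import Algebra.Properties.Group ℚ.+-0-group using () renaming (⁻¹-involutive to neg-involutive)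

  square≡∣∣² : ∀ p → p * p ≡ ∣ p ∣ * ∣ p ∣
  square≡∣∣² p with ℚ.∣p∣≡p∨∣p∣≡-p p
  ... | inj₁ eq = ≡.sym (≡.cong₂ _*_ eq eq)
  ... | inj₂ eq = ≡.trans (≡.sym (neg*neg p)) (≡.sym (≡.cong₂ _*_ eq eq))

  *-mono-≤ : ∀ {p p′ r r′} → 0ℚ ≤ r → 0ℚ ≤ p′ → p ≤ p′ → r ≤ r′ → p * r ≤ p′ * r′
  *-mono-≤ {p} {p′} {r} {r′} 0≤r 0≤p′ p≤p′ r≤r′ = ℚ.≤-trans
    (ℚ.*-monoʳ-≤-nonNeg r {{nonNegative 0≤r}} p≤p′) (ℚ.*-monoˡ-≤-nonNeg p′ {{nonNegative 0≤p′}} r≤r′)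

  ∣p-0∣ : ∀ p → ∣ p - 0ℚ ∣ ≡ ∣ p ∣
  ∣p-0∣ p = ≡.cong ∣_∣ (ℚ.+-identityʳ p)

  fromℕ : ℕ → ℚ
  fromℕ zero    = 0ℚ
  fromℕ (suc n) = 1ℚ + fromℕ n

  fromℕ≥0 : ∀ n → 0ℚ ≤ fromℕ n
  fromℕ≥0 zero    = ℚ.≤-refl
  fromℕ≥0 (suc n) = ℚ.+-mono-≤ (ℚ.<⇒≤ (ℚ.positive⁻¹ 1ℚ)) (fromℕ≥0 n)

  fromℕ-suc>0 : ∀ n → 0ℚ < fromℕ (suc n)
  fromℕ-suc>0 n = ℚ.+-mono-<-≤ (ℚ.positive⁻¹ 1ℚ) (fromℕ≥0 n)

  fromℕ-homo-* : ∀ m n → fromℕ (m ℕ.* n) ≡ fromℕ m * fromℕ n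
  fromℕ-homo-* zero    n = ≡.sym (ℚ.*-zeroˡ (fromℕ n))
  fromℕ-homo-* (suc m) n = ≡.trans (homo-+ n (m ℕ.* n)) (≡.trans (≡.cong₂ _+_ (≡.sym (ℚ.*-identityˡ (fromℕ n))) (fromℕ-homo-* m n))
    (≡.sym (ℚ.*-distribʳ-+ (fromℕ n) 1ℚ (fromℕ m))))
    where
    homo-+ : ∀ m n → fromℕ (m ℕ.+ n) ≡ fromℕ m + fromℕ n
    homo-+ zero    n = ≡.sym (ℚ.+-identityˡ (fromℕ n))
    homo-+ (suc m) n = ≡.trans (≡.cong (λ z → 1ℚ + z) (homo-+ m n)) (≡.sym (ℚ.+-assoc 1ℚ (fromℕ m) (fromℕ n)))

  fromℕᵘ : ∀ n → toℚᵘ (fromℕ n) ℚᵘ.≃ mkℚᵘ (+ n) 0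
  fromℕᵘ zero    = ℚᵘ.≃-refl
  fromℕᵘ (suc n) = ℚᵘ.≃-trans (ℚ.toℚᵘ-homo-+ 1ℚ (fromℕ n))
    (ℚᵘ.≃-trans (ℚᵘ.+-congʳ (toℚᵘ 1ℚ) (fromℕᵘ n)) (ℚᵘ.*≡* (≡.cong (λ z → (+ 1 ℤ.+ z) ℤ.* + 1) (ℤ.*-identityʳ (+ n)))))

  denominator-bound : ∀ ε → 0ℚ < ε → 1ℚ ≤ fromℕ (ℚ.denominatorℕ ε) * ε
  denominator-bound ε@(mkℚ (+ suc a) d _) _ = ℚ.toℚᵘ-cancel-≤ (ℚᵘ.≤-respʳ-≃
    (ℚᵘ.≃-sym (ℚᵘ.≃-trans (ℚ.toℚᵘ-homo-* (fromℕ (suc d)) ε) (ℚᵘ.*-congʳ (fromℕᵘ (suc d)))))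
    (ℚᵘ.*≤* (ℤ.+≤+ (ℕ.s≤s (≡.subst₂ ℕ._≤_
      (≡.sym (≡.trans (ℕ.+-identityʳ (d ℕ.+ 0)) (ℕ.+-identityʳ d))) (≡.sym (ℕ.*-identityʳ (a ℕ.+ d ℕ.* suc a)))
      (ℕ.≤-trans (ℕ.m≤m*n d (suc a)) (ℕ.m≤n+m (d ℕ.* suc a) a)))))))
  denominator-bound (mkℚ (+ 0) d _) (*<* (ℤ.+<+ ()))
  denominator-bound (mkℚ (ℤ.-[1+ _ ]) d _) (*<* ())

  archimedean : ∀ b ε → 0ℚ < ε → ∃ λ n → fromℕ b < fromℕ (suc n) * ε
  archimedean b ε ε>0 = ℕ.pred (suc b ℕ.* d) , ≡.subst (λ m → fromℕ b < fromℕ m * ε) (≡.sym (ℕ.suc-pred (suc b ℕ.* d)))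
    (begin-strict
      fromℕ b                            ≡⟨ ℚ.+-identityˡ (fromℕ b) ⟨
      0ℚ + fromℕ b                       <⟨ ℚ.+-monoˡ-< (fromℕ b) (ℚ.positive⁻¹ 1ℚ) ⟩
      fromℕ (suc b)                      ≡⟨ ℚ.*-identityʳ (fromℕ (suc b)) ⟨
      fromℕ (suc b) * 1ℚ                 ≤⟨ ℚ.*-monoˡ-≤-nonNeg (fromℕ (suc b)) {{nonNegative (fromℕ≥0 (suc b))}} (denominator-bound ε ε>0) ⟩
      fromℕ (suc b) * (fromℕ d * ε)      ≡⟨ ℚ.*-assoc (fromℕ (suc b)) (fromℕ d) ε ⟨
      fromℕ (suc b) * fromℕ d * ε        ≡⟨ ≡.cong (_* ε) (fromℕ-homo-* (suc b) d) ⟨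
      fromℕ (suc b ℕ.* d) * ε            ∎)
    where
    open ℚ.≤-Reasoning
    d : ℕ
    d = ℚ.denominatorℕ ε
    instance
      product-nonZero : ℕ.NonZero (suc b ℕ.* d)
      product-nonZero = ℕ.m*n≢0 (suc b) d

module Bisection (q : ℕ) where
  open import Data.Rational.Base
  open ℚ-Lemmas
  open ℚ-Estimates using (½ε>0; ½ε+½ε; scaled; sum-pos)
  open RingIdentities ℚ.+-*-commutativeRing using (square-difference)

  Q : ℚ
  Q = fromℕ q

  record Bracket : Set where
    field
      lo width : ℚ
      lo≥0     : 0ℚ ≤ lo
      width>0  : 0ℚ < width
      lower    : lo * lo ≤ Q
      upper    : Q < (lo + width) * (lo + width)

    hi : ℚ
    hi = lo + width

    lo≤hi : lo ≤ hi
    lo≤hi = ≡.subst (_≤ hi) (ℚ.+-identityʳ lo) (ℚ.+-monoʳ-≤ lo (ℚ.<⇒≤ width>0))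

  open Bracket

  initial : Bracket
  initial = record
    { lo = 0ℚ ; width = fromℕ (suc q) ; lo≥0 = ℚ.≤-refl ; width>0 = fromℕ-suc>0 q
    ; lower = ≡.subst (_≤ Q) (≡.sym (ℚ.*-zeroˡ 0ℚ)) (fromℕ≥0 q)
    ; upper = ≡.subst (λ s → Q < s * s) (≡.sym (ℚ.+-identityˡ (fromℕ (suc q)))) (begin-strict
        Q                              ≡⟨ ℚ.+-identityˡ Q ⟨
        0ℚ + Q                         <⟨ ℚ.+-monoˡ-< Q (ℚ.positive⁻¹ 1ℚ) ⟩
        fromℕ (suc q)                  ≡⟨ ℚ.*-identityʳ (fromℕ (suc q)) ⟨
        fromℕ (suc q) * 1ℚ             ≤⟨ ℚ.*-monoˡ-≤-nonNeg (fromℕ (suc q)) {{nonNegative (fromℕ≥0 (suc q))}} 1≤ ⟩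
        fromℕ (suc q) * fromℕ (suc q)  ∎) }
    where
    open ℚ.≤-Reasoning
    1≤ : 1ℚ ≤ fromℕ (suc q)
    1≤ = ≡.subst (_≤ fromℕ (suc q)) (ℚ.+-identityʳ 1ℚ) (ℚ.+-monoʳ-≤ 1ℚ (fromℕ≥0 q))

  Refines : Bracket → Bracket → Set
  Refines B C = lo B ≤ lo C × hi C ≤ hi B

  half : ∀ B → ∃ λ C → Refines B C × width C ≡ ½ * width B
  half B with (lo B + ½ * width B) * (lo B + ½ * width B) ℚ.≤? Q
  ... | yes mid²≤Q = record
      { lo = lo B + w ; width = w
      ; lo≥0 = ℚ.≤-trans (lo≥0 B) lo≤mid ; width>0 = ½ε>0 (width>0 B)
      ; lower = mid²≤Q ; upper = ≡.subst (λ s → Q < s * s) (≡.sym end) (upper B) } ,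
    (lo≤mid , ℚ.≤-reflexive end) , ≡.refl
    where
    w : ℚ
    w = ½ * width B
    lo≤mid : lo B ≤ lo B + w
    lo≤mid = ≡.subst (_≤ lo B + w) (ℚ.+-identityʳ (lo B)) (ℚ.+-monoʳ-≤ (lo B) (ℚ.<⇒≤ (½ε>0 (width>0 B))))
    end : lo B + w + w ≡ hi B
    end = ≡.trans (ℚ.+-assoc (lo B) w w) (≡.cong (λ s → lo B + s) (½ε+½ε (width B)))
  ... | no mid²≰Q = record
      { lo = lo B ; width = w ; lo≥0 = lo≥0 B ; width>0 = ½ε>0 (width>0 B)
      ; lower = lower B ; upper = ℚ.≰⇒> mid²≰Q } ,
    (ℚ.≤-refl , ≡.subst₂ _≤_ (ℚ.+-identityʳ (lo B + w)) (≡.trans (ℚ.+-assoc (lo B) w w) (≡.cong (λ s → lo B + s) (½ε+½ε (width B))))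
      (ℚ.+-monoʳ-≤ (lo B + w) (ℚ.<⇒≤ (½ε>0 (width>0 B))))) , ≡.refl
    where
    w : ℚ
    w = ½ * width B

  abstract
    bracket : ℕ → Bracket
    bracket zero    = initial
    bracket (suc n) = proj₁ (half (bracket n))

    bracket-refines-suc : ∀ n → Refines (bracket n) (bracket (suc n))
    bracket-refines-suc n = proj₁ (proj₂ (half (bracket n)))

    bracket-width-0 : width (bracket 0) ≡ fromℕ (suc q)
    bracket-width-0 = ≡.refl

    bracket-hi-0 : hi (bracket 0) ≡ fromℕ (suc q)
    bracket-hi-0 = ℚ.+-identityˡ (fromℕ (suc q))

    bracket-width : ∀ n → width (bracket (suc n)) ≡ ½ * width (bracket n)
    bracket-width n = proj₂ (proj₂ (half (bracket n)))

  bracket-refines-+ : ∀ k n → Refines (bracket k) (bracket (n ℕ.+ k))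
  bracket-refines-+ k zero    = ℚ.≤-refl , ℚ.≤-refl
  bracket-refines-+ k (suc n) =
    let (lo≤ , hi≥) = bracket-refines-+ k n
        (lo≤′ , hi≥′) = bracket-refines-suc (n ℕ.+ k)
    in ℚ.≤-trans lo≤ lo≤′ , ℚ.≤-trans hi≥′ hi≥

  bracket-refines : ∀ {k n} → k ℕ.≤ n → Refines (bracket k) (bracket n)
  bracket-refines {k} {n} k≤n = ≡.subst (λ m → Refines (bracket k) (bracket m)) (ℕ.m∸n+n≡m k≤n) (bracket-refines-+ k (n ℕ.∸ k))

  width-bound : ∀ n → fromℕ (suc n) * width (bracket n) ≤ fromℕ (suc q)
  width-bound zero    = ℚ.≤-reflexive (≡.trans (≡.cong (_* width (bracket 0)) (ℚ.+-identityʳ 1ℚ))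
    (≡.trans (ℚ.*-identityˡ _) bracket-width-0))
  width-bound (suc n) = begin
    fromℕ (suc (suc n)) * width (bracket (suc n))       ≡⟨ ≡.cong (fromℕ (suc (suc n)) *_) (bracket-width n) ⟩
    fromℕ (suc (suc n)) * (½ * w)                       ≡⟨ ≡.trans (≡.sym (ℚ.*-assoc f₂ ½ w)) (≡.cong (_* w) (ℚ.*-comm f₂ ½)) ⟩
    ½ * f₂ * w                                          ≤⟨ ℚ.*-monoʳ-≤-nonNeg w {{nonNegative (ℚ.<⇒≤ (width>0 (bracket n)))}} halved ⟩
    fromℕ (suc n) * w                                   ≤⟨ width-bound n ⟩
    fromℕ (suc q)                                       ∎
    where
    open ℚ.≤-Reasoning
    w f₁ f₂ : ℚ
    w = width (bracket n)
    f₁ = fromℕ (suc n)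
    f₂ = fromℕ (suc (suc n))
    1≤f₁ : 1ℚ ≤ f₁
    1≤f₁ = ≡.subst (_≤ f₁) (ℚ.+-identityʳ 1ℚ) (ℚ.+-monoʳ-≤ 1ℚ (fromℕ≥0 n))
    halved : ½ * f₂ ≤ f₁
    halved = begin
      ½ * f₂             ≤⟨ ℚ.*-monoˡ-≤-nonNeg ½ (ℚ.+-monoˡ-≤ f₁ 1≤f₁) ⟩
      ½ * (f₁ + f₁)      ≡⟨ ℚ.*-distribˡ-+ ½ f₁ f₁ ⟩
      ½ * f₁ + ½ * f₁    ≡⟨ ½ε+½ε f₁ ⟩
      f₁                 ∎

  narrow : ∀ ε → 0ℚ < ε → ∃ λ k → width (bracket k) < ε
  narrow ε ε>0 = let (k , large) = archimedean (suc q) ε ε>0 in k ,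
    ℚ.*-cancelˡ-<-nonNeg (fromℕ (suc k)) {{nonNegative (fromℕ≥0 (suc k))}} (ℚ.≤-<-trans (width-bound k) large)

  private
    sub-bound : ∀ B {x y} → lo B ≤ y → x ≤ hi B → x - y ≤ width B
    sub-bound B {x} {y} lo≤y x≤hi = begin
      x - y                         ≤⟨ ℚ.+-mono-≤ x≤hi (ℚ.neg-antimono-≤ lo≤y) ⟩
      lo B + width B - lo B         ≡⟨ ≡.cong (_- lo B) (ℚ.+-comm (lo B) (width B)) ⟩
      width B + lo B - lo B         ≡⟨ ℚ.+-assoc (width B) (lo B) (- lo B) ⟩
      width B + (lo B - lo B)       ≡⟨ ≡.cong (λ s → width B + s) (ℚ.+-inverseʳ (lo B)) ⟩
      width B + 0ℚ                  ≡⟨ ℚ.+-identityʳ (width B) ⟩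
      width B                       ∎
      where open ℚ.≤-Reasoning

  close : ∀ B {x y} → lo B ≤ x → x ≤ hi B → lo B ≤ y → y ≤ hi B → ∣ x - y ∣ ≤ width B
  close B {x} {y} lo≤x x≤hi lo≤y y≤hi = ∣∣-bound (sub-bound B lo≤y x≤hi)
    (≡.subst (_≤ width B) (≡.sym (Differences.sub-flip ℚ.+-*-commutativeRing x y)) (sub-bound B lo≤x y≤hi))

  root : ℝ
  root = mkℝ (λ n → lo (bracket n)) λ ε ε>0 →
    let (k , small) = narrow ε ε>0
        inside = λ n k≤n → let (lo≤ , hi≥) = bracket-refines k≤n in lo≤ , ℚ.≤-trans (lo≤hi (bracket n)) hi≥
    in k , λ m n k≤m k≤n → ℚ.≤-<-trans
      (close (bracket k) (proj₁ (inside m k≤m)) (proj₂ (inside m k≤m)) (proj₁ (inside n k≤n)) (proj₂ (inside n k≤n)))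
      small

  root-square : root *ℝ root ≈ℝ fromℚ Q
  root-square ε ε>0 =
    let bound = fromℕ (suc q) + fromℕ (suc q)
        bound>0 = sum-pos (fromℕ (suc q)) (fromℕ (suc q)) (fromℕ-suc>0 q) (fromℕ-suc>0 q)
        (δ , δ>0 , bδ≡½ε) = scaled bound bound>0 ε ε>0
        (k , small) = narrow δ δ>0
    in k , λ n k≤n → begin-strict
      ∣ lo (bracket n) * lo (bracket n) - Q ∣  ≤⟨ ∣∣-bound (ℚ.≤-trans (below-Q n) (error≥0 n)) (above-Q n) ⟩
      error n                                  ≤⟨ ℚ.*-monoˡ-≤-nonNeg (width (bracket n)) {{nonNegative (ℚ.<⇒≤ (width>0 (bracket n)))}}
                                                    (ℚ.+-mono-≤ (ℚ.≤-trans (lo≤hi (bracket n)) (hi-bound n)) (hi-bound n)) ⟩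
      width (bracket n) * bound                ≤⟨ ℚ.*-monoʳ-≤-nonNeg bound {{nonNegative (ℚ.<⇒≤ bound>0)}} (width-mono k n k≤n) ⟩
      width (bracket k) * bound                ≡⟨ ℚ.*-comm (width (bracket k)) bound ⟩
      bound * width (bracket k)                <⟨ ℚ.*-monoʳ-<-pos bound {{positive bound>0}} small ⟩
      bound * δ                                ≡⟨ bδ≡½ε ⟩
      ½ * ε                                    ≡⟨ ℚ.+-identityʳ (½ * ε) ⟨
      ½ * ε + 0ℚ                               <⟨ ℚ.+-monoʳ-< (½ * ε) (½ε>0 ε>0) ⟩
      ½ * ε + ½ * ε                            ≡⟨ ½ε+½ε ε ⟩
      ε                                        ∎
    where
    open ℚ.≤-Reasoning
    error : ℕ → ℚ
    error n = width (bracket n) * (lo (bracket n) + hi (bracket n))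
    hi-bound : ∀ n → hi (bracket n) ≤ fromℕ (suc q)
    hi-bound n = ≡.subst (hi (bracket n) ≤_) bracket-hi-0 (proj₂ (bracket-refines {0} {n} ℕ.z≤n))
    width-mono : ∀ k n → k ℕ.≤ n → width (bracket n) ≤ width (bracket k)
    width-mono k n k≤n = begin
      width (bracket n)                           ≡⟨ ℚ.+-identityˡ _ ⟨
      0ℚ + width (bracket n)                      ≡⟨ ≡.cong (_+ width (bracket n)) (ℚ.+-inverseˡ (lo (bracket n))) ⟨
      - lo (bracket n) + lo (bracket n) + width (bracket n)  ≡⟨ ℚ.+-assoc (- lo (bracket n)) (lo (bracket n)) (width (bracket n)) ⟩
      - lo (bracket n) + hi (bracket n)           ≡⟨ ℚ.+-comm (- lo (bracket n)) (hi (bracket n)) ⟩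
      hi (bracket n) - lo (bracket n)             ≤⟨ sub-bound (bracket k) (proj₁ (bracket-refines k≤n)) (proj₂ (bracket-refines k≤n)) ⟩
      width (bracket k)                           ∎
    error≥0 : ∀ n → 0ℚ ≤ error n
    error≥0 n = ≡.subst (_≤ error n) (ℚ.*-zeroˡ 0ℚ) (*-mono-≤ ℚ.≤-refl (ℚ.<⇒≤ (width>0 (bracket n)))
      (ℚ.<⇒≤ (width>0 (bracket n))) (ℚ.+-mono-≤ (lo≥0 (bracket n)) (ℚ.≤-trans (lo≥0 (bracket n)) (lo≤hi (bracket n)))))
    below-Q : ∀ n → lo (bracket n) * lo (bracket n) - Q ≤ 0ℚ
    below-Q n = ≡.subst (lo (bracket n) * lo (bracket n) - Q ≤_) (ℚ.+-inverseʳ Q) (ℚ.+-monoˡ-≤ (- Q) (lower (bracket n)))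
    above-Q : ∀ n → - (lo (bracket n) * lo (bracket n) - Q) ≤ error n
    above-Q n = begin
      - (l * l - Q)                 ≡⟨ Differences.sub-flip ℚ.+-*-commutativeRing (l * l) Q ⟩
      Q - l * l                     ≤⟨ ℚ.+-monoˡ-≤ (- (l * l)) (ℚ.<⇒≤ (upper (bracket n))) ⟩
      hi (bracket n) * hi (bracket n) - l * l
                                    ≡⟨ ≡.cong (_- l * l) (square-difference l (width (bracket n))) ⟩
      l * l + error n - l * l       ≡⟨ ≡.cong (_- l * l) (ℚ.+-comm (l * l) (error n)) ⟩
      error n + l * l - l * l       ≡⟨ ℚ.+-assoc (error n) (l * l) (- (l * l)) ⟩
      error n + (l * l - l * l)     ≡⟨ ≡.cong (λ s → error n + s) (ℚ.+-inverseʳ (l * l)) ⟩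
      error n + 0ℚ                  ≡⟨ ℚ.+-identityʳ (error n) ⟩
      error n                       ∎
      where
      l : ℚ
      l = lo (bracket n)

module RealApartness where
  open import Data.Rational.Base
  open ℚ-Lemmas
  open ℚ-Estimates using (½ε>0; ½ε+½ε; ∣-∣-sym)

  Away : ℝ → Set
  Away x = ∃ λ δ → 0ℚ < δ × ∃ λ k → ∀ n → k ℕ.≤ n → δ ≤ ∣ approx x n ∣

  0ℝ : ℝ
  0ℝ = fromℚ 0ℚ

  away-cancel : ∀ x y → Away x → x *ℝ y ≈ℝ 0ℝ → y ≈ℝ 0ℝ
  away-cancel x y (δ , δ>0 , k , away) xy≈0 ε ε>0 =
    let (l , close) = xy≈0 (δ * ε) (ℚ.positive⁻¹ (δ * ε) {{ℚ.pos*pos⇒pos δ {{positive δ>0}} ε {{positive ε>0}}}})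
    in k ℕ.⊔ l , λ n n≥ → let X = approx x n ; Y = approx y n in
      ≡.subst (_< ε) (≡.sym (∣p-0∣ Y)) (ℚ.*-cancelˡ-<-nonNeg δ {{nonNegative (ℚ.<⇒≤ δ>0)}} (begin-strict
        δ * ∣ Y ∣            ≤⟨ ℚ.*-monoʳ-≤-nonNeg ∣ Y ∣ {{ℚ.∣-∣-nonNeg Y}} (away n (ℕ.m⊔n≤o⇒m≤o k l n≥)) ⟩
        ∣ X ∣ * ∣ Y ∣        ≡⟨ ℚ.∣p*q∣≡∣p∣*∣q∣ X Y ⟨
        ∣ X * Y ∣            ≡⟨ ∣p-0∣ (X * Y) ⟨
        ∣ X * Y - 0ℚ ∣       <⟨ close n (ℕ.m⊔n≤o⇒n≤o k l n≥) ⟩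
        δ * ε                ∎))
    where open ℚ.≤-Reasoning

  away-norm : ∀ a b → Away a → Away (a *ℝ a +ℝ b *ℝ b)
  away-norm a b (δ , δ>0 , k , away) = δ * δ ,
    ℚ.positive⁻¹ (δ * δ) {{ℚ.pos*pos⇒pos δ {{positive δ>0}} δ {{positive δ>0}}}} , k , λ n k≤n →
    let A = approx a n ; B = approx b n in begin
      δ * δ                          ≤⟨ *-mono-≤ (ℚ.<⇒≤ δ>0) (ℚ.0≤∣p∣ A) (away n k≤n) (away n k≤n) ⟩
      ∣ A ∣ * ∣ A ∣                  ≡⟨ square≡∣∣² A ⟨
      A * A                          ≡⟨ ℚ.+-identityʳ (A * A) ⟨
      A * A + 0ℚ                     ≤⟨ ℚ.+-monoʳ-≤ (A * A) (square≥0 B) ⟩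
      A * A + B * B                  ≤⟨ p≤∣p∣ (A * A + B * B) ⟩
      ∣ A * A + B * B ∣              ∎
    where
    open ℚ.≤-Reasoning
    square≥0 : ∀ p → 0ℚ ≤ p * p
    square≥0 p = ≡.subst (0ℚ ≤_) (ℚ.∣p*q∣≡∣p∣*∣q∣ p p ⨾ ≡.sym (square≡∣∣² p)) (ℚ.0≤∣p∣ (p * p))
      where
      infixr 5 _⨾_
      _⨾_ : ∀ {x y z : ℚ} → x ≡ y → y ≡ z → x ≡ z
      _⨾_ = ≡.trans
    p≤∣p∣ : ∀ p → p ≤ ∣ p ∣
    p≤∣p∣ p with ℚ.∣p∣≡p∨∣p∣≡-p p | ℚ.≤-total 0ℚ p
    ... | inj₁ eq | _        = ℚ.≤-reflexive (≡.sym eq)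
    ... | inj₂ _  | inj₁ 0≤p = ℚ.≤-reflexive (≡.sym (ℚ.0≤p⇒∣p∣≡p 0≤p))
    ... | inj₂ _  | inj₂ p≤0 = ℚ.≤-trans p≤0 (ℚ.0≤∣p∣ p)

  Small : ℝ → ℚ → Set
  Small x ε = ∃ λ k → ∀ n → k ℕ.≤ n → ∣ approx x n ∣ < ε

  triangle : ∀ p r → ∣ p ∣ ≤ ∣ p - r ∣ + ∣ r ∣
  triangle p r = begin
    ∣ p ∣                     ≡⟨ ≡.cong ∣_∣ (Differences.cancel ℚ.+-*-commutativeRing p r) ⟩
    ∣ (p - r) + r ∣           ≤⟨ ℚ.∣p+q∣≤∣p∣+∣q∣ (p - r) r ⟩
    ∣ p - r ∣ + ∣ r ∣         ∎
    where open ℚ.≤-Reasoning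

  away-or-small : ∀ x ε → 0ℚ < ε → Away x ⊎ Small x ε
  away-or-small x ε ε>0 =
    let η = ½ * ε ; ζ = ½ * η
        ζ>0 = ½ε>0 (½ε>0 ε>0)
        (k , close) = cauchy x ζ ζ>0
    in case ∣ approx x k ∣ ℚ.<? η of λ where
      (yes small) → inj₂ (k , λ n k≤n → begin-strict
        ∣ approx x n ∣                                       ≤⟨ triangle (approx x n) (approx x k) ⟩
        ∣ approx x n - approx x k ∣ + ∣ approx x k ∣         <⟨ ℚ.+-mono-< (close n k k≤n ℕ.≤-refl) small ⟩
        ζ + η                                                ≤⟨ ℚ.+-monoˡ-≤ η (≡.subst₂ _≤_ (ℚ.+-identityʳ ζ) (½ε+½ε η) (ℚ.+-monoʳ-≤ ζ (ℚ.<⇒≤ ζ>0))) ⟩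
        η + η                                                ≡⟨ ½ε+½ε ε ⟩
        ε                                                    ∎)
      (no large) → inj₁ (ζ , ζ>0 , k , λ n k≤n → ℚ.≮⇒≥ λ small → large (begin-strict
        ∣ approx x k ∣                                       ≤⟨ triangle (approx x k) (approx x n) ⟩
        ∣ approx x k - approx x n ∣ + ∣ approx x n ∣         <⟨ ℚ.+-mono-< (close k n ℕ.≤-refl k≤n) small ⟩
        ζ + ζ                                                ≡⟨ ½ε+½ε η ⟩
        η                                                    ∎))
    where open ℚ.≤-Reasoning

  ≈0-stable : ∀ x → ¬ Away x → x ≈ℝ 0ℝ
  ≈0-stable x ¬away ε ε>0 with away-or-small x ε ε>0
  ... | inj₁ away        = contradiction away ¬away
  ... | inj₂ (k , small) = k , λ n k≤n → ≡.subst (_< ε) (≡.sym (∣p-0∣ (approx x n))) (small n k≤n)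

  away-split : ∀ x y → x +ℝ y ≈ℝ fromℚ 1ℚ → Away x ⊎ Away y
  away-split x y sum≈1 with away-or-small x (½ * ½) (ℚ.positive⁻¹ (½ * ½)) | away-or-small y (½ * ½) (ℚ.positive⁻¹ (½ * ½))
  ... | inj₁ away | _         = inj₁ away
  ... | inj₂ _    | inj₁ away = inj₂ away
  ... | inj₂ (k , x-small) | inj₂ (l , y-small) =
    let (m , close) = sum≈1 ½ (ℚ.positive⁻¹ ½)
        n = k ℕ.⊔ (l ℕ.⊔ m)
        X = approx x n ; Y = approx y n
        lm≤ = ℕ.m≤n⊔m k (l ℕ.⊔ m)
    in contradiction (begin-strict
      ∣ 1ℚ ∣                                ≤⟨ triangle 1ℚ (X + Y) ⟩
      ∣ 1ℚ - (X + Y) ∣ + ∣ X + Y ∣          ≡⟨ ≡.cong (_+ ∣ X + Y ∣) (∣-∣-sym 1ℚ (X + Y)) ⟩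
      ∣ X + Y - 1ℚ ∣ + ∣ X + Y ∣            ≤⟨ ℚ.+-monoʳ-≤ ∣ X + Y - 1ℚ ∣ (ℚ.∣p+q∣≤∣p∣+∣q∣ X Y) ⟩
      ∣ X + Y - 1ℚ ∣ + (∣ X ∣ + ∣ Y ∣)      <⟨ ℚ.+-mono-< (close n (ℕ.≤-trans (ℕ.m≤n⊔m l m) lm≤))
                                                (ℚ.+-mono-< (x-small n (ℕ.m≤m⊔n k (l ℕ.⊔ m))) (y-small n (ℕ.≤-trans (ℕ.m≤m⊔n l m) lm≤))) ⟩
      1ℚ                                    ∎) (ℚ.<-irrefl ≡.refl)
    where open ℚ.≤-Reasoning

module ComplexField where
  open RealApartness
  open CommutativeRing ℂ using (1#; 0#; _*_; _+_; _≈_; refl; sym; trans; +-congˡ)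
  open RingLemmas ℂ
  open Characteristic0 ℂ
  open ℚ-Lemmas using (fromℕ; fromℕ-suc>0)
  module Real = CommutativeRing ℝ-commutativeRing
  module Id = RingIdentities ℝ-commutativeRing

  away-re : ∀ a b → Away a → Cancellable (a , b)
  away-re a b away (c , d) (re≈0 , im≈0) =
    away-cancel (a *ℝ a +ℝ b *ℝ b) c (away-norm a b away) (Id.norm-re a b c d re≈0 im≈0) ,
    away-cancel (a *ℝ a +ℝ b *ℝ b) d (away-norm a b away) (Id.norm-im a b c d re≈0 im≈0)

  away-im : ∀ a b → Away b → Cancellable (a , b)
  away-im a b away (c , d) (re≈0 , im≈0) =
    away-cancel (b *ℝ b +ℝ a *ℝ a) c (away-norm b a away) (Real.trans {(b *ℝ b +ℝ a *ℝ a) *ℝ c} {(a *ℝ a +ℝ b *ℝ b) *ℝ c} {0ℝ}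
      (Real.*-congʳ {c} {b *ℝ b +ℝ a *ℝ a} {a *ℝ a +ℝ b *ℝ b} (Real.+-comm (b *ℝ b) (a *ℝ a))) (Id.norm-re a b c d re≈0 im≈0)) ,
    away-cancel (b *ℝ b +ℝ a *ℝ a) d (away-norm b a away) (Real.trans {(b *ℝ b +ℝ a *ℝ a) *ℝ d} {(a *ℝ a +ℝ b *ℝ b) *ℝ d} {0ℝ}
      (Real.*-congʳ {d} {b *ℝ b +ℝ a *ℝ a} {a *ℝ a +ℝ b *ℝ b} (Real.+-comm (b *ℝ b) (a *ℝ a))) (Id.norm-im a b c d re≈0 im≈0))

  embed : ℝ → ℝ × ℝ
  embed x = x , 0ℝ

  embed-* : ∀ x y → embed x * embed y ≈ embed (x *ℝ y)
  embed-* x y = Id.embed-* x y , Id.embed-*-im x y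

  ι≈fromℕ : ∀ n → ι n ≈ embed (fromℚ (fromℕ n))
  ι≈fromℕ zero    = refl {0#}
  ι≈fromℕ (suc n) = trans {ι (suc n)} {1# + embed (fromℚ (fromℕ n))} {embed (fromℚ (fromℕ (suc n)))}
    (+-congˡ {1#} {ι n} {embed (fromℚ (fromℕ n))} (ι≈fromℕ n))
    (Real.refl {fromℚ (1ℚ ℚ.+ fromℕ n)} , Real.+-identityˡ 0ℝ)

  fieldLike : FieldLike
  fieldLike = record
    { nontrivial = λ (1≈0 , _) → let (k , close) = 1≈0 ½ (ℚ.positive⁻¹ ½) in
        contradiction (close k ℕ.≤-refl) (from-no (∣ 1ℚ ℚ.- 0ℚ ∣ ℚ.<? ½))
    ; ι-invertible = λ n → Invertible-resp {embed (fromℚ (fromℕ (suc n)))} {ι (suc n)}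
        (sym {ι (suc n)} {embed (fromℚ (fromℕ (suc n)))} (ι≈fromℕ (suc n))) (inverse n)
    ; local = λ (a , b) (c , d) (re≈1 , _) → case away-split a c re≈1 of λ where
        (inj₁ away) → inj₁ (away-re a b away)
        (inj₂ away) → inj₂ (away-re c d away)
    ; tight = λ (a , b) ¬canc →
        ≈0-stable a (λ away → ¬canc (away-re a b away)) , ≈0-stable b (λ away → ¬canc (away-im a b away)) }
    where
    inverse : ∀ n → Invertible (embed (fromℚ (fromℕ (suc n))))
    inverse n = embed (fromℚ y) , trans {embed (fromℚ x) * embed (fromℚ y)} {embed (fromℚ x *ℝ fromℚ y)} {1#}
      (embed-* (fromℚ x) (fromℚ y)) (pointwise {fromℚ x *ℝ fromℚ y} {fromℚ 1ℚ} (λ _ → xy≡1) , Real.refl {0ℝ})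
      where
      x y : ℚ
      x = fromℕ (suc n)
      instance
        x-nonZero : ℚ.NonZero x
        x-nonZero = ℚ.pos⇒nonZero x {{ℚ.positive (fromℕ-suc>0 n)}}
      y = ℚ.1/ x
      xy≡1 : x ℚ.* y ≡ 1ℚ
      xy≡1 = ℚ.*-inverseʳ x

  squareRoot : ∀ q → ∃ λ t → t * t ≈ ι q
  squareRoot q = embed root , trans {embed root * embed root} {embed (root *ℝ root)} {ι q} (embed-* root root)
    (trans {embed (root *ℝ root)} {embed (fromℚ (fromℕ q))} {ι q} (root-square , Real.refl {0ℝ})
      (sym {ι q} {embed (fromℚ (fromℕ q))} (ι≈fromℕ q)))
    where open Bisection q

open import Data.Nat.Base using (NonZero; _+_)

theorem10p5 : ∀ {c ℓ m ℓm} (F : FiniteField c ℓ) (N M : ℕ) .{{_ : NonZero N}} .{{_ : NonZero M}}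
    (H : Module (FiniteField.commutativeRing F) m ℓm) →
    let open VectorSpace F H in
    (dimH : HasDim whole (N + M)) (h : Subspace) → HasDim h M →
    let open AttenuatedSpace F H N M dimH h in
    IsQPolynomial ℂ (qAdjacency ℂ)
theorem10p5 F N M H dimH h dim-h =
  QPolynomial.qPolynomial ℂ ComplexField.fieldLike (FiniteField.order F) (LinearAlgebra.2≤q F H dimH) N M
    (proj₁ √q) (proj₂ √q) A.dimension X.covers (X.combinatorics (ℕ.>-nonZero⁻¹ N) (ℕ.>-nonZero⁻¹ M))
  where
  √q = ComplexField.squareRoot (FiniteField.order F)
  module A = AttenuatedSpace F H N M dimH h
  module X = Poset.Covering F H N M dimH h dim-h A.vertex A.vertex-disjoint A.vertex-injective A.vertex-surjective A.covers?
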